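{- Let $T=(G,P,L)$ be a canvas, where $P$ is a path of length one, and let $P'$ be a path of length one in the boundary of the outer face of $G$. Let $\mathcal{C}$ be a collection of proper $L$-colorings of $P$ that is a government or a confederacy. Then $\Phi_T(P',\mathcal{C})$ contains a government, and furthermore either (a) $\Phi_T(P',\mathcal{C})$ contains a confederacy, or (b) $\mathcal{C}$ is a government and $T$ contains a harmonica from $P$ to $P'$ with government $\mathcal{C}$.
   Context: All graphs are finite and simple. A list assignment is a family of non-empty sets $L(v)$; an $L$-coloring is a proper coloring $\phi$ with $\phi(v)\in L(v)$. Canvas: a triple $(G,S,L)$ where $G$ is a plane graph, $S$ is a subgraph of the boundary $C$ of the outer face of $G$, $L$ is a list assignment for some supergraph of $G$ with $|L(v)|\ge 5$ for $v\in V(G)-V(C)$, $|L(v)|\ge 3$ for $v\in V(G)-V(S)$, and $S$ has a proper $L$-coloring. A canvas $(G,S,L)$ contains a canvas $(G',S',L')$ if $G'$ is a subgraph of $G$, $S=S'$, and $L,L'$ agree on $V(G')$. For a canvas $T=(G,P,L)$ with $P$ a path of length one in the outer boundary, a collection $\mathcal{C}$ of $L$-colorings of $P$, and an edge $P'$ of $G$ with both ends on the outer boundary, $\Phi_T(P',\mathcal{C})$ is the set of proper $L$-colorings of $P'$ that extend to an $L$-coloring $\phi$ of $G$ whose restriction to $P$ lies in $\mathcal{C}$. Governments: let $\mathcal{C}=\{\phi_1,\dots,\phi_k\}$, $k\ge 2$, be a collection of disjoint (distinct) proper colorings of a path $P=p_1p_2$; for $p\in V(P)$ write $\mathcal{C}(p)=\{\phi(p):\phi\in\mathcal{C}\}$.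 $\mathcal{C}$ is a dictatorship if for some $i\in\{1,2\}$ all $\phi_j(p_i)$ are equal ($p_i$ is the dictator, in that color); a democracy if $k=2$, $\phi_1(p_1)=\phi_2(p_2)$ and $\phi_2(p_1)=\phi_1(p_2)$; a government if it is a dictatorship or a democracy. A collection of disjoint proper colorings of $P$ is a confederacy if it is not a government but is the union of two governments. Harmonica (recursive definition): a canvas $T=(G,P,L)$ with $P$ a path of length one, a government $\mathcal{C}$ for $P$, and a (not necessarily distinct) path $P'$ of length one incident with the outer face; $T$ is a harmonica from $P$ to $P'$ with government $\mathcal{C}$ if one of: (1) $G=P=P'$; (2) $\mathcal{C}$ is a dictatorship, $G=P\cup P'$, and $V(P)\cap V(P')=\{z\}$ where $z$ is the dictator of $\mathcal{C}$; (3) $\mathcal{C}$ is a dictatorship and there is a triangle $zu_1u_2$ where $z\in V(P)$ is the dictator of $\mathcal{C}$ in color $c$, for $i=1,2$ we have $L(u_i)=L_0\cup\{c\}$ if $u_i\notin V(P)$ and $\mathcal{C}(u_i)=L_0$ otherwise, where $|L_0|=2$, and the canvas $(G\setminus(V(P)-V(U)),U,L)$ is a harmonica from $U=u_1u_2$ to $P'$ with democracy $\mathcal{C}'$ where $\mathcal{C}'(u_1)=\mathcal{C}'(u_2)=L_0$; (4) $\mathcal{C}$ is a democracy, $P=p_1p_2$, and there is a vertex $z$ adjacent to $p_1$ and $p_2$ with $L(z)=L_0\cup\{c\}$ where $L_0=\mathcal{C}(p_1)=\mathcal{C}(p_2)$, and for some $i\in\{1,2\}$ the canvas $(G\setminus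 p_i,U,L)$, with $U=zp_{3-i}$, is a harmonica from $U$ to $P'$ with dictatorship $\mathcal{C}'=\{\phi_1,\phi_2\}$ where $\phi_1(z)=\phi_2(z)=c$ and $\{\phi_1(p_{3-i}),\phi_2(p_{3-i})\}=L_0$. -}

module Defs where

open import Data.Nat using (ℕ; zero; suc; _+_; _*_; _≤_; _≤ᵇ_)
open import Data.Bool using (Bool; true; false; _∧_; _∨_; not)
open import Data.Fin using (Fin; toℕ; _≟_)
open import Data.List using (List; []; _∷_; length; allFin; upTo; filter)
open import Data.Bool.ListAction using (any; all)
open import Data.List.Relation.Unary.All using (All)
open import Data.List.Relation.Unary.Unique.Propositional using (Unique)
open import Data.List.Membership.Propositional using (_∈_)
open import Data.Product using (Σ; ∃; ∃-syntax; _×_; _,_; proj₁; proj₂)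
open import Data.Sum using (_⊎_)
open import Relation.Nullary using (¬_; ⌊_⌋)
open import Relation.Binary.PropositionalEquality using (_≡_; _≢_)
open import Function.Bundles using (_⇔_)

iter : {A : Set} → (A → A) → ℕ → A → A
iter f zero    x = x
iter f (suc k) x = f (iter f k x)

count : {k : ℕ} → (Fin k → Bool) → ℕ
count {k} p = length (filter (λ i → p i Data.Bool.≟ true) (allFin k))

-- Faces of a map with darts Fin m: orbits of φ = σ ∘ α; counted by the
-- number of darts that are least (as numbers) in their face.

module _ {m : ℕ} (α σ : Fin m → Fin m) where
  faceStep : Fin m → Fin m
  faceStep d = σ (α d)

  sameFace : Fin m → Fin m → Bool
  sameFace d e = any (λ k → ⌊ iter faceStep k d ≟ e ⌋) (upTo m)

  faceRep : Fin m → Bool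
  faceRep d = all (λ e → not (sameFace e d) ∨ (toℕ d ≤ᵇ toℕ e)) (allFin m)

  faceCount : ℕ
  faceCount = count faceRep

  data Conn (d : Fin m) : Fin m → Set where
    here : Conn d d
    viaα : ∀ {e} → Conn d e → Conn d (α e)
    viaσ : ∀ {e} → Conn d e → Conn d (σ e)

-- The plane: a connected combinatorial map of genus 0 (sphere), with a
-- marked dart whose face is the unbounded (outer) face.
-- Darts Fin m; dart d goes from vert d to vert (α d); α pairs the two
-- darts of an edge; σ is the rotation of darts around their common tail.
-- Faces are orbits of φ = σ ∘ α.

record PlaneMap : Set where
  field
    n m     : ℕ
    vert    : Fin m → Fin n
    α σ σ⁻  : Fin m → Fin m
    α-invol : ∀ d → α (α d) ≡ d
    α-nofix : ∀ d → α d ≢ d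
    σσ⁻     : ∀ d → σ (σ⁻ d) ≡ d
    σ⁻σ     : ∀ d → σ⁻ (σ d) ≡ d
    σ-vert  : ∀ d → vert (σ d) ≡ vert d
    σ-trans : ∀ d e → vert d ≡ vert e → ∃[ k ] iter σ k d ≡ e
    vert-sur : ∀ v → ∃[ d ] vert d ≡ v

  field
    connected : ∀ d e → Conn α σ d e
    -- Euler's formula  V - E + F = 2  (E = m/2): genus 0
    euler   : 2 * n + 2 * faceCount α σ ≡ m + 4
    outer   : Fin m

  φ : Fin m → Fin m
  φ = faceStep α σ

-- Plane graphs = subgraphs of the plane map (with the induced embedding)

module _ (M : PlaneMap) where
  open PlaneMap M

  record Sub : Set where
    field
      vs : Fin n → Bool
      es : Fin m → Bool
      es-α  : ∀ d → es (α d) ≡ es d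
      es-vs : ∀ d → es d ≡ true → vs (vert d) ≡ true

  open Sub public

  Simple : Sub → Set
  Simple G = (∀ d → es G d ≡ true → vert d ≢ vert (α d))
           × (∀ d e → es G d ≡ true → es G e ≡ true → vert d ≡ vert e
                → vert (α d) ≡ vert (α e) → d ≡ e)

  EdgeOn : Fin m → Fin n → Fin n → Set
  EdgeOn d u v = (vert d ≡ u × vert (α d) ≡ v) ⊎ (vert d ≡ v × vert (α d) ≡ u)

  Adj : Sub → Fin n → Fin n → Set
  Adj G u v = ∃[ d ] (es G d ≡ true × vert d ≡ u × vert (α d) ≡ v)

  _⊆_ : Sub → Sub → Set
  G' ⊆ G = (∀ v → vs G' v ≡ true → vs G v ≡ true) × (∀ d → es G' d ≡ true → es G d ≡ true)

  delete : Sub → (Fin n → Bool) → Sub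
  delete G X = record
    { vs = λ v → vs G v ∧ not (X v)
    ; es = λ d → es G d ∧ not (X (vert d)) ∧ not (X (vert (α d)))
    ; es-α = λ d → lemα d
    ; es-vs = λ d h → lemvs d h }
    where
    open import Relation.Binary.PropositionalEquality using (cong; sym; trans)
    open import Data.Bool.Properties using (∧-comm; ∧-assoc)
    lemα : ∀ d → (es G (α d) ∧ not (X (vert (α d))) ∧ not (X (vert (α (α d)))))
               ≡ (es G d ∧ not (X (vert d)) ∧ not (X (vert (α d))))
    lemα d rewrite es-α G d | α-invol d with es G d
    ... | false = Relation.Binary.PropositionalEquality.refl
    ... | true  = ∧-comm (not (X (vert (α d)))) (not (X (vert d)))
    lemvs : ∀ d → (es G d ∧ not (X (vert d)) ∧ not (X (vert (α d)))) ≡ true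
              → (vs G (vert d) ∧ not (X (vert d))) ≡ true
    lemvs d h with es G d in eq | X (vert d)
    lemvs d () | false | _
    lemvs d () | true  | true
    lemvs d h  | true  | false rewrite es-vs G d eq = Relation.Binary.PropositionalEquality.refl

  -- The region of the plane minus G containing the outer face of the map:
  -- faces of the map merge along edges not in G.
  data OuterR (G : Sub) : Fin m → Set where
    base  : OuterR G outer
    along : ∀ {d} → OuterR G d → OuterR G (φ d)
    cross : ∀ {d} → es G d ≡ false → OuterR G d → OuterR G (α d)

  OnOuterV : Sub → Fin n → Set
  OnOuterV G v = vs G v ≡ true × ∃[ d ] (vert d ≡ v × OuterR G d)

  OuterEdge : Sub → Fin n → Fin n → Set
  OuterEdge G u v = ∃[ d ] (es G d ≡ true × vert d ≡ u × vert (α d) ≡ v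
                            × (OuterR G d ⊎ OuterR G (α d)))

  LColoring : Sub → (Fin n → List ℕ) → (Fin n → ℕ) → Set
  LColoring G L ψ = (∀ v → vs G v ≡ true → ψ v ∈ L v)
                  × (∀ d → es G d ≡ true → ψ (vert d) ≢ ψ (vert (α d)))

  record Canvas (G : Sub) (p1 p2 : Fin n) (L : Fin n → List ℕ) : Set where
    field
      simple  : Simple G
      P-outer : OuterEdge G p1 p2
      L-set   : ∀ v → vs G v ≡ true → Unique (L v)
      L-int   : ∀ v → vs G v ≡ true → ¬ OnOuterV G v → 5 ≤ length (L v)
      L-nonS  : ∀ v → vs G v ≡ true → v ≢ p1 → v ≢ p2 → 3 ≤ length (L v)
      S-col   : ∃[ a ] ∃[ b ] (a ∈ L p1 × b ∈ L p2 × a ≢ b)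

-- Collections of colorings of a path p1p2: a coloring is the pair
-- (colour of p1, colour of p2).

Coll : Set
Coll = List (ℕ × ℕ)

Collection : Coll → Set
Collection 𝒞 = Unique 𝒞 × All (λ x → proj₁ x ≢ proj₂ x) 𝒞

Dictatorship : Coll → Set
Dictatorship 𝒞 = ∃[ c ] (All (λ x → proj₁ x ≡ c) 𝒞 ⊎ All (λ x → proj₂ x ≡ c) 𝒞)

Democracy : Coll → Set
Democracy 𝒞 = ∃[ a ] ∃[ b ] (𝒞 ≡ (a , b) ∷ (b , a) ∷ [])

Government : Coll → Set
Government 𝒞 = Collection 𝒞 × 2 ≤ length 𝒞 × (Dictatorship 𝒞 ⊎ Democracy 𝒞)

Confederacy : Coll → Set
Confederacy 𝒞 = Collection 𝒞 × ¬ Government 𝒞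
  × ∃[ 𝒞₁ ] ∃[ 𝒞₂ ] (Government 𝒞₁ × Government 𝒞₂
                     × (∀ x → (x ∈ 𝒞) ⇔ (x ∈ 𝒞₁ ⊎ x ∈ 𝒞₂)))

module _ {n : ℕ} where
  DictatorAt : Coll → Fin n → Fin n → Fin n → ℕ → Set
  DictatorAt 𝒞 p1 p2 z c = (z ≡ p1 × All (λ x → proj₁ x ≡ c) 𝒞)
                         ⊎ (z ≡ p2 × All (λ x → proj₂ x ≡ c) 𝒞)

  Proj : Coll → Fin n → Fin n → Fin n → ℕ → Set
  Proj 𝒞 p1 p2 u x = ∃[ y ] (y ∈ 𝒞 × ((u ≡ p1 × proj₁ y ≡ x) ⊎ (u ≡ p2 × proj₂ y ≡ x)))

  InP : Fin n → Fin n → Fin n → Set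
  InP p1 p2 v = v ≡ p1 ⊎ v ≡ p2

  inP? : Fin n → Fin n → Fin n → Bool
  inP? p1 p2 v = ⌊ v ≟ p1 ⌋ ∨ ⌊ v ≟ p2 ⌋

-- Harmonicas.  Harmonica M L q1 q2 G p1 p2 𝒞 : the canvas (G, p1p2, L)
-- is a harmonica from P = p1p2 to P' = q1q2 with government 𝒞.

module _ (M : PlaneMap) (L : Fin (PlaneMap.n M) → List ℕ)
         (q1 q2 : Fin (PlaneMap.n M)) where
  open PlaneMap M

  data Harmonica : Sub M → Fin n → Fin n → Coll → Set where
    harm1 : ∀ {G p1 p2 𝒞} → Canvas M G p1 p2 L → Government 𝒞 → OuterEdge M G q1 q2
          → (∀ v → (vs G v ≡ true) ⇔ InP p1 p2 v)
          → (∀ d → es G d ≡ true → EdgeOn M d p1 p2)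
          → ((q1 ≡ p1 × q2 ≡ p2) ⊎ (q1 ≡ p2 × q2 ≡ p1))
          → Harmonica G p1 p2 𝒞
    harm2 : ∀ {G p1 p2 𝒞} (z : Fin n) (c : ℕ)
          → Canvas M G p1 p2 L → Government 𝒞 → OuterEdge M G q1 q2
          → DictatorAt 𝒞 p1 p2 z c
          → (∀ v → (InP p1 p2 v × InP q1 q2 v) ⇔ (v ≡ z))
          → (∀ v → (vs G v ≡ true) ⇔ (InP p1 p2 v ⊎ InP q1 q2 v))
          → (∀ d → es G d ≡ true → EdgeOn M d p1 p2 ⊎ EdgeOn M d q1 q2)
          → Harmonica G p1 p2 𝒞
    harm3 : ∀ {G p1 p2 𝒞} (z : Fin n) (c : ℕ) (u1 u2 : Fin n) (a b : ℕ)
          → Canvas M G p1 p2 L → Government 𝒞 → OuterEdge M G q1 q2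
          → DictatorAt 𝒞 p1 p2 z c
          → Adj M G z u1 → Adj M G z u2 → Adj M G u1 u2
          → a ≢ b
          → (∀ u → InP u1 u2 u → ¬ InP p1 p2 u
                 → ∀ x → (x ∈ L u) ⇔ (x ≡ a ⊎ x ≡ b ⊎ x ≡ c))
          → (∀ u → InP u1 u2 u → InP p1 p2 u
                 → ∀ x → Proj 𝒞 p1 p2 u x ⇔ (x ≡ a ⊎ x ≡ b))
          → Harmonica (delete M G (λ v → inP? p1 p2 v ∧ not (inP? u1 u2 v)))
                      u1 u2 ((a , b) ∷ (b , a) ∷ [])
          → Harmonica G p1 p2 𝒞
    harm4₁ : ∀ {G p1 p2 𝒞} (z : Fin n) (c a b : ℕ)
          → Canvas M G p1 p2 L → Government 𝒞 → OuterEdge M G q1 q2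
          → Democracy 𝒞
          → (∀ x → Proj 𝒞 p1 p2 p1 x ⇔ (x ≡ a ⊎ x ≡ b))
          → (∀ x → Proj 𝒞 p1 p2 p2 x ⇔ (x ≡ a ⊎ x ≡ b))
          → Adj M G z p1 → Adj M G z p2
          → (∀ x → (x ∈ L z) ⇔ (x ≡ a ⊎ x ≡ b ⊎ x ≡ c))
          → Harmonica (delete M G (λ v → ⌊ v ≟ p1 ⌋)) z p2 ((c , a) ∷ (c , b) ∷ [])
          → Harmonica G p1 p2 𝒞
    harm4₂ : ∀ {G p1 p2 𝒞} (z : Fin n) (c a b : ℕ)
          → Canvas M G p1 p2 L → Government 𝒞 → OuterEdge M G q1 q2
          → Democracy 𝒞
          → (∀ x → Proj 𝒞 p1 p2 p1 x ⇔ (x ≡ a ⊎ x ≡ b))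
          → (∀ x → Proj 𝒞 p1 p2 p2 x ⇔ (x ≡ a ⊎ x ≡ b))
          → Adj M G z p1 → Adj M G z p2
          → (∀ x → (x ∈ L z) ⇔ (x ≡ a ⊎ x ≡ b ⊎ x ≡ c))
          → Harmonica (delete M G (λ v → ⌊ v ≟ p2 ⌋)) z p1 ((c , a) ∷ (c , b) ∷ [])
          → Harmonica G p1 p2 𝒞

  Φ : Sub M → Fin n → Fin n → Coll → ℕ × ℕ → Set
  Φ G p1 p2 𝒞 (x , y) = ∃[ ψ ] (LColoring M G L ψ × (ψ p1 , ψ p2) ∈ 𝒞
                               × ψ q1 ≡ x × ψ q2 ≡ y)

{-# OPTIONS --safe #-}

-- The coloured canvas is shrunk by induction. A government at P is described by a state, a star (one end has a fixed
-- colour, the other one a list of possible colours) or a democracy, and a harmonica by a sequence of moves between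
-- states: turning about the dictator, passing from a dictator to a democracy on a triangle, and passing from a
-- democracy to a dictator. Let B consist of the ends of P and P′ and the vertices with fewer than five colours. If an
-- edge between vertices of B separates P from P′, then the results for the two sides are composed; parts cut off from
-- P and P′ are removed, since by Thomassen's theorem every colouring extends to them. In what remains the vertices of
-- B have at most two neighbours in B, and short arguments, which delete a vertex or an alternately coloured path,
-- yield two different governments at P′ unless P and P′ share a vertex and a single move leads from P to P′. Two
-- different governments at P lead to two different ones at P′ in the same way.
--
-- The topology needed is that a vertex v on the outer face orders its neighbours linearly, and that for neighbours
-- r < s < t a path from r to t and a path from s to the outer face, both avoiding v, meet. This follows from the
-- vanishing of the homology of the sphere modulo 2, which is derived from Euler's formula by counting dimensions.

module Submission where

open import Defs
open import Algebra using (CommutativeRing)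
import Algebra.Properties.CommutativeMonoid.Sum as SumP
open import Data.Bool as Bool using (Bool; true; false; _∧_; not; _xor_; if_then_else_)
import Data.Bool.ListAction as BL
open import Data.Bool.Properties as Boolₚ using (xor-assoc; xor-comm; xor-same; xor-identityʳ; ∧-distribˡ-xor; ∧-distribʳ-xor)
open import Data.Empty using (⊥; ⊥-elim)
open import Data.Fin as Fin using (Fin; zero; suc; toℕ; _≟_; funToFin; finToFun)
open import Data.Fin.Permutation using (Permutation; permutation; _⟨$⟩ʳ_)
open import Data.Fin.Properties as Finₚ using (any?; pigeonhole; toℕ-injective; finToFun-funToFin; funToFin-finToFin)
open import Data.List using (List; []; _∷_; length; allFin; upTo; filter; map; _++_; lookup; deduplicate)
open import Data.List.Membership.Propositional using (_∈_; lose; find)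
open import Data.List.Membership.Propositional.Properties
  using (∈-filter⁺; ∈-filter⁻; ∈-allFin; ∈-lookup; ∈-∃++; ∈-++⁻; ∈-++⁺ˡ; ∈-++⁺ʳ; ∈-map⁺; ∈-map⁻; ∈-upTo⁺; ∈-deduplicate⁺; ∈-deduplicate⁻)
open import Data.List.Properties using (length-++; length-map; filter-notAll; length-tabulate)
open import Data.List.Relation.Unary.All as All using (All; []; _∷_)
open import Data.List.Relation.Unary.Any as Any using (Any; here; there)
open import Data.List.Relation.Unary.Any.Properties using (lookup-index)
open import Data.List.Relation.Unary.Unique.DecPropositional.Properties using (deduplicate-!)
open import Data.List.Relation.Unary.Unique.Propositional using (Unique; []; _∷_)
import Data.List.Relation.Unary.Unique.Propositional.Properties as Uniqₚ
open import Data.Maybe using (Maybe; just; nothing)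
open import Data.Maybe.Properties using (just-injective)
open import Data.Nat as ℕ using (ℕ; zero; suc; _+_; _*_; _^_; _≤_; _<_; z≤n; s≤s; _≤?_; _∸_)
open import Data.Nat.DivMod using (_%_; _/_; m≡m%n+[m/n]*n; m%n<n)
import Data.Nat.Properties as ℕₚ
open import Data.Product using (Σ; ∃-syntax; _×_; _,_; proj₁; proj₂; _,′_)
open import Data.Product.Properties using (≡-dec)
open import Data.Sum using (_⊎_; inj₁; inj₂)
open import Data.Unit using (⊤; tt)
open import Function using (_∘_; id; case_of_)
open import Function.Bundles using (_⇔_; mk⇔; Equivalence)
open import Relation.Binary.Definitions using (tri<; tri≈; tri>)
open import Relation.Binary.PropositionalEquality
open import Relation.Nullary using (¬_; Dec; yes; no; ⌊_⌋; ¬?; _×-dec_; _⊎-dec_)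
open import Relation.Nullary.Decidable using (map′; decidable-stable)

-- Finite sets of vertices

-- The claim for one government does not compose: across a separating edge the first side may
-- deliver two different governments, and the second must not merge them. So `IH` carries both
-- claims, and `Conf` reduces a confederacy to two governments of different `Ty`. The recurring
-- exchange is five minus two: when an outer vertex is deleted, two of its colours leave the lists
-- of its long neighbours, which keep three and become outer; the vertex later takes whichever of
-- the two its one other neighbour in `B` allows. The obstacle is that the induction hypothesis may
-- then return moves instead of a confederacy. But triangles and apexes require lists {a, b, c},
-- which occur only in `B` or where two colours have just been removed, and `Ctx` makes the
-- resulting configuration a rigid fan around one vertex outside `B`, where two governments can be
-- written down. Turns are a clause of a harmonica only as its last step. They arise when successive
-- separating edges share the dictator, so `Steps` admits them and `starNorm` absorbs them. Every
-- canvas of the induction is induced on a subset of one vertex set, and the colouring arguments see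
-- the topology only through `Plane`.

VSet : ℕ → Set
VSet n = Fin n → Bool

-- Wrapped in a record so that unification recovers `X` and `v` from the type; the bare equation
-- would lose them as soon as `X v` reduces.
record _∋_ {n} (X : VSet n) (v : Fin n) : Set where
  constructor mk
  field un : X v ≡ true
open _∋_ public
infix 4 _∋_ _⊂_

_∋?_ : ∀ {n} (X : VSet n) v → Dec (X ∋ v)
X ∋? v = map′ mk un (X v Bool.≟ true)

_⊂_ : ∀ {n} → VSet n → VSet n → Set
X ⊂ Y = ∀ {v} → X ∋ v → Y ∋ v

b2n : Bool → ℕ
b2n true = 1
b2n false = 0

sz : ∀ {n} → VSet n → ℕ
sz {zero} X = 0
sz {suc n} X = b2n (X zero) + sz (X ∘ suc)

sz-mono : ∀ {n} {X Y : VSet n} → X ⊂ Y → sz X ≤ sz Y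
sz-mono {zero} h = z≤n
sz-mono {suc n} {X} {Y} h = ℕₚ.+-mono-≤ hd (sz-mono {X = X ∘ suc} {Y ∘ suc} λ {v} p → mk (un (h {suc v} (mk (un p)))))
  where
  hd : b2n (X zero) ≤ b2n (Y zero)
  hd with X zero in e
  ... | false = z≤n
  ... | true rewrite un (h (mk {X = X} e)) = ℕₚ.≤-refl

sz-strict : ∀ {n} {X Y : VSet n} {v} → X ⊂ Y → Y ∋ v → ¬ X ∋ v → sz X < sz Y
sz-strict {suc n} {X} {Y} {zero} h y x with X zero in e
... | true = ⊥-elim (x (mk e))
... | false rewrite un y = s≤s (sz-mono {X = X ∘ suc} {Y ∘ suc} λ {v} p → mk (un (h {suc v} (mk (un p)))))
sz-strict {suc n} {X} {Y} {suc v} h y x = ℕₚ.+-mono-≤-< hd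
    (sz-strict {X = X ∘ suc} {Y ∘ suc} {v} (λ {w} p → mk (un (h {suc w} (mk (un p))))) (mk (un y)) (λ p → x (mk (un p))))
  where
  hd : b2n (X zero) ≤ b2n (Y zero)
  hd with X zero in e
  ... | false = z≤n
  ... | true rewrite un (h (mk {X = X} e)) = ℕₚ.≤-refl

sz-full : ∀ n → sz {n} (λ _ → true) ≡ n
sz-full zero = refl
sz-full (suc n) = cong suc (sz-full n)

⌊⌋-true : ∀ {P : Set} {d : Dec P} → ⌊ d ⌋ ≡ true → P
⌊⌋-true {d = yes p} _ = p

true-⌊⌋ : ∀ {P : Set} {d : Dec P} → P → ⌊ d ⌋ ≡ true
true-⌊⌋ {d = yes p} _ = refl
true-⌊⌋ {d = no ¬p} p = ⊥-elim (¬p p)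

false-⌊⌋ : ∀ {P : Set} {d : Dec P} → ¬ P → ⌊ d ⌋ ≡ false
false-⌊⌋ {d = yes p} ¬p = ⊥-elim (¬p p)
false-⌊⌋ {d = no ¬p} _ = refl

∧-true : ∀ {a b} → a ∧ b ≡ true → a ≡ true × b ≡ true
∧-true {true} {true} _ = refl , refl

true-∧ : ∀ {a b} → a ≡ true → b ≡ true → a ∧ b ≡ true
true-∧ refl refl = refl

not-true : ∀ {a} → not a ≡ true → a ≡ false
not-true {false} _ = refl

true≢false : ∀ {b} → b ≡ true → b ≡ false → ⊥
true≢false refl ()

¬true : ∀ {b} → ¬ (b ≡ true) → b ≡ false
¬true {true} h = ⊥-elim (h refl)
¬true {false} h = refl

module _ {n : ℕ} where
  infixl 6 _-_ _⊹_ _∖_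

  abstract
    _-_ : VSet n → Fin n → VSet n
    (X - u) v = X v ∧ not ⌊ v ≟ u ⌋

    -in : ∀ {X : VSet n} {u v} → X ∋ v → v ≢ u → (X - u) ∋ v
    -in p q = mk (true-∧ (un p) (cong not (false-⌊⌋ {d = _ ≟ _} q)))

    -out : ∀ {X : VSet n} {u v} → (X - u) ∋ v → X ∋ v
    -out p = mk (proj₁ (∧-true (un p)))

    -ne : ∀ {X : VSet n} {u v} → (X - u) ∋ v → v ≢ u
    -ne {X} {u} {v} p e = true≢false (true-⌊⌋ {d = v ≟ u} e) (not-true (proj₂ (∧-true {X v} (un p))))

    _∖_ : VSet n → VSet n → VSet n
    (X ∖ Y) v = X v ∧ not (Y v)

    ∖in : ∀ {X Y : VSet n} {v} → X ∋ v → ¬ Y ∋ v → (X ∖ Y) ∋ v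
    ∖in {Y = Y} {v} p q = mk (true-∧ (un p) (cong not (¬true λ e → q (mk e))))

    ∖out : ∀ {X Y : VSet n} {v} → (X ∖ Y) ∋ v → X ∋ v
    ∖out p = mk (proj₁ (∧-true (un p)))

    ∖no : ∀ {X Y : VSet n} {v} → (X ∖ Y) ∋ v → ¬ Y ∋ v
    ∖no p q = true≢false (un q) (not-true (proj₂ (∧-true (un p))))

  _⊹_ : VSet n → Fin n → VSet n
  (X ⊹ u) v = if ⌊ v ≟ u ⌋ then true else X v

  ⊹in : ∀ {X : VSet n} {u v} → X ∋ v → (X ⊹ u) ∋ v
  ⊹in {X} {u} {v} p = mk (case v ≟ u of λ where
    (yes e) → cong (λ b → if b then true else X v) (true-⌊⌋ {d = v ≟ u} e)
    (no e) → trans (cong (λ b → if b then true else X v) (false-⌊⌋ {d = v ≟ u} e)) (un p))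

  ⊹new : ∀ {X : VSet n} {u} → (X ⊹ u) ∋ u
  ⊹new {X} {u} = mk (cong (λ b → if b then true else X u) (true-⌊⌋ {d = u ≟ u} refl))

  ⊹out : ∀ {X : VSet n} {u v} → (X ⊹ u) ∋ v → v ≢ u → X ∋ v
  ⊹out {X} {u} {v} p e = mk (trans (sym (cong (λ b → if b then true else X v) (false-⌊⌋ {d = v ≟ u} e))) (un p))

  ∅ : VSet n
  ∅ _ = false

  ∅-no : ∀ {v} → ¬ ∅ ∋ v
  ∅-no (mk ())


unique-⊆-length : ∀ {A : Set} {xs ys : List A} → Unique xs → (∀ {x} → x ∈ xs → x ∈ ys)
  → length xs ≤ length ys
unique-⊆-length [] h = z≤n
unique-⊆-length {xs = x ∷ xs} {ys} (p ∷ u) h with ∈-∃++ (h (here refl))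
... | as , bs , refl = subst (suc (length xs) ≤_) eq (s≤s (unique-⊆-length u g))
  where
  eq : suc (length (as ++ bs)) ≡ length (as ++ x ∷ bs)
  eq rewrite length-++ as {bs} | length-++ as {x ∷ bs} = sym (ℕₚ.+-suc (length as) (length bs))
  g : ∀ {y} → y ∈ xs → y ∈ as ++ bs
  g {y} y∈ with ∈-++⁻ as (h (there y∈))
  ... | inj₁ q = ∈-++⁺ˡ q
  ... | inj₂ (here refl) = ⊥-elim (All.lookup p y∈ refl)
  ... | inj₂ (there q) = ∈-++⁺ʳ as q

-- Linear algebra modulo 2

⨁ : ∀ {m} → (Fin m → Bool) → Bool
⨁ {zero} f = false
⨁ {suc m} f = f zero xor ⨁ (f ∘ suc)

⨁-cong : ∀ {m} {f g : Fin m → Bool} → (∀ i → f i ≡ g i) → ⨁ f ≡ ⨁ g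
⨁-cong {zero} h = refl
⨁-cong {suc m} h = cong₂ _xor_ (h zero) (⨁-cong (h ∘ suc))

xor-mid : ∀ a b c d → (a xor b) xor (c xor d) ≡ (a xor c) xor (b xor d)
xor-mid a b c d = begin
  (a xor b) xor (c xor d) ≡⟨ xor-assoc a b (c xor d) ⟩
  a xor (b xor (c xor d)) ≡⟨ cong (a xor_) (sym (xor-assoc b c d)) ⟩
  a xor ((b xor c) xor d) ≡⟨ cong (λ t → a xor (t xor d)) (xor-comm b c) ⟩
  a xor ((c xor b) xor d) ≡⟨ cong (a xor_) (xor-assoc c b d) ⟩
  a xor (c xor (b xor d)) ≡⟨ sym (xor-assoc a c (b xor d)) ⟩
  (a xor c) xor (b xor d) ∎
  where open ≡-Reasoning

⨁-xor : ∀ {m} (f g : Fin m → Bool) → ⨁ (λ i → f i xor g i) ≡ ⨁ f xor ⨁ g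
⨁-xor {zero} f g = refl
⨁-xor {suc m} f g rewrite ⨁-xor (f ∘ suc) (g ∘ suc) =
  xor-mid (f zero) (g zero) (⨁ (f ∘ suc)) (⨁ (g ∘ suc))

⨁-zero : ∀ {m} {f : Fin m → Bool} → (∀ i → f i ≡ false) → ⨁ f ≡ false
⨁-zero {zero} h = refl
⨁-zero {suc m} h rewrite h zero = ⨁-zero (h ∘ suc)

⨁-single : ∀ {m} {f : Fin m → Bool} j → (∀ i → i ≢ j → f i ≡ false) → ⨁ f ≡ f j
⨁-single {suc m} {f} zero h = trans (cong (f zero xor_) (⨁-zero λ i → h (suc i) λ ())) (xor-identityʳ _)
⨁-single {suc m} {f} (suc j) h rewrite h zero (λ ()) = ⨁-single j λ i ne → h (suc i) λ e → ne (Finₚ.suc-injective e)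

xor-false : ∀ {a b} → a xor b ≡ false → a ≡ b
xor-false {false} {false} _ = refl
xor-false {true} {true} _ = refl

funToFin-cong : ∀ {m k} {f g : Fin m → Fin k} → (∀ i → f i ≡ g i) → funToFin f ≡ funToFin g
funToFin-cong {zero} h = refl
funToFin-cong {suc m} h = cong₂ Fin.combine (h zero) (funToFin-cong (h ∘ suc))

toB : Fin 2 → Bool
toB zero = false
toB (suc _) = true

toF : Bool → Fin 2
toF false = zero
toF true = suc zero

toB-toF : ∀ b → toB (toF b) ≡ b
toB-toF false = refl
toB-toF true = refl

toF-toB : ∀ b → toF (toB b) ≡ b
toF-toB zero = refl
toF-toB (suc zero) = refl

-- A stand-in for the kernel of a linear map: with fewer equations than unknowns over the field of
-- two elements, two assignments agree in all equations. The pigeonhole principle for 2^N and 2^k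
-- suffices; linearity enters only when the two assignments are added.
collision : ∀ {k N} → k < N → (F : (Fin N → Bool) → Fin k → Bool)
  → (∀ {c c'} → (∀ j → c j ≡ c' j) → ∀ i → F c i ≡ F c' i)
  → ∃[ c ] ∃[ c' ] ∃[ j ] (c j ≢ c' j × ∀ i → F c i ≡ F c' i)
collision {k} {N} k<N F Fc = c₁ , c₂ , differ
  where
  G : Fin (2 ^ N) → Fin (2 ^ k)
  G a = funToFin (toF ∘ F (toB ∘ finToFun a))
  hit = pigeonhole (ℕₚ.^-monoʳ-< 2 (s≤s (s≤s z≤n)) k<N) G
  a = proj₁ hit
  b = proj₁ (proj₂ hit)
  c₁ c₂ : Fin N → Bool
  c₁ = toB ∘ finToFun a
  c₂ = toB ∘ finToFun b
  same : ∀ i → F c₁ i ≡ F c₂ i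
  same i = begin
    F c₁ i ≡⟨ sym (toB-toF _) ⟩
    toB (toF (F c₁ i)) ≡⟨ cong toB (sym (finToFun-funToFin (toF ∘ F c₁) i)) ⟩
    toB (finToFun (G a) i) ≡⟨ cong (λ t → toB (finToFun t i)) (proj₂ (proj₂ (proj₂ hit))) ⟩
    toB (finToFun (G b) i) ≡⟨ cong toB (finToFun-funToFin (toF ∘ F c₂) i) ⟩
    toB (toF (F c₂ i)) ≡⟨ toB-toF _ ⟩
    F c₂ i ∎ where open ≡-Reasoning
  ne : ¬ (∀ j → c₁ j ≡ c₂ j)
  ne h = Finₚ.<⇒≢ (proj₁ (proj₂ (proj₂ hit))) (begin
    a ≡⟨ sym (funToFin-finToFin {N} {2} a) ⟩
    funToFin (finToFun {2} {N} a) ≡⟨ funToFin-cong (λ j → trans (sym (toF-toB _)) (trans (cong toF (h j)) (toF-toB _))) ⟩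
    funToFin (finToFun {2} {N} b) ≡⟨ funToFin-finToFin {N} {2} b ⟩
    b ∎) where open ≡-Reasoning
  differ : ∃[ j ] (c₁ j ≢ c₂ j × ∀ i → F c₁ i ≡ F c₂ i)
  differ with any? (λ j → ¬? (c₁ j Bool.≟ c₂ j))
  ... | yes (j , p) = j , p , same
  ... | no q = ⊥-elim (ne λ j → decidable-stable (c₁ j Bool.≟ c₂ j) λ h → q (j , h))

-- Boolean searches and orbits of injections on a finite set

any-true : ∀ {A : Set} (p : A → Bool) xs → BL.any p xs ≡ true → ∃[ x ] (x ∈ xs × p x ≡ true)
any-true p (x ∷ xs) h with p x in e
... | true = x , here refl , e
... | false with any-true p xs h
...   | y , y∈ , q = y , there y∈ , q

true-any : ∀ {A : Set} (p : A → Bool) {xs x} → x ∈ xs → p x ≡ true → BL.any p xs ≡ true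
true-any p (here refl) h rewrite h = refl
true-any p {y ∷ _} (there q) h with p y
... | true = refl
... | false = true-any p q h

all-true : ∀ {A : Set} (p : A → Bool) {xs x} → BL.all p xs ≡ true → x ∈ xs → p x ≡ true
all-true p h (here refl) = proj₁ (∧-true h)
all-true p {y ∷ _} h (there q) = all-true p (proj₂ (∧-true {p y} h)) q

iter-+ : ∀ {A : Set} (f : A → A) j k x → iter f (j + k) x ≡ iter f j (iter f k x)
iter-+ f zero k x = refl
iter-+ f (suc j) k x = cong f (iter-+ f j k x)

iter-comm : ∀ {A : Set} (f : A → A) k x → iter f k (f x) ≡ f (iter f k x)
iter-comm f zero x = refl
iter-comm f (suc k) x = cong f (iter-comm f k x)

iter-inj : ∀ {A : Set} {f : A → A} → (∀ {x y} → f x ≡ f y → x ≡ y) → ∀ k {x y} → iter f k x ≡ iter f k y → x ≡ y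
iter-inj inj zero e = e
iter-inj inj (suc k) e = iter-inj inj k (inj e)

iter-* : ∀ {A : Set} (f : A → A) p {x} → iter f p x ≡ x → ∀ k → iter f (k * p) x ≡ x
iter-* f p e zero = refl
iter-* f p {x} e (suc k) = trans (iter-+ f p (k * p) x) (trans (cong (iter f p) (iter-* f p e k)) e)

period : ∀ {m} (f : Fin m → Fin m) → (∀ {x y} → f x ≡ f y → x ≡ y) → ∀ x
  → ∃[ p ] (p < m × iter f (suc p) x ≡ x)
period {m} f inj x with pigeonhole (ℕₚ.n<1+n m) (λ (i : Fin (suc m)) → iter f (toℕ i) x)
... | i , j , i<j , e = p , p<m , iter-inj inj (toℕ i) eq
  where
  p = toℕ j ∸ suc (toℕ i)
  split : toℕ i + suc p ≡ toℕ j
  split = trans (ℕₚ.+-suc (toℕ i) p) (ℕₚ.m+[n∸m]≡n i<j)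
  p<m : p < m
  p<m = ℕₚ.≤-trans (ℕₚ.≤-trans (ℕₚ.m≤n+m (suc p) (toℕ i)) (ℕₚ.≤-reflexive split)) (ℕₚ.≤-pred (Finₚ.toℕ<n j))
  eq : iter f (toℕ i) (iter f (suc p) x) ≡ iter f (toℕ i) x
  eq = trans (sym (iter-+ f (toℕ i) (suc p) x)) (trans (cong (λ t → iter f t x) split) (sym e))

-- `sameFace` inspects only the iterates below `m`; reducing the exponent modulo the period shows
-- that none is missed.
reduce-iter : ∀ {m} (f : Fin m → Fin m) → (∀ {x y} → f x ≡ f y → x ≡ y) → ∀ x k
  → ∃[ j ] (j < m × iter f j x ≡ iter f k x)
reduce-iter f inj x k with period f inj x
... | p , p<m , e = k % suc p , ℕₚ.≤-trans (m%n<n k (suc p)) p<m , sym (begin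
  iter f k x ≡⟨ cong (λ t → iter f t x) (m≡m%n+[m/n]*n k (suc p)) ⟩
  iter f (k % suc p + k / suc p * suc p) x ≡⟨ iter-+ f (k % suc p) _ x ⟩
  iter f (k % suc p) (iter f (k / suc p * suc p) x) ≡⟨ cong (iter f (k % suc p)) (iter-* f (suc p) e (k / suc p)) ⟩
  iter f (k % suc p) x ∎) where open ≡-Reasoning

-- On a finite orbit the inverse is itself an iterate: the added steps complete k whole periods.
iter-back : ∀ {m} (f : Fin m → Fin m) → (∀ {x y} → f x ≡ f y → x ≡ y) → ∀ x k → ∃[ j ] iter f j (iter f k x) ≡ x
iter-back f inj x k with period f inj x
... | p , _ , e = k * suc p ∸ k , trans (sym (iter-+ f (k * suc p ∸ k) k x)) (trans (cong (λ t → iter f t x) (ℕₚ.m∸n+n≡m k≤)) (iter-* f (suc p) e k))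
  where
  k≤ : k ≤ k * suc p
  k≤ = ℕₚ.m≤m*n k (suc p)

lookup-inj : ∀ {A : Set} {xs : List A} → Unique xs → ∀ i j → lookup xs i ≡ lookup xs j → i ≡ j
lookup-inj (p ∷ u) zero zero e = refl
lookup-inj (p ∷ u) zero (suc j) e = ⊥-elim (All.lookup p (∈-lookup j) e)
lookup-inj (p ∷ u) (suc i) zero e = ⊥-elim (All.lookup p (∈-lookup i) (sym e))
lookup-inj (p ∷ u) (suc i) (suc j) e = cong suc (lookup-inj u i j e)

⨁-permute : ∀ {m} (π : Permutation m m) (g : Fin m → Bool) → ⨁ g ≡ ⨁ (g ∘ (π ⟨$⟩ʳ_))
⨁-permute π g = trans (sum≡ g) (trans (S.sum-permute g π) (sym (sum≡ (g ∘ (π ⟨$⟩ʳ_)))))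
  where
  module S = SumP (CommutativeRing.+-commutativeMonoid Boolₚ.xor-∧-commutativeRing)
  sum≡ : ∀ {k} (h : Fin k → Bool) → ⨁ h ≡ S.sum h
  sum≡ {zero} h = refl
  sum≡ {suc k} h = cong (h zero xor_) (sum≡ (h ∘ suc))

-- Here `l` counts the edges off a spanning tree. Euler's formula makes them fewer than the faces,
-- and this strict inequality is all that genus 0 contributes.
euler-bound : ∀ n e f m l → l + n ≤ suc e → e + e ≤ m → 2 * n + 2 * f ≡ m + 4 → suc l ≤ f
euler-bound n e f m l h₁ h₂ h₃ = ℕₚ.*-cancelˡ-≤ {suc l} {f} 2 (ℕₚ.+-cancelˡ-≤ (2 * n) (2 * suc l) (2 * f) (begin
  2 * n + 2 * suc l ≡⟨ solve 2 (λ a b → con 2 :* b :+ con 2 :* (con 1 :+ a) := con 2 :* (a :+ b) :+ con 2) refl l n ⟩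
  2 * (l + n) + 2 ≤⟨ ℕₚ.+-monoˡ-≤ 2 (ℕₚ.*-monoʳ-≤ 2 h₁) ⟩
  2 * suc e + 2 ≡⟨ solve 1 (λ a → con 2 :* (con 1 :+ a) :+ con 2 := a :+ a :+ con 4) refl e ⟩
  e + e + 4 ≤⟨ ℕₚ.+-monoˡ-≤ 4 h₂ ⟩
  m + 4 ≡⟨ sym h₃ ⟩
  2 * n + 2 * f ∎))
  where
  open ℕₚ.≤-Reasoning
  open import Data.Nat.Solver
  open +-*-Solver

bool-⇔ : ∀ {a b} → (a ≡ true → b ≡ true) → (b ≡ true → a ≡ true) → a ≡ b
bool-⇔ {true} {b} f g = sym (f refl)
bool-⇔ {false} {true} f g = g refl
bool-⇔ {false} {false} f g = refl

-- Homology of the sphere modulo 2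

module Homology (M : PlaneMap) where
  open PlaneMap M public

  α-inj : ∀ {d e} → α d ≡ α e → d ≡ e
  α-inj {d} {e} h = trans (sym (α-invol d)) (trans (cong α h) (α-invol e))

  σ-inj : ∀ {d e} → σ d ≡ σ e → d ≡ e
  σ-inj {d} {e} h = trans (sym (σ⁻σ d)) (trans (cong σ⁻ h) (σ⁻σ e))

  φ-inj : ∀ {d e} → φ d ≡ φ e → d ≡ e
  φ-inj h = α-inj (σ-inj h)

  φα : ∀ d → φ (α d) ≡ σ d
  φα d = cong σ (α-invol d)

  φ-vert : ∀ d → vert (φ d) ≡ vert (α d)
  φ-vert d = σ-vert (α d)

  iter-σ-vert : ∀ k d → vert (iter σ k d) ≡ vert d
  iter-σ-vert zero d = refl
  iter-σ-vert (suc k) d = trans (σ-vert _) (iter-σ-vert k d)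

  SF : Fin m → Fin m → Bool
  SF = sameFace α σ

  SF-out : ∀ {d e} → SF d e ≡ true → ∃[ k ] iter φ k d ≡ e
  SF-out {d} {e} h with any-true (λ k → ⌊ iter φ k d ≟ e ⌋) (upTo m) h
  ... | k , _ , q = k , ⌊⌋-true {d = iter φ k d ≟ e} q

  SF-in : ∀ {d e} k → iter φ k d ≡ e → SF d e ≡ true
  SF-in {d} {e} k h with reduce-iter φ φ-inj d k
  ... | j , j<m , q = true-any (λ k → ⌊ iter φ k d ≟ e ⌋) (∈-upTo⁺ j<m) (true-⌊⌋ {d = iter φ j d ≟ e} (trans q h))

  SF-sym : ∀ {d e} → SF d e ≡ true → SF e d ≡ true
  SF-sym {d} h with SF-out h
  ... | k , refl with iter-back φ φ-inj d k
  ...   | j , q = SF-in j q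

  SF-φ : ∀ r d → SF r (φ d) ≡ SF r d
  SF-φ r d = bool-⇔ back forth
    where
    forth : SF r d ≡ true → SF r (φ d) ≡ true
    forth h with SF-out {r} h
    ... | k , q = SF-in (suc k) (cong φ q)
    back : SF r (φ d) ≡ true → SF r d ≡ true
    back h with SF-out {r} h
    ... | k , q with iter-back φ φ-inj d 1
    ...   | j , q' = SF-in (j + k) (trans (iter-+ φ j k r) (trans (cong (iter φ j) q) q'))

  reps : List (Fin m)
  reps = filter (λ i → faceRep α σ i Bool.≟ true) (allFin m)

  reps-unique : Unique reps
  reps-unique = Uniqₚ.filter⁺ _ (Uniqₚ.allFin⁺ m)

  rep-least : ∀ {r} → r ∈ reps → ∀ e → SF e r ≡ true → toℕ r ≤ toℕ e
  rep-least {r} r∈ e h with all-true _ (proj₂ (∈-filter⁻ (λ i → faceRep α σ i Bool.≟ true) {xs = allFin m} r∈)) (∈-allFin e)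
  ... | q rewrite h = ℕₚ.≤ᵇ⇒≤ (toℕ r) (toℕ e) (subst Bool.T (sym q) _)

  reps-apart : ∀ {r s} → r ∈ reps → s ∈ reps → r ≢ s → SF r s ≡ false
  reps-apart {r} {s} r∈ s∈ ne = ¬true λ h →
    ne (toℕ-injective (ℕₚ.≤-antisym (rep-least r∈ s (SF-sym h)) (rep-least s∈ r h)))

  Nf : ℕ
  Nf = faceCount α σ

  rep : Fin Nf → Fin m
  rep j = lookup reps j

  -- The face function with prescribed values on the faces: `SF (rep j)` is the indicator of the
  -- j-th face, and distinct representatives lie in distinct faces.
  f̂ : (Fin Nf → Bool) → Fin m → Bool
  f̂ c d = ⨁ λ j → c j ∧ SF (rep j) d

  f̂-φ : ∀ c d → f̂ c (φ d) ≡ f̂ c d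
  f̂-φ c d = ⨁-cong λ j → cong (c j ∧_) (SF-φ (rep j) d)

  f̂-at : ∀ c j → f̂ c (rep j) ≡ c j
  f̂-at c j = trans (⨁-single j off) (trans (cong (c j ∧_) (SF-in {rep j} 0 refl)) (Boolₚ.∧-identityʳ (c j)))
    where
    off : ∀ i → i ≢ j → c i ∧ SF (rep i) (rep j) ≡ false
    off i ne rewrite reps-apart (∈-lookup {xs = reps} i) (∈-lookup {xs = reps} j) (λ e → ne (lookup-inj reps-unique i j e)) = Boolₚ.∧-zeroʳ (c i)

  f̂-xor : ∀ c c' d → f̂ (λ j → c j xor c' j) d ≡ f̂ c d xor f̂ c' d
  f̂-xor c c' d = trans (⨁-cong λ j → ∧-distribʳ-xor (SF (rep j) d) (c j) (c' j)) (⨁-xor (λ j → c j ∧ SF (rep j) d) (λ j → c' j ∧ SF (rep j) d))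

  const-f : ∀ (f : Fin m → Bool) → (∀ d → f (φ d) ≡ f d) → (∀ d → f (α d) ≡ f d) → ∀ {d e} → Conn α σ d e → f e ≡ f d
  const-f f fφ fα here = refl
  const-f f fφ fα (viaα c) = trans (fα _) (const-f f fφ fα c)
  const-f f fφ fα (viaσ {e} c) = trans (cong f (sym (φα e))) (trans (fφ (α e)) (trans (fα e) (const-f f fφ fα c)))

  at-vertex : (Fin m → Bool) → Fin n → Bool
  at-vertex z u = ⨁ λ d → ⌊ vert d ≟ u ⌋ ∧ z d

  record Cycle (z : Fin m → Bool) : Set where
    field
      z-α : ∀ d → z (α d) ≡ z d
      z-even : ∀ u → at-vertex z u ≡ false
  open Cycle public

  -- The property wanted of the complement of a spanning tree, where it holds because a forest
  -- carries no nonzero cycle.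
  Detects : List (Fin m) → Set
  Detects es = ∀ z → Cycle z → (∀ {d} → d ∈ es → z d ≡ false) → ∀ d → z d ≡ false

  edgesL : List (Fin m)
  edgesL = filter (λ d → toℕ d ℕ.<? toℕ (α d)) (allFin m)

  edgesL-or : ∀ d → d ∈ edgesL ⊎ α d ∈ edgesL
  edgesL-or d with ℕₚ.<-cmp (toℕ d) (toℕ (α d))
  ... | tri< lt _ _ = inj₁ (∈-filter⁺ (λ d → toℕ d ℕ.<? toℕ (α d)) (∈-allFin d) lt)
  ... | tri≈ _ e _ = ⊥-elim (α-nofix d (sym (toℕ-injective e)))
  ... | tri> _ _ gt = inj₂ (∈-filter⁺ (λ d → toℕ d ℕ.<? toℕ (α d)) (∈-allFin (α d)) (subst (λ t → toℕ (α d) < toℕ t) (sym (α-invol d)) gt))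

  edgesL-len : length edgesL + length edgesL ≤ m
  edgesL-len = ℕₚ.≤-trans (ℕₚ.≤-reflexive eq) (ℕₚ.≤-trans (unique-⊆-length uu λ {x} _ → ∈-allFin x) (ℕₚ.≤-reflexive (length-tabulate (id {A = Fin m}))))
    where
    lt : ∀ {d} → d ∈ edgesL → toℕ d < toℕ (α d)
    lt q = proj₂ (∈-filter⁻ (λ d → toℕ d ℕ.<? toℕ (α d)) {xs = allFin m} q)
    eq : length edgesL + length edgesL ≡ length (edgesL ++ map α edgesL)
    eq = trans (cong (length edgesL +_) (sym (length-map α edgesL))) (sym (length-++ edgesL))
    ue = Uniqₚ.filter⁺ (λ d → toℕ d ℕ.<? toℕ (α d)) (Uniqₚ.allFin⁺ m)
    disj : ∀ {v} → ¬ (v ∈ edgesL × v ∈ map α edgesL)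
    disj (p , q) with ∈-map⁻ α q
    ... | e , e∈ , refl = ℕₚ.<-asym (lt e∈) (subst (λ t → toℕ (α e) < toℕ t) (α-invol e) (lt p))
    uu : Unique (edgesL ++ map α edgesL)
    uu = Uniqₚ.++⁺ ue (Uniqₚ.map⁺ α-inj ue) disj

  boundary : ∀ (U : VSet n) {d e} → Conn α σ d e → U ∋ vert d → ¬ U ∋ vert e → ∃[ t ] (U ∋ vert t × ¬ U ∋ vert (α t))
  boundary U here p q = ⊥-elim (q p)
  boundary U (viaα {e} c) p q with U ∋? vert e
  ... | yes u = e , u , q
  ... | no u = boundary U c p u
  boundary U (viaσ {e} c) p q = boundary U c p λ u → q (subst (U ∋_) (sym (σ-vert e)) u)

  -- A tree on the vertex set `U`, described by what it leaves over: `es` lists the edges not in the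
  -- tree, and `detects` replaces the statement that the removed edges form a forest.
  record Span (U : VSet n) (es : List (Fin m)) : Set where
    field
      start : U ∋ vert outer
      len : length es + sz U ≤ suc (length edgesL)
      cover : ∀ d → (d ∈ es ⊎ α d ∈ es) ⊎ (U ∋ vert d × U ∋ vert (α d))
      detects : Detects es

  -- An edge leaving `U` joins the tree. Its new end is a leaf, so every other edge there is still
  -- listed; a cycle that vanishes on those vanishes on the new tree edge by parity at the leaf.
  grow : ∀ {U es} → Span U es → ∀ {v} → ¬ U ∋ v → ∃[ w ] ∃[ es' ] (¬ U ∋ w × Span (U ⊹ w) es')
  grow {U} {es} S {v} nv = vert (α t) , es' , t∉ , record
    { start = ⊹in (S .start) ; len = len' ; cover = cover' ; detects = det }
    where
    open Span
    vd = vert-sur v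
    bd = boundary U (connected outer (proj₁ vd)) (S .start) (λ h → nv (subst (U ∋_) (proj₂ vd) h))
    t = proj₁ bd
    t∈ = proj₁ (proj₂ bd)
    t∉ = proj₂ (proj₂ bd)
    keep? : ∀ d → Dec (¬ (d ≡ t ⊎ d ≡ α t))
    keep? d = ¬? ((d ≟ t) ⊎-dec (d ≟ α t))
    es' = filter keep? es
    drop : ∀ {d} → d ∈ es → d ≡ t ⊎ d ≡ α t → length es' < length es
    drop d∈ e = filter-notAll keep? es (lose d∈ λ k → k e)
    t∈es : length es' < length es
    t∈es with S .cover t
    ... | inj₁ (inj₁ p) = drop p (inj₁ refl)
    ... | inj₁ (inj₂ p) = drop p (inj₂ refl)
    ... | inj₂ (_ , q) = ⊥-elim (t∉ q)
    len' : length es' + sz (U ⊹ vert (α t)) ≤ suc (length edgesL)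
    len' = ℕₚ.≤-trans (ℕₚ.+-monoʳ-≤ (length es') sz⊹) (ℕₚ.≤-trans (ℕₚ.≤-reflexive (ℕₚ.+-suc (length es') (sz U))) (ℕₚ.≤-trans (ℕₚ.+-monoˡ-≤ (sz U) t∈es) (S .len)))
      where
      sz⊹ : sz (U ⊹ vert (α t)) ≤ suc (sz U)
      sz⊹ = lem U (vert (α t))
        where
        lem : ∀ {k} (U : VSet k) v → sz (U ⊹ v) ≤ suc (sz U)
        lem {suc k} U zero = s≤s (ℕₚ.≤-trans (sz-mono {X = (U ⊹ zero) ∘ suc} {U ∘ suc} (λ p → mk (un p))) (ℕₚ.m≤n+m (sz (U ∘ suc)) (b2n (U zero))))
        lem {suc k} U (suc v) = ℕₚ.≤-trans (ℕₚ.+-monoʳ-≤ (b2n (U zero)) (ℕₚ.≤-trans (sz-mono {X = (U ⊹ suc v) ∘ suc} {(U ∘ suc) ⊹ v} sub) (lem (U ∘ suc) v))) (ℕₚ.≤-reflexive (ℕₚ.+-suc (b2n (U zero)) _))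
          where
          sub : ∀ {w} → ((U ⊹ suc v) ∘ suc) ∋ w → ((U ∘ suc) ⊹ v) ∋ w
          sub {w} p = case w ≟ v of λ where
            (yes refl) → ⊹new {X = U ∘ suc}
            (no ne) → ⊹in {X = U ∘ suc} (mk (un (⊹out {X = U} {suc v} {suc w} (mk (un p)) λ e → ne (Finₚ.suc-injective e))))
    ends : ∀ {d} → d ≡ t ⊎ d ≡ α t → (U ⊹ vert (α t)) ∋ vert d × (U ⊹ vert (α t)) ∋ vert (α d)
    ends (inj₁ refl) = ⊹in t∈ , ⊹new {X = U}
    ends (inj₂ refl) = ⊹new {X = U} , subst (λ e → (U ⊹ vert (α t)) ∋ vert e) (sym (α-invol t)) (⊹in t∈)
    cover' : ∀ d → (d ∈ es' ⊎ α d ∈ es') ⊎ ((U ⊹ vert (α t)) ∋ vert d × (U ⊹ vert (α t)) ∋ vert (α d))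
    cover' d with (d ≟ t) ⊎-dec (d ≟ α t) | S .cover d
    ... | yes e | _ = inj₂ (ends e)
    ... | no ne | inj₂ (p , q) = inj₂ (⊹in p , ⊹in q)
    ... | no ne | inj₁ (inj₁ p) = inj₁ (inj₁ (∈-filter⁺ keep? p ne))
    ... | no ne | inj₁ (inj₂ p) = inj₁ (inj₂ (∈-filter⁺ keep? p λ where
      (inj₁ e) → ne (inj₂ (trans (sym (α-invol d)) (cong α e)))
      (inj₂ e) → ne (inj₁ (α-inj e))))
    det : Detects es'
    det z cz h = S .detects z cz full
      where
      zαt : z (α t) ≡ false
      zαt = trans (sym (trans (⨁-single (α t) off) (cong (_∧ z (α t)) (true-⌊⌋ {d = vert (α t) ≟ vert (α t)} refl)))) (cz .z-even (vert (α t)))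
        where
        off : ∀ i → i ≢ α t → ⌊ vert i ≟ vert (α t) ⌋ ∧ z i ≡ false
        off i ne with vert i ≟ vert (α t)
        ... | no _ = refl
        ... | yes ve with S .cover i
        ...   | inj₂ (p , _) = ⊥-elim (t∉ (subst (U ∋_) ve p))
        ...   | inj₁ (inj₁ p) = h (∈-filter⁺ keep? p λ where
          (inj₁ e) → t∉ (subst (U ∋_) (trans (cong vert (sym e)) ve) t∈)
          (inj₂ e) → ne e)
        ...   | inj₁ (inj₂ p) = trans (sym (cz .z-α i)) (h (∈-filter⁺ keep? p λ where
          (inj₁ e) → ne (trans (sym (α-invol i)) (cong α e))
          (inj₂ e) → t∉ (subst (U ∋_) (trans (cong vert (sym (α-inj e))) ve) t∈)))
      full : ∀ {d} → d ∈ es → z d ≡ false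
      full {d} d∈ with (d ≟ t) ⊎-dec (d ≟ α t)
      ... | no ne = h (∈-filter⁺ keep? d∈ ne)
      ... | yes (inj₁ refl) = trans (sym (cz .z-α d)) zαt
      ... | yes (inj₂ refl) = zαt

  spanning : ∀ k {U es} → n ≤ sz U + k → Span U es → ∃[ es' ] (length es' + n ≤ suc (length edgesL) × Detects es')
  spanning k {U} {es} le S with any? (λ v → ¬? (U ∋? v))
  ... | no all∈ = es , subst (λ t → length es + t ≤ suc (length edgesL)) eq (S .Span.len) , S .Span.detects
    where
    eq : sz U ≡ n
    eq = ℕₚ.≤-antisym (subst (sz U ≤_) (sz-full n) (sz-mono {X = U} {λ _ → true} λ _ → mk refl))
      (subst (_≤ sz U) (sz-full n) (sz-mono {X = λ _ → true} {U} λ {v} _ → decidable-stable (U ∋? v) λ h → all∈ (v , h)))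
  ... | yes (v , nv) with k | grow S nv
  ...   | suc k' | w , es' , nw , S' = spanning k' (ℕₚ.≤-trans le (ℕₚ.≤-trans (ℕₚ.≤-reflexive (ℕₚ.+-suc (sz U) k')) (ℕₚ.+-monoˡ-≤ k' (sz-strict {X = U} {U ⊹ w} {w} ⊹in (⊹new {X = U}) nw)))) S'
  ...   | zero | _ = ⊥-elim (ℕₚ.<⇒≱ (subst (sz U <_) (sz-full n) (sz-strict {X = U} {λ _ → true} {v} (λ _ → mk refl) (mk refl) nv)) (subst (n ≤_) (ℕₚ.+-identityʳ _) le))

  span₀ : Span (∅ ⊹ vert outer) edgesL
  span₀ = record
    { start = ⊹new {X = ∅}
    ; len = subst (length edgesL + sz (∅ ⊹ vert outer) ≤_) (ℕₚ.+-comm (length edgesL) 1) (ℕₚ.+-monoʳ-≤ (length edgesL) (one (vert outer)))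
    ; cover = λ d → inj₁ (edgesL-or d)
    ; detects = λ z cz h d → case edgesL-or d of λ where
        (inj₁ p) → h p
        (inj₂ p) → trans (sym (cz .z-α d)) (h p) }
    where
    none : ∀ {k} (X : VSet k) → (∀ v → X v ≡ false) → sz X ≡ 0
    none {zero} X h = refl
    none {suc k} X h rewrite h zero = none (X ∘ suc) (h ∘ suc)
    one : ∀ {k} (v : Fin k) → sz (∅ ⊹ v) ≤ 1
    one {suc k} zero = s≤s (ℕₚ.≤-reflexive (none ((∅ {suc k} ⊹ zero) ∘ suc) λ _ → refl))
    one {suc k} (suc v) = ℕₚ.≤-trans (sz-mono {X = (∅ ⊹ suc v) ∘ suc} {∅ ⊹ v} sub) (one v)
      where
      sub : ∀ {w} → ((∅ ⊹ suc v) ∘ suc) ∋ w → (∅ {k} ⊹ v) ∋ w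
      sub {w} p = case w ≟ v of λ where
        (yes refl) → ⊹new {X = ∅}
        (no ne) → ⊥-elim (∅-no {suc k} (⊹out {X = ∅} {suc v} {suc w} (mk (un p)) λ e → ne (Finₚ.suc-injective e)))

  module Fill (z : Fin m → Bool) (cz : Cycle z) (el : List (Fin m)) (det : Detects el) where
    ev : (Fin (suc Nf) → Bool) → Fin m → Bool
    ev c d = (f̂ (c ∘ suc) d xor f̂ (c ∘ suc) (α d)) xor (c zero ∧ z d)
    -- One unknown per face and one for the multiple of `z`; one equation per listed edge and one
    -- for the value on the outer face. `euler-bound` leaves fewer equations than unknowns.
    F : (Fin (suc Nf) → Bool) → Fin (suc (length el)) → Bool
    F c zero = f̂ (c ∘ suc) outer
    F c (suc i) = ev c (lookup el i)
    f̂-cong : ∀ {c c'} → (∀ j → c j ≡ c' j) → ∀ d → f̂ c d ≡ f̂ c' d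
    f̂-cong h d = ⨁-cong λ j → cong (_∧ SF (rep j) d) (h j)
    F-cong : ∀ {c c'} → (∀ j → c j ≡ c' j) → ∀ i → F c i ≡ F c' i
    F-cong h zero = f̂-cong (h ∘ suc) outer
    F-cong h (suc i) = cong₂ _xor_ (cong₂ _xor_ (f̂-cong (h ∘ suc) (lookup el i)) (f̂-cong (h ∘ suc) (α (lookup el i)))) (cong (_∧ z (lookup el i)) (h zero))
    module Diff (c₁ c₂ : Fin (suc Nf) → Bool) (j₀ : Fin (suc Nf)) (ne : c₁ j₀ ≢ c₂ j₀) (same : ∀ i → F c₁ i ≡ F c₂ i) where
      c : Fin (suc Nf) → Bool
      c j = c₁ j xor c₂ j
      cc = c ∘ suc
      f : Fin m → Bool
      f = f̂ cc
      f-outer : f outer ≡ false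
      f-outer = trans (f̂-xor (c₁ ∘ suc) (c₂ ∘ suc) outer) (trans (cong (_xor f̂ (c₂ ∘ suc) outer) (same zero)) (xor-same (f̂ (c₂ ∘ suc) outer)))
      ev-xor : ∀ d → ev c d ≡ ev c₁ d xor ev c₂ d
      ev-xor d = trans (cong₂ _xor_ (trans (cong₂ _xor_ (f̂-xor (c₁ ∘ suc) (c₂ ∘ suc) d) (f̂-xor (c₁ ∘ suc) (c₂ ∘ suc) (α d))) (xor-mid (f̂ (c₁ ∘ suc) d) (f̂ (c₂ ∘ suc) d) (f̂ (c₁ ∘ suc) (α d)) (f̂ (c₂ ∘ suc) (α d)))) (∧-distribʳ-xor (z d) (c₁ zero) (c₂ zero)))
        (xor-mid (f̂ (c₁ ∘ suc) d xor f̂ (c₁ ∘ suc) (α d)) (f̂ (c₂ ∘ suc) d xor f̂ (c₂ ∘ suc) (α d)) (c₁ zero ∧ z d) (c₂ zero ∧ z d))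
      ev-el : ∀ {d} → d ∈ el → ev c d ≡ false
      ev-el {d} d∈ = subst (λ e → ev c e ≡ false) (sym (lookup-index d∈))
        (trans (ev-xor _) (trans (cong (_xor ev c₂ (lookup el (Any.index d∈))) (same (suc (Any.index d∈)))) (xor-same (ev c₂ (lookup el (Any.index d∈))))))
      -- The coboundary of a function on faces is even at u because rotation about u permutes the darts at u.
      ∂-cycle : Cycle (λ d → f d xor f (α d))
      ∂-cycle = record
        { z-α = λ d → trans (cong (λ t → f (α d) xor f t) (α-invol d)) (xor-comm (f (α d)) (f d))
        ; z-even = λ u → trans (⨁-cong λ d → ∧-distribˡ-xor ⌊ vert d ≟ u ⌋ (f d) (f (α d)))
            (trans (⨁-xor (λ d → ⌊ vert d ≟ u ⌋ ∧ f d) (λ d → ⌊ vert d ≟ u ⌋ ∧ f (α d))) (trans (cong (_xor ⨁ (λ d → ⌊ vert d ≟ u ⌋ ∧ f (α d))) (shift u)) (xor-same (⨁ (λ d → ⌊ vert d ≟ u ⌋ ∧ f (α d)))))) }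
        where
        perm : ∀ (g : Fin m → Bool) → ⨁ g ≡ ⨁ (g ∘ σ)
        perm g = ⨁-permute (permutation σ σ⁻ σσ⁻ σ⁻σ) g
        shift : ∀ u → ⨁ (λ d → ⌊ vert d ≟ u ⌋ ∧ f d) ≡ ⨁ (λ d → ⌊ vert d ≟ u ⌋ ∧ f (α d))
        shift u = trans (perm (λ d → ⌊ vert d ≟ u ⌋ ∧ f d)) (⨁-cong λ d → cong₂ _∧_ (cong (λ v → ⌊ v ≟ u ⌋) (σ-vert d)) (trans (cong f (sym (φα d))) (f̂-φ cc (α d))))
      ev-cycle : Cycle (ev c)
      ev-cycle = record
        { z-α = λ d → cong₂ _xor_ (∂-cycle .z-α d) (cong (c zero ∧_) (cz .z-α d))
        ; z-even = λ u → trans (⨁-cong λ d → ∧-distribˡ-xor ⌊ vert d ≟ u ⌋ (f d xor f (α d)) (c zero ∧ z d))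
            (trans (⨁-xor (λ d → ⌊ vert d ≟ u ⌋ ∧ (f d xor f (α d))) (λ d → ⌊ vert d ≟ u ⌋ ∧ (c zero ∧ z d))) (cong₂ _xor_ (∂-cycle .z-even u) (rest u))) }
        where
        rest : ∀ u → ⨁ (λ d → ⌊ vert d ≟ u ⌋ ∧ (c zero ∧ z d)) ≡ false
        rest u with c zero
        ... | false = ⨁-zero λ d → Boolₚ.∧-zeroʳ ⌊ vert d ≟ u ⌋
        ... | true = cz .z-even u
      ev-zero : ∀ d → ev c d ≡ false
      ev-zero = det (ev c) ev-cycle ev-el
      -- If `z` did not occur, `f` would jump at no edge, hence be constant by connectedness and
      -- equal to its value at `outer`, which is false; the two colliding assignments would then
      -- coincide.
      c0 : c zero ≡ true
      c0 with c zero in e0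
      ... | true = refl
      ... | false = ⊥-elim (ne (xor-false (all0 j₀)))
        where
        flat : ∀ d → f (α d) ≡ f d
        flat d = sym (xor-false (trans (sym (xor-identityʳ _)) (trans (cong (λ b → (f d xor f (α d)) xor (b ∧ z d)) (sym e0)) (ev-zero d))))
        all0 : ∀ j → c j ≡ false
        all0 zero = e0
        all0 (suc j) = trans (sym (f̂-at cc j)) (trans (const-f f (f̂-φ cc) flat (connected outer (rep j))) f-outer)
      f∂ : ∀ d → f d xor f (α d) ≡ z d
      f∂ d = xor-false (trans (cong (λ b → (f d xor f (α d)) xor (b ∧ z d)) (sym c0)) (ev-zero d))

  -- Genus 0: every cycle is the boundary of a set of faces.
  fill : ∀ z → Cycle z → ∃[ f ] ((∀ d → f (φ d) ≡ f d) × (∀ d → f d xor f (α d) ≡ z d) × f outer ≡ false)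
  fill z cz = go (spanning n (ℕₚ.m≤n+m n (sz (∅ ⊹ vert outer))) span₀)
    where
    Goal = ∃[ f ] ((∀ d → f (φ d) ≡ f d) × (∀ d → f d xor f (α d) ≡ z d) × f outer ≡ false)
    module _ (el : List (Fin m)) (det : Detects el) where
      open Fill z cz el det
      diff : ∃[ c ] ∃[ c' ] ∃[ j ] (c j ≢ c' j × ∀ i → F c i ≡ F c' i) → Goal
      diff (c₁ , c₂ , j₀ , ne , same) = f , f̂-φ cc , f∂ , f-outer
        where open Diff c₁ c₂ j₀ ne same
      collide : suc (length el) ≤ Nf → Goal
      collide le = diff (collision (s≤s le) F (λ {c} {c'} → F-cong {c} {c'}))
    go : ∃[ el ] (length el + n ≤ suc (length edgesL) × Detects el) → Goal
    go (el , len-el , det) = collide el det (euler-bound n (length edgesL) Nf m (length el) len-el edgesL-len euler)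

least : ∀ {P : ℕ → Set} → (∀ i → Dec (P i)) → ∀ {k} → P k → ∃[ j ] (P j × (∀ {i} → i < j → ¬ P i) × j ≤ k)
least {P} P? {k} pk with P? 0
... | yes p = 0 , p , (λ ()) , z≤n
... | no ¬p with k
...   | zero = ⊥-elim (¬p pk)
...   | suc k' with least {P ∘ suc} (P? ∘ suc) {k'} pk
...     | j , pj , mn , le = suc j , pj , mn' , s≤s le
  where
  mn' : ∀ {i} → i < suc j → ¬ P i
  mn' {zero} _ = ¬p
  mn' {suc i} (s≤s lt) = mn lt

-- Walks and components in induced subgraphs

module Walks {n : ℕ} (_~_ : Fin n → Fin n → Set) (_~?_ : ∀ u v → Dec (u ~ v)) where

  data Walk (S : VSet n) (u : Fin n) : Fin n → Set where
    [_] : S ∋ u → Walk S u u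
    _▸_ : ∀ {v w} → Walk S u v → v ~ w × S ∋ w → Walk S u w

  infixl 5 _▸_

  Wstart : ∀ {S u v} → Walk S u v → S ∋ u
  Wstart [ p ] = p
  Wstart (w ▸ _) = Wstart w

  Wend : ∀ {S u v} → Walk S u v → S ∋ v
  Wend [ p ] = p
  Wend (_ ▸ (_ , p)) = p

  _◂◂_ : ∀ {S u v w} → Walk S u v → Walk S v w → Walk S u w
  a ◂◂ [ _ ] = a
  a ◂◂ (b ▸ s) = (a ◂◂ b) ▸ s

  Wcons : ∀ {S u v w} → S ∋ u → u ~ v → Walk S v w → Walk S u w
  Wcons p e b = ([ p ] ▸ (e , Wstart b)) ◂◂ b

  Wmono : ∀ {S T u v} → S ⊂ T → Walk S u v → Walk T u v
  Wmono h [ p ] = [ h p ]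
  Wmono h (a ▸ (e , p)) = Wmono h a ▸ (e , h p)

  -- Everything before the last visit to `u` is discarded, and the rest lives in a smaller vertex
  -- set. This is the termination measure of `walk?`.
  peel : ∀ {S u v} → Walk S u v → v ≡ u ⊎ ∃[ w ] (u ~ w × Walk (S - u) w v)
  peel [ p ] = inj₁ refl
  peel {S} {u} (_▸_ {v} {w} a (e , p)) = case w ≟ u of λ where
    (yes q) → inj₁ q
    (no ne) → inj₂ (case peel a of λ where
      (inj₁ refl) → w , e , [ -in p ne ]
      (inj₂ (x , e' , b)) → x , e' , (b ▸ (e , -in p ne)))

  walk?' : ∀ k S → sz S ≤ k → ∀ u v → Dec (Walk S u v)
  walk?' k S le u v with S ∋? u | u ≟ v
  ... | no ¬p | _ = no λ w → ¬p (Wstart w)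
  ... | yes p | yes refl = yes [ p ]
  walk?' zero S le u v | yes p | no ne =
    ⊥-elim (ℕₚ.<⇒≱ (sz-strict {X = ∅} {S} {u} (λ q → ⊥-elim (∅-no q)) p ∅-no) (ℕₚ.≤-trans le z≤n))
  walk?' (suc k) S le u v | yes p | no ne =
    map′ (λ { (w , e , b) → Wcons p e (Wmono -out b) })
         (λ a → case peel a of λ { (inj₁ q) → ⊥-elim (ne (sym q)) ; (inj₂ r) → r })
         (any? λ w → (u ~? w) ×-dec walk?' k (S - u) small w v)
    where
    small : sz (S - u) ≤ k
    small = ℕₚ.≤-pred (ℕₚ.≤-trans (sz-strict {X = S - u} {S} {u} -out p λ q → -ne q refl) le)

  walk? : ∀ S u v → Dec (Walk S u v)
  walk? S = walk?' (sz S) S ℕₚ.≤-refl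

  abstract
    comp : VSet n → Fin n → VSet n
    comp S u v = ⌊ walk? S u v ⌋

    comp-out : ∀ {S u v} → comp S u ∋ v → Walk S u v
    comp-out {S} {u} {v} p = ⌊⌋-true {d = walk? S u v} (un p)

    comp-in : ∀ {S u v} → Walk S u v → comp S u ∋ v
    comp-in {S} {u} {v} w = mk (true-⌊⌋ {d = walk? S u v} w)

-- Plane graphs as an interface: outer vertices, rotation, crossing

record Graph (n : ℕ) : Set₁ where
  infix 4 _~_ _~?_
  field
    _~_ : Fin n → Fin n → Set
    _~?_ : ∀ u v → Dec (u ~ v)
    ~-sym : ∀ {u v} → u ~ v → v ~ u
    ~-irr : ∀ {u v} → u ~ v → u ≢ v
  open Walks _~_ _~?_ public

  Wrev : ∀ {S u v} → Walk S u v → Walk S v u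
  Wrev [ p ] = [ p ]
  Wrev (a ▸ (e , p)) = Wcons p (~-sym e) (Wrev a)

-- Out X v: in the plane graph induced on X, the vertex v lies on the outer face.
-- The neighbours of v are ordered by pos, the order of rotation about v starting from the outer face.
record Plane {n : ℕ} (Γ : Graph n) : Set₁ where
  open Graph Γ
  field
    Out : VSet n → Fin n → Set
    Out? : ∀ X v → Dec (Out X v)
    out∈ : ∀ {X v} → Out X v → X ∋ v
    mono : ∀ {X Y v} → X ⊂ Y → X ∋ v → Out Y v → Out X v
    expose : ∀ {X u v} → Out X v → v ~ u → X ∋ u → Out (X - v) u
    next : ∀ {X u v} → Out X v → v ~ u → X ∋ u → ∃[ y ] (v ~ y × Out X y)
    some : ∀ {X v} → X ∋ v → ∃[ u ] Out X u
    pos : ∀ {X v} → Out X v → Fin n → ℕ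
    pos-inj : ∀ {X v} (o : Out X v) {s t} → X ∋ s → X ∋ t → v ~ s → v ~ t → pos o s ≡ pos o t → s ≡ t
    nocross : ∀ {X v} (o : Out X v) {r s t} → X ∋ r → X ∋ s → X ∋ t → v ~ r → v ~ s → v ~ t
      → pos o r < pos o s → pos o s < pos o t
      → ∀ {S y} → S ⊂ X → ¬ S ∋ v → Walk S r t → Out X y → ¬ Walk ((X - v) ∖ S) s y

xor-true : ∀ {a b} → a xor b ≡ true → a ≡ true ⊎ b ≡ true
xor-true {true} _ = inj₁ refl
xor-true {false} h = inj₂ h

xor-flip : ∀ {a b c} → a xor b ≡ c → b ≡ a xor c
xor-flip {false} refl = refl
xor-flip {true} {false} refl = refl
xor-flip {true} {true} refl = refl

-- The crossing argument in a combinatorial map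

module Topology (M : PlaneMap) (G : Sub M) (simple : Simple M G) where
  open Homology M

  ind : VSet n → Sub M
  ind X = record
    { vs = X
    ; es = λ d → es G d ∧ (X (vert d) ∧ X (vert (α d)))
    ; es-α = λ d → cong₂ _∧_ (es-α G d) (trans (cong (λ t → X (vert (α d)) ∧ X (vert t)) (α-invol d)) (Boolₚ.∧-comm (X (vert (α d))) (X (vert d))))
    ; es-vs = λ d h → proj₁ (∧-true (proj₂ (∧-true {es G d} h))) }

  ei : VSet n → Fin m → Bool
  ei X = es (ind X)

  ei-in : ∀ {X d} → es G d ≡ true → X ∋ vert d → X ∋ vert (α d) → ei X d ≡ true
  ei-in a b c = true-∧ a (true-∧ (un b) (un c))

  ei-out : ∀ {X d} → ei X d ≡ true → es G d ≡ true × X ∋ vert d × X ∋ vert (α d)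
  ei-out {X} {d} h = proj₁ a , mk (proj₁ b) , mk (proj₂ b)
    where
    a = ∧-true {es G d} h
    b = ∧-true (proj₂ a)

  ei-no : ∀ {X d} → ¬ X ∋ vert d → ei X d ≡ false
  ei-no {X} {d} q = ¬true λ h → q (proj₁ (proj₂ (ei-out {X} {d} h)))

  Γ : Graph n
  Γ = record
    { _~_ = Adj M G
    ; _~?_ = λ u v → any? λ d → (es G d Bool.≟ true) ×-dec (vert d ≟ u) ×-dec (vert (α d) ≟ v)
    ; ~-sym = λ { (d , e , refl , refl) → α d , trans (es-α G d) e , refl , cong vert (α-invol d) }
    ; ~-irr = λ { (d , e , refl , refl) p → proj₁ simple d e p } }
  open Graph Γ hiding (Wrev)

  Ω : VSet n → Fin m → Set
  Ω X = OuterR M (ind X)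

  Ω-mono : ∀ {X Y d} → X ⊂ Y → Ω Y d → Ω X d
  Ω-mono h base = base
  Ω-mono h (along o) = along (Ω-mono h o)
  Ω-mono {X} {Y} h (cross {d} e o) = cross (¬true λ q →
    true≢false (let (a , b , c) = ei-out {X} {d} q in ei-in {Y} {d} a (h b) (h c)) e) (Ω-mono h o)

  Ω-iter : ∀ {X d} k → Ω X d → Ω X (iter φ k d)
  Ω-iter zero o = o
  Ω-iter (suc k) o = along (Ω-iter k o)

  Ω-φ⁻ : ∀ {X d} → Ω X (φ d) → Ω X d
  Ω-φ⁻ {X} {d} o with iter-back φ φ-inj d 1
  ... | j , q = subst (Ω X) q (Ω-iter j o)

  Ω-σ : ∀ {X d} → ei X d ≡ false → Ω X d → Ω X (σ d)
  Ω-σ {X} {d} e o = subst (Ω X) (φα d) (along (cross e o))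

  Ω-σ⁻ : ∀ {X d} → Ω X (σ d) → Ω X (α d)
  Ω-σ⁻ {X} {d} o = Ω-φ⁻ (subst (Ω X) (sym (φα d)) o)

  -- The outer region is a reachability set of darts, so the decision procedure for walks is reused
  -- with darts in place of vertices.
  Ω? : ∀ X d → Dec (Ω X d)
  Ω? X d = map′ to from (D.walk? (λ _ → true) outer d)
    where
    R : Fin m → Fin m → Set
    R d e = e ≡ φ d ⊎ (ei X d ≡ false × e ≡ α d)
    module D = Walks R (λ d e → (e ≟ φ d) ⊎-dec ((ei X d Bool.≟ false) ×-dec (e ≟ α d)))
    to : ∀ {d} → D.Walk (λ _ → true) outer d → Ω X d
    to D.[ _ ] = base
    to (w D.▸ (inj₁ refl , _)) = along (to w)
    to (w D.▸ (inj₂ (e , refl) , _)) = cross e (to w)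
    from : ∀ {d} → Ω X d → D.Walk (λ _ → true) outer d
    from base = D.[ mk refl ]
    from (along o) = from o D.▸ (inj₁ refl , mk refl)
    from (cross e o) = from o D.▸ (inj₂ (e , refl) , mk refl)

  Out : VSet n → Fin n → Set
  Out X v = OnOuterV M (ind X) v

  toW : ∀ {X v} → Out X v → X ∋ v
  toW (p , _) = mk p

  -- The edge set of a walk, modulo 2.

  edge : Fin m → Fin m → Bool
  edge d x = ⌊ x ≟ d ⌋ xor ⌊ x ≟ α d ⌋

  edge-or : ∀ {d x} → edge d x ≡ true → x ≡ d ⊎ x ≡ α d
  edge-or {d} {x} h = case xor-true {⌊ x ≟ d ⌋} h of λ where
    (inj₁ q) → inj₁ (⌊⌋-true {d = x ≟ d} q)
    (inj₂ q) → inj₂ (⌊⌋-true {d = x ≟ α d} q)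

  edge-α : ∀ d x → edge d (α x) ≡ edge d x
  edge-α d x = trans (cong₂ _xor_ (bool-⇔ (λ h → true-⌊⌋ {d = x ≟ α d} (trans (sym (α-invol x)) (cong α (⌊⌋-true {d = α x ≟ d} h))))
                                           (λ h → true-⌊⌋ {d = α x ≟ d} (trans (cong α (⌊⌋-true {d = x ≟ α d} h)) (α-invol d))))
                                  (bool-⇔ (λ h → true-⌊⌋ {d = x ≟ d} (α-inj (⌊⌋-true {d = α x ≟ α d} h)))
                                           (λ h → true-⌊⌋ {d = α x ≟ α d} (cong α (⌊⌋-true {d = x ≟ d} h)))))
                     (xor-comm ⌊ x ≟ α d ⌋ ⌊ x ≟ d ⌋)

  at-edge : ∀ d u → at-vertex (edge d) u ≡ ⌊ vert d ≟ u ⌋ xor ⌊ vert (α d) ≟ u ⌋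
  at-edge d u = trans (⨁-cong λ x → ∧-distribˡ-xor ⌊ vert x ≟ u ⌋ ⌊ x ≟ d ⌋ ⌊ x ≟ α d ⌋)
    (trans (⨁-xor (λ x → ⌊ vert x ≟ u ⌋ ∧ ⌊ x ≟ d ⌋) (λ x → ⌊ vert x ≟ u ⌋ ∧ ⌊ x ≟ α d ⌋)) (cong₂ _xor_ (one d) (one (α d))))
    where
    one : ∀ e → ⨁ (λ x → ⌊ vert x ≟ u ⌋ ∧ ⌊ x ≟ e ⌋) ≡ ⌊ vert e ≟ u ⌋
    one e = trans (⨁-single e λ x ne → trans (cong (⌊ vert x ≟ u ⌋ ∧_) (false-⌊⌋ {d = x ≟ e} ne)) (Boolₚ.∧-zeroʳ ⌊ vert x ≟ u ⌋))
      (trans (cong (⌊ vert e ≟ u ⌋ ∧_) (true-⌊⌋ {d = e ≟ e} refl)) (Boolₚ.∧-identityʳ ⌊ vert e ≟ u ⌋))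

  at-xor : ∀ f g u → at-vertex (λ x → f x xor g x) u ≡ at-vertex f u xor at-vertex g u
  at-xor f g u = trans (⨁-cong λ x → ∧-distribˡ-xor ⌊ vert x ≟ u ⌋ (f x) (g x)) (⨁-xor (λ x → ⌊ vert x ≟ u ⌋ ∧ f x) (λ x → ⌊ vert x ≟ u ⌋ ∧ g x))

  zw : ∀ {S u v} → Walk S u v → Fin m → Bool
  zw [ _ ] x = false
  zw (w ▸ ((d , _) , _)) x = zw w x xor edge d x

  zw-α : ∀ {S u v} (w : Walk S u v) x → zw w (α x) ≡ zw w x
  zw-α [ _ ] x = refl
  zw-α (w ▸ ((d , _) , _)) x = cong₂ _xor_ (zw-α w x) (edge-α d x)

  zw-at : ∀ {S u v} (w : Walk S u v) y → at-vertex (zw w) y ≡ ⌊ u ≟ y ⌋ xor ⌊ v ≟ y ⌋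
  zw-at {u = u} [ _ ] y = trans (⨁-zero λ x → Boolₚ.∧-zeroʳ ⌊ vert x ≟ y ⌋) (sym (xor-same ⌊ u ≟ y ⌋))
  zw-at {u = u} (_▸_ {v} w ((d , _ , refl , refl) , _)) y = trans (at-xor (zw w) (edge d) y)
    (trans (cong₂ _xor_ (zw-at w y) (at-edge d y)) (cancel ⌊ u ≟ y ⌋ ⌊ vert d ≟ y ⌋ ⌊ vert (α d) ≟ y ⌋))
    where
    cancel : ∀ a b c → (a xor b) xor (b xor c) ≡ a xor c
    cancel a false c = cong (_xor c) (xor-identityʳ a)
    cancel false true false = refl
    cancel false true true = refl
    cancel true true false = refl
    cancel true true true = refl

  zw-in : ∀ {S u v} (w : Walk S u v) {x} → zw w x ≡ true → es G x ≡ true × S ∋ vert x × S ∋ vert (α x)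
  zw-in (w ▸ ((d , e , refl , refl) , p)) {x} h with xor-true {zw w x} h
  ... | inj₁ q = zw-in w q
  ... | inj₂ q with edge-or {d} {x} q
  ...   | inj₁ refl = e , Wend w , p
  ...   | inj₂ refl = trans (es-α G d) e , p , subst (λ t → _ ∋ vert t) (sym (α-invol d)) (Wend w)

  module _ {X v} (o : Out X v) where
    d₀ : Fin m
    d₀ = proj₁ (proj₂ o)
    d₀-v : vert d₀ ≡ v
    d₀-v = proj₁ (proj₂ (proj₂ o))
    d₀-Ω : Ω X d₀
    d₀-Ω = proj₂ (proj₂ (proj₂ o))

    Hits : Fin n → ℕ → Set
    Hits u i = es G (iter σ i d₀) ≡ true × vert (α (iter σ i d₀)) ≡ u

    Hits? : ∀ u i → Dec (Hits u i)
    Hits? u i = (es G (iter σ i d₀) Bool.≟ true) ×-dec (vert (α (iter σ i d₀)) ≟ u)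

    at-v : ∀ i → vert (iter σ i d₀) ≡ v
    at-v i = trans (iter-σ-vert i d₀) d₀-v

    first : ∀ {u} → v ~ u → ∃[ j ] (Hits u j × (∀ {i} → i < j → ¬ Hits u i))
    first {u} (d , e , p , q) with σ-trans d₀ d (trans d₀-v (sym p))
    ... | k , refl with least (Hits? u) {k} (e , q)
    ...   | j , h , mn , _ = j , h , mn

    -- The rotation starts at a dart of the outer region, which cuts the cyclic order open at the
    -- outer face. The value 0 at non-neighbours is a placeholder.
    pos : Fin n → ℕ
    pos u with v ~? u
    ... | yes e = proj₁ (first e)
    ... | no _ = 0

    pos-spec : ∀ {u} → v ~ u → Hits u (pos u) × (∀ {i} → i < pos u → ¬ Hits u i)
    pos-spec {u} e with v ~? u
    ... | yes e' = proj₂ (first e')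
    ... | no ne = ⊥-elim (ne e)

    pos-≤ : ∀ {u i} → v ~ u → Hits u i → pos u ≤ i
    pos-≤ e h = ℕₚ.≮⇒≥ λ lt → proj₂ (pos-spec e) lt h

    Hits-~ : ∀ {u i} → Hits u i → v ~ u
    Hits-~ {i = i} (e , q) = iter σ i d₀ , e , at-v i , q

    module Cross {r s t} (Xr : X ∋ r) (Xs : X ∋ s) (Xt : X ∋ t) (vr : v ~ r) (vs' : v ~ s) (vt : v ~ t)
      (rs : pos r < pos s) (st : pos s < pos t) {S y} (SX : S ⊂ X) (Sv : ¬ S ∋ v) (W : Walk S r t)
      (oy : Out X y) (W₂ : Walk ((X - v) ∖ S) s y) where

      kr kt ks : Fin m
      kr = iter σ (pos r) d₀
      ks = iter σ (pos s) d₀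
      kt = iter σ (pos t) d₀
      hr = proj₁ (pos-spec vr)
      hs = proj₁ (pos-spec vs')
      ht = proj₁ (pos-spec vt)

      -- The walk `W` closed up by the two edges from `v`. By `fill` it bounds a face function that
      -- is false on the outer face: a parity version of inside and outside.
      z : Fin m → Bool
      z x = zw W x xor (edge kr x xor edge kt x)

      z-cycle : Cycle z
      z-cycle = record
        { z-α = λ x → cong₂ _xor_ (zw-α W x) (cong₂ _xor_ (edge-α kr x) (edge-α kt x))
        ; z-even = λ u → trans (at-xor (zw W) (λ x → edge kr x xor edge kt x) u) (trans (cong₂ _xor_ (zw-at W u)
            (trans (at-xor (edge kr) (edge kt) u) (cong₂ _xor_ (ends u (pos r) r (proj₂ hr)) (ends u (pos t) t (proj₂ ht)))))
            (cancel ⌊ r ≟ u ⌋ ⌊ t ≟ u ⌋ ⌊ v ≟ u ⌋)) }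
        where
        ends : ∀ u i w → vert (α (iter σ i d₀)) ≡ w → at-vertex (edge (iter σ i d₀)) u ≡ ⌊ v ≟ u ⌋ xor ⌊ w ≟ u ⌋
        ends u i w q = trans (at-edge (iter σ i d₀) u) (cong₂ (λ a b → ⌊ a ≟ u ⌋ xor ⌊ b ≟ u ⌋) (at-v i) q)
        cancel : ∀ a b c → (a xor b) xor ((c xor a) xor (c xor b)) ≡ false
        cancel false false false = refl
        cancel false false true = refl
        cancel false true false = refl
        cancel false true true = refl
        cancel true false false = refl
        cancel true false true = refl
        cancel true true false = refl
        cancel true true true = refl

      module Labelled (f : Fin m → Bool) (fφ : ∀ d → f (φ d) ≡ f d) (f∂ : ∀ d → f d xor f (α d) ≡ z d) (f-outer : f outer ≡ false) where
        fα : ∀ d → f (α d) ≡ f d xor z d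
        fα d = xor-flip {f d} (f∂ d)

        fσ : ∀ d → f (σ d) ≡ f d xor z d
        fσ d = trans (cong f (sym (φα d))) (trans (fφ (α d)) (fα d))

        z-supp : ∀ {x} → z x ≡ true → es G x ≡ true × (vert x ≡ v ⊎ S ∋ vert x) × (vert (α x) ≡ v ⊎ S ∋ vert (α x))
        z-supp {x} h with xor-true {zw W x} h
        ... | inj₁ q = let (a , b , c) = zw-in W q in a , inj₂ b , inj₂ c
        ... | inj₂ q with xor-true {edge kr x} q
        ...   | inj₁ q' = side (pos r) hr (Wstart W) q'
          where
          side : ∀ i {u} → Hits u i → S ∋ u → edge (iter σ i d₀) x ≡ true → es G x ≡ true × (vert x ≡ v ⊎ S ∋ vert x) × (vert (α x) ≡ v ⊎ S ∋ vert (α x))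
          side i (e , refl) p q with edge-or {iter σ i d₀} {x} q
          ... | inj₁ refl = e , inj₁ (at-v i) , inj₂ p
          ... | inj₂ refl = trans (es-α G _) e , inj₂ p , inj₁ (trans (cong vert (α-invol _)) (at-v i))
        ...   | inj₂ q' = side (pos t) ht (Wend W) q'
          where
          side : ∀ i {u} → Hits u i → S ∋ u → edge (iter σ i d₀) x ≡ true → es G x ≡ true × (vert x ≡ v ⊎ S ∋ vert x) × (vert (α x) ≡ v ⊎ S ∋ vert (α x))
          side i (e , refl) p q with edge-or {iter σ i d₀} {x} q
          ... | inj₁ refl = e , inj₁ (at-v i) , inj₂ p
          ... | inj₂ refl = trans (es-α G _) e , inj₂ p , inj₁ (trans (cong vert (α-invol _)) (at-v i))

        inX : ∀ {u} → u ≡ v ⊎ S ∋ u → X ∋ u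
        inX (inj₁ refl) = toW o
        inX (inj₂ p) = SX p

        -- All edges of `z` lie in the graph induced on `X`, and the outer region crosses only other
        -- edges; so it never meets a jump of `f`.
        f-Ω : ∀ {d} → Ω X d → f d ≡ false
        f-Ω base = f-outer
        f-Ω (along {d} ω) = trans (fφ d) (f-Ω ω)
        f-Ω (cross {d} e ω) = trans (fα d) (cong₂ _xor_ (f-Ω ω) (¬true λ h →
          true≢false (let (a , b , c) = z-supp h in ei-in {X} {d} a (inX b) (inX c)) e))

        not-S : ∀ {u} → vert u ≡ v → ¬ S ∋ vert u
        not-S e p = Sv (subst (S ∋_) e p)

        z-at-v : ∀ i → z (iter σ i d₀) ≡ true → Hits r i ⊎ Hits t i
        z-at-v i h with xor-true {zw W (iter σ i d₀)} h
        ... | inj₁ q = ⊥-elim (not-S (at-v i) (proj₁ (proj₂ (zw-in W q))))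
        ... | inj₂ q with xor-true {edge kr (iter σ i d₀)} q
        ...   | inj₁ q' = inj₁ (dart (pos r) hr (Wstart W) q')
          where
          dart : ∀ j {u} → Hits u j → S ∋ u → edge (iter σ j d₀) (iter σ i d₀) ≡ true → Hits u i
          dart j {u} h p q with edge-or {iter σ j d₀} {iter σ i d₀} q
          ... | inj₁ e = trans (cong (es G) e) (proj₁ h) , trans (cong (vert ∘ α) e) (proj₂ h)
          ... | inj₂ e = ⊥-elim (not-S (trans (sym (cong vert e)) (at-v i)) (subst (S ∋_) (sym (proj₂ h)) p))
        ...   | inj₂ q' = inj₂ (dart (pos t) ht (Wend W) q')
          where
          dart : ∀ j {u} → Hits u j → S ∋ u → edge (iter σ j d₀) (iter σ i d₀) ≡ true → Hits u i
          dart j {u} h p q with edge-or {iter σ j d₀} {iter σ i d₀} q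
          ... | inj₁ e = trans (cong (es G) e) (proj₁ h) , trans (cong (vert ∘ α) e) (proj₂ h)
          ... | inj₂ e = ⊥-elim (not-S (trans (sym (cong vert e)) (at-v i)) (subst (S ∋_) (sym (proj₂ h)) p))

        z-kr : z kr ≡ true
        z-kr = cong₂ _xor_ (¬true λ q → not-S (at-v (pos r)) (proj₁ (proj₂ (zw-in W q))))
          (cong₂ _xor_ (cong₂ _xor_ (true-⌊⌋ {d = kr ≟ kr} refl) (false-⌊⌋ {d = kr ≟ α kr} λ e → α-nofix kr (sym e)))
                       (cong₂ _xor_ (false-⌊⌋ {d = kr ≟ kt} λ e → proj₂ (pos-spec vt) (ℕₚ.<-trans rs st) (subst (λ k → es G k ≡ true × vert (α k) ≡ t) (sym e) ht))
                                    (false-⌊⌋ {d = kr ≟ α kt} λ e → Sv (subst (S ∋_) (trans (sym (proj₂ ht)) (trans (sym (cong vert e)) (at-v (pos r)))) (Wend W)))))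

        -- Rotating about v from the outer face, f is false up to the dart to r and true from there on up to the dart to t.
        before : ∀ i → i ≤ pos r → f (iter σ i d₀) ≡ false
        before zero _ = f-Ω d₀-Ω
        before (suc i) lt = trans (fσ (iter σ i d₀)) (cong₂ _xor_ (before i (ℕₚ.<⇒≤ lt)) (¬true λ h → case z-at-v i h of λ where
          (inj₁ q) → proj₂ (pos-spec vr) lt q
          (inj₂ q) → proj₂ (pos-spec vt) (ℕₚ.<-trans lt (ℕₚ.<-trans rs st)) q))

        between : ∀ j → pos r + suc j ≤ pos s → f (iter σ (pos r + suc j) d₀) ≡ true
        between zero le = trans (cong (λ k → f (iter σ k d₀)) (ℕₚ.+-comm (pos r) 1)) (trans (fσ kr) (cong₂ _xor_ (before (pos r) ℕₚ.≤-refl) z-kr))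
        between (suc j) le = trans (cong (λ k → f (iter σ k d₀)) (ℕₚ.+-suc (pos r) (suc j))) (trans (fσ (iter σ i d₀)) (cong₂ _xor_ (between j (ℕₚ.<⇒≤ lt)) (¬true λ h → case z-at-v i h of λ where
            (inj₂ q) → proj₂ (pos-spec vt) (ℕₚ.<-trans lt st) q
            (inj₁ q) → again (samedart q))))
          where
          i = pos r + suc j
          lt : i < pos s
          lt = subst (_≤ pos s) (ℕₚ.+-suc (pos r) (suc j)) le
          samedart : Hits r i → iter σ i d₀ ≡ kr
          samedart q = proj₂ simple _ _ (proj₁ q) (proj₁ hr) (trans (at-v i) (sym (at-v (pos r)))) (trans (proj₂ q) (sym (proj₂ hr)))
          -- A second passage through the dart to `r` makes the rotation periodic, so `s` would have
          -- been met just as many steps after the first passage, against the minimality of `pos s`.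
          again : iter σ i d₀ ≡ kr → ⊥
          again e = proj₂ (pos-spec vs') {pos s ∸ i + pos r} small (subst (λ k → es G k ≡ true × vert (α k) ≡ s) eq hs)
            where
            eq : ks ≡ iter σ (pos s ∸ i + pos r) d₀
            eq = trans (cong (λ k → iter σ k d₀) (sym (ℕₚ.m∸n+n≡m (ℕₚ.<⇒≤ lt)))) (trans (iter-+ σ (pos s ∸ i) i d₀) (trans (cong (iter σ (pos s ∸ i)) e) (sym (iter-+ σ (pos s ∸ i) (pos r) d₀))))
            small : pos s ∸ i + pos r < pos s
            small = ℕₚ.≤-trans (ℕₚ.≤-trans (ℕₚ.≤-reflexive (sym (ℕₚ.+-suc (pos s ∸ i) (pos r)))) (ℕₚ.+-monoʳ-≤ (pos s ∸ i) (ℕₚ.≤-trans (ℕₚ.m≤m+n (suc (pos r)) j) (ℕₚ.≤-reflexive (sym (ℕₚ.+-suc (pos r) j))))))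
              (ℕₚ.≤-reflexive (ℕₚ.m∸n+n≡m (ℕₚ.<⇒≤ lt)))

        f-ks : f ks ≡ true
        f-ks with ℕₚ.m≤n⇒∃[o]m+o≡n rs
        ... | j , e = subst (λ k → f (iter σ k d₀) ≡ true) e' (between j (ℕₚ.≤-reflexive e'))
          where
          e' : pos r + suc j ≡ pos s
          e' = trans (ℕₚ.+-suc (pos r) j) e

        off : ∀ {d} → ((X - v) ∖ S) ∋ vert d → z d ≡ false
        off {d} p = ¬true λ h → case proj₁ (proj₂ (z-supp h)) of λ where
          (inj₁ e) → -ne {X = X} {u = v} (∖out p) e
          (inj₂ q) → ∖no p q

        around : ∀ {d e} → ((X - v) ∖ S) ∋ vert d → vert d ≡ vert e → f d ≡ true → f e ≡ true
        around {d} {e} p q h with σ-trans d e q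
        ... | k , refl = turn k
          where
          turn : ∀ k → f (iter σ k d) ≡ true
          turn zero = h
          turn (suc k) = trans (fσ (iter σ k d)) (cong₂ _xor_ (turn k) (off (subst (((X - v) ∖ S) ∋_) (sym (iter-σ-vert k d)) p)))

        -- The value true passes along a face from one vertex of the walk to the next, and rotation
        -- around a vertex off the closed walk preserves it.
        walk-true : ∀ {u} → Walk ((X - v) ∖ S) s u → ∀ {d} → vert d ≡ u → f d ≡ true
        walk-true [ p ] {d} e = around {φ ks} (subst (((X - v) ∖ S) ∋_) (sym hd) p) (trans hd (sym e)) (trans (fφ ks) f-ks)
          where
          hd : vert (φ ks) ≡ s
          hd = trans (φ-vert ks) (proj₂ hs)
        walk-true (w ▸ ((k , _ , a , b) , p)) {d} e = around {φ k} (subst (((X - v) ∖ S) ∋_) (sym hd) p) (trans hd (sym e)) (trans (fφ k) (walk-true w a))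
          where
          hd = trans (φ-vert k) b

        contra : ⊥
        contra = true≢false (walk-true W₂ (proj₁ (proj₂ (proj₂ oy)))) (f-Ω (proj₂ (proj₂ (proj₂ oy))))

      contradiction′ : ⊥
      contradiction′ = case fill z z-cycle of λ (f , fφ , f∂ , f-outer) → Labelled.contra f fφ f∂ f-outer

-- Maps of genus 0 satisfy the interface

module Planar (M : PlaneMap) (G : Sub M) (simple : Simple M G) where
  open Homology M
  open Topology M G simple public
  open Graph Γ

  -- Without `v` no edge at `v` is left, so the outer region sweeps around `v` and slips along each
  -- former edge to its other end.
  expose : ∀ {X u v} → Out X v → v ~ u → X ∋ u → Out (X - v) u
  expose {X} {u} {v} o (d , e , refl , refl) Xu with σ-trans (d₀ o) d (d₀-v o)
  ... | k , q = un (-in {X = X} Xu λ p → proj₁ simple d e (sym p)) , φ d , φ-vert d , along (subst (Ω (X - v)) q (rot k))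
    where
    rot : ∀ k → Ω (X - v) (iter σ k (d₀ o))
    rot zero = Ω-mono {X - v} {X} -out (d₀-Ω o)
    rot (suc k) = Ω-σ (ei-no {X - v} λ p → -ne p (at-v o k)) (rot k)

  next : ∀ {X u v} → Out X v → v ~ u → X ∋ u → ∃[ y ] (v ~ y × Out X y)
  next {X} {u} {v} o (d , e , p , refl) Xu with σ-trans (d₀ o) d (trans (d₀-v o) (sym p))
  ... | k , refl with least {λ i → ei X (iter σ i (d₀ o)) ≡ true} (λ i → ei X (iter σ i (d₀ o)) Bool.≟ true) {k}
                       (ei-in {X} e (subst (X ∋_) (sym (at-v o k)) (toW o)) Xu)
  ...   | j , h , mn , _ = vert (α (iter σ j (d₀ o))) , (iter σ j (d₀ o) , proj₁ (ei-out {X} h) , at-v o j , refl) ,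
          (un (proj₂ (proj₂ (ei-out {X} h))) , φ (iter σ j (d₀ o)) , φ-vert _ , along (rot j λ {i} → mn {i}))
    where
    rot : ∀ j → (∀ {i} → i < j → ¬ (ei X (iter σ i (d₀ o)) ≡ true)) → Ω X (iter σ j (d₀ o))
    rot zero _ = d₀-Ω o
    rot (suc j) mn = Ω-σ (¬true (mn ℕₚ.≤-refl)) (rot j λ lt → mn (ℕₚ.<-trans lt ℕₚ.≤-refl))

  -- Travel through the darts from `outer`, within the outer region, until an edge of the induced
  -- graph is met; its tail is outer. If none is met on the way to a dart at `v`, then `v` itself is
  -- outer.
  some : ∀ {X v} → X ∋ v → ∃[ u ] Out X u
  some {X} {v} Xv with vert-sur v
  ... | d , refl with reach (connected outer d)
    where
    here? : ∀ {d} → Ω X d → (∃[ u ] Out X u) ⊎ ei X d ≡ false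
    here? {d} o with ei X d in q
    ... | false = inj₂ refl
    ... | true = inj₁ (vert d , un (proj₁ (proj₂ (ei-out {X} q))) , d , refl , o)
    reach : ∀ {e} → Conn α σ outer e → (∃[ u ] Out X u) ⊎ Ω X e
    reach here = inj₂ base
    reach (viaα c) with reach c
    ... | inj₁ r = inj₁ r
    ... | inj₂ o with here? o
    ...   | inj₁ r = inj₁ r
    ...   | inj₂ q = inj₂ (cross q o)
    reach (viaσ c) with reach c
    ... | inj₁ r = inj₁ r
    ... | inj₂ o with here? o
    ...   | inj₁ r = inj₁ r
    ...   | inj₂ q = inj₂ (Ω-σ q o)
  ...   | inj₁ r = r
  ...   | inj₂ o = vert d , un Xv , d , refl , o

  plane : Plane Γ
  plane = record
    { Out = Out
    ; Out? = λ X v → (X v Bool.≟ true) ×-dec any? λ d → (vert d ≟ v) ×-dec Ω? X d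
    ; out∈ = toW
    ; mono = λ { {X} {Y} h p (_ , d , e , o) → un p , d , e , Ω-mono {X} {Y} h o }
    ; expose = expose
    ; next = next
    ; some = some
    ; pos = λ {X} {v} o → pos {X} {v} o
    ; pos-inj = λ o {s} {t} _ _ vs vt e →
        trans (sym (proj₂ (proj₁ (pos-spec o vs)))) (trans (cong (λ i → vert (α (iter σ i (d₀ o)))) e) (proj₂ (proj₁ (pos-spec o vt))))
    ; nocross = λ o a b c d e f g h i j k l w → Cross.contradiction′ o a b c d e f g h i j k l w }

  -- The rotation from the outer face reaches the dart to `w` unhindered in one direction or the
  -- other, which makes the edge outer, unless edges of the induced graph stand on both sides. Edges
  -- of a harmonica are recognised as outer in this way.
  flank : ∀ {X u w} (o : Out X u) → X ∋ w → u ~ w → OuterEdge M (ind X) u w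
    ⊎ ∃[ r ] ∃[ t ] (X ∋ r × X ∋ t × u ~ r × u ~ t × pos o r < pos o w × pos o w < pos o t)
  flank {X} {u} {w} o Xw uw with pos-spec o uw | ℕₚ.anyUpTo? (λ j → ei X (iter σ j (d₀ o)) Bool.≟ true) (pos o w)
  ... | (kes , kw) , kmin | no none = inj₁ (k , ei-in {X} kes Xu Xw' , at-v o i , kw , inj₁ (rot i λ lt h → none (_ , lt , h)))
    where
    i = pos o w
    k = iter σ i (d₀ o)
    Xu = subst (X ∋_) (sym (at-v o i)) (toW o)
    Xw' = subst (X ∋_) (sym kw) Xw
    rot : ∀ j → (∀ {i} → i < j → ¬ (ei X (iter σ i (d₀ o)) ≡ true)) → Ω X (iter σ j (d₀ o))
    rot zero _ = d₀-Ω o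
    rot (suc j) mn = Ω-σ (¬true (mn ℕₚ.≤-refl)) (rot j λ lt → mn (ℕₚ.<-trans lt ℕₚ.≤-refl))
  ... | (kes , kw) , kmin | yes (j₁ , j₁< , h₁) with σ-trans (σ (iter σ (pos o w) (d₀ o))) (d₀ o) (trans (iter-σ-vert (suc (pos o w)) (d₀ o)) refl)
  ...   | K , qK with least {λ K → iter σ K (σ (iter σ (pos o w) (d₀ o))) ≡ d₀ o} (λ K → _ ≟ _) {K} qK
  ...     | kk , qk , mnk , _ with ℕₚ.anyUpTo? (λ j → ei X (iter σ j (σ (iter σ (pos o w) (d₀ o)))) Bool.≟ true) kk
  ...       | no none = inj₁ (k , ei-in {X} kes Xu Xw' , at-v o i , kw , inj₂ (Ω-σ⁻ {X} {k} (back kk qk λ lt h → none (_ , lt , h))))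
    where
    i = pos o w
    k = iter σ i (d₀ o)
    Xu = subst (X ∋_) (sym (at-v o i)) (toW o)
    Xw' = subst (X ∋_) (sym kw) Xw
    back : ∀ kk {e} → iter σ kk e ≡ d₀ o → (∀ {j} → j < kk → ¬ (ei X (iter σ j e) ≡ true)) → Ω X e
    back zero refl _ = d₀-Ω o
    back (suc kk) {e} q mn = subst (Ω X) (α-invol e) (cross (trans (es-α (ind X) e) (¬true (mn {0} (s≤s z≤n))))
      (Ω-σ⁻ {X} {e} (back kk (trans (iter-comm σ kk e) q) λ {j} lt h → mn (s≤s lt) (trans (cong (ei X) (sym (iter-comm σ j e))) h))))
  ...       | yes (j₂ , j₂< , h₂) = inj₂ (r , t , Xr , Xt , Hits-~ o {r} {j₁} hit₁ , ut , ℕₚ.≤-<-trans (pos-≤ o (Hits-~ o {r} {j₁} hit₁) hit₁) j₁< , ℕₚ.≰⇒> far)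
    where
    i = pos o w
    D = d₀ o
    k = iter σ i D
    dr = iter σ j₁ D
    r = vert (α dr)
    Xr = proj₂ (proj₂ (ei-out {X} h₁))
    hit₁ : Hits o r j₁
    hit₁ = proj₁ (ei-out {X} h₁) , refl
    dt = iter σ j₂ (σ k)
    t = vert (α dt)
    Xt = proj₂ (proj₂ (ei-out {X} h₂))
    ut : u ~ t
    ut = dt , proj₁ (ei-out {X} h₂) , trans (iter-σ-vert j₂ (σ k)) (trans (σ-vert k) (at-v o i)) , refl
    i' = pos o t
    ht = proj₁ (pos-spec o ut)
    samedart : iter σ i' D ≡ dt
    samedart = proj₂ simple _ _ (proj₁ ht) (proj₁ (ei-out {X} h₂)) (trans (at-v o i') (sym (proj₁ (proj₂ (proj₂ ut))))) (proj₂ ht)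
    -- A number of rotation steps that returns to the start: `i'` steps to the dart of `t`, the
    -- others from there back. If `t` came no later than `w`, this loop could be cut out of the way
    -- to `w` or would give a shorter way back, against the minimality of `pos o w` or of `kk`.
    q = kk ∸ j₂ + i'
    loop : iter σ q D ≡ D
    loop = trans (iter-+ σ (kk ∸ j₂) i' D) (trans (cong (iter σ (kk ∸ j₂)) samedart)
      (trans (sym (iter-+ σ (kk ∸ j₂) j₂ (σ k))) (trans (cong (λ a → iter σ a (σ k)) (ℕₚ.m∸n+n≡m (ℕₚ.<⇒≤ j₂<))) qk)))
    q>0 : 0 < q
    q>0 = ℕₚ.≤-trans (ℕₚ.m<n⇒0<n∸m j₂<) (ℕₚ.m≤m+n (kk ∸ j₂) i')
    far : ¬ i' ≤ i
    far le with ℕₚ.≤-<-connex q i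
    ... | inj₁ q≤i = kmin (ℕₚ.∸-monoʳ-< q>0 q≤i) (subst (λ d → es G d ≡ true × vert (α d) ≡ w) eq (kes , kw))
      where
      eq : k ≡ iter σ (i ∸ q) D
      eq = trans (cong (λ a → iter σ a D) (sym (ℕₚ.m∸n+n≡m q≤i))) (trans (iter-+ σ (i ∸ q) q D) (cong (iter σ (i ∸ q)) loop))
    ... | inj₂ i<q = mnk {q ∸ suc i} small (trans (trans (sym (iter-+ σ (q ∸ suc i) (suc i) D)) (cong (λ a → iter σ a D) (ℕₚ.m∸n+n≡m i<q))) loop)
      where
      small : q ∸ suc i < kk
      small = ℕₚ.≤-trans (ℕₚ.≤-reflexive (sym (ℕₚ.+-∸-assoc 1 i<q))) (ℕₚ.≤-trans (ℕₚ.∸-monoˡ-≤ i (ℕₚ.+-monoʳ-≤ (kk ∸ j₂) le))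
        (ℕₚ.≤-trans (ℕₚ.≤-reflexive (ℕₚ.m+n∸n≡m (kk ∸ j₂) i)) (ℕₚ.m∸n≤m kk j₂)))

-- Lists of colours and pointwise updates

abstract
  ⟦_⟧ : ∀ {n} {P : Fin n → Set} → (∀ v → Dec (P v)) → VSet n
  ⟦ P? ⟧ v = ⌊ P? v ⌋

  ⟦⟧in : ∀ {n} {P : Fin n → Set} {P? : ∀ v → Dec (P v)} {v} → P v → ⟦ P? ⟧ ∋ v
  ⟦⟧in {P? = P?} {v} p = mk (true-⌊⌋ {d = P? v} p)

  ⟦⟧out : ∀ {n} {P : Fin n → Set} {P? : ∀ v → Dec (P v)} {v} → ⟦ P? ⟧ ∋ v → P v
  ⟦⟧out {P? = P?} {v} p = ⌊⌋-true {d = P? v} (un p)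


infixl 6 _⊖_
abstract
  _⊖_ : List ℕ → ℕ → List ℕ
  l ⊖ a = filter (λ x → ¬? (x ℕ.≟ a)) l

  ⊖in : ∀ {l a x} → x ∈ l → x ≢ a → x ∈ l ⊖ a
  ⊖in = ∈-filter⁺ (λ x → ¬? (x ℕ.≟ _))

  ⊖out : ∀ {l a x} → x ∈ l ⊖ a → x ∈ l
  ⊖out {l} {a} h = proj₁ (∈-filter⁻ (λ x → ¬? (x ℕ.≟ a)) {xs = l} h)

  ⊖ne : ∀ {l a x} → x ∈ l ⊖ a → x ≢ a
  ⊖ne {l} {a} h = proj₂ (∈-filter⁻ (λ x → ¬? (x ℕ.≟ a)) {xs = l} h)

  ⊖uniq : ∀ {l a} → Unique l → Unique (l ⊖ a)
  ⊖uniq = Uniqₚ.filter⁺ _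

  ⊖len : ∀ {l a k} → Unique l → suc k ≤ length l → k ≤ length (l ⊖ a)
  ⊖len {l} {a} u le = ℕₚ.≤-pred (ℕₚ.≤-trans le (unique-⊆-length {ys = a ∷ (l ⊖ a)} u λ {x} x∈ → case x ℕ.≟ a of λ where
    (yes refl) → here refl
    (no ne) → there (⊖in x∈ ne)))

pick1 : ∀ {l : List ℕ} → 1 ≤ length l → ∃[ a ] a ∈ l
pick1 {x ∷ _} _ = x , here refl

pick2 : ∀ {l : List ℕ} → Unique l → 2 ≤ length l → ∃[ a ] ∃[ b ] (a ∈ l × b ∈ l × a ≢ b)
pick2 {x ∷ []} _ (s≤s ())
pick2 {x ∷ y ∷ l} ((x≢y ∷ _) ∷ _) _ = x , y , here refl , there (here refl) , x≢y

_∈?ℕ_ : ∀ (x : ℕ) l → Dec (x ∈ l)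
x ∈?ℕ l = Any.any? (x ℕ.≟_) l

abstract
  upd : ∀ {n} {A : Set} → (Fin n → A) → Fin n → A → Fin n → A
  upd f v a u = if ⌊ u ≟ v ⌋ then a else f u

  upd-eq : ∀ {n} {A : Set} (f : Fin n → A) v a → upd f v a v ≡ a
  upd-eq f v a = cong (λ b → if b then a else f v) (true-⌊⌋ {d = v ≟ v} refl)

  upd-ne : ∀ {n} {A : Set} (f : Fin n → A) {v a u} → u ≢ v → upd f v a u ≡ f u
  upd-ne f {v} {a} {u} ne = cong (λ b → if b then a else f u) (false-⌊⌋ {d = u ≟ v} ne)


-- Types of governments contained in a relation of colours

Rel : Set₁
Rel = ℕ → ℕ → Set

_ᵀ : Rel → Rel
(F ᵀ) x y = F y x

-- Dictatorship of the first end, of the second end, democracy. A government may be replaced by its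
-- type, since two of its colourings already form a government of that type.
data Ty : Set where
  st₁ st₂ : ℕ → Ty
  dm : ℕ → ℕ → Ty

Has : Rel → Ty → Set
Has F (st₁ c) = ∃[ y ] ∃[ y' ] (y ≢ y' × F c y × F c y')
Has F (st₂ c) = ∃[ x ] ∃[ x' ] (x ≢ x' × F x c × F x' c)
Has F (dm a b) = a ≢ b × F a b × F b a

Differ : Ty → Ty → Set
Differ (st₁ c) (st₁ c') = c ≢ c'
Differ (st₂ c) (st₂ c') = c ≢ c'
Differ (dm a b) (dm a' b') = ¬ ((a ≡ a' × b ≡ b') ⊎ (a ≡ b' × b ≡ a'))
Differ (st₁ _) (st₂ _) = ⊤
Differ (st₁ _) (dm _ _) = ⊤
Differ (st₂ _) (st₁ _) = ⊤
Differ (st₂ _) (dm _ _) = ⊤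
Differ (dm _ _) (st₁ _) = ⊤
Differ (dm _ _) (st₂ _) = ⊤

-- Amounts to containing a confederacy, because a union of two governments is a government exactly
-- when their types agree.
Conf : Rel → Set
Conf F = ∃[ τ ] ∃[ τ' ] (Differ τ τ' × Has F τ × Has F τ')

Has-mono : ∀ {F F' : Rel} → (∀ {x y} → F x y → F' x y) → ∀ τ → Has F τ → Has F' τ
Has-mono h (st₁ c) (y , y' , ne , p , q) = y , y' , ne , h p , h q
Has-mono h (st₂ c) (y , y' , ne , p , q) = y , y' , ne , h p , h q
Has-mono h (dm a b) (ne , p , q) = ne , h p , h q

Conf-mono : ∀ {F F' : Rel} → (∀ {x y} → F x y → F' x y) → Conf F → Conf F'
Conf-mono h (τ , τ' , d , p , q) = τ , τ' , d , Has-mono h τ p , Has-mono h τ' q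

Tyᵀ : Ty → Ty
Tyᵀ (st₁ c) = st₂ c
Tyᵀ (st₂ c) = st₁ c
Tyᵀ (dm a b) = dm a b

Hasᵀ : ∀ {F} τ → Has F τ → Has (F ᵀ) (Tyᵀ τ)
Hasᵀ (st₁ c) h = h
Hasᵀ (st₂ c) h = h
Hasᵀ (dm a b) (ne , p , q) = ne , q , p

Differᵀ : ∀ τ τ' → Differ τ τ' → Differ (Tyᵀ τ) (Tyᵀ τ')
Differᵀ (st₁ _) (st₁ _) d = d
Differᵀ (st₂ _) (st₂ _) d = d
Differᵀ (dm _ _) (dm _ _) d = d
Differᵀ (st₁ _) (st₂ _) d = d
Differᵀ (st₁ _) (dm _ _) d = d
Differᵀ (st₂ _) (st₁ _) d = d
Differᵀ (st₂ _) (dm _ _) d = d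
Differᵀ (dm _ _) (st₁ _) d = d
Differᵀ (dm _ _) (st₂ _) d = d

Confᵀ : ∀ {F} → Conf F → Conf (F ᵀ)
Confᵀ {F} (τ , τ' , d , p , q) = Tyᵀ τ , Tyᵀ τ' , Differᵀ τ τ' d , Hasᵀ {F} τ p , Hasᵀ {F} τ' q

Same? : ∀ τ τ' → Dec (Differ τ τ')
Same? (st₁ c) (st₁ c') = ¬? (c ℕ.≟ c')
Same? (st₂ c) (st₂ c') = ¬? (c ℕ.≟ c')
Same? (dm a b) (dm a' b') = ¬? (((a ℕ.≟ a') ×-dec (b ℕ.≟ b')) ⊎-dec ((a ℕ.≟ b') ×-dec (b ℕ.≟ a')))
Same? (st₁ _) (st₂ _) = yes tt
Same? (st₁ _) (dm _ _) = yes tt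
Same? (st₂ _) (st₁ _) = yes tt
Same? (st₂ _) (dm _ _) = yes tt
Same? (dm _ _) (st₁ _) = yes tt
Same? (dm _ _) (st₂ _) = yes tt

_≐₂_ : List ℕ → ℕ × ℕ → Set
l ≐₂ (a , b) = a ∈ l × b ∈ l × a ≢ b × (∀ x → x ∈ l → x ≡ a ⊎ x ≡ b)

_≐₃_ : List ℕ → ℕ × ℕ × ℕ → Set
l ≐₃ (a , b , c) = (a ∈ l × b ∈ l × c ∈ l) × (a ≢ b × a ≢ c × b ≢ c) × (∀ x → x ∈ l → x ≡ a ⊎ x ≡ b ⊎ x ≡ c)

-- Three colours on one side leave two for each colour of the other side, which gives stars with two
-- centres. With two colours on each side, a colour missing from the other list gives a star, and a
-- second star comes with it; if none is missing, the lists coincide and only one democracy is left.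
prod : ∀ {F : Rel} {l l'} → Unique l → Unique l' → 2 ≤ length l → 2 ≤ length l' → (∀ {x y} → x ∈ l → y ∈ l' → x ≢ y → F x y)
  → Conf F ⊎ ∃[ a ] ∃[ b ] (l ≐₂ (a , b) × l' ≐₂ (a , b))
prod {F} {a ∷ b ∷ []} {c ∷ d ∷ []} ((ab ∷ []) ∷ _) ((cd ∷ []) ∷ _) _ _ h = case ((a ℕ.≟ c) ⊎-dec (a ℕ.≟ d)) ,′ ((b ℕ.≟ c) ⊎-dec (b ℕ.≟ d)) of λ where
    (no na , no nb) → inj₁ (st₁ a , st₁ b , ab , stars a₁ na , stars b₁ nb)
    (no na , yes (inj₁ refl)) → inj₁ (st₁ a , st₂ d , tt , stars a₁ na , a , b , ab , h a₁ d₁ (λ e → na (inj₂ e)) , h b₁ d₁ cd)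
    (no na , yes (inj₂ refl)) → inj₁ (st₁ a , st₂ c , tt , stars a₁ na , a , b , ab , h a₁ c₁ (λ e → na (inj₁ e)) , h b₁ c₁ λ e → cd (sym e))
    (yes (inj₁ refl) , no nb) → inj₁ (st₁ b , st₂ d , tt , stars b₁ nb , b , a , (λ e → ab (sym e)) , h b₁ d₁ (λ e → nb (inj₂ e)) , h a₁ d₁ cd)
    (yes (inj₂ refl) , no nb) → inj₁ (st₁ b , st₂ c , tt , stars b₁ nb , b , a , (λ e → ab (sym e)) , h b₁ c₁ (λ e → nb (inj₁ e)) , h a₁ c₁ λ e → cd (sym e))
    (yes (inj₁ refl) , yes (inj₁ refl)) → ⊥-elim (ab refl)
    (yes (inj₂ refl) , yes (inj₂ refl)) → ⊥-elim (ab refl)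
    (yes (inj₁ refl) , yes (inj₂ refl)) → inj₂ (a , b , (a₁ , b₁ , ab , λ _ → two) , (c₁ , d₁ , ab , λ _ → two))
    (yes (inj₂ refl) , yes (inj₁ refl)) → inj₂ (a , b , (a₁ , b₁ , ab , λ _ → two) , (d₁ , c₁ , ab , λ { _ (here e) → inj₂ e ; _ (there (here e)) → inj₁ e }))
  where
  a₁ : a ∈ a ∷ b ∷ []
  a₁ = here refl
  b₁ : b ∈ a ∷ b ∷ []
  b₁ = there (here refl)
  c₁ : c ∈ c ∷ d ∷ []
  c₁ = here refl
  d₁ : d ∈ c ∷ d ∷ []
  d₁ = there (here refl)
  stars : ∀ {x} → x ∈ a ∷ b ∷ [] → ¬ (x ≡ c ⊎ x ≡ d) → Has F (st₁ x)
  stars x∈ nx = c , d , cd , h x∈ c₁ (λ e → nx (inj₁ e)) , h x∈ d₁ (λ e → nx (inj₂ e))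
  two : ∀ {x y z : ℕ} → z ∈ x ∷ y ∷ [] → z ≡ x ⊎ z ≡ y
  two (here e) = inj₁ e
  two (there (here e)) = inj₂ e
prod {F} {a ∷ b ∷ e ∷ l} {c ∷ d ∷ l'} ((ab ∷ ae ∷ _) ∷ (be ∷ _) ∷ _) ((cd ∷ _) ∷ _) _ _ h =
    inj₁ (st₂ c , st₂ d , cd , stars (here refl) , stars (there (here refl)))
  where
  stars : ∀ {y} → y ∈ c ∷ d ∷ l' → Has F (st₂ y)
  stars {y} y∈ = case (a ℕ.≟ y) ,′ (b ℕ.≟ y) of λ where
    (yes refl , yes refl) → ⊥-elim (ab refl)
    (yes refl , no nb) → b , e , be , h (there (here refl)) y∈ nb , h (there (there (here refl))) y∈ λ q → ae (sym q)
    (no na , yes refl) → a , e , ae , h (here refl) y∈ na , h (there (there (here refl))) y∈ λ q → be (sym q)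
    (no na , no nb) → a , b , ab , h (here refl) y∈ na , h (there (here refl)) y∈ nb
prod {F} {a ∷ b ∷ []} {c ∷ d ∷ e ∷ l} ((ab ∷ []) ∷ _) ((cd ∷ ce ∷ _) ∷ (de ∷ _) ∷ _) _ _ h =
    inj₁ (st₁ a , st₁ b , ab , stars (here refl) , stars (there (here refl)))
  where
  stars : ∀ {y} → y ∈ a ∷ b ∷ [] → Has F (st₁ y)
  stars {y} y∈ = case (y ℕ.≟ c) ,′ (y ℕ.≟ d) of λ where
    (yes refl , yes refl) → ⊥-elim (cd refl)
    (yes refl , no nb) → d , e , de , h y∈ (there (here refl)) nb , h y∈ (there (there (here refl))) ce
    (no na , yes refl) → c , e , ce , h y∈ (here refl) na , h y∈ (there (there (here refl))) de
    (no na , no nb) → c , d , cd , h y∈ (here refl) na , h y∈ (there (here refl)) nb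
prod {l = []} _ _ () _ _
prod {l = _ ∷ []} _ _ (s≤s ()) _ _
prod {l = _ ∷ _ ∷ []} {[]} _ _ _ () _
prod {l = _ ∷ _ ∷ []} {_ ∷ []} _ _ _ (s≤s ()) _
prod {l = _ ∷ _ ∷ _ ∷ _} {[]} _ _ _ () _
prod {l = _ ∷ _ ∷ _ ∷ _} {_ ∷ []} _ _ _ (s≤s ()) _

≐₂-not-3 : ∀ {l a b} → Unique l → 3 ≤ length l → ¬ l ≐₂ (a , b)
≐₂-not-3 {l} {a} {b} u le (_ , _ , _ , all) = ℕₚ.<⇒≱ le (unique-⊆-length {ys = a ∷ b ∷ []} u λ {z} z∈ → case all z z∈ of λ where
  (inj₁ refl) → here refl
  (inj₂ refl) → there (here refl))

≐₃-not-5 : ∀ {l t} → Unique l → 5 ≤ length l → ¬ l ≐₃ t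
≐₃-not-5 {l} {a , b , c} u le (_ , _ , all) = ℕₚ.<⇒≱ (ℕₚ.≤-trans (s≤s (s≤s (s≤s (s≤s z≤n)))) le) (unique-⊆-length {ys = a ∷ b ∷ c ∷ []} u λ {z} z∈ → case all z z∈ of λ where
  (inj₁ refl) → here refl
  (inj₂ (inj₁ refl)) → there (here refl)
  (inj₂ (inj₂ refl)) → there (there (here refl)))

prod₃ : ∀ {F : Rel} {l l'} → Unique l → Unique l' → 3 ≤ length l → 2 ≤ length l' → (∀ {x y} → x ∈ l → y ∈ l' → x ≢ y → F x y) → Conf F
prod₃ u u' le le' h = case prod u u' (ℕₚ.≤-trans (s≤s (s≤s z≤n)) le) le' h of λ where
  (inj₁ r) → r
  (inj₂ (_ , _ , e , _)) → ⊥-elim (≐₂-not-3 u le e)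

-- At least five colours shrink to three only by losing two, so neither removal can have been
-- vacuous.
deleted : ∀ {l a₁ a₂ t} → Unique l → 5 ≤ length l → (l ⊖ a₁ ⊖ a₂) ≐₃ t → a₁ ∈ l × a₂ ∈ l
deleted {l} {a₁} {a₂} {a , b , c} u le (_ , _ , all) = get a₁ a₂ (λ {z} z∈ n₁ n₂ → all z (⊖in {l ⊖ a₁} (⊖in z∈ n₁) n₂)) , get a₂ a₁ (λ {z} z∈ n₁ n₂ → all z (⊖in {l ⊖ a₁} (⊖in z∈ n₂) n₁))
  where
  get : ∀ x y → (∀ {z} → z ∈ l → z ≢ x → z ≢ y → z ≡ a ⊎ z ≡ b ⊎ z ≡ c) → x ∈ l
  get x y h = decidable-stable (x ∈?ℕ l) λ nx → ℕₚ.<⇒≱ le (unique-⊆-length {ys = y ∷ a ∷ b ∷ c ∷ []} u λ {z} z∈ → case z ℕ.≟ y of λ where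
    (yes refl) → here refl
    (no ne) → case h z∈ (λ { refl → nx z∈ }) ne of λ where
      (inj₁ refl) → there (here refl)
      (inj₂ (inj₁ refl)) → there (there (here refl))
      (inj₂ (inj₂ refl)) → there (there (there (here refl))))

perm : ∀ {l a b a' b' e} → (a ∷ b ∷ []) ≐₂ (a' , b') → l ≐₃ (a' , b' , e) → l ≐₃ (a , b , e)
perm (here refl , there (here refl) , _) h = h
perm (there (here refl) , here refl , _) ((p , q , r) , (d₁ , d₂ , d₃) , all) = (q , p , r) , ((λ e → d₁ (sym e)) , d₃ , d₂) , λ z z∈ → case all z z∈ of λ where
  (inj₁ e) → inj₂ (inj₁ e)
  (inj₂ (inj₁ e)) → inj₁ e
  (inj₂ (inj₂ e)) → inj₂ (inj₂ e)
perm (here refl , here refl , ne , _) h = ⊥-elim (ne refl)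
perm (there (here refl) , there (here refl) , ne , _) h = ⊥-elim (ne refl)

uniq₃ : ∀ {a b c : ℕ} → a ≢ b → a ≢ c → b ≢ c → Unique (a ∷ b ∷ c ∷ [])
uniq₃ ab ac bc = (ab ∷ ac ∷ []) ∷ (bc ∷ []) ∷ [] ∷ []

uniq₂ : ∀ {a b : ℕ} → a ≢ b → Unique (a ∷ b ∷ [])
uniq₂ ab = (ab ∷ []) ∷ [] ∷ []

list₃ : ∀ {a b c x : ℕ} → x ∈ a ∷ b ∷ c ∷ [] → x ≢ c → x ≡ a ⊎ x ≡ b
list₃ (here e) _ = inj₁ e
list₃ (there (here e)) _ = inj₂ e
list₃ (there (there (here e))) ne = ⊥-elim (ne e)

list₂ : ∀ {a b x : ℕ} → x ∈ a ∷ b ∷ [] → x ≡ a ⊎ x ≡ b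
list₂ (here e) = inj₁ e
list₂ (there (here e)) = inj₂ e

other : ∀ {a b : ℕ} → a ≢ b → ∀ x → ∃[ o ] ((o ≡ a ⊎ o ≡ b) × o ≢ x)
other {a} {b} ab x = case x ℕ.≟ a of λ where
  (yes refl) → b , inj₂ refl , λ e → ab (sym e)
  (no ne) → a , inj₁ refl , λ e → ne (sym e)

not-self : ∀ x → not x ≢ x
not-self true ()
not-self false ()

third-colour : ∀ {l a b} → Unique l → 3 ≤ length l → ∃[ e ] (e ∈ l × e ≢ a × e ≢ b)
third-colour {l} {a} {b} u le = case pick1 (⊖len {l ⊖ a} {b} (⊖uniq u) (⊖len {l} {a} u le)) of λ (e , e∈) → e , ⊖out {l} (⊖out e∈) , ⊖ne {l} (⊖out {l ⊖ a} e∈) , ⊖ne {l ⊖ a} e∈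

≐₂-≐₃ : ∀ {l a b c} → Unique l → 3 ≤ length l → (l ⊖ c) ≐₂ (a , b) → l ≐₃ (a , b , c)
≐₂-≐₃ {l} {a} {b} {c} u le (a∈ , b∈ , ab , all) = (⊖out a∈ , ⊖out b∈ , c∈) , (ab , ⊖ne {l} a∈ , ⊖ne {l} b∈) , three
  where
  three : ∀ z → z ∈ l → z ≡ a ⊎ z ≡ b ⊎ z ≡ c
  three z z∈ = case z ℕ.≟ c of λ where
    (yes e) → inj₂ (inj₂ e)
    (no ne) → case all z (⊖in z∈ ne) of λ where
      (inj₁ e) → inj₁ e
      (inj₂ e) → inj₂ (inj₁ e)
  c∈ : c ∈ l
  c∈ = decidable-stable (c ∈?ℕ l) λ nc → ≐₂-not-3 u le (⊖out a∈ , ⊖out b∈ , ab , λ z z∈ → all z (⊖in z∈ λ { refl → nc z∈ }))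

-- List colourings: extension and gluing

module ListColouring {n : ℕ} (Γ : Graph n) (Π : Plane Γ) where
  open Graph Γ public
  open Plane Π public

  Lists : Set
  Lists = Fin n → List ℕ

  Constraint : Set₁
  Constraint = Fin n → ℕ → Set

  ∈L : Lists → Constraint
  ∈L L v x = x ∈ L v

  -- The colours of `p` and `q` are prescribed separately and may lie outside their lists.
  Off : Lists → Fin n → Fin n → Constraint
  Off L p q v x = v ≢ p → v ≢ q → x ∈ L v

  record Col (X : VSet n) (P : Constraint) (ψ : Fin n → ℕ) : Set where
    constructor col
    field
      lst : ∀ {v} → X ∋ v → P v (ψ v)
      prp : ∀ {u v} → X ∋ u → X ∋ v → u ~ v → ψ u ≢ ψ v
  open Col public

  Reg : VSet n → Lists → Fin n → Set
  Reg X L v = Unique (L v) × (5 ≤ length (L v) ⊎ (3 ≤ length (L v) × Out X v))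

  Reg-3≤ : ∀ {X L v} → Reg X L v → 3 ≤ length (L v)
  Reg-3≤ (_ , inj₁ h) = ℕₚ.≤-trans (s≤s (s≤s (s≤s z≤n))) h
  Reg-3≤ (_ , inj₂ (h , _)) = h

  Reg-mono : ∀ {X Y L v} → Y ⊂ X → Y ∋ v → Reg X L v → Reg Y L v
  Reg-mono h p (u , inj₁ q) = u , inj₁ q
  Reg-mono h p (u , inj₂ (q , o)) = u , inj₂ (q , mono h p o)

  Reg-Out : ∀ {X L v} → Reg X L v → ¬ 5 ≤ length (L v) → Out X v
  Reg-Out (_ , inj₁ h) ns = ⊥-elim (ns h)
  Reg-Out (_ , inj₂ (_ , o)) _ = o

  Col-mono : ∀ {X Y P ψ} → Y ⊂ X → Col X P ψ → Col Y P ψ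
  Col-mono h c = col (λ p → c .lst (h p)) (λ p q → c .prp (h p) (h q))

  Col-lists : ∀ {X P Q ψ} → (∀ {v} → X ∋ v → P v (ψ v) → Q v (ψ v)) → Col X P ψ → Col X Q ψ
  Col-lists h c = col (λ p → h p (c .lst p)) (c .prp)

  abstract
    -- Two colours at once, since a deleted outer vertex keeps two in reserve; with `a` equal to `b`
    -- it removes the colour of a precoloured vertex.
    drop : VSet n → ℕ → ℕ → Lists → Lists
    drop D a b L u = if D u then L u ⊖ a ⊖ b else L u

    drop-on : ∀ {D a b L u} → D ∋ u → drop D a b L u ≡ L u ⊖ a ⊖ b
    drop-on {D} {a} {b} {L} {u} p = cong (λ t → if t then L u ⊖ a ⊖ b else L u) (un p)

    drop-off : ∀ {D a b L u} → ¬ D ∋ u → drop D a b L u ≡ L u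
    drop-off {D} {a} {b} {L} {u} p = cong (λ t → if t then L u ⊖ a ⊖ b else L u) (¬true λ e → p (mk e))

  drop-⊆ : ∀ {D a b L u x} → x ∈ drop D a b L u → x ∈ L u
  drop-⊆ {D} {a} {b} {L} {u} {x} h = case D ∋? u of λ where
    (yes p) → ⊖out {L u} {a} (⊖out (subst (x ∈_) (drop-on {D} {L = L} p) h))
    (no q) → subst (x ∈_) (drop-off {D} {L = L} q) h

  drop-≢ : ∀ {D a b L u x} → D ∋ u → x ∈ drop D a b L u → x ≢ a × x ≢ b
  drop-≢ {D} {a} {b} {L} {u} {x} p h = ⊖ne {L u} (⊖out {L u ⊖ a} h') , ⊖ne {L u ⊖ a} h'
    where h' = subst (x ∈_) (drop-on {D} {L = L} p) h

  -- The exchange behind every deletion: five colours lose at most two, and the vertex has become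
  -- outer.
  drop-Reg-on : ∀ {X D a b L u} → D ∋ u → Unique (L u) → 5 ≤ length (L u) → Out X u → Reg X (drop D a b L) u
  drop-Reg-on {X} {D} {a} {b} {L} {u} p un5 le o =
    subst (λ l → Unique l × (5 ≤ length l ⊎ (3 ≤ length l × Out X u))) (sym (drop-on {D} {L = L} p))
      (⊖uniq {L u ⊖ a} (⊖uniq un5) , inj₂ (⊖len {L u ⊖ a} (⊖uniq un5) (⊖len {L u} un5 le) , o))

  drop-Reg-off : ∀ {X D a b L u} → ¬ D ∋ u → Reg X L u → Reg X (drop D a b L) u
  drop-Reg-off {X} {D} {a} {b} {L} {u} p r =
    subst (λ l → Unique l × (5 ≤ length l ⊎ (3 ≤ length l × Out X u))) (sym (drop-off {D} {L = L} p)) r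

  extend : ∀ {X P Q ψ v c} → Col (X - v) Q ψ → (∀ {u x} → (X - v) ∋ u → Q u x → P u x) → P v c
    → (∀ {u} → (X - v) ∋ u → v ~ u → ψ u ≢ c) → Col X P (upd ψ v c)
  extend {X} {P} {Q} {ψ} {v} {c} C sub c∈ ok = col l p
    where
    l : ∀ {u} → X ∋ u → P u (upd ψ v c u)
    l {u} Xu = case u ≟ v of λ where
      (yes refl) → subst (P u) (sym (upd-eq ψ u c)) c∈
      (no ne) → subst (P u) (sym (upd-ne ψ ne)) (sub (-in Xu ne) (C .lst (-in Xu ne)))
    p : ∀ {u w} → X ∋ u → X ∋ w → u ~ w → upd ψ v c u ≢ upd ψ v c w
    p {u} {w} Xu Xw e q = case (u ≟ v) ,′ (w ≟ v) of λ where
      (yes refl , yes refl) → ~-irr e refl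
      (yes refl , no ne) → ok (-in Xw ne) e (trans (sym (upd-ne ψ ne)) (trans (sym q) (upd-eq ψ u c)))
      (no ne , yes refl) → ok (-in Xu ne) (~-sym e) (trans (sym (upd-ne ψ ne)) (trans q (upd-eq ψ w c)))
      (no ne , no ne') → C .prp (-in Xu ne) (-in Xw ne') e (trans (sym (upd-ne ψ ne)) (trans q (upd-ne ψ ne')))

  abstract
    glued : VSet n → (Fin n → ℕ) → (Fin n → ℕ) → Fin n → ℕ
    glued Y ψ₁ ψ₂ u = if Y u then ψ₂ u else ψ₁ u

    glued-on : ∀ {Y ψ₁ ψ₂ u} → Y ∋ u → glued Y ψ₁ ψ₂ u ≡ ψ₂ u
    glued-on {Y} {ψ₁} {ψ₂} {u} p = cong (λ t → if t then ψ₂ u else ψ₁ u) (un p)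

    glued-off : ∀ {Y ψ₁ ψ₂ u} → ¬ Y ∋ u → glued Y ψ₁ ψ₂ u ≡ ψ₁ u
    glued-off {Y} {ψ₁} {ψ₂} {u} p = cong (λ t → if t then ψ₂ u else ψ₁ u) (¬true λ e → p (mk e))

  glue : ∀ {X Y P ψ₁ ψ₂} → Col (X ∖ Y) P ψ₁ → Col Y P ψ₂
    → (∀ {u w} → Y ∋ u → X ∋ w → ¬ Y ∋ w → u ~ w → ψ₂ u ≢ ψ₁ w) → Col X P (glued Y ψ₁ ψ₂)
  glue {X} {Y} {P} {ψ₁} {ψ₂} C₁ C₂ bd = col l p
    where
    on : ∀ {u} → Y ∋ u → glued Y ψ₁ ψ₂ u ≡ ψ₂ u
    on = glued-on {Y} {ψ₁} {ψ₂}
    off : ∀ {u} → ¬ Y ∋ u → glued Y ψ₁ ψ₂ u ≡ ψ₁ u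
    off = glued-off {Y} {ψ₁} {ψ₂}
    l : ∀ {u} → X ∋ u → P u (glued Y ψ₁ ψ₂ u)
    l {u} Xu = case Y ∋? u of λ where
      (yes y) → subst (P u) (sym (on y)) (C₂ .lst y)
      (no y) → subst (P u) (sym (off y)) (C₁ .lst (∖in Xu y))
    p : ∀ {u w} → X ∋ u → X ∋ w → u ~ w → glued Y ψ₁ ψ₂ u ≢ glued Y ψ₁ ψ₂ w
    p {u} {w} Xu Xw e q = case (Y ∋? u) ,′ (Y ∋? w) of λ where
      (yes a , yes b) → C₂ .prp a b e (trans (sym (on a)) (trans q (on b)))
      (no a , no b) → C₁ .prp (∖in Xu a) (∖in Xw b) e (trans (sym (off a)) (trans q (off b)))
      (yes a , no b) → bd a Xw b e (trans (sym (on a)) (trans q (off b)))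
      (no a , yes b) → bd b Xu a (~-sym e) (trans (sym (on b)) (trans (sym q) (off a)))

  -- The crossing property is applied with `b` itself as the outer vertex to be reached; the walk
  -- around avoids both `v` and `b`.
  sep3 : ∀ {X v} (o : Out X v) {a b c} → Out X b → v ~ a → v ~ b → v ~ c → pos o a < pos o b → pos o b < pos o c → ¬ Walk (X - v - b) a c
  sep3 {X} {v} o {a} {b} {c} ob va vb vc l₁ l₂ w = nocross o (-out (-out (Wstart w))) (out∈ ob) (-out (-out (Wend w))) va vb vc l₁ l₂
    {X - v - b} (λ q → -out (-out q)) (λ q → -ne (-out q) refl) w ob [ ∖in (-in (out∈ ob) λ q → ~-irr vb (sym q)) (λ q → -ne q refl) ]

  -- One of the three is the middle one in the linear order at `v`. Being outer, it separates the
  -- other two together with `v`.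
  middle : ∀ {X v p r s} → Out X v → Out X p → Out X r → Out X s → v ~ p → v ~ r → v ~ s → p ≢ r → p ≢ s → r ≢ s
    → ¬ Walk (X - v - p) r s ⊎ ¬ Walk (X - v - r) p s ⊎ ¬ Walk (X - v - s) p r
  middle {X} {v} {p} {r} {s} o op or os vp vr vs pr ps rs
    with ℕₚ.<-cmp (pos o p) (pos o r) | ℕₚ.<-cmp (pos o p) (pos o s) | ℕₚ.<-cmp (pos o r) (pos o s)
  ... | tri≈ _ e _ | _ | _ = ⊥-elim (pr (pos-inj o (out∈ op) (out∈ or) vp vr e))
  ... | _ | tri≈ _ e _ | _ = ⊥-elim (ps (pos-inj o (out∈ op) (out∈ os) vp vs e))
  ... | _ | _ | tri≈ _ e _ = ⊥-elim (rs (pos-inj o (out∈ or) (out∈ os) vr vs e))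
  ... | tri< a _ _ | _ | tri< c _ _ = inj₂ (inj₁ λ w → sep3 o or vp vr vs a c w)
  ... | tri< a _ _ | tri< b _ _ | tri> _ _ c = inj₂ (inj₂ λ w → sep3 o os vp vs vr b c w)
  ... | tri< a _ _ | tri> _ _ b | tri> _ _ c = inj₁ λ w → sep3 o op vs vp vr b a (Wrev w)
  ... | tri> _ _ a | tri< b _ _ | tri< c _ _ = inj₁ λ w → sep3 o op vr vp vs a b w
  ... | tri> _ _ a | tri> _ _ b | tri< c _ _ = inj₂ (inj₂ λ w → sep3 o os vr vs vp c b (Wrev w))
  ... | tri> _ _ a | _ | tri> _ _ c = inj₂ (inj₁ λ w → sep3 o or vs vr vp c a (Wrev w))

  -- Thomassen's theorem

  comp-edge : ∀ {S y u w} → comp S y ∋ u → S ∋ w → u ~ w → comp S y ∋ w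
  comp-edge p q e = comp-in (comp-out p ▸ (e , q))

  -- A precoloured outer edge or, when `p ≡ q`, a single precoloured outer vertex, as remains when
  -- one end of the edge is deleted.
  Pre : VSet n → Fin n → Fin n → ℕ → ℕ → Set
  Pre X p q cp cq = Out X p × Out X q × ((p ≡ q × cp ≡ cq) ⊎ (p ~ q × cp ≢ cq))

  Extends : VSet n → Lists → Fin n → Fin n → ℕ → ℕ → Set
  Extends X L p q cp cq = ∃[ ψ ] (Col X (∈L L) ψ × ψ p ≡ cp × ψ q ≡ cq)

  across : ∀ {X P Q v m ψ₁ ψ₂} (Y : VSet n) → Y ⊂ X → (∀ {u w} → Y ∋ u → X ∋ w → ¬ Y ∋ w → u ~ w → w ≡ v ⊎ w ≡ m)
    → Col (X ∖ Y) P ψ₁ → Col (Y ⊹ v ⊹ m) Q ψ₂ → (∀ {u x} → Y ∋ u → Q u x → P u x) → ψ₂ v ≡ ψ₁ v → ψ₂ m ≡ ψ₁ m → Col X P (glued Y ψ₁ ψ₂)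
  across {X} {P} {Q} {v} {m} {ψ₁} {ψ₂} Y YX bd C₁ C₂ QP hv hm = glue C₁ (Col-lists QP (Col-mono (λ p → ⊹in (⊹in p)) C₂))
    λ {u} {w} a b c e q → case bd a b c e of λ where
      (inj₁ refl) → C₂ .prp (⊹in (⊹in a)) (⊹in (⊹new {X = Y})) e (trans q (sym hv))
      (inj₂ refl) → C₂ .prp (⊹in (⊹in a)) (⊹new {X = Y ⊹ v}) e (trans q (sym hm))

  Extendable : ℕ → Set
  Extendable k = ∀ {X L p q cp cq} → sz X < k → Pre X p q cp cq → cp ∈ L p → cq ∈ L q
    → (∀ {v} → X ∋ v → v ≢ p → v ≢ q → Reg X L v) → Extends X L p q cp cq

  free : ∀ k {X L} → Extendable k → sz X < k → (∀ {v} → X ∋ v → Reg X L v) → ∃[ ψ ] Col X (∈L L) ψ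
  free k {X} {L} IH lt reg = case any? (X ∋?_) of λ where
    (no e) → (λ _ → 0) , col (λ p → ⊥-elim (e (_ , p))) (λ p → ⊥-elim (e (_ , p)))
    (yes (v , Xv)) → case some Xv of λ (u , ou) → case pick1 {L u} (ℕₚ.≤-trans (s≤s z≤n) (Reg-3≤ {L = L} (reg (out∈ ou)))) of λ (c , c∈) →
      case IH {X} {L} {u} {u} {c} {c} lt (ou , ou , inj₁ (refl , refl)) c∈ c∈ (λ Xw _ _ → reg Xw) of λ (ψ , C , _) → ψ , C

  -- The short neighbours of `p` other than `q` decide. If there is none, delete `p`. Otherwise take
  -- such a `v`. If at most one neighbour of `v` besides `p` is short or equal to `q`, delete `v`
  -- and keep two colours for it. If there are two, one of these three neighbours separates together
  -- with `v`, and the parts are coloured in turn.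
  extend-suc : ∀ k → Extendable k → Extendable (suc k)
  extend-suc k IH {X} {L} {p} {q} {cp} {cq} lt pre@(op , oq , adj) cp∈ cq∈ reg
    with any? (λ v → (X ∋? v) ×-dec (p ~? v) ×-dec ¬? (v ≟ q) ×-dec ¬? (5 ≤? length (L v)))
  ... | no none = case adj of λ where
        (inj₁ (refl , refl)) → let (ψ , C) = free k IH small (λ Xu → reg' Xu (-ne Xu)) in
          upd ψ p cp , ext C (λ { pu refl → ⊥-elim (~-irr pu refl) }) , upd-eq ψ p cp , upd-eq ψ p cp
        (inj₂ (pq , c≢)) → let (ψ , C , e , _) = IH {X - p} {L'} {q} {q} {cq} {cq} small
                                 (oq' pq , oq' pq , inj₁ (refl , refl)) q∈ q∈ (λ Xu ne _ → reg' Xu ne) in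
          upd ψ p cp , ext C (λ { _ refl r → c≢ (trans (sym r) e) }) , upd-eq ψ p cp , trans (upd-ne ψ λ e → ~-irr pq (sym e)) e
    where
    small : sz (X - p) < k
    small = ℕₚ.≤-trans (sz-strict {X = X - p} {X} {p} -out (out∈ op) λ r → -ne r refl) (ℕₚ.≤-pred lt)
    D : VSet n
    D = ⟦ (λ u → (p ~? u) ×-dec ¬? (u ≟ q)) ⟧
    L' = drop D cp cp L
    q∉ : ¬ D ∋ q
    q∉ h = proj₂ (⟦⟧out {P? = λ u → (p ~? u) ×-dec ¬? (u ≟ q)} h) refl
    q∈ : cq ∈ L' q
    q∈ = subst (cq ∈_) (sym (drop-off {D} {L = L} q∉)) cq∈
    oq' : p ~ q → Out (X - p) q
    oq' pq = expose op pq (out∈ oq)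
    reg' : ∀ {u} → (X - p) ∋ u → u ≢ q → Reg (X - p) L' u
    reg' {u} Xu ne = case p ~? u of λ where
      (yes pu) → drop-Reg-on {L = L} (⟦⟧in (pu , ne)) (proj₁ (reg (-out Xu) (-ne Xu) ne))
                   (decidable-stable (5 ≤? _) λ h → none (u , -out Xu , pu , ne , h)) (expose op pu (-out Xu))
      (no npu) → drop-Reg-off {L = L} (λ h → npu (proj₁ (⟦⟧out {P? = λ u → (p ~? u) ×-dec ¬? (u ≟ q)} h))) (Reg-mono {L = L} -out Xu (reg (-out Xu) (-ne Xu) ne))
    ext : ∀ {ψ} → Col (X - p) (∈L L') ψ → (∀ {u} → p ~ u → u ≡ q → ψ u ≢ cp) → Col X (∈L L) (upd ψ p cp)
    ext C hq = extend {P = ∈L L} {∈L L'} C (λ _ → drop-⊆ {D} {L = L}) cp∈ λ {u} Xu pu → case u ≟ q of λ where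
      (yes e) → hq pu e
      (no ne) → proj₁ (drop-≢ {D} {L = L} (⟦⟧in (pu , ne)) (C .lst Xu))
  ... | yes (v , Xv , pv , vq , v5) = case any? cond? of λ where
        -- There is no exceptional neighbour: `p` serves as default, since the two reserved colours
        -- avoid `cp` anyway.
        (no none) → simple p λ h → ⊥-elim (none (_ , h))
        (yes (r , cr)) → case any? (λ s → cond? s ×-dec ¬? (s ≟ r)) of λ where
          (no none) → simple r λ {u} h → decidable-stable (u ≟ r) λ ne → none (u , h , ne)
          (yes (s , cs , s≢r)) → case middle ov op (out cr) (out cs) (~-sym pv) (proj₁ (proj₂ cr)) (proj₁ (proj₂ cs))
                (λ e → proj₁ (proj₂ (proj₂ cr)) (sym e)) (λ e → proj₁ (proj₂ (proj₂ cs)) (sym e)) (λ e → s≢r (sym e)) of λ where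
            (inj₁ h) → sepa (~-sym pv) op (inn cr (proj₁ (proj₂ (proj₂ cr)))) (inn cs (proj₁ (proj₂ (proj₂ cs)))) h
            (inj₂ (inj₁ h)) → sepa (proj₁ (proj₂ cr)) (out cr) (-in (-in (out∈ op) (~-irr pv)) λ e → proj₁ (proj₂ (proj₂ cr)) (sym e)) (inn cs s≢r) h
            (inj₂ (inj₂ h)) → sepa (proj₁ (proj₂ cs)) (out cs) (-in (-in (out∈ op) (~-irr pv)) λ e → proj₁ (proj₂ (proj₂ cs)) (sym e)) (inn cr λ e → s≢r (sym e)) h
    where
    v≢p : v ≢ p
    v≢p e = ~-irr pv (sym e)
    rv = reg Xv v≢p vq
    ov : Out X v
    ov = Reg-Out {L = L} rv v5
    Cond : Fin n → Set
    Cond r = X ∋ r × v ~ r × r ≢ p × (r ≡ q ⊎ ¬ 5 ≤ length (L r))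
    cond? : ∀ r → Dec (Cond r)
    cond? r = (X ∋? r) ×-dec (v ~? r) ×-dec ¬? (r ≟ p) ×-dec ((r ≟ q) ⊎-dec ¬? (5 ≤? length (L r)))
    out : ∀ {r} → Cond r → Out X r
    out {r} (Xr , vr , rp , c) = case r ≟ q of λ where
      (yes refl) → oq
      (no ne) → case c of λ where
        (inj₁ e) → ⊥-elim (ne e)
        (inj₂ h) → Reg-Out {L = L} (reg Xr rp ne) h
    inn : ∀ {r m} → Cond r → r ≢ m → (X - v - m) ∋ r
    inn (Xr , vr , _) ne = -in (-in Xr λ e → ~-irr vr (sym e)) ne
    small : ∀ {Y w} → Y ⊂ X → X ∋ w → ¬ Y ∋ w → sz Y < k
    small {Y} {w} h a b = ℕₚ.≤-trans (sz-strict {X = Y} {X} {w} h a b) (ℕₚ.≤-pred lt)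
    simple : ∀ r₀ → (∀ {u} → Cond u → u ≡ r₀) → Extends X L p q cp cq
    simple r₀ only = case pick2 (⊖uniq {L v} {cp} (proj₁ rv)) (⊖len {L v} (proj₁ rv) (Reg-3≤ {L = L} rv)) of λ where
        (a , b , a∈ , b∈ , a≢b) → go a b a∈ b∈ a≢b
      where
      D? : ∀ u → Dec (v ~ u × u ≢ p × u ≢ q × u ≢ r₀)
      D? u = (v ~? u) ×-dec ¬? (u ≟ p) ×-dec ¬? (u ≟ q) ×-dec ¬? (u ≟ r₀)
      D = ⟦ D? ⟧
      out' : ∀ {u} → D ∋ u → v ~ u × u ≢ p × u ≢ q × u ≢ r₀
      out' = ⟦⟧out {P? = D?}
      module _ (a b : ℕ) (a∈ : a ∈ L v ⊖ cp) (b∈ : b ∈ L v ⊖ cp) (a≢b : a ≢ b) where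
        L' = drop D a b L
        reg' : ∀ {u} → (X - v) ∋ u → u ≢ p → u ≢ q → Reg (X - v) L' u
        reg' {u} Xu up uq = case D? u of λ where
          (yes d) → drop-Reg-on {L = L} (⟦⟧in d) (proj₁ (reg (-out Xu) up uq))
            (decidable-stable (5 ≤? _) λ h → proj₂ (proj₂ (proj₂ d)) (only (-out Xu , proj₁ d , up , inj₂ h))) (expose ov (proj₁ d) (-out Xu))
          (no nd) → drop-Reg-off {L = L} (λ h → nd (out' h)) (Reg-mono {L = L} -out Xu (reg (-out Xu) up uq))
        choose : ∀ x → ∃[ c ] (c ∈ L v ⊖ cp × c ≢ x × (c ≡ a ⊎ c ≡ b))
        choose x = case x ℕ.≟ a of λ where
          (yes refl) → b , b∈ , (λ e → a≢b (sym e)) , inj₂ refl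
          (no ne) → a , a∈ , (λ e → ne (sym e)) , inj₁ refl
        finish : Extends (X - v) L' p q cp cq → Extends X L p q cp cq
        finish (ψ , C , ep , eq) = case choose (ψ r₀) of λ (c , c∈ , c≢ , ab) →
          upd ψ v c , extend {P = ∈L L} {∈L L'} C (λ _ → drop-⊆ {D} {L = L}) (⊖out c∈) (λ {u} Xu vu → case D? u of λ where
              (yes d) → case ab of λ where
                (inj₁ refl) → proj₁ (drop-≢ {D} {L = L} (⟦⟧in d) (C .lst Xu))
                (inj₂ refl) → proj₂ (drop-≢ {D} {L = L} (⟦⟧in d) (C .lst Xu))
              (no nd) → λ e → case u ≟ p of λ where
                (yes refl) → ⊖ne {L v} c∈ (trans (sym e) ep)
                (no up) → case u ≟ r₀ of λ where
                  (yes refl) → c≢ (sym e)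
                  (no ur) → case u ≟ q of λ where
                    (yes uq) → ur (only (-out Xu , vu , up , inj₁ uq))
                    (no uq) → nd (vu , up , uq , ur))
            , trans (upd-ne ψ λ e → v≢p (sym e)) ep , trans (upd-ne ψ λ e → vq (sym e)) eq
        Xp = -in (out∈ op) λ e → v≢p (sym e)
        Xq = -in (out∈ oq) λ e → vq (sym e)
        go : Extends X L p q cp cq
        go = finish (IH {X - v} {L'} (small -out Xv λ h → -ne h refl) (mono -out Xp op , mono -out Xq oq , adj)
          (subst (cp ∈_) (sym (drop-off {D} {L = L} λ h → proj₁ (proj₂ (out' h)) refl)) cp∈)
          (subst (cq ∈_) (sym (drop-off {D} {L = L} λ h → proj₁ (proj₂ (proj₂ (out' h))) refl)) cq∈) reg')
    -- The vertex `ρ` below marks the side of the precoloured vertices: `p`, or `q` if `p` lies in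
    -- the cut. A component without `ρ` contains neither of them and is coloured last, with `v` and
    -- `m` precoloured.
    sepa : ∀ {m y y'} → v ~ m → Out X m → (X - v - m) ∋ y → (X - v - m) ∋ y' → ¬ Walk (X - v - m) y y' → Extends X L p q cp cq
    sepa {m} {y} {y'} vm om Sy Sy' nw = case p ≟ m of λ where
        (yes pm) → pick q (inj₂ pm) (inj₁ refl)
        (no npm) → pick p (inj₁ refl) (case q ≟ m of λ where
          (yes qm) → inj₂ (inj₁ qm)
          (no nqm) → case adj of λ where
            (inj₁ (refl , _)) → inj₁ refl
            (inj₂ (pq , _)) → inj₂ (inj₂ ([ Sp npm ] ▸ (pq , -in (-in (out∈ oq) λ e → vq (sym e)) nqm))))
      where
      S = X - v - m
      Sp : p ≢ m → S ∋ p
      Sp npm = -in (-in (out∈ op) λ e → v≢p (sym e)) npm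
      module _ (ρ y y' : Fin n) (Sy : S ∋ y) (Sy' : S ∋ y') (nρ : ¬ Walk S ρ y) (nw : ¬ Walk S y y')
        (p∉ : ¬ comp S y ∋ p) (q∉ : ¬ comp S y ∋ q) where
        Y = comp S y
        YX : Y ⊂ X
        YX h = -out (-out (Wend (comp-out h)))
        bd : ∀ {u w} → Y ∋ u → X ∋ w → ¬ Y ∋ w → u ~ w → w ≡ v ⊎ w ≡ m
        bd {u} {w} a b c e = case ((w ≟ v) ,′ (w ≟ m)) of λ where
          (yes q , _) → inj₁ q
          (_ , yes q) → inj₂ q
          (no q , no r) → ⊥-elim (c (comp-edge {S} a (-in (-in b q) r) e))
        v∉ : ¬ Y ∋ v
        v∉ h = -ne (-out (Wend (comp-out h))) refl
        m∉ : ¬ Y ∋ m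
        m∉ h = -ne (Wend (comp-out h)) refl
        Z = Y ⊹ v ⊹ m
        ZX : Z ⊂ X
        ZX {u} h = case ((u ≟ m) ,′ (u ≟ v)) of λ where
          (yes refl , _) → out∈ om
          (_ , yes refl) → Xv
          (no a , no b) → YX (⊹out (⊹out {X = Y ⊹ v} h a) b)
        y'∉Z : ¬ Z ∋ y'
        y'∉Z h = nw (comp-out (⊹out (⊹out {X = Y ⊹ v} h (-ne Sy')) (-ne (-out Sy'))))
        outside : Extends X L p q cp cq
        outside = join (IH {X ∖ Y} {L} (small ∖out (-out (-out Sy)) λ h → ∖no h (comp-in [ Sy ]))
            (mono ∖out (∖in (out∈ op) p∉) op , mono ∖out (∖in (out∈ oq) q∉) oq , adj) cp∈ cq∈
            λ Xu a b → Reg-mono {L = L} ∖out Xu (reg (∖out Xu) a b))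
          where
          join₂ : ∀ {ψ₁} → Col (X ∖ Y) (∈L L) ψ₁ → ψ₁ p ≡ cp → ψ₁ q ≡ cq → Extends Z L v m (ψ₁ v) (ψ₁ m) → Extends X L p q cp cq
          join₂ {ψ₁} C₁ ep eq (ψ₂ , C₂ , ev , em) = glued Y ψ₁ ψ₂ , across {P = ∈L L} {∈L L} Y YX bd C₁ C₂ (λ _ h → h) ev em , trans (glued-off {Y} {ψ₁} p∉) ep , trans (glued-off {Y} {ψ₁} q∉) eq
          join : Extends (X ∖ Y) L p q cp cq → Extends X L p q cp cq
          join (ψ₁ , C₁ , ep , eq) = join₂ C₁ ep eq (IH {Z} {L} (small ZX (-out (-out Sy')) y'∉Z)
            (mono ZX (⊹in (⊹new {X = Y})) ov , mono ZX (⊹new {X = Y ⊹ v}) om , inj₂ (vm , C₁ .prp (∖in Xv v∉) (∖in (out∈ om) m∉) vm))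
            (C₁ .lst (∖in Xv v∉)) (C₁ .lst (∖in (out∈ om) m∉))
            λ {u} Zu a b → Reg-mono {L = L} ZX Zu (regZ (⊹out (⊹out {X = Y ⊹ v} Zu b) a)))
            where
            regZ : ∀ {u} → Y ∋ u → Reg X L u
            regZ h = reg (YX h) (λ { refl → p∉ h }) (λ { refl → q∉ h })
      pick : ∀ ρ → ρ ≡ p ⊎ p ≡ m → ρ ≡ q ⊎ q ≡ m ⊎ Walk S ρ q → Extends X L p q cp cq
      pick ρ hp hq = case walk? S ρ y of λ where
          (yes w) → outside ρ y' y Sy' Sy (λ w' → nw (Wrev w ◂◂ w')) (λ w' → nw (Wrev w')) (np (λ w' → nw (Wrev w ◂◂ w'))) (nq (λ w' → nw (Wrev w ◂◂ w')))
          (no nρ) → outside ρ y y' Sy Sy' nρ nw (np nρ) (nq nρ)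
        where
        np : ∀ {y} → ¬ Walk S ρ y → ¬ comp S y ∋ p
        np nρ h = case hp of λ where
          (inj₁ refl) → nρ (Wrev (comp-out h))
          (inj₂ e) → -ne (Wend (comp-out h)) e
        nq : ∀ {y} → ¬ Walk S ρ y → ¬ comp S y ∋ q
        nq nρ h = case hq of λ where
          (inj₁ refl) → nρ (Wrev (comp-out h))
          (inj₂ (inj₁ e)) → -ne (Wend (comp-out h)) e
          (inj₂ (inj₂ w)) → nρ (w ◂◂ Wrev (comp-out h))

  extendable : ∀ k → Extendable k
  extendable zero ()
  extendable (suc k) = extend-suc k (extendable k)

  -- Thomassen's theorem on five-list-colourings
  thomassen : ∀ {X L p q cp cq} → Pre X p q cp cq → (∀ {v} → X ∋ v → v ≢ p → v ≢ q → Reg X L v)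
    → ∃[ ψ ] (Col X (Off L p q) ψ × ψ p ≡ cp × ψ q ≡ cq)
  thomassen {X} {L} {p} {q} {cp} {cq} pre@(_ , _ , adj) reg = weaken (extendable _ {L = L'} ℕₚ.≤-refl pre p∈ q∈
      λ {v} Xv vp vq → subst (λ l → Unique l × (5 ≤ length l ⊎ (3 ≤ length l × Out X v))) (sym (L'-off vp vq)) (reg Xv vp vq))
    where
    L' : Lists
    L' = upd (upd L q (cq ∷ [])) p (cp ∷ [])
    L'-off : ∀ {v} → v ≢ p → v ≢ q → L' v ≡ L v
    L'-off a b = trans (upd-ne (upd L q (cq ∷ [])) a) (upd-ne L b)
    p∈ : cp ∈ L' p
    p∈ = subst (cp ∈_) (sym (upd-eq (upd L q (cq ∷ [])) p (cp ∷ []))) (here refl)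
    q∈ : cq ∈ L' q
    q∈ = case q ≟ p of λ where
      (no ne) → subst (cq ∈_) (sym (trans (upd-ne (upd L q (cq ∷ [])) ne) (upd-eq L q (cq ∷ [])))) (here refl)
      (yes refl) → case adj of λ where
        (inj₁ (_ , refl)) → p∈
        (inj₂ (e , _)) → ⊥-elim (~-irr e refl)
    weaken : Extends X L' p q cp cq → ∃[ ψ ] (Col X (Off L p q) ψ × ψ p ≡ cp × ψ q ≡ cq)
    weaken (ψ , C , a , b) = ψ , Col-lists {P = ∈L L'} {Off L p q} (λ {v} _ h vp vq → subst (ψ v ∈_) (L'-off vp vq) h) C , a , b

  -- The edge `uw` is the precoloured edge of Thomassen's theorem for the part `Y` behind it.
  refill : ∀ {X P L u w Y ψ₁} → Out X u → Out X w → u ~ w → Y ⊂ X → ¬ Y ∋ u → ¬ Y ∋ w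
    → (∀ {x y} → Y ∋ x → X ∋ y → ¬ Y ∋ y → x ~ y → y ≡ u ⊎ y ≡ w)
    → (∀ {v} → Y ∋ v → Reg X L v × (∀ {x} → x ∈ L v → P v x))
    → Col (X ∖ Y) P ψ₁ → ∃[ ψ ] (Col X P ψ × (∀ {v} → ¬ Y ∋ v → ψ v ≡ ψ₁ v))
  refill {X} {P} {L} {u} {w} {Y} {ψ₁} ou ow uw YX Yu Yw bd reg C₁ = go (thomassen {Z} {L} {u} {w} {ψ₁ u} {ψ₁ w}
      (mono ZX (⊹in (⊹new {X = Y})) ou , mono ZX (⊹new {X = Y ⊹ u}) ow , inj₂ (uw , C₁ .prp (∖in (out∈ ou) Yu) (∖in (out∈ ow) Yw) uw))
      λ Zv a b → let Yv = ⊹out (⊹out {X = Y ⊹ u} Zv b) a in Reg-mono {L = L} ZX Zv (proj₁ (reg Yv)))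
    where
    Z = Y ⊹ u ⊹ w
    ZX : Z ⊂ X
    ZX {v} h = case (v ≟ w) ,′ (v ≟ u) of λ where
      (yes refl , _) → out∈ ow
      (_ , yes refl) → out∈ ou
      (no a , no b) → YX (⊹out (⊹out {X = Y ⊹ u} h a) b)
    go : ∃[ ψ ] (Col Z (Off L u w) ψ × ψ u ≡ ψ₁ u × ψ w ≡ ψ₁ w) → ∃[ ψ ] (Col X P ψ × (∀ {v} → ¬ Y ∋ v → ψ v ≡ ψ₁ v))
    go (ψ₂ , C₂ , eu , ew) = glued Y ψ₁ ψ₂ , across {P = P} {Off L u w} Y YX bd C₁ C₂
      (λ Yv h → proj₂ (reg Yv) (h (λ { refl → Yu Yv }) (λ { refl → Yw Yv }))) eu ew , glued-off {Y} {ψ₁} {ψ₂}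

  -- Delete z₁ and z₂ together with their colours from the lists of their neighbours.
  refill₄ : ∀ {X P L z₁ z₂ z₃ z₄ Y ψ₁} → Out X z₁ → z₂ ≡ z₁ ⊎ Out (X - z₁) z₂ → Out (X - z₁) z₃ → Out (X - z₁) z₄ → z₃ ~ z₄
    → z₂ ≢ z₃ → z₂ ≢ z₄ → Y ⊂ X → ¬ Y ∋ z₁ → ¬ Y ∋ z₂ → ¬ Y ∋ z₃ → ¬ Y ∋ z₄
    → (∀ {x y} → Y ∋ x → X ∋ y → ¬ Y ∋ y → x ~ y → y ≡ z₁ ⊎ y ≡ z₂ ⊎ y ≡ z₃ ⊎ y ≡ z₄)
    → (∀ {v} → Y ∋ v → Unique (L v) × 5 ≤ length (L v) × (∀ {x} → x ∈ L v → P v x))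
    → Col (X ∖ Y) P ψ₁ → ∃[ ψ ] (Col X P ψ × (∀ {v} → ¬ Y ∋ v → ψ v ≡ ψ₁ v))
  refill₄ {X} {P} {L} {z₁} {z₂} {z₃} {z₄} {Y} {ψ₁} o₁ o₂ o₃ o₄ e₃₄ n₂₃ n₂₄ YX Y₁ Y₂ Y₃ Y₄ bd reg C₁ =
    go (thomassen {Z} {L'} {z₃} {z₄} {ψ₁ z₃} {ψ₁ z₄}
      (mono ZX (⊹in (⊹new {X = Y})) o₃ , mono ZX (⊹new {X = Y ⊹ z₃}) o₄ , inj₂ (e₃₄ , C₁ .prp (∖in (-out (out∈ o₃)) Y₃) (∖in (-out (out∈ o₄)) Y₄) e₃₄))
      λ Zv a b → reg' (⊹out (⊹out {X = Y ⊹ z₃} Zv b) a))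
    where
    Z = Y ⊹ z₃ ⊹ z₄
    ZX : Z ⊂ X - z₁
    ZX {v} h = case (v ≟ z₄) ,′ (v ≟ z₃) of λ where
      (yes refl , _) → out∈ o₄
      (_ , yes refl) → out∈ o₃
      (no a , no b) → let Yv = ⊹out (⊹out {X = Y ⊹ z₃} h a) b in -in (YX Yv) λ { refl → Y₁ Yv }
    D? : ∀ v → Dec (Y ∋ v × (z₁ ~ v ⊎ z₂ ~ v))
    D? v = (Y ∋? v) ×-dec ((z₁ ~? v) ⊎-dec (z₂ ~? v))
    L' = drop ⟦ D? ⟧ (ψ₁ z₁) (ψ₁ z₂) L
    reg' : ∀ {v} → Y ∋ v → Reg Z L' v
    reg' {v} Yv = case (z₁ ~? v) ⊎-dec (z₂ ~? v) of λ where
        (yes e) → drop-Reg-on {L = L} (⟦⟧in (Yv , e)) (proj₁ (reg Yv)) (proj₁ (proj₂ (reg Yv))) (exposed e)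
        (no ne) → drop-Reg-off {L = L} (λ h → ne (proj₂ (⟦⟧out {P? = D?} h))) (proj₁ (reg Yv) , inj₁ (proj₁ (proj₂ (reg Yv))))
      where
      Zv : Z ∋ v
      Zv = ⊹in (⊹in Yv)
      exposed : z₁ ~ v ⊎ z₂ ~ v → Out Z v
      exposed (inj₁ e) = mono ZX Zv (expose o₁ e (YX Yv))
      exposed (inj₂ e) = case o₂ of λ where
          (inj₁ refl) → exposed (inj₁ e)
          (inj₂ o) → mono {X = Z} (λ {x} Zx → -in (ZX Zx) λ { refl → out₂ Zx }) Zv (expose o e (ZX Zv))
        where
        out₂ : ¬ Z ∋ z₂
        out₂ h = Y₂ (⊹out (⊹out {X = Y ⊹ z₃} h n₂₄) n₂₃)
    go : ∃[ ψ ] (Col Z (Off L' z₃ z₄) ψ × ψ z₃ ≡ ψ₁ z₃ × ψ z₄ ≡ ψ₁ z₄) → ∃[ ψ ] (Col X P ψ × (∀ {v} → ¬ Y ∋ v → ψ v ≡ ψ₁ v))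
    go (ψ₂ , C₂ , h₃ , h₄) = glued Y ψ₁ ψ₂ , glue C₁ (Col-lists (λ Yv h → proj₂ (proj₂ (reg Yv)) (drop-⊆ {⟦ D? ⟧} {L = L} (lists Yv h))) (Col-mono (λ p → ⊹in (⊹in p)) C₂)) clash , glued-off {Y} {ψ₁} {ψ₂}
      where
      lists : ∀ {v x} → Y ∋ v → Off L' z₃ z₄ v x → x ∈ L' v
      lists Yv h = h (λ { refl → Y₃ Yv }) (λ { refl → Y₄ Yv })
      clash : ∀ {u w} → Y ∋ u → X ∋ w → ¬ Y ∋ w → u ~ w → ψ₂ u ≢ ψ₁ w
      clash {u} Yu Xw Yw e q = case bd Yu Xw Yw e of λ where
        (inj₁ refl) → proj₁ (drop-≢ {⟦ D? ⟧} {L = L} (⟦⟧in (Yu , inj₁ (~-sym e))) (lists Yu (C₂ .lst (⊹in (⊹in Yu))))) q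
        (inj₂ (inj₁ refl)) → proj₂ (drop-≢ {⟦ D? ⟧} {L = L} (⟦⟧in (Yu , inj₂ (~-sym e))) (lists Yu (C₂ .lst (⊹in (⊹in Yu))))) q
        (inj₂ (inj₂ (inj₁ refl))) → C₂ .prp (⊹in (⊹in Yu)) (⊹in (⊹new {X = Y})) e (trans q (sym h₃))
        (inj₂ (inj₂ (inj₂ refl))) → C₂ .prp (⊹in (⊹in Yu)) (⊹new {X = Y ⊹ z₃}) e (trans q (sym h₄))

  -- States at an edge and moves between them

  Ext : VSet n → Lists → Fin n → Fin n → Rel → Fin n → Fin n → Rel
  Ext X L p₁ p₂ C q₁ q₂ x y = ∃[ ψ ] (Col X (Off L p₁ p₂) ψ × C (ψ p₁) (ψ p₂) × ψ q₁ ≡ x × ψ q₂ ≡ y)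

  -- star p x c W: p has colour c and x a colour in W;  dem u w a b: u and w have the colours a and b in some order.
  data State : Set where
    star : Fin n → Fin n → ℕ → List ℕ → State
    dem : Fin n → Fin n → ℕ → ℕ → State

  src dst : State → Fin n
  src (star p x c W) = p
  src (dem u w a b) = u
  dst (star p x c W) = x
  dst (dem u w a b) = w

  ⟪_⟫ : State → Rel
  ⟪ star p x c W ⟫ k l = k ≡ c × l ∈ W
  ⟪ dem u w a b ⟫ k l = (k ≡ a × l ≡ b) ⊎ (k ≡ b × l ≡ a)

  Valid : State → Set
  Valid (star p x c W) = Unique W × 2 ≤ length W × ¬ c ∈ W
  Valid (dem u w a b) = a ≢ b

  End : State → Fin n → Fin n → Rel → Set
  End s q₁ q₂ F = (src s ≡ q₁ × dst s ≡ q₂ × (∀ {k l} → ⟪ s ⟫ k l → F k l)) ⊎ (src s ≡ q₂ × dst s ≡ q₁ × (∀ {k l} → ⟪ s ⟫ k l → F l k))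

  -- A vertex of the triangle at the dictator that is left with {a, b} once `c` is spent: the old
  -- leaf with its colours `W`, or a vertex with list {a, b, c}.
  Free : Lists → Fin n → List ℕ → Fin n → ℕ → ℕ → ℕ → Set
  Free L x W u a b c = (u ≡ x × W ≐₂ (a , b)) ⊎ (u ≢ x × L u ≐₃ (a , b , c))

  -- The last index is the set of vertices left behind. `tri` and the two `apex` moves mirror the
  -- recursive clauses of a harmonica; `turn` passes to another edge at the dictator and has no
  -- recursive clause of its own.
  data Move (L : Lists) (X : VSet n) : State → State → VSet n → Set where
    turn : ∀ {p x y c W} → p ~ y → X ∋ y → y ≢ x → p ≢ x → Move L X (star p x c W) (star p y c (L y ⊖ c)) (∅ ⊹ x)
    tri : ∀ {p x c W u₁ u₂ a b} → p ~ u₁ → p ~ u₂ → u₁ ~ u₂ → X ∋ u₁ → X ∋ u₂ → Free L x W u₁ a b c → Free L x W u₂ a b c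
      → Move L X (star p x c W) (dem u₁ u₂ a b) ((∅ ⊹ p ⊹ x) ∖ (∅ ⊹ u₁ ⊹ u₂))
    apex₁ : ∀ {u w z a b c} → z ~ u → z ~ w → X ∋ z → u ≢ w → L z ≐₃ (a , b , c) → Move L X (dem u w a b) (star z w c (a ∷ b ∷ [])) (∅ ⊹ u)
    apex₂ : ∀ {u w z a b c} → z ~ u → z ~ w → X ∋ z → u ≢ w → L z ≐₃ (a , b , c) → Move L X (dem u w a b) (star z u c (a ∷ b ∷ [])) (∅ ⊹ w)

  data Steps (L : Lists) : VSet n → State → State → Set where
    nil : ∀ {X s} → Steps L X s s
    _∷_ : ∀ {X s s₁ s' R} → Move L X s s₁ R → Steps L (X ∖ R) s₁ s' → Steps L X s s'

  On : VSet n → State → Set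
  On X s = X ∋ src s × X ∋ dst s

  pair-out : ∀ {u w v} → (∅ {n} ⊹ u ⊹ w) ∋ v → v ≡ u ⊎ v ≡ w
  pair-out {u} {w} {v} h = case (v ≟ u) ,′ (v ≟ w) of λ where
    (yes p , _) → inj₁ p
    (_ , yes q) → inj₂ q
    (no p , no q) → ⊥-elim (∅-no (⊹out {X = ∅} (⊹out {X = ∅ ⊹ u} h q) p))

  sing-out : ∀ {u v} → (∅ {n} ⊹ u) ∋ v → v ≡ u
  sing-out {u} {v} h = decidable-stable (v ≟ u) λ ne → ∅-no (⊹out {X = ∅} h ne)

  move-removed : ∀ {L X s s₁ R v} → Move L X s s₁ R → R ∋ v → v ≡ src s ⊎ v ≡ dst s
  move-removed (turn _ _ _ _) h = inj₂ (sing-out h)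
  move-removed (tri _ _ _ _ _ _ _) h = pair-out (∖out h)
  move-removed (apex₁ _ _ _ _ _) h = inj₁ (sing-out h)
  move-removed (apex₂ _ _ _ _ _) h = inj₂ (sing-out h)

  move-on : ∀ {L X s s₁ R} → Move L X s s₁ R → On X s → On (X ∖ R) s₁
  move-on (turn py Xy yx px) (a , b) = ∖in a (λ h → px (sing-out h)) , ∖in Xy (λ h → yx (sing-out h))
  move-on (tri {u₁ = u₁} _ _ _ x₁ x₂ _ _) _ = ∖in x₁ (λ h → ∖no h (⊹in (⊹new {X = ∅}))) , ∖in x₂ (λ h → ∖no h (⊹new {X = ∅ ⊹ u₁}))
  move-on (apex₁ zu zw Xz uw _) (a , b) = ∖in Xz (λ h → ~-irr zu (sing-out h)) , ∖in b (λ h → uw (sym (sing-out h)))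
  move-on (apex₂ zu zw Xz uw _) (a , b) = ∖in Xz (λ h → ~-irr zw (sing-out h)) , ∖in a (λ h → uw (sing-out h))

  move-mono : ∀ {L X Y s s₁ R} → X ⊂ Y → Move L X s s₁ R → Move L Y s s₁ R
  move-mono h (turn a b c d) = turn a (h b) c d
  move-mono h (tri a b c d e f g) = tri a b c (h d) (h e) f g
  move-mono h (apex₁ a b c d e) = apex₁ a b (h c) d e
  move-mono h (apex₂ a b c d e) = apex₂ a b (h c) d e

  ∖-mono : ∀ {X Y R : VSet n} → X ⊂ Y → (X ∖ R) ⊂ (Y ∖ R)
  ∖-mono h p = ∖in (h (∖out p)) (∖no p)

  steps-mono : ∀ {L X Y s s'} → X ⊂ Y → Steps L X s s' → Steps L Y s s'
  steps-mono h nil = nil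
  steps-mono h (m ∷ r) = move-mono h m ∷ steps-mono (∖-mono h) r

  steps-on : ∀ {L X s s'} → Steps L X s s' → On X s → On X s'
  steps-on nil o = o
  steps-on (m ∷ r) o = let (a , b) = steps-on r (move-on m o) in ∖out a , ∖out b

  -- The first part must not delete what the second needs. They share only the ends of the middle
  -- edge, and these survive the first part.
  steps-++ : ∀ {L X X₁ X₂ s s₁ s'} → X₁ ⊂ X → X₂ ⊂ X → (∀ {v} → X₁ ∋ v → X₂ ∋ v → v ≡ src s₁ ⊎ v ≡ dst s₁)
    → On X₁ s → Steps L X₁ s s₁ → Steps L X₂ s₁ s' → Steps L X s s'
  steps-++ h₁ h₂ meet o nil r₂ = steps-mono h₂ r₂
  steps-++ {X₂ = X₂} {s} {s₁} h₁ h₂ meet o (_∷_ {R = R} m r) r₂ = move-mono h₁ m ∷ steps-++ (∖-mono h₁) (λ p → ∖in (h₂ p) λ q → clash q p) (λ p q → meet (∖out p) q) (move-on m o) r r₂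
    where
    e = steps-on r (move-on m o)
    clash : ∀ {v} → R ∋ v → X₂ ∋ v → ⊥
    clash {v} p q = case meet (removed p) q of λ where
        (inj₁ refl) → ∖no (proj₁ e) p
        (inj₂ refl) → ∖no (proj₂ e) p
      where
      removed : R ∋ v → _ ∋ v
      removed p = case move-removed m p of λ where
        (inj₁ refl) → proj₁ o
        (inj₂ refl) → proj₂ o

  record Can (X : VSet n) (L : Lists) (p₁ p₂ q₁ q₂ : Fin n) : Set where
    field
      out₁ : Out X p₁
      out₂ : Out X p₂
      p-adj : p₁ ~ p₂
      outq₁ : Out X q₁
      outq₂ : Out X q₂
      q-adj : q₁ ~ q₂
      reg : ∀ {v} → X ∋ v → v ≢ p₁ → v ≢ p₂ → Reg X L v
  open Can public

  Res : VSet n → Lists → State → Fin n → Fin n → Set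
  Res X L s q₁ q₂ = Conf (Ext X L (src s) (dst s) ⟪ s ⟫ q₁ q₂)
    ⊎ ∃[ s' ] (End s' q₁ q₂ (Ext X L (src s) (dst s) ⟪ s ⟫ q₁ q₂) × Valid s' × Steps L X s s')

  record IH (k : ℕ) : Set₁ where
    field
      gov : ∀ {X L q₁ q₂} s → sz X < k → Can X L (src s) (dst s) q₁ q₂ → Valid s → Res X L s q₁ q₂
      con : ∀ {X L p₁ p₂ q₁ q₂} {C : Rel} → sz X < k → Can X L p₁ p₂ q₁ q₂ → (∀ {x y} → C x y → x ≢ y) → Conf C
        → Conf (Ext X L p₁ p₂ C q₁ q₂)
  open IH public

  -- Turns about p need not be recorded: after a turn to y the list of y without c plays the role of W.
  starNorm : ∀ {L X p x c W s'} → Steps L X (star p x c W) s' → (∀ {y} → X ∋ y → y ≢ p → y ≢ x → Unique (L y) × 3 ≤ length (L y))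
    → src s' ≡ p ⊎ ∃[ u₁ ] ∃[ u₂ ] ∃[ a ] ∃[ b ] (p ~ u₁ × p ~ u₂ × u₁ ~ u₂ × X ∋ u₁ × X ∋ u₂ × Free L x W u₁ a b c × Free L x W u₂ a b c
        × Steps L (X ∖ ((∅ ⊹ p ⊹ x) ∖ (∅ ⊹ u₁ ⊹ u₂))) (dem u₁ u₂ a b) s')
  starNorm nil h = inj₁ refl
  starNorm (tri {u₁ = u₁} {u₂} {a} {b} e₁ e₂ e₁₂ x₁ x₂ f₁ f₂ ∷ r) h = inj₂ (u₁ , u₂ , a , b , e₁ , e₂ , e₁₂ , x₁ , x₂ , f₁ , f₂ , r)
  starNorm {L} {X} {p} {x} {c} (turn {y = y} py Xy yx px ∷ r) h = case starNorm r (λ Xv vp vy → h (∖out Xv) vp λ { refl → ∖no Xv (⊹new {X = ∅}) }) of λ where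
      (inj₁ e) → inj₁ e
      (inj₂ (u₁ , u₂ , a , b , e₁ , e₂ , e₁₂ , x₁ , x₂ , f₁ , f₂ , r')) → inj₂ (u₁ , u₂ , a , b , e₁ , e₂ , e₁₂ , ∖out x₁ , ∖out x₂ , free' x₁ f₁ , free' x₂ f₂ , steps-mono (sub u₁ u₂ e₁ e₂) r')
    where
    free' : ∀ {u a b} → (X ∖ (∅ ⊹ x)) ∋ u → Free L y (L y ⊖ c) u a b c → Free L x _ u a b c
    free' {u} {a} {b} Xu (inj₁ (refl , a∈ , b∈ , ab , all)) = inj₂ (yx , (⊖out a∈ , ⊖out b∈ , c∈) , (ab , ⊖ne {L u} a∈ , ⊖ne {L u} b∈) , all')
      where
      all' : ∀ z → z ∈ L u → z ≡ a ⊎ z ≡ b ⊎ z ≡ c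
      all' z z∈ = case z ℕ.≟ c of λ where
        (yes e) → inj₂ (inj₂ e)
        (no ne) → case all z (⊖in z∈ ne) of λ where
          (inj₁ e) → inj₁ e
          (inj₂ e) → inj₂ (inj₁ e)
      c∈ : c ∈ L u
      c∈ = decidable-stable (c ∈?ℕ L u) λ nc → let (un3 , le) = h Xy (λ e → ~-irr py (sym e)) yx in
        ℕₚ.<⇒≱ le (unique-⊆-length {ys = a ∷ b ∷ []} un3 λ {z} z∈ → case all z (⊖in z∈ λ { refl → nc z∈ }) of λ where
          (inj₁ refl) → here refl
          (inj₂ refl) → there (here refl))
    free' Xu (inj₂ (_ , l)) = inj₂ ((λ { refl → ∖no Xu (⊹new {X = ∅}) }) , l)
    sub : ∀ u₁ u₂ → p ~ u₁ → p ~ u₂ → ((X ∖ (∅ ⊹ x)) ∖ ((∅ ⊹ p ⊹ y) ∖ (∅ ⊹ u₁ ⊹ u₂))) ⊂ (X ∖ ((∅ ⊹ p ⊹ x) ∖ (∅ ⊹ u₁ ⊹ u₂)))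
    sub u₁ u₂ e₁ e₂ {v} q = ∖in (∖out (∖out q)) λ r → case pair-out (∖out r) of λ where
      (inj₁ refl) → ∖no q (∖in (⊹in (⊹new {X = ∅})) (∖no r))
      (inj₂ refl) → ∖no (∖out q) (⊹new {X = ∅})

  -- Callers need only the existence of an apex: a democracy that is not yet at the target edge must
  -- have one.
  demNorm : ∀ {L X u w a b s'} → Steps L X (dem u w a b) s' → s' ≡ dem u w a b
    ⊎ ∃[ z ] ∃[ c ] (z ~ u × z ~ w × X ∋ z × L z ≐₃ (a , b , c))
  demNorm nil = inj₁ refl
  demNorm (apex₁ {z = z} {c = c} zu zw Xz _ l ∷ _) = inj₂ (z , c , zu , zw , Xz , l)
  demNorm (apex₂ {z = z} {c = c} zu zw Xz _ l ∷ _) = inj₂ (z , c , zu , zw , Xz , l)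

  -- PC: no edge between vertices of B separates; IR: no vertex is cut off from B by four vertices close to B.
  record Ctx (X B : VSet n) (q₁ q₂ : Fin n) : Set where
    field
      B-out : ∀ {v} → B ∋ v → Out X v
      PC : ∀ {u w y y'} → B ∋ u → B ∋ w → u ~ w → (X - u - w) ∋ y → (X - u - w) ∋ y' → Walk (X - u - w) y y'
      IR : ∀ {z₁ z₂ z₃ z₄ y} → B ∋ z₁ → B ∋ z₂ → X ∋ z₃ → X ∋ z₄ → (B ∋ z₃ ⊎ z₁ ~ z₃) → (B ∋ z₄ ⊎ z₁ ~ z₄)
        → z₃ ~ z₄ → z₁ ≢ z₃ → z₁ ≢ z₄ → z₂ ≢ z₃ → z₂ ≢ z₄ → (X - z₁ - z₂ - z₃ - z₄) ∋ y
        → ∃[ b ] (B ∋ b × Walk (X - z₁ - z₂ - z₃ - z₄) y b)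
      Bq₁ : B ∋ q₁
      Bq₂ : B ∋ q₂
      q~ : q₁ ~ q₂

  -- Local structure at the short vertices of a reduced canvas

  module Reduced {X B : VSet n} {q₁ q₂ : Fin n} (ctx : Ctx X B q₁ q₂) where
    open Ctx ctx public

    B∈ : ∀ {v} → B ∋ v → X ∋ v
    B∈ h = out∈ (B-out h)

    -- Of three neighbours in `B` the middle one, together with `v`, would separate the other two,
    -- against `PC`.
    at-most-two : ∀ {v r s t} → B ∋ v → B ∋ r → B ∋ s → B ∋ t → v ~ r → v ~ s → v ~ t → r ≢ s → r ≢ t → s ≢ t → ⊥
    at-most-two Bv Br Bs Bt vr vs vt rs rt st = case middle (B-out Bv) (B-out Br) (B-out Bs) (B-out Bt) vr vs vt rs rt st of λ where
        (inj₁ h) → h (PC Bv Br vr (inn Bs vs λ e → rs (sym e)) (inn Bt vt λ e → rt (sym e)))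
        (inj₂ (inj₁ h)) → h (PC Bv Bs vs (inn Br vr rs) (inn Bt vt λ e → st (sym e)))
        (inj₂ (inj₂ h)) → h (PC Bv Bt vt (inn Br vr rt) (inn Bs vs st))
      where
      inn : ∀ {v y m} → B ∋ y → v ~ y → y ≢ m → (X - v - m) ∋ y
      inn By vy ne = -in (-in (B∈ By) λ e → ~-irr vy (sym e)) ne

    third : ∀ {v r s t} → B ∋ v → B ∋ r → B ∋ s → B ∋ t → v ~ r → v ~ s → v ~ t → r ≢ s → t ≡ r ⊎ t ≡ s
    third {v} {r} {s} {t} Bv Br Bs Bt vr vs vt rs = case (t ≟ r) ,′ (t ≟ s) of λ where
      (yes e , _) → inj₁ e
      (_ , yes e) → inj₂ e
      (no a , no b) → ⊥-elim (at-most-two Bv Br Bs Bt vr vs vt rs (λ e → a (sym e)) (λ e → b (sym e)))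

    module Around {v} (Bv : B ∋ v) where
      o = B-out Bv

      Btw : Fin n → Fin n → Fin n → Set
      Btw r s t = (pos o r < pos o s × pos o s < pos o t) ⊎ (pos o t < pos o s × pos o s < pos o r)

      Nb : Fin n → Set
      Nb r = X ∋ r × v ~ r

      btw : ∀ {r s t} → Nb r → Nb s → Nb t → r ≢ s → r ≢ t → s ≢ t → ¬ Btw s r t → ¬ Btw r t s → Btw r s t
      btw {r} {s} {t} (Xr , vr) (Xs , vs) (Xt , vt) rs rt st nr nt
        with ℕₚ.<-cmp (pos o r) (pos o s) | ℕₚ.<-cmp (pos o r) (pos o t) | ℕₚ.<-cmp (pos o s) (pos o t)
      ... | tri≈ _ e _ | _ | _ = ⊥-elim (rs (pos-inj o Xr Xs vr vs e))
      ... | _ | tri≈ _ e _ | _ = ⊥-elim (rt (pos-inj o Xr Xt vr vt e))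
      ... | _ | _ | tri≈ _ e _ = ⊥-elim (st (pos-inj o Xs Xt vs vt e))
      ... | tri< a _ _ | _ | tri< c _ _ = inj₁ (a , c)
      ... | tri< a _ _ | tri< b _ _ | tri> _ _ c = ⊥-elim (nt (inj₁ (b , c)))
      ... | tri< a _ _ | tri> _ _ b | tri> _ _ c = ⊥-elim (nr (inj₂ (b , a)))
      ... | tri> _ _ a | tri< b _ _ | tri< c _ _ = ⊥-elim (nr (inj₁ (a , b)))
      ... | tri> _ _ a | tri> _ _ b | tri< c _ _ = ⊥-elim (nt (inj₂ (c , b)))
      ... | tri> _ _ a | _ | tri> _ _ c = inj₂ (c , a)

      crossing : ∀ {r s t} → Nb r → Nb s → Nb t → Btw r s t → ∀ {S y} → S ⊂ X → ¬ S ∋ v → Walk S r t → Out X y → ¬ Walk ((X - v) ∖ S) s y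
      crossing (Xr , vr) (Xs , vs) (Xt , vt) (inj₁ (a , b)) h nv w oy w' = nocross o Xr Xs Xt vr vs vt a b h nv w oy w'
      crossing (Xr , vr) (Xs , vs) (Xt , vt) (inj₂ (a , b)) h nv w oy w' = nocross o Xt Xs Xr vt vs vr a b h nv (Wrev w) oy w'

      cross₁ : ∀ {r s t} → Nb r → Nb s → Nb t → Btw r s t → Out X s → ¬ Walk (X - v - s) r t
      cross₁ nr ns nt bt os w = crossing nr ns nt bt {X - v - _} (λ q → -out (-out q)) (λ q → -ne (-out q) refl) w os
        [ ∖in (-in (proj₁ ns) λ e → ~-irr (proj₂ ns) (sym e)) (λ q → -ne q refl) ]

      -- The edge `rt` closes a triangle with `v` around `s` and so cuts `s` off from all of `B`.
      cross₂ : ∀ {r s t b} → Nb r → Nb s → Nb t → Btw r s t → r ~ t → B ∋ b → ¬ Walk (X - v - r - t) s b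
      cross₂ {r} {s} {t} nr ns nt bt rt Bb w = crossing nr ns nt bt {∅ ⊹ r ⊹ t} sub nv ([ ⊹in (⊹new {X = ∅}) ] ▸ (rt , ⊹new {X = ∅ ⊹ r})) (B-out Bb)
          (Wmono (λ q → ∖in (-out (-out q)) λ r → case pair-out r of λ where
            (inj₁ e) → -ne (-out q) e
            (inj₂ e) → -ne q e) w)
        where
        sub : (∅ ⊹ r ⊹ t) ⊂ X
        sub q = case pair-out q of λ where
          (inj₁ refl) → proj₁ nr
          (inj₂ refl) → proj₁ nt
        nv : ¬ (∅ ⊹ r ⊹ t) ∋ v
        nv q = case pair-out q of λ where
          (inj₁ e) → ~-irr (proj₂ nr) e
          (inj₂ e) → ~-irr (proj₂ nt) e

      cross₃ : ∀ {r s t z b} → Nb r → Nb s → Nb t → Btw r s t → X ∋ z → z ≢ v → r ~ z → z ~ t → B ∋ b → ¬ Walk (X - v - r - z - t) s b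
      cross₃ {r} {s} {t} {z} nr ns nt bt Xz zv rz zt Bb w = crossing nr ns nt bt {∅ ⊹ r ⊹ z ⊹ t} sub nv
          ([ ⊹in (⊹in (⊹new {X = ∅})) ] ▸ (rz , ⊹in (⊹new {X = ∅ ⊹ r})) ▸ (zt , ⊹new {X = ∅ ⊹ r ⊹ z})) (B-out Bb)
          (Wmono (λ q → ∖in (-out (-out (-out q))) λ r → case three r of λ where
            (inj₁ e) → -ne (-out (-out q)) e
            (inj₂ (inj₁ e)) → -ne (-out q) e
            (inj₂ (inj₂ e)) → -ne q e) w)
        where
        three : ∀ {y} → (∅ ⊹ r ⊹ z ⊹ t) ∋ y → y ≡ r ⊎ y ≡ z ⊎ y ≡ t
        three {y} q = case y ≟ t of λ where
          (yes e) → inj₂ (inj₂ e)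
          (no ne) → case pair-out (⊹out {X = ∅ ⊹ r ⊹ z} q ne) of λ where
            (inj₁ e) → inj₁ e
            (inj₂ e) → inj₂ (inj₁ e)
        sub : (∅ ⊹ r ⊹ z ⊹ t) ⊂ X
        sub q = case three q of λ where
          (inj₁ refl) → proj₁ nr
          (inj₂ (inj₁ refl)) → Xz
          (inj₂ (inj₂ refl)) → proj₁ nt
        nv : ¬ (∅ ⊹ r ⊹ z ⊹ t) ∋ v
        nv q = case three q of λ where
          (inj₁ e) → ~-irr (proj₂ nr) e
          (inj₂ (inj₁ e)) → zv (sym e)
          (inj₂ (inj₂ e)) → ~-irr (proj₂ nt) e

    -- A neighbour between `r` and `s` would be enclosed by the triangle, whereas `IR`, with `v` for
    -- both `z₁` and `z₂`, leads it to `B`.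
    between-tri : ∀ {v r s y} (Bv : B ∋ v) → B ∋ r → X ∋ s → v ~ r → v ~ s → r ~ s → (Xy : X ∋ y) → v ~ y → y ≢ r → y ≢ s
      → ¬ Around.Btw Bv r y s
    between-tri {v} {r} {s} {y} Bv Br Xs vr vs rs Xy vy yr ys bt =
      let (b , Bb , w) = IR {v} {v} {r} {s} {y} Bv Bv (B∈ Br) Xs (inj₁ Br) (inj₂ vs) rs (~-irr vr) (~-irr vs) (~-irr vr) (~-irr vs)
                           (-in (-in (-in (-in Xy yv) yv) yr) ys)
      in cross₂ (B∈ Br , vr) (Xy , vy) (Xs , vs) bt rs Bb (Wmono (λ q → -in (-in (-in (-out (-out (-out (-out q)))) (-ne (-out (-out q)))) (-ne (-out q))) (-ne q)) w)
      where
      open Around Bv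
      yv : y ≢ v
      yv e = ~-irr vy (sym e)

    -- Triangles fill the two wedges at `v`, so a further neighbour would lie beyond `s` as seen
    -- from `r` and also as seen from `t`; but `s` lies between `r` and `t`.
    degree-3 : ∀ {v r s t} → B ∋ v → B ∋ r → X ∋ s → B ∋ t → v ~ r → v ~ s → v ~ t → r ~ s → s ~ t → r ≢ t
      → ∀ {y} → X ∋ y → v ~ y → y ≡ r ⊎ y ≡ s ⊎ y ≡ t
    degree-3 {v} {r} {s} {t} Bv Br Xs Bt vr vs vt rs st rt {y} Xy vy = case (y ≟ r) ,′ (y ≟ s) of λ where
        (yes e , _) → inj₁ e
        (_ , yes e) → inj₂ (inj₁ e)
        (no yr , no ys) → case y ≟ t of λ where
          (yes e) → inj₂ (inj₂ e)
          (no yt) → ⊥-elim (clash (side Br vr rs yr ys) (side Bt vt (~-sym st) yt ys) mid)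
      where
      open Around Bv
      ns : Nb s
      ns = Xs , vs
      ny : Nb y
      ny = Xy , vy
      offv : ∀ {u m} → Nb u → u ≢ m → (X - v - m) ∋ u
      offv (Xu , vu) ne = -in (-in Xu λ e → ~-irr vu (sym e)) ne
      side : ∀ {r} → B ∋ r → v ~ r → r ~ s → y ≢ r → y ≢ s → Btw r s y
      side {r} Br vr rs yr ys = btw (B∈ Br , vr) ns ny (~-irr rs) (λ e → yr (sym e)) (λ e → ys (sym e))
        (λ b → cross₁ ns (B∈ Br , vr) ny b (B-out Br) (PC Bv Br vr (offv ns λ e → ~-irr rs (sym e)) (offv ny yr)))
        (λ b → between-tri Bv Br Xs vr vs rs Xy vy yr ys b)
      mid : Btw r s t
      mid = btw (B∈ Br , vr) ns (B∈ Bt , vt) (~-irr rs) rt (~-irr st)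
        (λ b → cross₁ ns (B∈ Br , vr) (B∈ Bt , vt) b (B-out Br) ([ offv ns (λ e → ~-irr rs (sym e)) ] ▸ (st , offv (B∈ Bt , vt) λ e → rt (sym e))))
        (λ b → cross₁ (B∈ Br , vr) (B∈ Bt , vt) ns b (B-out Bt) ([ offv (B∈ Br , vr) rt ] ▸ (rs , offv ns (~-irr st))))
      clash : ∀ {r t} → Btw r s y → Btw t s y → Btw r s t → ⊥
      clash (inj₁ (a , b)) (inj₁ (c , d)) (inj₁ (e , f)) = ℕₚ.<-asym c f
      clash (inj₁ (a , b)) (inj₁ (c , d)) (inj₂ (e , f)) = ℕₚ.<-asym a f
      clash (inj₁ (a , b)) (inj₂ (c , d)) _ = ℕₚ.<-asym b c
      clash (inj₂ (a , b)) (inj₁ (c , d)) _ = ℕₚ.<-asym a d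
      clash (inj₂ (a , b)) (inj₂ (c , d)) (inj₁ (e , f)) = ℕₚ.<-asym b e
      clash (inj₂ (a , b)) (inj₂ (c , d)) (inj₂ (e , f)) = ℕₚ.<-asym d e

  -- Steering the colour of a single vertex

  with-lists : ∀ {X L v l} → Unique l → 3 ≤ length l → Out X v → ∀ {u} → (u ≢ v → Reg X L u) → Reg X (upd L v l) u
  with-lists {X} {L} {v} {l} un le o {u} h = case u ≟ v of λ where
    (yes refl) → subst (λ m → Unique m × (5 ≤ length m ⊎ (3 ≤ length m × Out X u))) (sym (upd-eq L u l)) (un , inj₂ (le , o))
    (no ne) → subst (λ m → Unique m × (5 ≤ length m ⊎ (3 ≤ length m × Out X u))) (sym (upd-ne L ne)) (h ne)

  -- Three colours of free choice can be prescribed for `v`, even outside its list; an adjacent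
  -- coloured vertex then narrows them to the two that are wanted.
  paint : ∀ {Y L r s v cr cs l} → (∀ {u} → Y ∋ u → Reg Y L u) → Out Y r → Out Y s → r ~ s → cr ≢ cs → Unique l → 3 ≤ length l → Out Y v → v ≢ r → v ≢ s
    → ∃[ ψ ] (Col Y (λ u y → u ≢ r → u ≢ s → u ≢ v → y ∈ L u) ψ × ψ r ≡ cr × ψ s ≡ cs × ψ v ∈ l)
  paint {Y} {L} {r} {s} {v} {cr} {cs} {l} reg or os rs ne un le ov vr vs = case thomassen {Y} {upd L v l} {r} {s} {cr} {cs} (or , os , inj₂ (rs , ne))
      (λ Yu _ _ → with-lists un le ov λ _ → reg Yu) of λ (ψ , C , e₁ , e₂) →
    ψ , Col-lists (λ {u} _ h ur us uv → subst (ψ u ∈_) (upd-ne L uv) (h ur us)) C , e₁ , e₂ , subst (ψ v ∈_) (upd-eq L v l) (C .lst (out∈ ov) vr vs)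

  -- Two colours at `r` and three at an outer neighbour give two stars centred at `r`, hence a
  -- confederacy on that edge, and the induction hypothesis carries it to the target. If `r` has no
  -- neighbour, it restricts nothing and the ends of the target keep their lists.
  two-colours : ∀ {k} → IH k → ∀ {X L r q₁ q₂ s t} → sz X < k → Out X r → Out X q₁ → Out X q₂ → q₁ ~ q₂ → s ≢ t
    → (∀ {v} → X ∋ v → v ≢ r → Reg X L v)
    → Conf (λ x y → ∃[ ψ ] (Col X (Off L r r) ψ × (ψ r ≡ s ⊎ ψ r ≡ t) × ψ q₁ ≡ x × ψ q₂ ≡ y))
  two-colours ih {X} {L} {r} {q₁} {q₂} {s} {t} lt or oq₁ oq₂ q~ st reg = case any? (λ u → (X ∋? u) ×-dec (r ~? u)) of λ where
      (yes (u , Xu , ru)) → attached (next or ru Xu)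
      (no none) → isolated λ {u} Xu ru → none (u , Xu , ru)
    where
    attached : ∃[ y ] (r ~ y × Out X y) → _
    attached (y , ry , oy) = Conf-mono conv (con ih {C = C} lt can (λ (_ , _ , ne) → ne) (st₁ s , st₁ t , st , star₁ (inj₁ refl) , star₁ (inj₂ refl)))
      where
      C : Rel
      C x y' = (x ≡ s ⊎ x ≡ t) × y' ∈ L y × x ≢ y'
      Ly = reg (out∈ oy) λ e → ~-irr ry (sym e)
      star₁ : ∀ {x} → x ≡ s ⊎ x ≡ t → Has C (st₁ x)
      star₁ {x} h = case pick2 (⊖uniq {L y} {x} (proj₁ Ly)) (⊖len {L y} {x} (proj₁ Ly) (Reg-3≤ {L = L} Ly)) of λ (c , d , c∈ , d∈ , ne) →
        c , d , ne , (h , ⊖out c∈ , λ e → ⊖ne {L y} c∈ (sym e)) , (h , ⊖out d∈ , λ e → ⊖ne {L y} d∈ (sym e))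
      can : Can X L r y q₁ q₂
      can = record { out₁ = or ; out₂ = oy ; p-adj = ry ; outq₁ = oq₁ ; outq₂ = oq₂ ; q-adj = q~ ; reg = λ Xv a _ → reg Xv a }
      conv : ∀ {x y'} → Ext X L r y C q₁ q₂ x y' → ∃[ ψ ] (Col X (Off L r r) ψ × (ψ r ≡ s ⊎ ψ r ≡ t) × ψ q₁ ≡ x × ψ q₂ ≡ y')
      conv (ψ , Cψ , (a , b , _) , e₁ , e₂) = ψ , Col-lists (λ {v} _ h vr _ → case v ≟ y of λ where
        (yes refl) → b
        (no ne) → h vr ne) Cψ , a , e₁ , e₂
    isolated : (∀ {u} → X ∋ u → ¬ r ~ u) → _
    isolated none = prod₃ (proj₁ (Lq oq₁ ne₁)) (proj₁ (Lq oq₂ ne₂)) (Reg-3≤ {L = L} (Lq oq₁ ne₁)) (ℕₚ.≤-trans (s≤s (s≤s z≤n)) (Reg-3≤ {L = L} (Lq oq₂ ne₂))) build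
      where
      ne₁ : q₁ ≢ r
      ne₁ refl = none (out∈ oq₂) q~
      ne₂ : q₂ ≢ r
      ne₂ refl = none (out∈ oq₁) (~-sym q~)
      Lq : ∀ {q} → Out X q → q ≢ r → Reg X L q
      Lq o ne = reg (out∈ o) ne
      build : ∀ {x y} → x ∈ L q₁ → y ∈ L q₂ → x ≢ y → ∃[ ψ ] (Col X (Off L r r) ψ × (ψ r ≡ s ⊎ ψ r ≡ t) × ψ q₁ ≡ x × ψ q₂ ≡ y)
      build {x} {y} x∈ y∈ xy = case thomassen {X - r} {L} {q₁} {q₂} {x} {y} (mono -out (-in (out∈ oq₁) ne₁) oq₁ , mono -out (-in (out∈ oq₂) ne₂) oq₂ , inj₂ (q~ , xy))
          (λ Xv _ _ → Reg-mono {L = L} -out Xv (reg (-out Xv) (-ne Xv))) of λ (ψ , Cψ , e₁ , e₂) →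
        upd ψ r s , extend {P = Off L r r} {∈L L} (Col-lists (λ {v} _ h → case (v ≟ q₁) ,′ (v ≟ q₂) of λ where
            (yes refl , _) → subst (_∈ L v) (sym e₁) x∈
            (_ , yes refl) → subst (_∈ L v) (sym e₂) y∈
            (no a , no b) → h a b) Cψ) (λ _ h _ _ → h) (λ ne _ → ⊥-elim (ne refl)) (λ Xu ru → ⊥-elim (none (-out Xu) ru))
          , inj₁ (upd-eq ψ r s) , trans (upd-ne ψ ne₁) e₁ , trans (upd-ne ψ ne₂) e₂

  -- Makes a sequence of moves accessible to the crossing argument, where the moves would have to
  -- leave an enclosed part.
  steps-walk : ∀ {L X s s'} → Steps L X s s' → On X s → Walk X (src s) (src s')
  steps-walk nil (a , _) = [ a ]
  steps-walk (m@(turn _ _ _ _) ∷ r) o = Wmono ∖out (steps-walk r (move-on m o))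
  steps-walk (m@(tri pu _ _ _ _ _ _) ∷ r) o = Wcons (proj₁ o) pu (Wmono ∖out (steps-walk r (move-on m o)))
  steps-walk (m@(apex₁ zu _ _ _ _) ∷ r) o = Wcons (proj₁ o) (~-sym zu) (Wmono ∖out (steps-walk r (move-on m o)))
  steps-walk (m@(apex₂ zu _ _ _ _) ∷ r) o = Wcons (proj₁ o) (~-sym zu) (Wmono ∖out (steps-walk r (move-on m o)))

  -- Two governments of different types on an edge at `v` cannot agree in one and the same colour of
  -- `v`, so some colouring avoids `β`.
  avoiding : ∀ {k} → IH k → ∀ {X L y v s t β} → sz X < k → Out X y → Out X v → v ≢ y → s ≢ t → (∀ {u} → X ∋ u → u ≢ y → Reg X L u)
    → ∃[ ψ ] (Col X (Off L y y) ψ × (ψ y ≡ s ⊎ ψ y ≡ t) × ψ v ≢ β)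
  avoiding ih {X} {L} {y} {v} {s} {t} {β} lt oy ov vy st reg = case any? (λ u → (X ∋? u) ×-dec (v ~? u)) of λ where
      (yes (u , Xu , vu)) → attached (next ov vu Xu)
      (no none) → isolated λ {u} Xu vu → none (u , Xu , vu)
    where
    Goal = ∃[ ψ ] (Col X (Off L y y) ψ × (ψ y ≡ s ⊎ ψ y ≡ t) × ψ v ≢ β)
    attached : ∃[ w ] (v ~ w × Out X w) → Goal
    attached (w , vw , ow) = case two-colours ih lt oy ov ow vw st reg of λ (τ , τ' , d , h , h') → from τ τ' d h h'
      where
      G : Rel
      G x z = ∃[ ψ ] (Col X (Off L y y) ψ × (ψ y ≡ s ⊎ ψ y ≡ t) × ψ v ≡ x × ψ w ≡ z)
      get : ∀ {x z} → x ≢ β → G x z → Goal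
      get ne (ψ , C , e , refl , _) = ψ , C , e , ne
      two : ∀ {x x' z z'} → x ≢ x' → G x z → G x' z' → Goal
      two {x} {x'} ne g g' = case x ℕ.≟ β of λ where
        (no q) → get q g
        (yes refl) → get (λ q → ne (sym q)) g'
      from : ∀ τ τ' → Differ τ τ' → Has G τ → Has G τ' → Goal
      from (st₂ _) _ _ (_ , _ , ne , g , g') _ = two ne g g'
      from (dm _ _) _ _ (ne , g , g') _ = two ne g g'
      from (st₁ _) (st₂ _) _ _ (_ , _ , ne , g , g') = two ne g g'
      from (st₁ _) (dm _ _) _ _ (ne , g , g') = two ne g g'
      from (st₁ _) (st₁ _) ne (_ , _ , _ , g , _) (_ , _ , _ , g' , _) = two ne g g'
    isolated : (∀ {u} → X ∋ u → ¬ v ~ u) → Goal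
    isolated none = case pick2 (proj₁ (reg (out∈ ov) vy)) (ℕₚ.≤-trans (s≤s (s≤s z≤n)) (Reg-3≤ {L = L} (reg (out∈ ov) vy))) of λ (c , d , c∈ , d∈ , cd) →
      case thomassen {X} {L} {y} {y} {s} {s} (oy , oy , inj₁ (refl , refl)) (λ Xu a _ → reg Xu a) of λ (ψ , C , e , _) →
      case (λ o (o∈ : o ∈ L v) (oβ : o ≢ β) → upd ψ v o , extend {P = Off L y y} {Off L y y} (Col-mono -out C) (λ _ h → h) (λ _ _ → o∈) (λ Xu vu → ⊥-elim (none (-out Xu) vu))
          , inj₁ (trans (upd-ne ψ λ q → vy (sym q)) e) , λ q → oβ (trans (sym (upd-eq ψ v o)) q)) of λ build →
      case c ℕ.≟ β of λ where
        (no q) → build c c∈ q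
        (yes refl) → build d d∈ λ q → cd (sym q)

  -- Reduced canvases within the induction

  record Setup : Set₁ where
    constructor setup
    field
      {X B} : VSet n
      {q₁ q₂} : Fin n
      ctx : Ctx X B q₁ q₂
      {k} : ℕ
      ih : IH k
      lt : sz X < suc k

  module Geometry (σ : Setup) where
    open Setup σ
    open Reduced ctx

    Q : Fin n → Set
    Q v = v ≡ q₁ ⊎ v ≡ q₂

    Q? : ∀ v → Dec (Q v)
    Q? v = (v ≟ q₁) ⊎-dec (v ≟ q₂)

    Q-B : ∀ {v} → Q v → B ∋ v
    Q-B (inj₁ refl) = Bq₁
    Q-B (inj₂ refl) = Bq₂

    less : ∀ {Y v} → Y ⊂ X → X ∋ v → ¬ Y ∋ v → sz Y < k
    less {Y} {v} h a b = ℕₚ.≤-trans (sz-strict {X = Y} {X} {v} h a b) (ℕₚ.≤-pred lt)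

    Q~ : ∀ {r s} → Q r → Q s → r ≢ s → r ~ s
    Q~ (inj₁ refl) (inj₁ refl) ne = ⊥-elim (ne refl)
    Q~ (inj₁ refl) (inj₂ refl) ne = q~
    Q~ (inj₂ refl) (inj₁ refl) ne = ~-sym q~
    Q~ (inj₂ refl) (inj₂ refl) ne = ⊥-elim (ne refl)

    Oriented : Rel → Fin n → Fin n → Rel
    Oriented E r s x y = (r ≡ q₁ × s ≡ q₂ × E x y) ⊎ (r ≡ q₂ × s ≡ q₁ × E y x)

    orient : ∀ {E : Rel} {r s} (ψ : Fin n → ℕ) → Q r → Q s → r ≢ s → E (ψ q₁) (ψ q₂) → Oriented E r s (ψ r) (ψ s)
    orient ψ (inj₁ refl) (inj₁ refl) ne f = ⊥-elim (ne refl)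
    orient ψ (inj₁ refl) (inj₂ refl) ne f = inj₁ (refl , refl , f)
    orient ψ (inj₂ refl) (inj₁ refl) ne f = inj₂ (refl , refl , f)
    orient ψ (inj₂ refl) (inj₂ refl) ne f = ⊥-elim (ne refl)

    -- One coloured vertex and the wheels that obstruct deletion

    record Rooted : Set where
      constructor rooted
      field
        L : Lists
        p : Fin n
        c : ℕ
        Bp : B ∋ p
        regular : ∀ {v} → X ∋ v → v ≢ p → Reg X L v
        B-no : ∀ {v} → X ∋ v → ¬ B ∋ v → 5 ≤ length (L v)
        pq₁ : p ≢ q₁
        pq₂ : p ≢ q₂

    module AtVertex (ρ : Rooted) where
      open Rooted ρ

      FF : Fin n → Fin n → Rel
      FF r s x y = ∃[ ψ ] (Col X (Off L p p) ψ × ψ p ≡ c × ψ r ≡ x × ψ s ≡ y)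

      F : Rel
      F = FF q₁ q₂

      target : ∀ {r s} → Q r → Q s → r ≢ s → Conf (FF r s) → Conf F
      target (inj₁ refl) (inj₁ refl) ne h = ⊥-elim (ne refl)
      target (inj₁ refl) (inj₂ refl) ne h = h
      target (inj₂ refl) (inj₁ refl) ne h = Conf-mono (λ (ψ , a , b , d , e) → ψ , a , b , e , d) (Confᵀ h)
      target (inj₂ refl) (inj₂ refl) ne h = ⊥-elim (ne refl)

      q-in : ∀ {Y} → Y ⊂ X → (∀ {v} → Q v → Y ∋ v) → Out Y q₁ × Out Y q₂
      q-in h m = mono h (m (inj₁ refl)) (B-out Bq₁) , mono h (m (inj₂ refl)) (B-out Bq₂)

      add-p : ∀ {ψ} → Col (X - p) (∈L L) ψ → (∀ {u} → X ∋ u → p ~ u → ψ u ≢ c) → Col X (Off L p p) (upd ψ p c) × upd ψ p c p ≡ c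
      add-p {ψ} C h = extend {P = Off L p p} {∈L L} C (λ _ h _ _ → h) (λ ne _ → ⊥-elim (ne refl)) (λ Xu pu → h (-out Xu) pu) , upd-eq ψ p c

      -- Deleting `p` takes only `c` from its other neighbours, which are long, and `w` keeps two
      -- colours besides `c`.
      one-neighbour : ∀ {w} → B ∋ w → w ≢ p → (∀ {u} → B ∋ u → p ~ u → u ≡ w) → Conf F
      one-neighbour {w} Bw wp only = case pick2 (⊖uniq {L w} {c} (proj₁ Lw)) (⊖len {L w} {c} (proj₁ Lw) (Reg-3≤ {L = L} Lw)) of λ (s , t , s∈ , t∈ , st) →
          Conf-mono (conv s∈ t∈) (two-colours ih {X - p} {L'} {w} (less -out (B∈ Bp) λ h → -ne h refl) (mono -out (-in (B∈ Bw) wp) (B-out Bw))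
            (proj₁ qq) (proj₂ qq) q~ st reg')
        where
        Lw = regular (B∈ Bw) wp
        qq = q-in {X - p} -out λ { (inj₁ refl) → -in (B∈ Bq₁) (λ e → pq₁ (sym e)) ; (inj₂ refl) → -in (B∈ Bq₂) (λ e → pq₂ (sym e)) }
        D? : ∀ u → Dec (p ~ u × u ≢ w)
        D? u = (p ~? u) ×-dec ¬? (u ≟ w)
        L' = drop ⟦ D? ⟧ c c L
        reg' : ∀ {v} → (X - p) ∋ v → v ≢ w → Reg (X - p) L' v
        reg' {v} Xv vw = case p ~? v of λ where
          (yes pv) → drop-Reg-on {L = L} (⟦⟧in (pv , vw)) (proj₁ (regular (-out Xv) (-ne Xv))) (B-no (-out Xv) λ b → vw (only b pv)) (expose (B-out Bp) pv (-out Xv))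
          (no npv) → drop-Reg-off {L = L} (λ h → npv (proj₁ (⟦⟧out {P? = D?} h))) (Reg-mono {L = L} -out Xv (regular (-out Xv) (-ne Xv)))
        conv : ∀ {s t x y} → s ∈ L w ⊖ c → t ∈ L w ⊖ c → ∃[ ψ ] (Col (X - p) (Off L' w w) ψ × (ψ w ≡ s ⊎ ψ w ≡ t) × ψ q₁ ≡ x × ψ q₂ ≡ y) → F x y
        conv {s} {t} s∈ t∈ (ψ , C , e , e₁ , e₂) = case add-p (Col-lists ls C) ns of λ (C' , ep) →
            upd ψ p c , C' , ep , trans (upd-ne ψ λ q → pq₁ (sym q)) e₁ , trans (upd-ne ψ λ q → pq₂ (sym q)) e₂
          where
          w∈ : ψ w ∈ L w ⊖ c
          w∈ = case e of λ { (inj₁ q) → subst (_∈ L w ⊖ c) (sym q) s∈ ; (inj₂ q) → subst (_∈ L w ⊖ c) (sym q) t∈ }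
          ls : ∀ {v} → (X - p) ∋ v → Off L' w w v (ψ v) → ψ v ∈ L v
          ls {v} _ h = case v ≟ w of λ where
            (yes refl) → ⊖out w∈
            (no ne) → drop-⊆ {⟦ D? ⟧} {L = L} (h ne ne)
          ns : ∀ {u} → X ∋ u → p ~ u → ψ u ≢ c
          ns {u} Xu pu = case u ≟ w of λ where
            (yes refl) → ⊖ne {L u} w∈
            (no ne) → proj₁ (drop-≢ {⟦ D? ⟧} {L = L} (⟦⟧in (pu , ne)) (C .lst (-in Xu λ q → ~-irr pu (sym q)) ne ne))

      -- All other neighbours of `p` are long, so Thomassen's theorem with the edge `wv` precoloured
      -- realises every pair of colours.
      both-neighbours : ∀ {w v α β} → B ∋ w → B ∋ v → p ~ w → p ~ v → w ~ v → α ∈ L w ⊖ c → β ∈ L v ⊖ c → α ≢ β → FF w v α β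
      both-neighbours {w} {v} {α} {β} Bw Bv pw pv wv α∈ β∈ αβ = case thomassen {X - p} {L'} {w} {v} {α} {β}
            (mono -out (-in (B∈ Bw) λ e → ~-irr pw (sym e)) (B-out Bw) , mono -out (-in (B∈ Bv) λ e → ~-irr pv (sym e)) (B-out Bv) , inj₂ (wv , αβ)) reg' of λ (ψ , C , e₁ , e₂) →
          case add-p (Col-lists (ls {ψ} e₁ e₂) C) (ns C e₁ e₂) of λ (C' , ep) →
            upd ψ p c , C' , ep , trans (upd-ne ψ λ q → ~-irr pw (sym q)) e₁ , trans (upd-ne ψ λ q → ~-irr pv (sym q)) e₂
        where
        D? : ∀ u → Dec (p ~ u × u ≢ w × u ≢ v)
        D? u = (p ~? u) ×-dec ¬? (u ≟ w) ×-dec ¬? (u ≟ v)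
        L' = drop ⟦ D? ⟧ c c L
        reg' : ∀ {u} → (X - p) ∋ u → u ≢ w → u ≢ v → Reg (X - p) L' u
        reg' {u} Xu uw uv = case p ~? u of λ where
          (yes pu) → drop-Reg-on {L = L} (⟦⟧in (pu , uw , uv)) (proj₁ (regular (-out Xu) (-ne Xu)))
            (B-no (-out Xu) λ b → case third Bp Bw Bv b pw pv pu (~-irr wv) of λ { (inj₁ e) → uw e ; (inj₂ e) → uv e }) (expose (B-out Bp) pu (-out Xu))
          (no npu) → drop-Reg-off {L = L} (λ h → npu (proj₁ (⟦⟧out {P? = D?} h))) (Reg-mono {L = L} -out Xu (regular (-out Xu) (-ne Xu)))
        ls : ∀ {ψ} → ψ w ≡ α → ψ v ≡ β → ∀ {u} → (X - p) ∋ u → Off L' w v u (ψ u) → ψ u ∈ L u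
        ls e₁ e₂ {u} _ h = case (u ≟ w) ,′ (u ≟ v) of λ where
          (yes refl , _) → subst (_∈ L u) (sym e₁) (⊖out α∈)
          (_ , yes refl) → subst (_∈ L u) (sym e₂) (⊖out β∈)
          (no a , no b) → drop-⊆ {⟦ D? ⟧} {L = L} (h a b)
        ns : ∀ {ψ} → Col (X - p) (Off L' w v) ψ → ψ w ≡ α → ψ v ≡ β → ∀ {u} → X ∋ u → p ~ u → ψ u ≢ c
        ns C e₁ e₂ {u} Xu pu = case (u ≟ w) ,′ (u ≟ v) of λ where
          (yes refl , _) → λ q → ⊖ne {L u} α∈ (trans (sym e₁) q)
          (_ , yes refl) → λ q → ⊖ne {L u} β∈ (trans (sym e₂) q)
          (no a , no b) → proj₁ (drop-≢ {⟦ D? ⟧} {L = L} (⟦⟧in (pu , a , b)) (C .lst (-in Xu λ q → ~-irr pu (sym q)) a b))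

      -- What obstructs the deletion of `v`: a vertex `x` outside `B` joined to `p`, `w`, `v` and to
      -- the next vertex `z` of `B` after `w`. The colours of `w` besides `c` recur at `z` and at
      -- `x`, and they avoid the two colours reserved for `v`.
      record Wheel (w v : Fin n) (a₁ a₂ : ℕ) : Set where
        field
          x z : Fin n
          a b e : ℕ
          Xx : X ∋ x
          Bx : ¬ B ∋ x
          px : p ~ x
          wx : w ~ x
          vx : v ~ x
          Bz : B ∋ z
          wz : w ~ z
          xz : x ~ z
          zp : z ≢ p
          zv : z ≢ v
          Lw : (L w ⊖ c) ≐₂ (a , b)
          Lz : L z ≐₃ (a , b , e)
          a₁∈ : a₁ ∈ L x
          a₂∈ : a₂ ∈ L x
          a∈ : a ∈ L x
          b∈ : b ∈ L x
          a≢ : a ≢ a₁ × a ≢ a₂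
          b≢ : b ≢ a₁ × b ≢ a₂

      -- The induction hypothesis for X - v, with a₁ and a₂ removed from the lists of the neighbours of v outside B.
      wheel : ∀ {w v a₁ a₂} → B ∋ w → B ∋ v → p ~ w → p ~ v → w ≢ v → ¬ Q v → a₁ ∈ L v ⊖ c → a₂ ∈ L v ⊖ c → a₁ ≢ a₂ → Conf F ⊎ Wheel w v a₁ a₂
      wheel {w} {v} {a₁} {a₂} Bw Bv pw pv wv nQv a₁∈ a₂∈ a₁₂ = case gov ih {X - v} {L'} {q₁} {q₂} (star p w c (L w ⊖ c))
            (less -out (B∈ Bv) λ h → -ne h refl) can (⊖uniq (proj₁ Lw') , ⊖len {L w} {c} (proj₁ Lw') (Reg-3≤ {L = L} Lw') , λ h → ⊖ne {L w} h refl) of λ where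
          (inj₁ cf) → inj₁ (Conf-mono lift cf)
          (inj₂ (s' , en , _ , st)) → case starNorm st (λ Xy yp yw → let r = reg' Xy yp yw in proj₁ r , Reg-3≤ {L = L'} r) of λ where
            (inj₁ e) → ⊥-elim (case en of λ { (inj₁ (e' , _)) → pq₁ (trans (sym e) e') ; (inj₂ (e' , _)) → pq₂ (trans (sym e) e') })
            (inj₂ (u₁ , u₂ , a , b , pu₁ , pu₂ , u₁₂ , X₁ , X₂ , f₁ , f₂ , r)) → inj₂ (triangle en pu₁ pu₂ u₁₂ X₁ X₂ f₁ f₂ r)
        where
        Lw' = regular (B∈ Bw) λ e → ~-irr pw (sym e)
        v≢p : v ≢ p
        v≢p e = ~-irr pv (sym e)
        D? : ∀ u → Dec (v ~ u × ¬ B ∋ u)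
        D? u = (v ~? u) ×-dec ¬? (B ∋? u)
        D = ⟦ D? ⟧
        L' = drop D a₁ a₂ L
        offB : ∀ {u} → B ∋ u → L' u ≡ L u
        offB Bu = drop-off {D} {L = L} λ h → proj₂ (⟦⟧out {P? = D?} h) Bu
        reg' : ∀ {u} → (X - v) ∋ u → u ≢ p → u ≢ w → Reg (X - v) L' u
        reg' {u} Xu up _ = case D? u of λ where
          (yes d) → drop-Reg-on {L = L} (⟦⟧in d) (proj₁ (regular (-out Xu) up)) (B-no (-out Xu) (proj₂ d)) (expose (B-out Bv) (proj₁ d) (-out Xu))
          (no nd) → drop-Reg-off {L = L} (λ h → nd (⟦⟧out {P? = D?} h)) (Reg-mono {L = L} -out Xu (regular (-out Xu) up))
        inB : ∀ {u} → B ∋ u → u ≢ v → Out (X - v) u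
        inB Bu ne = mono -out (-in (B∈ Bu) ne) (B-out Bu)
        can : Can (X - v) L' p w q₁ q₂
        can = record { out₁ = inB Bp (λ e → v≢p (sym e)) ; out₂ = inB Bw wv ; p-adj = pw ; outq₁ = inB Bq₁ (λ e → nQv (inj₁ (sym e)))
                     ; outq₂ = inB Bq₂ (λ e → nQv (inj₂ (sym e))) ; q-adj = q~ ; reg = reg' }
        pick-v : ∀ t → ∃[ o ] (o ∈ L v ⊖ c × (o ≡ a₁ ⊎ o ≡ a₂) × o ≢ t)
        pick-v t = case other a₁₂ t of λ where
          (_ , inj₁ refl , ne) → a₁ , a₁∈ , inj₁ refl , ne
          (_ , inj₂ refl , ne) → a₂ , a₂∈ , inj₂ refl , ne
        lift : ∀ {x y} → Ext (X - v) L' p w ⟪ star p w c (L w ⊖ c) ⟫ q₁ q₂ x y → F x y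
        -- To colour `v`: it has at most one neighbour `t` in `B` besides `p`, and one of `a₁`, `a₂`
        -- avoids the colour of `t`; the neighbours outside `B` have lost both. Without such a `t`
        -- the vertex `p` stands in.
        lift (ψ , C , (ep , ew) , e₁ , e₂) = case any? (λ t → (B ∋? t) ×-dec (v ~? t) ×-dec ¬? (t ≟ p)) of λ where
            (yes (t , Bt , vt , tp)) → fin t λ {u} Bu vu up → case third Bv Bp Bt Bu (~-sym pv) vt vu (λ e → tp (sym e)) of λ { (inj₁ e) → ⊥-elim (up e) ; (inj₂ e) → e }
            (no none) → fin p λ {u} Bu vu up → ⊥-elim (none (u , Bu , vu , up))
          where
          C' : Col (X - v) (Off L p p) ψ
          C' = Col-lists (λ {u} _ h up _ → case u ≟ w of λ where
            (yes refl) → ⊖out ew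
            (no uw) → drop-⊆ {D} {L = L} (h up uw)) C
          fin : ∀ t → (∀ {u} → B ∋ u → v ~ u → u ≢ p → u ≡ t) → F _ _
          fin t only = case pick-v (ψ t) of λ (o , o∈ , oa , ot) → upd ψ v o ,
            extend {P = Off L p p} {Off L p p} C' (λ _ h → h) (λ _ _ → ⊖out o∈) (λ {u} Xu vu → case B ∋? u of λ where
              (yes Bu) → case u ≟ p of λ where
                (yes refl) → λ q → ⊖ne {L v} o∈ (trans (sym q) ep)
                (no up) → λ q → ot (trans (sym q) (cong ψ (only Bu vu up)))
              (no nB) → λ q → case oa of λ where
                (inj₁ refl) → proj₁ (drop-≢ {D} {L = L} (⟦⟧in (vu , nB)) (C .lst Xu (λ { refl → nB Bp }) (λ { refl → nB Bw }))) q
                (inj₂ refl) → proj₂ (drop-≢ {D} {L = L} (⟦⟧in (vu , nB)) (C .lst Xu (λ { refl → nB Bp }) (λ { refl → nB Bw }))) q)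
            , trans (upd-ne ψ λ q → v≢p (sym q)) ep , trans (upd-ne ψ λ q → nQv (inj₁ (sym q))) e₁ , trans (upd-ne ψ λ q → nQv (inj₂ (sym q))) e₂

        -- Outside `B` a list of exactly three colours can only come from the removal of two.
        shrunk : ∀ {u t} → (X - v) ∋ u → u ≢ p → ¬ B ∋ u → L' u ≐₃ t → v ~ u
        shrunk {u} Xu up nB l = decidable-stable (v ~? u) λ nv → ≐₃-not-5 (proj₁ (regular (-out Xu) up)) (B-no (-out Xu) nB) (subst (_≐₃ _) (drop-off {D} {L = L} λ h → nv (proj₁ (⟦⟧out {P? = D?} h))) l)
        inner : ∀ {u} → (X - v) ∋ u → p ~ u → u ≢ w → ¬ B ∋ u
        inner Xu pu uw Bu = case third Bp Bw Bv Bu pw pv pu wv of λ { (inj₁ e) → uw e ; (inj₂ e) → -ne Xu e }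

        module _ {a b : ℕ} {s' : State} (en : End s' q₁ q₂ (Ext (X - v) L' p w ⟪ star p w c (L w ⊖ c) ⟫ q₁ q₂)) where
          Lr = L w ⊖ c
          mk-wheel : ∀ {x R} → p ~ x → w ~ x → (X - v) ∋ x → x ≢ w → L' x ≐₃ (a , b , c) → Lr ≐₂ (a , b) → R ∋ p
            → s' ≡ dem w x a b ⊎ s' ≡ dem x w a b ⊎ ∃[ z ] ∃[ e ] (z ~ w × z ~ x × ((X - v) ∖ R) ∋ z × L' z ≐₃ (a , b , e))
            → Wheel w v a₁ a₂
          -- A democracy that involves `x` is not at the target, since `x` is not in `B`; so it must
          -- move on to an apex.
          mk-wheel {x} px wx Xx xw Lx lw Rp (inj₁ refl) = ⊥-elim (inner Xx px xw (case en of λ { (inj₁ (_ , refl , _)) → Bq₂ ; (inj₂ (_ , refl , _)) → Bq₁ }))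
          mk-wheel {x} px wx Xx xw Lx lw Rp (inj₂ (inj₁ refl)) = ⊥-elim (inner Xx px xw (case en of λ { (inj₁ (refl , _)) → Bq₁ ; (inj₂ (refl , _)) → Bq₂ }))
          mk-wheel {x} px wx Xx xw Lx lw Rp (inj₂ (inj₂ (z , e , zw , zx , Yz , Lz))) = record
              { x = x ; z = z ; a = a ; b = b ; e = e ; Xx = -out Xx ; Bx = Bx ; px = px ; wx = wx ; vx = vx ; Bz = Bz ; wz = ~-sym zw ; xz = ~-sym zx
              ; zp = z≢p ; zv = -ne (∖out Yz) ; Lw = lw ; Lz = subst (_≐₃ _) (offB Bz) Lz ; a₁∈ = proj₁ dd ; a₂∈ = proj₂ dd
              ; a∈ = drop-⊆ {D} {L = L} (proj₁ (proj₁ Lx)) ; b∈ = drop-⊆ {D} {L = L} (proj₁ (proj₂ (proj₁ Lx)))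
              ; a≢ = drop-≢ {D} {L = L} Dx (proj₁ (proj₁ Lx)) ; b≢ = drop-≢ {D} {L = L} Dx (proj₁ (proj₂ (proj₁ Lx))) }
            where
            x≢p : x ≢ p
            x≢p q = ~-irr px (sym q)
            Bx = inner Xx px xw
            vx = shrunk Xx x≢p Bx Lx
            Dx : D ∋ x
            Dx = ⟦⟧in (vx , Bx)
            dd = deleted (proj₁ (regular (-out Xx) x≢p)) (B-no (-out Xx) Bx) (subst (_≐₃ _) (drop-on {D} {L = L} Dx) Lx)
            z≢p : z ≢ p
            z≢p refl = ∖no Yz Rp
            open Around Bp
            np : ∀ {u} → B ∋ u → p ~ u → Nb u
            np Bu pu = B∈ Bu , pu
            nx : Nb x
            nx = -out Xx , px
            at : ∀ {u m} → Nb u → u ≢ m → (X - p - m) ∋ u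
            at (Xu , pu) ne = -in (-in Xu λ q → ~-irr pu (sym q)) ne
            x≢v : x ≢ v
            x≢v = -ne Xx
            Bz : B ∋ z
            -- Were `z` outside `B`, its list too would have been shortened, so `z` would be
            -- adjacent to `v`. Then `p` and the path through `w`, `z`, `v` enclose `x`, while `IR`
            -- leads `x` to `B`.
            Bz = decidable-stable (B ∋? z) λ nBz →
              let vz = shrunk (∖out Yz) z≢p nBz Lz
                  bt : Btw w x v
                  bt = btw (np Bw pw) nx (np Bv pv) (λ q → xw (sym q)) wv x≢v
                    (λ bb → cross₁ nx (np Bw pw) (np Bv pv) bb (B-out Bw) ([ at nx xw ] ▸ (~-sym vx , at (np Bv pv) λ q → wv (sym q))))
                    (λ bb → cross₁ (np Bw pw) (np Bv pv) nx bb (B-out Bv) ([ at (np Bw pw) wv ] ▸ (wx , at nx x≢v)))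
                  Xz = -out (∖out Yz)
                  (o , Bo , ww) = IR {w} {p} {z} {v} {x} Bw Bp Xz (B∈ Bv) (inj₂ (~-sym zw)) (inj₁ Bv) (~-sym vz) (~-irr (~-sym zw)) wv (λ q → z≢p (sym q)) (λ q → v≢p (sym q))
                                    (-in (-in (-in (-in (-out Xx) xw) x≢p) (λ q → ~-irr zx (sym q))) x≢v)
              in cross₃ (np Bw pw) nx (np Bv pv) bt Xz z≢p (~-sym zw) (~-sym vz) Bo
                   (Wmono (λ q → -in (-in (-in (-in (-out (-out (-out (-out q)))) (-ne (-out (-out q)))) (-ne (-out (-out (-out q))))) (-ne (-out q))) (-ne q)) ww)

          triangle : ∀ {u₁ u₂} → p ~ u₁ → p ~ u₂ → u₁ ~ u₂ → (X - v) ∋ u₁ → (X - v) ∋ u₂ → Free L' w Lr u₁ a b c → Free L' w Lr u₂ a b c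
            → Steps L' ((X - v) ∖ ((∅ ⊹ p ⊹ w) ∖ (∅ ⊹ u₁ ⊹ u₂))) (dem u₁ u₂ a b) s' → Wheel w v a₁ a₂
          triangle {u₁} {u₂} pu₁ pu₂ u₁₂ X₁ X₂ f₁ f₂ r = go f₁ f₂
            where
            Rp : ((∅ ⊹ p ⊹ w) ∖ (∅ ⊹ u₁ ⊹ u₂)) ∋ p
            Rp = ∖in (⊹in (⊹new {X = ∅})) λ h → case pair-out h of λ { (inj₁ e) → ~-irr pu₁ e ; (inj₂ e) → ~-irr pu₂ e }
            go : Free L' w Lr u₁ a b c → Free L' w Lr u₂ a b c → Wheel w v a₁ a₂
            go (inj₁ (refl , _)) (inj₁ (refl , _)) = ⊥-elim (~-irr u₁₂ refl)
            go (inj₁ (refl , lw)) (inj₂ (u₂w , l)) = mk-wheel pu₂ u₁₂ X₂ u₂w l lw Rp (case demNorm r of λ { (inj₁ e) → inj₁ e ; (inj₂ (z , e , zu , zw , Yz , lz)) → inj₂ (inj₂ (z , e , zu , zw , Yz , lz)) })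
            go (inj₂ (u₁w , l)) (inj₁ (refl , lw)) = mk-wheel pu₁ (~-sym u₁₂) X₁ u₁w l lw Rp (case demNorm r of λ { (inj₁ e) → inj₂ (inj₁ e) ; (inj₂ (z , e , zu , zw , Yz , lz)) → inj₂ (inj₂ (z , e , zw , zu , Yz , lz)) })
            -- Both vertices would have shortened lists and so be adjacent to `v`; the two triangles
            -- on the edge `pv` and the edge between `u₁` and `u₂` leave no possible order around
            -- `p`.
            go (inj₂ (u₁w , l₁)) (inj₂ (u₂w , l₂)) = ⊥-elim (between-tri Bp Bv (-out X₂) pv pu₂ vu₂ (-out X₁) pu₁ (-ne X₁) (~-irr u₁₂)
                (btw (B∈ Bv , pv) n₁ n₂ (λ q → -ne X₁ (sym q)) (λ q → -ne X₂ (sym q)) (~-irr u₁₂)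
                  (λ bb → cross₁ n₁ (B∈ Bv , pv) n₂ bb (B-out Bv) ([ at n₁ (-ne X₁) ] ▸ (u₁₂ , at n₂ (-ne X₂))))
                  (λ bb → between-tri Bp Bv (-out X₁) pv pu₁ vu₁ (-out X₂) pu₂ (-ne X₂) (λ q → ~-irr u₁₂ (sym q)) bb)))
              where
              open Around Bp
              n₁ : Nb u₁
              n₁ = -out X₁ , pu₁
              n₂ : Nb u₂
              n₂ = -out X₂ , pu₂
              at : ∀ {u m} → Nb u → u ≢ m → (X - p - m) ∋ u
              at (Xu , pu) ne = -in (-in Xu λ q → ~-irr pu (sym q)) ne
              vu₁ = shrunk X₁ (λ q → ~-irr pu₁ (sym q)) (inner X₁ pu₁ u₁w) l₁
              vu₂ = shrunk X₂ (λ q → ~-irr pu₂ (sym q)) (inner X₂ pu₂ u₂w) l₂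

      -- Fans around a vertex with a long list

      module Fan (x : Fin n) (Bx : ¬ B ∋ x) where
        unorient : ∀ {r s} → Q r → Q s → r ≢ s → Conf (Oriented F r s) → Conf F
        unorient (inj₁ refl) (inj₁ refl) ne f = ⊥-elim (ne refl)
        unorient (inj₁ refl) (inj₂ refl) ne f = Conf-mono (λ { (inj₁ (_ , _ , h)) → h ; (inj₂ (e , _)) → ⊥-elim (ne e) }) f
        unorient (inj₂ refl) (inj₁ refl) ne f = Conf-mono (λ { (inj₁ (e , _)) → ⊥-elim (ne e) ; (inj₂ (_ , _ , h)) → h }) (Confᵀ f)
        unorient (inj₂ refl) (inj₂ refl) ne f = ⊥-elim (ne refl)

        -- One end of the fan at x: the colours a and b of x force the colour e at z.
        record Side (H : VSet n) (z zp : Fin n) (a b e : ℕ) : Set where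
          field
            Hz : H ∋ z
            Bz : B ∋ z
            Bzp : B ∋ zp
            Hzp : ¬ H ∋ zp
            zpz : zp ~ z
            zpx : zp ~ x
            zx : z ~ x
            Lz : L z ≐₃ (a , b , e)
            realised : ∀ {ψ} → Col H (Off L x x) ψ → ψ x ≡ a ⊎ ψ x ≡ b → ψ z ≡ e → F (ψ q₁) (ψ q₂)

        -- What is left of the canvas while the fan is shortened at its ends; `x` is outer because
        -- its neighbour `p` has been deleted.
        record Hub (H : VSet n) : Set where
          field
            HX : H ⊂ X
            Hp : ¬ H ∋ p
            small : sz H < k
            Ox : Out H x
            HQ : ∀ {v} → Q v → H ∋ v

        Apart : ℕ → ℕ → ℕ → ℕ → Set
        Apart a b a' b' = (a ≢ a' × a ≢ b') × (b ≢ a' × b ≢ b')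

        apart-sym : ∀ {a b a' b'} → Apart a b a' b' → Apart a' b' a b
        apart-sym ((p , q) , (r , s)) = ((λ e → p (sym e)) , (λ e → r (sym e))) , ((λ e → q (sym e)) , (λ e → s (sym e)))

        lists-differ : ∀ {u v a b a' b' e e'} → Apart a b a' b' → L u ≐₃ (a , b , e) → L v ≐₃ (a' , b' , e') → u ≢ v
        lists-differ ((p , q) , (r , s)) ((a∈ , b∈ , _) , (ab , _) , _) (_ , _ , all) refl = case all _ a∈ ,′ all _ b∈ of λ where
          (inj₁ e , _) → p e
          (inj₂ (inj₁ e) , _) → q e
          (_ , inj₁ e) → r e
          (_ , inj₂ (inj₁ e)) → s e
          (inj₂ (inj₂ e) , inj₂ (inj₂ e')) → ab (trans e (sym e'))

        module _ {H : VSet n} (hub : Hub H) where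
          open Hub hub

          x≢B : ∀ {v} → B ∋ v → v ≢ x
          x≢B Bv refl = Bx Bv

          HB : ∀ {v} → H ∋ v → B ∋ v → Out H v
          HB Hv Bv = mono HX Hv (B-out Bv)

          regH : ∀ {v} → H ∋ v → Reg H L v
          regH Hv = Reg-mono {L = L} HX Hv (regular (HX Hv) λ { refl → Hp Hv })

          regY : ∀ {Y} → Y ⊂ H → ∀ {u} → Y ∋ u → Reg Y L u
          regY YH Yu = Reg-mono {L = L} YH Yu (regH (YH Yu))

          -- With `e` at `z` the hub can be given the list {a, b, e}, so it takes `a` or `b`,
          -- whatever the colour at `z'`; likewise from the other side. This makes both ends of the
          -- target centres of stars.
          closed : ∀ {z zp z' zp' a b a' b' e e'} → Apart a b a' b' → Side H z zp a b e → Side H z' zp' a' b' e' → Q z → Q z' → Conf F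
          closed {z} {zp} {z'} {zp'} {a} {b} {a'} {b'} {e} {e'} ap S S' Qz Qz' = unorient Qz Qz' zz' (st₁ e , st₂ e' , tt , one , two)
            where
            module S = Side S
            module S' = Side S'
            zz' = lists-differ ap S.Lz S'.Lz
            half : ∀ {r rp s sp a b e η} → Side H r rp a b e → Side H s sp a' b' e' ⊎ B ∋ s → Q r → Q s → r ≢ s → η ∈ L s → η ≢ e → Oriented F r s e η
            half {r} {rp} {s} {sp} {a} {b} {e} {η} R _ Qr Qs rs η∈ ηe = case paint {H} {L} {r} {s} {x} {e} {η} {a ∷ b ∷ e ∷ []} regH
                  (HB (HQ Qr) (Q-B Qr)) (HB (HQ Qs) (Q-B Qs)) (Q~ Qr Qs rs) (λ q → ηe (sym q))
                  (let (ab , ae , be) = proj₁ (proj₂ R.Lz) in uniq₃ ab ae be) ℕₚ.≤-refl Ox (λ q → x≢B (Q-B Qr) (sym q)) (λ q → x≢B (Q-B Qs) (sym q)) of λ (ψ , C , er , es , x∈) →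
                subst₂ (Oriented F r s) er es (orient {F} ψ Qr Qs rs (R.realised (Col-lists (λ {u} _ h ux _ → case (u ≟ r) ,′ (u ≟ s) of λ where
                    (yes refl , _) → subst (_∈ L u) (sym er) (proj₂ (proj₂ (proj₁ R.Lz)))
                    (_ , yes refl) → subst (_∈ L u) (sym es) η∈
                    (no p , no q) → h p q ux) C) (list₃ x∈ λ q → C .prp (out∈ Ox) (HQ Qr) (~-sym R.zx) (trans q (sym er))) er))
              where module R = Side R
            swapO : ∀ {r s a b} → Oriented F r s a b → Oriented F s r b a
            swapO (inj₁ (p , q , f)) = inj₂ (q , p , f)
            swapO (inj₂ (p , q , f)) = inj₁ (q , p , f)
            one : Has (Oriented F z z') (st₁ e)
            one = case pick2 (⊖uniq {L z'} {e} (proj₁ (regH S'.Hz))) (⊖len {L z'} {e} (proj₁ (regH S'.Hz)) (Reg-3≤ {L = L} (regH S'.Hz))) of λ (y , y' , y∈ , y'∈ , ne) →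
              y , y' , ne , half {sp = zp'} S (inj₂ S'.Bz) Qz Qz' zz' (⊖out y∈) (⊖ne {L z'} y∈) , half {sp = zp'} S (inj₂ S'.Bz) Qz Qz' zz' (⊖out y'∈) (⊖ne {L z'} y'∈)
            two : Has (Oriented F z z') (st₂ e')
            two = case pick2 (⊖uniq {L z} {e'} (proj₁ (regH S.Hz))) (⊖len {L z} {e'} (proj₁ (regH S.Hz)) (Reg-3≤ {L = L} (regH S.Hz))) of λ (y , y' , y∈ , y'∈ , ne) →
              y , y' , ne , swapO (half {sp = zp} S' (inj₂ S.Bz) Qz' Qz (λ q → zz' (sym q)) (⊖out y∈) (⊖ne {L z} y∈))
                          , swapO (half {sp = zp} S' (inj₂ S.Bz) Qz' Qz (λ q → zz' (sym q)) (⊖out y'∈) (⊖ne {L z} y'∈))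

          -- Move on to the next but one vertex z₂ of the fan.
          record Open : Set where
            constructor opened
            field
              {z zp z' zp'} : Fin n
              {a b a' b' e e'} : ℕ
              ap : Apart a b a' b'
              S : Side H z zp a b e
              S' : Side H z' zp' a' b' e'
              nQ : ¬ Q z
              again : ∀ {H' z₂ zp₂ e₂} → sz H' < sz H → Hub H' → Side H' z₂ zp₂ a b e₂ → Side H' z' zp' a' b' e' → Conf F

          module Advance (φ : Open) where
            open Open φ
            module S = Side S
            module S' = Side S'
            ab = proj₁ (proj₁ (proj₂ S.Lz))

            -- When the induction hypothesis returns moves for the star at `z`, the fan goes on by
            -- two vertices: `y` next to `z`, and `z₂` next to `y`, all joined to `x`.
            record Link : Set where
              constructor link
              field
                {y z₂} : Fin n
                {e₂} : ℕ
                Hy : H ∋ y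
                By : B ∋ y
                zy : z ~ y
                xy : x ~ y
                Ly : L y ≐₃ (a , b , e)
                Hz₂ : H ∋ z₂
                Bz₂ : B ∋ z₂
                z₂x : z₂ ~ x
                z₂y : z₂ ~ y
                z₂z : z₂ ≢ z
                Lz₂ : L z₂ ≐₃ (a , b , e₂)

            module Next (μ : Link) where
              open Link μ
              Xx : X ∋ x
              Xx = HX (out∈ Ox)
              around-z : ∀ {v} → H ∋ v → z ~ v → v ≡ x ⊎ v ≡ y
              around-z Hv zv = case degree-3 S.Bz S.Bzp Xx By (~-sym S.zpz) S.zx zy S.zpx xy (λ { refl → S.Hzp Hy }) (HX Hv) zv of λ where
                (inj₁ refl) → ⊥-elim (S.Hzp Hv)
                (inj₂ r) → r
              around-y : ∀ {v} → X ∋ v → y ~ v → v ≡ z ⊎ v ≡ x ⊎ v ≡ z₂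
              around-y Xv yv = degree-3 By S.Bz Xx Bz₂ (~-sym zy) (~-sym xy) (~-sym z₂y) S.zx (~-sym z₂x) (λ q → z₂z (sym q)) Xv yv
              H' = H - z - y
              in' : ∀ {v} → H ∋ v → v ≢ z → v ≢ y → H' ∋ v
              in' h p q = -in (-in h p) q
              H'H : H' ⊂ H
              H'H h = -out (-out h)
              H'x : H' ∋ x
              H'x = in' (out∈ Ox) (λ q → x≢B S.Bz (sym q)) (λ q → x≢B By (sym q))
              H'z₂ : H' ∋ z₂
              H'z₂ = in' Hz₂ z₂z (~-irr z₂y)
              z'≢y : z' ≢ y
              z'≢y q = lists-differ ap Ly S'.Lz (sym q)
              z'≢z : z' ≢ z
              z'≢z q = lists-differ ap S.Lz S'.Lz (sym q)
              z'≢z₂ : z' ≢ z₂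
              z'≢z₂ q = lists-differ ap Lz₂ S'.Lz (sym q)
              H'z' : H' ∋ z'
              H'z' = in' S'.Hz z'≢z z'≢y

              put : ∀ {ψ o f} → Col H' (Off L x x) ψ → o ∈ L y → f ∈ L z → o ≢ ψ x → o ≢ ψ z₂ → f ≢ ψ x → f ≢ o
                → let ψ' = upd (upd ψ y o) z f in Col H (Off L x x) ψ' × ψ' z ≡ f × ψ' y ≡ o × (∀ v → v ≢ z → v ≢ y → ψ' v ≡ ψ v)
              put {ψ} {o} {f} C o∈ f∈ ox oz fx fo = extend {P = Off L x x} {Off L x x}
                    (extend {P = Off L x x} {Off L x x} C (λ _ h → h) (λ _ _ → o∈) λ Hu yu → case around-y (HX (-out (-out Hu))) yu of λ where
                      (inj₁ refl) → ⊥-elim (-ne (-out Hu) refl)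
                      (inj₂ (inj₁ refl)) → λ q → ox (sym q)
                      (inj₂ (inj₂ refl)) → λ q → oz (sym q))
                    (λ _ h → h) (λ _ _ → f∈) (λ Hu zu → case around-z (-out Hu) zu of λ where
                      (inj₁ refl) → λ q → fx (trans (sym q) (upd-ne ψ λ q → x≢B By (sym q)))
                      (inj₂ refl) → λ q → fo (trans (sym q) (upd-eq ψ y o)))
                  , upd-eq (upd ψ y o) z f , trans (upd-ne (upd ψ y o) (λ q → ~-irr zy (sym q))) (upd-eq ψ y o)
                  , λ _ vz vy → trans (upd-ne (upd ψ y o) vz) (upd-ne ψ vy)

              ∈z : ∀ {o} → o ≡ a ⊎ o ≡ b → o ∈ L z
              ∈z (inj₁ refl) = proj₁ (proj₁ S.Lz)
              ∈z (inj₂ refl) = proj₁ (proj₂ (proj₁ S.Lz))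
              ∈y : ∀ {o} → o ≡ a ⊎ o ≡ b → o ∈ L y
              ∈y (inj₁ refl) = proj₁ (proj₁ Ly)
              ∈y (inj₂ refl) = proj₁ (proj₂ (proj₁ Ly))
              ≢e : ∀ {o} → o ≡ a ⊎ o ≡ b → o ≢ e
              ≢e (inj₁ refl) = proj₁ (proj₂ (proj₁ (proj₂ S.Lz)))
              ≢e (inj₂ refl) = proj₂ (proj₂ (proj₁ (proj₂ S.Lz)))
              ≢e₂ : ∀ {o} → o ≡ a ⊎ o ≡ b → o ≢ e₂
              ≢e₂ (inj₁ refl) = proj₁ (proj₂ (proj₁ (proj₂ Lz₂)))
              ≢e₂ (inj₂ refl) = proj₂ (proj₂ (proj₁ (proj₂ Lz₂)))
              ≢' : ∀ {o o'} → o ≡ a ⊎ o ≡ b → o' ≡ a' ⊎ o' ≡ b' → o ≢ o'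
              ≢' (inj₁ refl) (inj₁ refl) = proj₁ (proj₁ ap)
              ≢' (inj₁ refl) (inj₂ refl) = proj₂ (proj₁ ap)
              ≢' (inj₂ refl) (inj₁ refl) = proj₁ (proj₂ ap)
              ≢' (inj₂ refl) (inj₂ refl) = proj₂ (proj₂ ap)

              Vals : (Fin n → ℕ) → ℕ → Set
              Vals ψ o = Σ (Fin n → ℕ) λ ψ' → F (ψ' q₁) (ψ' q₂) × ψ' y ≡ o × (∀ v → v ≢ z → v ≢ y → ψ' v ≡ ψ v)

              -- The colour `e₂` at `z₂` lets `y` take whichever of `a`, `b` the hub does not use,
              -- and `z` takes `e`.
              near : ∀ {ψ} → Col H' (Off L x x) ψ → ψ x ≡ a ⊎ ψ x ≡ b → ψ z₂ ≡ e₂ → ∃[ o ] ((o ≡ a ⊎ o ≡ b) × o ≢ ψ x × Vals ψ o)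
              near {ψ} C hx hz = case other ab (ψ x) of λ (o , oab , ox) → o , oab , ox ,
                (case put C (∈y oab) (proj₂ (proj₂ (proj₁ S.Lz))) ox (λ q → ≢e₂ oab (trans q hz)) (λ q → ≢e hx (sym q)) (λ q → ≢e oab (sym q)) of λ (C' , cz , cy , cv) →
                  _ , S.realised C' (subst (λ t → t ≡ a ⊎ t ≡ b) (sym (cv x (λ q → x≢B S.Bz (sym q)) (λ q → x≢B By (sym q)))) hx) cz , cy , cv)

              -- While the hub stays outside {a, b}, these two colours serve for `y` and `z`, with
              -- `y` avoiding the colour of `z₂`.
              far : ∀ {ψ} → Col H' (Off L x x) ψ → ψ x ≡ a' ⊎ ψ x ≡ b' → ψ z' ≡ e' → ∃[ o ] ((o ≡ a ⊎ o ≡ b) × o ≢ ψ z₂ × Vals ψ o)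
              far {ψ} C hx hz = case other ab (ψ z₂) of λ (o , oab , oz) → o , oab , oz , (case other ab o of λ (f , fab , fo) →
                case put C (∈y oab) (∈z fab) (≢' oab hx) oz (≢' fab hx) fo of λ (C' , cz , cy , cv) →
                  _ , S'.realised C' (subst (λ t → t ≡ a' ⊎ t ≡ b') (sym (cv x (λ q → x≢B S.Bz (sym q)) (λ q → x≢B By (sym q)))) hx) (trans (cv z' z'≢z z'≢y) hz) , cy , cv)

              Ox' : Out H' x
              Ox' = mono H'H H'x Ox
              Oz₂ : Out H' z₂
              Oz₂ = mono H'H H'z₂ (HB Hz₂ Bz₂)

              done : Conf F
              done = case Q? y of λ where
                  (no nQy) → again size (hub' nQy) (side nQy) (side' nQy)
                  (yes Qy) → finish Qy
                where
                size : sz H' < sz H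
                size = sz-strict {X = H'} {H} {z} H'H S.Hz λ h → -ne (-out h) refl
                module _ (nQy : ¬ Q y) where
                  q≢ : ∀ {v} → Q v → v ≢ z × v ≢ y
                  q≢ q = (λ { refl → nQ q }) , (λ { refl → nQy q })
                  hub' : Hub H'
                  hub' = record { HX = λ h → HX (H'H h) ; Hp = λ h → Hp (H'H h) ; small = ℕₚ.<-trans size small ; Ox = Ox' ; HQ = λ q → in' (HQ q) (proj₁ (q≢ q)) (proj₂ (q≢ q)) }
                  keep : ∀ {ψ o} → Vals ψ o → F (ψ q₁) (ψ q₂)
                  keep (ψ' , f , _ , h) = subst₂ F (h q₁ (proj₁ (q≢ (inj₁ refl))) (proj₂ (q≢ (inj₁ refl)))) (h q₂ (proj₁ (q≢ (inj₂ refl))) (proj₂ (q≢ (inj₂ refl)))) f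
                  side : Side H' z₂ y a b e₂
                  side = record { Hz = H'z₂ ; Bz = Bz₂ ; Bzp = By ; Hzp = λ h → -ne h refl ; zpz = ~-sym z₂y ; zpx = ~-sym xy ; zx = z₂x ; Lz = Lz₂
                    ; realised = λ C hx hz → keep {o = proj₁ (near C hx hz)} (proj₂ (proj₂ (proj₂ (near C hx hz)))) }
                  side' : Side H' z' zp' a' b' e'
                  side' = record { Hz = H'z' ; Bz = S'.Bz ; Bzp = S'.Bzp ; Hzp = λ h → S'.Hzp (H'H h) ; zpz = S'.zpz ; zpx = S'.zpx ; zx = S'.zx ; Lz = S'.Lz
                    ; realised = λ C hx hz → keep {o = proj₁ (far C hx hz)} (proj₂ (proj₂ (proj₂ (far C hx hz)))) }
                finish : Q y → Conf F
                -- The target is now the edge of `y` and `z₂`. Both colours of the pair occur at `y`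
                -- together with `e₂` at `z₂`; one more colouring, with the hub coloured from the
                -- other side, puts the pair itself on the target and adds a star at `y`.
                finish Qy = case vals of λ (ω , ωab , o , oab , oω , h) → unorient Qy Qz₂ yz₂
                    (st₂ e₂ , st₁ o , tt , (a , b , ab , at-e₂ (inj₁ refl) , at-e₂ (inj₂ refl)) , (e₂ , ω , (λ q → ≢e₂ ωab (sym q)) , at-e₂ oab , h))
                  where
                  yz₂ : y ≢ z₂
                  yz₂ q = ~-irr z₂y (sym q)
                  Qz₂ : Q z₂
                  Qz₂ = partner Qy
                    where
                    via : ∀ {v} → Q v → y ~ v → v ≡ z₂
                    via Qv yv = case third By S.Bz Bz₂ (Q-B Qv) (~-sym zy) (~-sym z₂y) yv (λ q → z₂z (sym q)) of λ where
                      (inj₁ refl) → ⊥-elim (nQ Qv)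
                      (inj₂ q) → q
                    partner : Q y → Q z₂
                    partner (inj₁ refl) = inj₂ (sym (via (inj₂ refl) q~))
                    partner (inj₂ refl) = inj₁ (sym (via (inj₁ refl) (~-sym q~)))
                  value : ∀ {ψ o} → Vals ψ o → Oriented F y z₂ o (ψ z₂)
                  value (ψ' , f , h , h') = subst₂ (Oriented F y z₂) h (h' z₂ z₂z (λ q → yz₂ (sym q))) (orient {F} ψ' Qy Qz₂ yz₂ f)
                  at-e₂ : ∀ {ω} → ω ≡ a ⊎ ω ≡ b → Oriented F y z₂ ω e₂
                  at-e₂ {ω} ωab = case other ab ω of λ (o , oab , oω) →
                    case paint {H'} {L} {x} {z₂} {z'} {o} {e₂} {a' ∷ b' ∷ e' ∷ []} (regY H'H) Ox' Oz₂ (~-sym z₂x) (≢e₂ oab)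
                      (let (p , q , r) = proj₁ (proj₂ S'.Lz) in uniq₃ p q r) ℕₚ.≤-refl (mono H'H H'z' (HB S'.Hz S'.Bz)) (x≢B S'.Bz) z'≢z₂ of λ (ψ , C , ex , ez , h') →
                    case near (Col-lists (λ {u} _ h ux _ → case (u ≟ z₂) ,′ (u ≟ z') of λ where
                        (yes refl , _) → subst (_∈ L u) (sym ez) (proj₂ (proj₂ (proj₁ Lz₂)))
                        (_ , yes refl) → in-z' h'
                        (no p , no q) → h ux p q) C) (subst (λ t → t ≡ a ⊎ t ≡ b) (sym ex) oab) ez of λ (o' , o'ab , o'x , V) →
                    subst₂ (Oriented F y z₂) (same oab ωab o'ab oω λ q → o'x (trans q (sym ex))) ez (value V)
                    where
                    in-z' : ∀ {t} → t ∈ a' ∷ b' ∷ e' ∷ [] → t ∈ L z'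
                    in-z' (here refl) = proj₁ (proj₁ S'.Lz)
                    in-z' (there (here refl)) = proj₁ (proj₂ (proj₁ S'.Lz))
                    in-z' (there (there (here refl))) = proj₂ (proj₂ (proj₁ S'.Lz))
                    same : ∀ {o ω o'} → o ≡ a ⊎ o ≡ b → ω ≡ a ⊎ ω ≡ b → o' ≡ a ⊎ o' ≡ b → o ≢ ω → o' ≢ o → o' ≡ ω
                    same (inj₁ refl) (inj₁ refl) _ ne _ = ⊥-elim (ne refl)
                    same (inj₂ refl) (inj₂ refl) _ ne _ = ⊥-elim (ne refl)
                    same (inj₁ refl) (inj₂ refl) (inj₁ refl) _ ne = ⊥-elim (ne refl)
                    same (inj₁ refl) (inj₂ refl) (inj₂ refl) _ _ = refl
                    same (inj₂ refl) (inj₁ refl) (inj₁ refl) _ _ = refl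
                    same (inj₂ refl) (inj₁ refl) (inj₂ refl) _ ne = ⊥-elim (ne refl)
                  vals : ∃[ ω ] ((ω ≡ a ⊎ ω ≡ b) × ∃[ o ] ((o ≡ a ⊎ o ≡ b) × o ≢ ω × Oriented F y z₂ o ω))
                  -- The hub has colour `a'`, so the artificial list {a, b, a'} steers `z₂` into {a,
                  -- b}.
                  vals = case paint {H'} {L} {x} {z'} {z₂} {a'} {e'} {a ∷ b ∷ a' ∷ []} (regY H'H) Ox' (mono H'H H'z' (HB S'.Hz S'.Bz)) (~-sym S'.zx) (proj₁ (proj₂ (proj₁ (proj₂ S'.Lz))))
                      (uniq₃ ab (proj₁ (proj₁ ap)) (proj₁ (proj₂ ap))) ℕₚ.≤-refl Oz₂ (x≢B Bz₂) (λ q → z'≢z₂ (sym q)) of λ (ψ , C , ex , ez' , h₂) →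
                    case list₃ h₂ (λ q → C .prp H'x H'z₂ (~-sym z₂x) (trans ex (sym q))) of λ ωab →
                    case far (Col-lists (λ {u} _ h ux _ → case (u ≟ z') ,′ (u ≟ z₂) of λ where
                        (yes refl , _) → subst (_∈ L u) (sym ez') (proj₂ (proj₂ (proj₁ S'.Lz)))
                        (_ , yes refl) → in-z₂ ωab
                        (no p , no q) → h ux p q) C) (inj₁ ex) ez' of λ (o , oab , oz , V) → ψ z₂ , ωab , o , oab , oz , value V
                    where
                    in-z₂ : ∀ {t} → t ≡ a ⊎ t ≡ b → t ∈ L z₂
                    in-z₂ (inj₁ refl) = proj₁ (proj₁ Lz₂)
                    in-z₂ (inj₂ refl) = proj₁ (proj₂ (proj₁ Lz₂))

            -- A democracy on `x` and `y` is not at the target, because `x` is not in `B`, so it has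
            -- an apex; lists of three colours force `y` and the apex into `B`.
            advance : Conf F
            advance = case gov ih {H} {L} {q₁} {q₂} (star z x e (a ∷ b ∷ [])) small can valid of λ where
                (inj₁ cf) → Conf-mono lift cf
                (inj₂ (s' , en , _ , st)) → case starNorm st (λ Hy yz yx → proj₁ (regH Hy) , Reg-3≤ {L = L} (regH Hy)) of λ where
                  (inj₁ eq) → ⊥-elim (nQ (case en of λ { (inj₁ (r , _)) → inj₁ (trans (sym eq) r) ; (inj₂ (r , _)) → inj₂ (trans (sym eq) r) }))
                  (inj₂ (u₁ , u₂ , a₀ , b₀ , zu₁ , zu₂ , u₁₂ , H₁ , H₂ , f₁ , f₂ , r)) → triangle en zu₁ zu₂ u₁₂ H₁ H₂ f₁ f₂ r
              where
              can : Can H L z x q₁ q₂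
              can = record { out₁ = HB S.Hz S.Bz ; out₂ = Ox ; p-adj = S.zx ; outq₁ = HB (HQ (inj₁ refl)) Bq₁ ; outq₂ = HB (HQ (inj₂ refl)) Bq₂ ; q-adj = q~ ; reg = λ Hv _ _ → regH Hv }
              valid : Valid (star z x e (a ∷ b ∷ []))
              valid = uniq₂ ab , s≤s (s≤s z≤n) , λ { (here q) → proj₁ (proj₂ (proj₁ (proj₂ S.Lz))) (sym q) ; (there (here q)) → proj₂ (proj₂ (proj₁ (proj₂ S.Lz))) (sym q) }
              lift : ∀ {s t} → Ext H L z x ⟪ star z x e (a ∷ b ∷ []) ⟫ q₁ q₂ s t → F s t
              lift (ψ , C , (ez , ex) , refl , refl) = S.realised (Col-lists (λ {u} _ h ux _ → case u ≟ z of λ where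
                (yes refl) → subst (_∈ L u) (sym ez) (proj₂ (proj₂ (proj₁ S.Lz)))
                (no uz) → h uz ux) C) (list₂ ex) ez
              short : ∀ {v t} → H ∋ v → L v ≐₃ t → B ∋ v
              short {v} Hv l = decidable-stable (B ∋? v) λ nB → ≐₃-not-5 (proj₁ (regH Hv)) (B-no (HX Hv) nB) l
              go : ∀ {y R a₀ b₀ s'} → End s' q₁ q₂ (Ext H L z x ⟪ star z x e (a ∷ b ∷ []) ⟫ q₁ q₂) → H ∋ y → z ~ y → x ~ y → (a ∷ b ∷ []) ≐₂ (a₀ , b₀) → L y ≐₃ (a₀ , b₀ , e) → R ∋ z
                → s' ≡ dem x y a₀ b₀ ⊎ s' ≡ dem y x a₀ b₀ ⊎ ∃[ z₂ ] ∃[ e₂ ] (z₂ ~ x × z₂ ~ y × (H ∖ R) ∋ z₂ × L z₂ ≐₃ (a₀ , b₀ , e₂)) → Conf F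
              go en Hy zy xy W≐ Ly Rz (inj₁ refl) = ⊥-elim (Bx (case en of λ { (inj₁ (refl , _)) → Bq₁ ; (inj₂ (refl , _)) → Bq₂ }))
              go en Hy zy xy W≐ Ly Rz (inj₂ (inj₁ refl)) = ⊥-elim (Bx (case en of λ { (inj₁ (_ , refl , _)) → Bq₂ ; (inj₂ (_ , refl , _)) → Bq₁ }))
              go en Hy zy xy W≐ Ly Rz (inj₂ (inj₂ (z₂ , e₂ , z₂x , z₂y , Hz₂ , Lz₂))) =
                Next.done (link Hy (short Hy Ly) zy xy (perm W≐ Ly) (∖out Hz₂) (short (∖out Hz₂) Lz₂) z₂x z₂y (λ { refl → ∖no Hz₂ Rz }) (perm W≐ Lz₂))
              triangle : ∀ {u₁ u₂ a₀ b₀ s'} → End s' q₁ q₂ (Ext H L z x ⟪ star z x e (a ∷ b ∷ []) ⟫ q₁ q₂) → z ~ u₁ → z ~ u₂ → u₁ ~ u₂ → H ∋ u₁ → H ∋ u₂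
                → Free L x (a ∷ b ∷ []) u₁ a₀ b₀ e → Free L x (a ∷ b ∷ []) u₂ a₀ b₀ e
                → Steps L (H ∖ ((∅ ⊹ z ⊹ x) ∖ (∅ ⊹ u₁ ⊹ u₂))) (dem u₁ u₂ a₀ b₀) s' → Conf F
              triangle {u₁} {u₂} {a₀} {b₀} {s'} en zu₁ zu₂ u₁₂ H₁ H₂ f₁ f₂ r = split f₁ f₂
                where
                Rz : ((∅ ⊹ z ⊹ x) ∖ (∅ ⊹ u₁ ⊹ u₂)) ∋ z
                Rz = ∖in (⊹in (⊹new {X = ∅})) λ h → case pair-out h of λ { (inj₁ q) → ~-irr zu₁ q ; (inj₂ q) → ~-irr zu₂ q }
                split : Free L x (a ∷ b ∷ []) u₁ a₀ b₀ e → Free L x (a ∷ b ∷ []) u₂ a₀ b₀ e → Conf F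
                split (inj₁ (refl , _)) (inj₁ (refl , _)) = ⊥-elim (~-irr u₁₂ refl)
                split (inj₁ (refl , W≐)) (inj₂ (_ , l)) = go en H₂ zu₂ u₁₂ W≐ l Rz (case demNorm r of λ { (inj₁ q) → inj₁ q ; (inj₂ (z₂ , e₂ , p , q , h , l₂)) → inj₂ (inj₂ (z₂ , e₂ , p , q , h , l₂)) })
                split (inj₂ (_ , l)) (inj₁ (refl , W≐)) = go en H₁ zu₁ (~-sym u₁₂) W≐ l Rz (case demNorm r of λ { (inj₁ q) → inj₂ (inj₁ q) ; (inj₂ (z₂ , e₂ , p , q , h , l₂)) → inj₂ (inj₂ (z₂ , e₂ , q , p , h , l₂)) })
                split (inj₂ (_ , l₁)) (inj₂ (_ , l₂)) = ⊥-elim (at-most-two S.Bz S.Bzp (short H₁ l₁) (short H₂ l₂) (~-sym S.zpz) zu₁ zu₂ (λ { refl → S.Hzp H₁ }) (λ { refl → S.Hzp H₂ }) (~-irr u₁₂))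

        -- Two vertices are removed at whichever end is still off the target; disjointness of the
        -- pairs is symmetric, so the sides may change roles.
        fan : ∀ j {H z zp z' zp' a b a' b' e e'} → sz H < j → Hub H → Apart a b a' b' → Side H z zp a b e → Side H z' zp' a' b' e' → Conf F
        fan (suc j) {H} {z} {zp} {z'} {zp'} lt hub ap S S' = case Q? z ,′ Q? z' of λ where
          (no nQ , _) → Advance.advance hub (opened ap S S' nQ λ lt' hub' T T' → fan j (ℕₚ.≤-trans lt' (ℕₚ.≤-pred lt)) hub' ap T T')
          (yes _ , no nQ') → Advance.advance hub (opened (apart-sym ap) S' S nQ' λ lt' hub' T T' → fan j (ℕₚ.≤-trans lt' (ℕₚ.≤-pred lt)) hub' (apart-sym ap) T T')
          (yes Qz , yes Qz') → closed hub ap S S' Qz Qz'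

      -- Wheels at the coloured vertex

      record Spoke : Set where
        constructor spoke
        field
          {w v} : Fin n
          {a₁ a₂} : ℕ
          Bw : B ∋ w
          Bv : B ∋ v
          pw : p ~ w
          pv : p ~ v
          wv : w ≢ v
          nQv : ¬ Q v
          a₁∈ : a₁ ∈ L v ⊖ c
          a₂∈ : a₂ ∈ L v ⊖ c
          a₁₂ : a₁ ≢ a₂
          T : Wheel w v a₁ a₂

      module Spoked (τ : Spoke) where
        open Spoke τ
        open Wheel T renaming (a₁∈ to a₁∈x; a₂∈ to a₂∈x)
        ab : a ≢ b
        ab = proj₁ (proj₁ (proj₂ Lz))
        x≢B : ∀ {u} → B ∋ u → u ≢ x
        x≢B Bu refl = Bx Bu

        around-p : ∀ {y} → X ∋ y → p ~ y → y ≡ w ⊎ y ≡ x ⊎ y ≡ v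
        around-p = degree-3 Bp Bw Xx Bv pw px pv wx (~-sym vx) wv
        around-w : ∀ {y} → X ∋ y → w ~ y → y ≡ p ⊎ y ≡ x ⊎ y ≡ z
        around-w = degree-3 Bw Bp Xx Bz (~-sym pw) wx wz px xz (λ q → zp (sym q))

        in-w : ∀ {o} → o ≡ a ⊎ o ≡ b → o ∈ L w ⊖ c
        in-w (inj₁ refl) = proj₁ Lw
        in-w (inj₂ refl) = proj₁ (proj₂ Lw)
        in-z : ∀ {o} → o ≡ a ⊎ o ≡ b → o ∈ L z
        in-z (inj₁ refl) = proj₁ (proj₁ Lz)
        in-z (inj₂ refl) = proj₁ (proj₂ (proj₁ Lz))
        in-x : ∀ {o} → o ≡ a ⊎ o ≡ b → o ∈ L x
        in-x (inj₁ refl) = a∈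
        in-x (inj₂ refl) = b∈
        ≢e : ∀ {o} → o ≡ a ⊎ o ≡ b → o ≢ e
        ≢e (inj₁ refl) = proj₁ (proj₂ (proj₁ (proj₂ Lz)))
        ≢e (inj₂ refl) = proj₂ (proj₂ (proj₁ (proj₂ Lz)))
        ≢a₁ : ∀ {o} → o ≡ a ⊎ o ≡ b → o ≢ a₁
        ≢a₁ (inj₁ refl) = proj₁ a≢
        ≢a₁ (inj₂ refl) = proj₁ b≢
        ≢a₂ : ∀ {o} → o ≡ a ⊎ o ≡ b → o ≢ a₂
        ≢a₂ (inj₁ refl) = proj₂ a≢
        ≢a₂ (inj₂ refl) = proj₂ b≢

        v∈L : ∀ {t} → t ≡ a₁ ⊎ t ≡ a₂ → t ∈ L v ⊖ c
        v∈L (inj₁ refl) = a₁∈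
        v∈L (inj₂ refl) = a₂∈

        module Near (Qw : Q w) where
          Y = X - p - w
          YX : Y ⊂ X
          YX h = -out (-out h)
          inY : ∀ {u} → X ∋ u → u ≢ p → u ≢ w → Y ∋ u
          inY h a b = -in (-in h a) b
          x≢p : x ≢ p
          x≢p q = ~-irr px (sym q)
          x≢w : x ≢ w
          x≢w q = ~-irr wx (sym q)
          z≢w : z ≢ w
          z≢w q = ~-irr wz (sym q)
          v≢p : v ≢ p
          v≢p q = ~-irr pv (sym q)
          Yx : Y ∋ x
          Yx = inY Xx x≢p x≢w
          Yz : Y ∋ z
          Yz = inY (B∈ Bz) zp z≢w
          Yv : Y ∋ v
          Yv = inY (B∈ Bv) v≢p (λ q → wv (sym q))
          Ox : Out Y x
          Ox = mono -out Yx (expose (B-out Bp) px Xx)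
          Oz : Out Y z
          Oz = mono YX Yz (B-out Bz)
          Ov : Out Y v
          Ov = mono YX Yv (B-out Bv)
          regY : ∀ {u} → Y ∋ u → Reg Y L u
          regY Yu = Reg-mono {L = L} YX Yu (regular (YX Yu) (-ne (-out Yu)))

          -- The other end of the target is a neighbour of `w` in `B`; these are `p` and `z`, and
          -- `p` is excluded.
          Qz : Q z
          Qz = partner Qw
            where
            via : ∀ {u} → Q u → w ~ u → u ≡ z
            via Qu wu = case third Bw Bp Bz (Q-B Qu) (~-sym pw) wz wu (λ q → zp (sym q)) of λ where
              (inj₁ refl) → ⊥-elim (case Qu of λ { (inj₁ q) → pq₁ q ; (inj₂ q) → pq₂ q })
              (inj₂ q) → q
            partner : Q w → Q z
            partner (inj₁ refl) = inj₂ (sym (via (inj₂ refl) q~))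
            partner (inj₂ refl) = inj₁ (sym (via (inj₁ refl) (~-sym q~)))

          put : ∀ {ψ o} → Col Y (∈L L) ψ → o ≡ a ⊎ o ≡ b → o ≢ ψ x → o ≢ ψ z → ψ x ≢ c → ψ v ≢ c → FF w z o (ψ z)
          put {ψ} {o} C oab ox oz xc vc = case add-p (extend {P = ∈L L} {∈L L} C (λ _ h → h) (⊖out (in-w oab)) λ Yu wu → case around-w (-out (-out Yu)) wu of λ where
                (inj₁ refl) → ⊥-elim (-ne (-out Yu) refl)
                (inj₂ (inj₁ refl)) → λ q → ox (sym q)
                (inj₂ (inj₂ refl)) → λ q → oz (sym q))
              (λ Xu pu → case around-p Xu pu of λ where
                (inj₁ refl) → λ q → ⊖ne {L w} (in-w oab) (trans (sym (upd-eq ψ w o)) q)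
                (inj₂ (inj₁ refl)) → λ q → xc (trans (sym (upd-ne ψ x≢w)) q)
                (inj₂ (inj₂ refl)) → λ q → vc (trans (sym (upd-ne ψ λ q → wv (sym q))) q)) of λ (C' , ep) →
            upd (upd ψ w o) p c , C' , ep , trans (upd-ne (upd ψ w o) λ q → ~-irr pw (sym q)) (upd-eq ψ w o) , trans (upd-ne (upd ψ w o) zp) (upd-ne ψ z≢w)

          -- While `x` has colour `α`, the list {a₁, a₂, α} steers `v` into {a₁, a₂}, which keeps it
          -- off `c`.
          stars : ∀ {α} → α ≡ a ⊎ α ≡ b → ∃[ o ] ((o ≡ a ⊎ o ≡ b) × o ≢ α × FF w z o e)
          stars {α} αab = case other ab α of λ (o , oab , oα) → o , oab , oα ,
            (case paint {Y} {L} {x} {z} {v} {α} {e} {a₁ ∷ a₂ ∷ α ∷ []} regY Ox Oz xz (≢e αab) (uniq₃ a₁₂ (λ q → ≢a₁ αab (sym q)) λ q → ≢a₂ αab (sym q)) ℕₚ.≤-refl Ov (x≢B Bv) (λ q → zv (sym q)) of λ (ψ , C , ex , ez , v∈) →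
              let v12 = list₃ v∈ (λ q → C .prp Yx Yv (~-sym vx) (trans ex (sym q))) in
              subst (FF w z o) ez (put (Col-lists (λ {u} _ h → case (u ≟ x) ,′ (u ≟ z) of λ where
                  (yes refl , _) → subst (_∈ L u) (sym ex) (in-x αab)
                  (_ , yes refl) → subst (_∈ L u) (sym ez) (proj₂ (proj₂ (proj₁ Lz)))
                  (no p , no q) → case u ≟ v of λ where
                    (yes refl) → ⊖out (v∈L v12)
                    (no r) → h p q r) C)
                oab (λ q → oα (trans q ex)) (λ q → ≢e oab (trans q ez)) (λ q → ⊖ne {L w} (in-w αab) (trans (sym ex) q)) (λ q → ⊖ne {L v} (v∈L v12) q)))

          -- With `a₁` at `x` and `a₂` at `v`, both `a` and `b` stay available for `w` and `z`.
          extra : ∃[ ω ] ((ω ≡ a ⊎ ω ≡ b) × ∃[ o ] ((o ≡ a ⊎ o ≡ b) × FF w z o ω))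
          extra = case paint {Y} {L} {x} {v} {z} {a₁} {a₂} {a ∷ b ∷ a₁ ∷ []} regY Ox Ov (~-sym vx) a₁₂ (uniq₃ ab (proj₁ a≢) (proj₁ b≢)) ℕₚ.≤-refl Oz (x≢B Bz) zv of λ (ψ , C , ex , ev , z∈) →
            case list₃ z∈ (λ q → C .prp Yx Yz xz (trans ex (sym q))) of λ zab →
            case other ab (ψ z) of λ (o , oab , oz) → ψ z , zab , o , oab ,
              put (Col-lists (λ {u} _ h → case (u ≟ x) ,′ (u ≟ v) of λ where
                  (yes refl , _) → subst (_∈ L u) (sym ex) a₁∈x
                  (_ , yes refl) → subst (_∈ L u) (sym ev) (⊖out a₂∈)
                  (no p , no q) → case u ≟ z of λ where
                    (yes refl) → in-z zab
                    (no r) → h p q r) C)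
                oab (λ q → ≢a₁ oab (trans q ex)) oz (λ q → ⊖ne {L v} a₁∈ (trans (sym ex) q)) (λ q → ⊖ne {L v} a₂∈ (trans (sym ev) q))

          conf : Conf F
          conf = case extra of λ (ω , ωab , o , oab , h) → target Qw Qz (λ q → ~-irr wz q)
              (st₂ e , st₁ o , tt , (case stars (inj₁ refl) ,′ stars (inj₂ refl) of λ ((o₁ , o₁ab , n₁ , h₁) , (o₂ , o₂ab , n₂ , h₂)) → o₁ , o₂ , apart o₁ab n₁ o₂ab n₂ , h₁ , h₂)
                , (e , ω , (λ q → ≢e ωab (sym q)) , at o oab , h))
            where
            apart : ∀ {o₁ o₂} → o₁ ≡ a ⊎ o₁ ≡ b → o₁ ≢ a → o₂ ≡ a ⊎ o₂ ≡ b → o₂ ≢ b → o₁ ≢ o₂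
            apart (inj₁ refl) n _ _ = ⊥-elim (n refl)
            apart (inj₂ refl) n (inj₁ refl) _ = λ q → ab (sym q)
            apart (inj₂ refl) n (inj₂ refl) n' = ⊥-elim (n' refl)
            at : ∀ o → o ≡ a ⊎ o ≡ b → FF w z o e
            at o (inj₁ refl) = case stars (inj₂ refl) of λ { (_ , inj₁ refl , _ , h) → h ; (_ , inj₂ refl , n , h) → ⊥-elim (n refl) }
            at o (inj₂ refl) = case stars (inj₁ refl) of λ { (_ , inj₂ refl , _ , h) → h ; (_ , inj₁ refl , n , h) → ⊥-elim (n refl) }

        -- The second wheel arises when `w` is deleted with `a` and `b` in reserve. Its hub is again
        -- `x`, the only neighbour of `p` outside `B`, and its pair avoids {a, b}.
        module Both (nQw : ¬ Q w) (T' : Wheel v w a b) where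
          module T' = Wheel T'
          x' = T'.x
          x'≡x : x' ≡ x
          x'≡x = case around-p T'.Xx T'.px of λ where
            (inj₁ q) → ⊥-elim (T'.Bx (subst (B ∋_) (sym q) Bw))
            (inj₂ (inj₁ q)) → q
            (inj₂ (inj₂ q)) → ⊥-elim (T'.Bx (subst (B ∋_) (sym q) Bv))
          z' = T'.z
          a' = T'.a
          b' = T'.b
          z'x : z' ~ x
          z'x = subst (z' ~_) x'≡x (~-sym T'.xz)
          around-v : ∀ {y} → X ∋ y → v ~ y → y ≡ p ⊎ y ≡ x ⊎ y ≡ z'
          around-v = degree-3 Bv Bp Xx T'.Bz (~-sym pv) vx T'.wz px (~-sym z'x) (λ q → T'.zp (sym q))
          H = X - p - w - v
          inH : ∀ {u} → X ∋ u → u ≢ p → u ≢ w → u ≢ v → H ∋ u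
          inH h a b d = -in (-in (-in h a) b) d
          HX : H ⊂ X
          HX h = -out (-out (-out h))
          Hx : H ∋ x
          Hx = inH Xx (λ q → ~-irr px (sym q)) (λ q → ~-irr wx (sym q)) (λ q → ~-irr vx (sym q))
          q∉ : ∀ {u} → Q u → u ≢ p × u ≢ w × u ≢ v
          q∉ q = (λ { refl → case q of λ { (inj₁ r) → pq₁ r ; (inj₂ r) → pq₂ r } }) , (λ { refl → nQw q }) , (λ { refl → nQv q })
          a'b' : a' ≢ b'
          a'b' = proj₁ (proj₁ (proj₂ T'.Lz))
          in-v : ∀ {o} → o ≡ a' ⊎ o ≡ b' → o ∈ L v ⊖ c
          in-v (inj₁ refl) = proj₁ T'.Lw
          in-v (inj₂ refl) = proj₁ (proj₂ T'.Lw)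
          in-x' : ∀ {o} → o ≡ a' ⊎ o ≡ b' → o ∈ L x
          in-x' (inj₁ refl) = subst (λ t → a' ∈ L t) x'≡x T'.a∈
          in-x' (inj₂ refl) = subst (λ t → b' ∈ L t) x'≡x T'.b∈
          ≢e' : ∀ {o} → o ≡ a' ⊎ o ≡ b' → o ≢ T'.e
          ≢e' (inj₁ refl) = proj₁ (proj₂ (proj₁ (proj₂ T'.Lz)))
          ≢e' (inj₂ refl) = proj₂ (proj₂ (proj₁ (proj₂ T'.Lz)))
          ≢' : ∀ {o o'} → o ≡ a ⊎ o ≡ b → o' ≡ a' ⊎ o' ≡ b' → o ≢ o'
          ≢' (inj₁ refl) (inj₁ refl) = λ q → proj₁ T'.a≢ (sym q)
          ≢' (inj₁ refl) (inj₂ refl) = λ q → proj₁ T'.b≢ (sym q)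
          ≢' (inj₂ refl) (inj₁ refl) = λ q → proj₂ T'.a≢ (sym q)
          ≢' (inj₂ refl) (inj₂ refl) = λ q → proj₂ T'.b≢ (sym q)

          put : ∀ {ψ o o'} → Col H (Off L x x) ψ → ψ x ∈ L x → ψ x ≢ c → o ≡ a ⊎ o ≡ b → o' ≡ a' ⊎ o' ≡ b' → o ≢ ψ x → o ≢ ψ z → o' ≢ ψ x → o' ≢ ψ z' → F (ψ q₁) (ψ q₂)
          put {ψ} {o} {o'} C x∈ xc oab o'ab ox oz o'x o'z = case add-p C₂ (λ Xu pu → case around-p Xu pu of λ where
                (inj₁ refl) → λ q → ⊖ne {L w} (in-w oab) (trans (sym (upd-eq ψ₁ w o)) q)
                (inj₂ (inj₁ refl)) → λ q → xc (trans (sym (trans (upd-ne ψ₁ x≢w) (upd-ne ψ x≢v))) q)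
                (inj₂ (inj₂ refl)) → λ q → ⊖ne {L v} (in-v o'ab) (trans (sym (trans (upd-ne ψ₁ (λ r → wv (sym r))) (upd-eq ψ v o'))) q)) of λ (C' , ep) →
              upd ψ₂ p c , C' , ep , keep (q∉ (inj₁ refl)) , keep (q∉ (inj₂ refl))
            where
            x≢w : x ≢ w
            x≢w q = ~-irr wx (sym q)
            x≢v : x ≢ v
            x≢v q = ~-irr vx (sym q)
            ψ₁ = upd ψ v o'
            ψ₂ = upd ψ₁ w o
            keep : ∀ {u} → u ≢ p × u ≢ w × u ≢ v → upd ψ₂ p c u ≡ ψ u
            keep (up , uw , uv) = trans (upd-ne ψ₂ up) (trans (upd-ne ψ₁ uw) (upd-ne ψ uv))
            C₀ : Col H (∈L L) ψ
            C₀ = Col-lists (λ {u} _ h → case u ≟ x of λ where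
              (yes refl) → x∈
              (no ne) → h ne ne) C
            C₁ : Col (X - p - w) (∈L L) ψ₁
            C₁ = extend {P = ∈L L} {∈L L} C₀ (λ _ h → h) (⊖out (in-v o'ab)) λ Hu vu → case around-v (HX Hu) vu of λ where
              (inj₁ refl) → ⊥-elim (-ne (-out (-out Hu)) refl)
              (inj₂ (inj₁ refl)) → λ q → o'x (sym q)
              (inj₂ (inj₂ refl)) → λ q → o'z (sym q)
            C₂ : Col (X - p) (∈L L) ψ₂
            C₂ = extend {P = ∈L L} {∈L L} C₁ (λ _ h → h) (⊖out (in-w oab)) λ Yu wu → case around-w (-out (-out Yu)) wu of λ where
              (inj₁ refl) → ⊥-elim (-ne (-out Yu) refl)
              (inj₂ (inj₁ refl)) → λ q → ox (trans (sym q) (upd-ne ψ x≢v))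
              (inj₂ (inj₂ refl)) → λ q → oz (trans (sym q) (upd-ne ψ zv))

          hub : Fan.Hub x Bx H
          hub = record { HX = HX ; Hp = λ h → -ne (-out (-out h)) refl ; small = less HX (B∈ Bp) (λ h → -ne (-out (-out h)) refl)
            ; Ox = mono (λ h → -out (-out h)) Hx (expose (B-out Bp) px Xx)
            ; HQ = λ q → inH (B∈ (Q-B q)) (proj₁ (q∉ q)) (proj₁ (proj₂ (q∉ q))) (proj₂ (proj₂ (q∉ q))) }

          side : Fan.Side x Bx H z w a b e
          side = record { Hz = inH (B∈ Bz) zp (λ q → ~-irr wz (sym q)) zv ; Bz = Bz ; Bzp = Bw ; Hzp = λ h → -ne (-out h) refl ; zpz = wz ; zpx = wx ; zx = ~-sym xz ; Lz = Lz
            ; realised = λ {ψ} C hx hz → case other ab (ψ x) ,′ other a'b' (ψ z') of λ ((o , oab , ox) , (o' , o'ab , o'z)) →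
                put C (in-x hx) (⊖ne {L w} (in-w hx)) oab o'ab ox (λ q → ≢e oab (trans q hz)) (λ q → ≢' hx o'ab (sym q)) o'z }

          side' : Fan.Side x Bx H z' v a' b' T'.e
          side' = record { Hz = inH (B∈ T'.Bz) T'.zp T'.zv (λ q → ~-irr T'.wz (sym q)) ; Bz = T'.Bz ; Bzp = Bv ; Hzp = λ h → -ne h refl ; zpz = T'.wz ; zpx = vx ; zx = z'x ; Lz = T'.Lz
            ; realised = λ {ψ} C hx hz → case other ab (ψ z) ,′ other a'b' (ψ x) of λ ((o , oab , oz) , (o' , o'ab , o'x)) →
                put C (in-x' hx) (⊖ne {L v} (in-v hx)) oab o'ab (≢' oab hx) oz o'x (λ q → ≢e' o'ab (trans q hz)) }

          conf : Conf F
          conf = Fan.fan x Bx (suc (sz H)) ℕₚ.≤-refl hub ((≢' (inj₁ refl) (inj₁ refl) , ≢' (inj₁ refl) (inj₂ refl)) , (≢' (inj₂ refl) (inj₁ refl) , ≢' (inj₂ refl) (inj₂ refl))) side side'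

      -- If the deletion of `v` fails, the wheel either already reaches the target at `w` or
      -- supplies the colours to be reserved when `w` is deleted instead. If that fails too, the two
      -- wheels share their hub and form a fan.
      two-neighbours : ∀ {w v} → B ∋ w → B ∋ v → p ~ w → p ~ v → w ≢ v → ¬ Q v → Conf F
      two-neighbours {w} {v} Bw Bv pw pv wv nQv = case pick2 (⊖uniq {L v} {c} (proj₁ Lv)) (⊖len {L v} {c} (proj₁ Lv) (Reg-3≤ {L = L} Lv)) of λ (a₁ , a₂ , a₁∈ , a₂∈ , a₁₂) →
          case wheel Bw Bv pw pv wv nQv a₁∈ a₂∈ a₁₂ of λ where
            (inj₁ cf) → cf
            (inj₂ T) → case Q? w of λ where
              (yes Qw) → Spoked.Near.conf (spoke Bw Bv pw pv wv nQv a₁∈ a₂∈ a₁₂ T) Qw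
              (no nQw) → case wheel Bv Bw pv pw (λ q → wv (sym q)) nQw (proj₁ (Wheel.Lw T)) (proj₁ (proj₂ (Wheel.Lw T))) (proj₁ (proj₂ (proj₂ (Wheel.Lw T)))) of λ where
                (inj₁ cf) → cf
                (inj₂ T') → Spoked.Both.conf (spoke Bw Bv pw pv wv nQv a₁∈ a₂∈ a₁₂ T) nQw T'
        where
        Lv = regular (B∈ Bv) λ q → ~-irr pv (sym q)

    -- Alternately coloured paths grown from a democracy

    record Seeds : Set where
      constructor seeds
      field
        L : Lists
        p₁ p₂ : Fin n
        a b : ℕ
        ab : a ≢ b
        B₁ : B ∋ p₁
        B₂ : B ∋ p₂
        p₁₂ : p₁ ~ p₂
        L₁ : a ∈ L p₁ × b ∈ L p₁
        L₂ : a ∈ L p₂ × b ∈ L p₂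
        regular : ∀ {v} → X ∋ v → v ≢ p₁ → v ≢ p₂ → Reg X L v
        B-no : ∀ {v} → X ∋ v → ¬ B ∋ v → 5 ≤ length (L v)

    module Alternation (δ : Seeds) where
      open Seeds δ

      FF : Fin n → Fin n → Rel
      FF r s x y = ∃[ ψ ] (Col X (∈L L) ψ × ψ r ≡ x × ψ s ≡ y)

      F : Rel
      F = FF q₁ q₂

      target : ∀ {r s} → Q r → Q s → r ≢ s → Conf (FF r s) → Conf F
      target (inj₁ refl) (inj₁ refl) ne h = ⊥-elim (ne refl)
      target (inj₁ refl) (inj₂ refl) ne h = h
      target (inj₂ refl) (inj₁ refl) ne h = Conf-mono (λ (ψ , a , d , e) → ψ , a , e , d) (Confᵀ h)
      target (inj₂ refl) (inj₂ refl) ne h = ⊥-elim (ne refl)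

      AB : ℕ → Set
      AB o = o ≡ a ⊎ o ≡ b

      -- The vertices of D are coloured a or b; both colours are removed from the long lists next to D.
      module Paste (D : VSet n) (DB : D ⊂ B) where
        N? : ∀ v → Dec (¬ B ∋ v × ∃[ u ] (D ∋ u × u ~ v))
        N? v = ¬? (B ∋? v) ×-dec any? (λ u → (D ∋? u) ×-dec (u ~? v))
        L' = drop ⟦ N? ⟧ a b L
        Y = X ∖ D

        Out-Y : ∀ {v} → Y ∋ v → B ∋ v → Out Y v
        Out-Y Yv Bv = mono ∖out Yv (B-out Bv)

        on-B : ∀ {v} → B ∋ v → L' v ≡ L v
        on-B Bv = drop-off {⟦ N? ⟧} {L = L} λ h → proj₁ (⟦⟧out {P? = N?} h) Bv

        reg' : ∀ {v} → Y ∋ v → v ≢ p₁ → v ≢ p₂ → Reg Y L' v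
        reg' {v} Yv v₁ v₂ = case N? v of λ where
          (yes (nB , u , Du , uv)) → drop-Reg-on {L = L} (⟦⟧in (nB , u , Du , uv)) (proj₁ (regular (∖out Yv) v₁ v₂)) (B-no (∖out Yv) nB)
            (mono (λ h → -in (∖out h) λ { refl → ∖no h Du }) Yv (expose (B-out (DB Du)) uv (∖out Yv)))
          (no nN) → drop-Reg-off {L = L} (λ h → nN (⟦⟧out {P? = N?} h)) (Reg-mono {L = L} ∖out Yv (regular (∖out Yv) v₁ v₂))

        paste : ∀ {ψ κ} → Col Y (∈L L') ψ → (∀ {u} → D ∋ u → κ u ∈ L u × AB (κ u)) → (∀ {u v} → D ∋ u → D ∋ v → u ~ v → κ u ≢ κ v)
          → (∀ {u v} → D ∋ u → Y ∋ v → B ∋ v → u ~ v → κ u ≢ ψ v) → Col X (∈L L) (glued D ψ κ)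
        paste {ψ} {κ} C κ∈ κp bd = glue {P = ∈L L} (Col-lists {P = ∈L L'} {∈L L} (λ _ → drop-⊆ {⟦ N? ⟧} {L = L}) C) (col (λ Du → proj₁ (κ∈ Du)) κp)
          λ {u} {v} Du Xv nD uv → case B ∋? v of λ where
            (yes Bv) → bd Du (∖in Xv nD) Bv uv
            (no nB) → λ q → let (x , y) = drop-≢ {⟦ N? ⟧} {L = L} (⟦⟧in (nB , u , Du , uv)) (C .lst (∖in Xv nD)) in case proj₂ (κ∈ Du) of λ where
              (inj₁ e) → x (trans (sym q) e)
              (inj₂ e) → y (trans (sym q) e)

      -- A path in B with ends el and er, all of whose lists contain a and b; l and r are its neighbours in B.
      record Alt (D : VSet n) (χ : Fin n → Bool) (el er : Fin n) (l r : Maybe (Fin n)) : Set where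
        field
          DB : D ⊂ B
          has : ∀ {v} → D ∋ v → a ∈ L v × b ∈ L v
          alt : ∀ {u v} → D ∋ u → D ∋ v → u ~ v → χ u ≢ χ v
          Del : D ∋ el
          Der : D ∋ er
          conn : Walk D el er
          lB : ∀ {y} → l ≡ just y → B ∋ y × ¬ D ∋ y × el ~ y
          rB : ∀ {y} → r ≡ just y → B ∋ y × ¬ D ∋ y × er ~ y
          front : ∀ {u y} → D ∋ u → ¬ D ∋ y → B ∋ y → u ~ y → (u ≡ el × l ≡ just y) ⊎ (u ≡ er × r ≡ just y)
          ends : el ≡ er → l ≢ r

      flip : ∀ {D χ el er l r} → Alt D χ el er l r → Alt D χ er el r l
      flip A = record { DB = DB ; has = has ; alt = alt ; Del = Der ; Der = Del ; conn = Wrev conn ; lB = rB ; rB = lB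
          ; front = λ Du Dy By uy → case front Du Dy By uy of λ { (inj₁ h) → inj₂ h ; (inj₂ h) → inj₁ h } ; ends = λ e q → ends (sym e) (sym q) }
        where open Alt A

      -- The two alternating colourings of the path, one for each value of `s`.
      κ : (Fin n → Bool) → Bool → Fin n → ℕ
      κ χ s v = if χ v xor s then a else b

      κ-AB : ∀ χ s v → AB (κ χ s v)
      κ-AB χ s v with χ v xor s
      ... | true = inj₁ refl
      ... | false = inj₂ refl

      κ-≢ : ∀ {χ u v} s → χ u ≢ χ v → κ χ s u ≢ κ χ s v
      κ-≢ {χ} {u} {v} s ne with χ u | χ v | s
      ... | true | true | _ = ⊥-elim (ne refl)
      ... | false | false | _ = ⊥-elim (ne refl)
      ... | true | false | false = ab
      ... | true | false | true = λ q → ab (sym q)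
      ... | false | true | false = λ q → ab (sym q)
      ... | false | true | true = ab

      κ-≡ : ∀ {χ u v} s → χ u ≡ χ v → κ χ s u ≡ κ χ s v
      κ-≡ s e = cong (λ t → if t xor s then a else b) e

      κ-pick : ∀ χ v {o} → AB o → ∃[ s ] κ χ s v ≡ o
      κ-pick χ v (inj₁ refl) with χ v
      ... | true = false , refl
      ... | false = true , refl
      κ-pick χ v (inj₂ refl) with χ v
      ... | true = true , refl
      ... | false = false , refl

      κ-not : ∀ χ s v → κ χ (not s) v ≢ κ χ s v
      κ-not χ s v with χ v | s
      ... | true | true = ab
      ... | true | false = λ q → ab (sym q)
      ... | false | true = λ q → ab (sym q)
      ... | false | false = ab

      AB-two : ∀ {o o' t} → AB o → AB o' → o ≢ o' → AB t → t ≡ o ⊎ t ≡ o'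
      AB-two (inj₁ refl) (inj₁ refl) ne _ = ⊥-elim (ne refl)
      AB-two (inj₂ refl) (inj₂ refl) ne _ = ⊥-elim (ne refl)
      AB-two (inj₁ refl) (inj₂ refl) ne t = t
      AB-two (inj₂ refl) (inj₁ refl) ne (inj₁ e) = inj₂ e
      AB-two (inj₂ refl) (inj₁ refl) ne (inj₂ e) = inj₁ e

      pick-AB : ∀ {P : ℕ → Set} {o} → AB o → P a → P b → P o
      pick-AB (inj₁ refl) p q = p
      pick-AB (inj₂ refl) p q = q

      step : ∀ {D χ el er r y} → Alt D χ el er (just y) r → a ∈ L y → b ∈ L y → just y ≢ r
        → ∃[ l' ] Alt (D ⊹ y) (upd χ y (not (χ el))) y er l' r
      step {D} {χ} {el} {er} {r} {y} A a∈ b∈ yr = case any? (λ u → (B ∋? u) ×-dec ¬? ((D ⊹ y) ∋? u) ×-dec (y ~? u)) of λ where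
          (yes (u , Bu , nu , yu)) → just u , mk-alt (λ { refl → Bu , nu , yu })
            (λ {w} Bw nw yw → case third By (DB Del) Bu Bw (~-sym ely) yu yw (λ { refl → nu (⊹in Del) }) of λ where
              (inj₁ refl) → ⊥-elim (nw (⊹in Del))
              (inj₂ refl) → refl)
          (no none) → nothing , mk-alt (λ ()) (λ {w} Bw nw yw → ⊥-elim (none (w , Bw , nw , yw)))
        where
        open Alt A
        By = proj₁ (lB refl)
        Dy = proj₁ (proj₂ (lB refl))
        ely = proj₂ (proj₂ (lB refl))
        χ' = upd χ y (not (χ el))
        only : ∀ {u} → D ∋ u → u ~ y → u ≡ el
        only Du uy = case front Du Dy By uy of λ where
          (inj₁ (e , _)) → e
          (inj₂ (_ , e)) → ⊥-elim (yr (sym e))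
        off : ∀ {u} → D ∋ u → u ≢ y
        off Du refl = Dy Du
        splits : ∀ {u} → (D ⊹ y) ∋ u → u ≡ y ⊎ D ∋ u
        splits {u} h = case u ≟ y of λ where
          (yes e) → inj₁ e
          (no ne) → inj₂ (⊹out {X = D} h ne)
        alt' : ∀ {u v} → (D ⊹ y) ∋ u → (D ⊹ y) ∋ v → u ~ v → χ' u ≢ χ' v
        alt' {u} {v} hu hv uv q = case splits hu ,′ splits hv of λ where
          (inj₁ refl , inj₁ refl) → ~-irr uv refl
          (inj₁ refl , inj₂ Dv) → not-self (χ el) (trans (sym (upd-eq χ u (not (χ el)))) (trans q (trans (upd-ne χ (off Dv)) (cong χ (only Dv (~-sym uv))))))
          (inj₂ Du , inj₁ refl) → not-self (χ el) (trans (sym (upd-eq χ v (not (χ el)))) (trans (sym q) (trans (upd-ne χ (off Du)) (cong χ (only Du uv)))))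
          (inj₂ Du , inj₂ Dv) → alt Du Dv uv (trans (sym (upd-ne χ (off Du))) (trans q (upd-ne χ (off Dv))))
        mk-alt : ∀ {l'} → (∀ {u} → l' ≡ just u → B ∋ u × ¬ (D ⊹ y) ∋ u × y ~ u) → (∀ {w} → B ∋ w → ¬ (D ⊹ y) ∋ w → y ~ w → l' ≡ just w) → Alt (D ⊹ y) χ' y er l' r
        mk-alt {l'} lB' fr = record
          { DB = λ h → case splits h of λ { (inj₁ refl) → By ; (inj₂ d) → DB d }
          ; has = λ h → case splits h of λ { (inj₁ refl) → a∈ , b∈ ; (inj₂ d) → has d }
          ; alt = alt' ; Del = ⊹new {X = D} ; Der = ⊹in Der
          ; conn = Wcons (⊹new {X = D}) (~-sym ely) (Wmono ⊹in conn)
          ; lB = lB'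
          ; rB = λ e → let (p , q , s) = rB e in p , (λ h → case splits h of λ { (inj₁ refl) → yr (sym e) ; (inj₂ d) → q d }) , s
          ; front = λ {u} {w} h nw Bw uw → case splits h of λ where
              (inj₁ refl) → inj₁ (refl , fr Bw nw uw)
              (inj₂ Du) → case front Du (λ d → nw (⊹in d)) Bw uw of λ where
                (inj₁ (_ , refl)) → ⊥-elim (nw (⊹new {X = D}))
                (inj₂ e) → inj₂ e
          ; ends = λ { refl → ⊥-elim (Dy Der) } }

      -- How the extension of an alternating path beyond el comes to an end.
      data Stop (l r : Maybe (Fin n)) : Set where
        weak : (∀ {y} → l ≡ just y → just y ≢ r × ∃[ o ] (AB o × ¬ o ∈ L y)) → Stop l r
        strong : ∀ {y} → l ≡ just y → Q y → just y ≢ r → a ∈ L y → b ∈ L y → Stop l r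
        closed : ∀ {y} → l ≡ just y → r ≡ just y → Stop l r

      NoQ : VSet n → Set
      NoQ D = ∀ {v} → D ∋ v → ¬ Q v

      record Grown (D : VSet n) (er : Fin n) (r : Maybe (Fin n)) : Set where
        constructor grown
        field
          {D'} : VSet n
          {χ'} : Fin n → Bool
          {el'} : Fin n
          {l'} : Maybe (Fin n)
          path : Alt D' χ' el' er l' r
          noQ : NoQ D'
          bigger : D ⊂ D'
          stop : Stop l' r

      -- The path stays inside `X`, so `j` bounds the number of further steps; it halts before it
      -- would enter the target.
      grow : ∀ j {D χ el er l r} → sz X < sz D + j → NoQ D → Alt D χ el er l r → Grown D er r
      grow zero {D} lt' nq A = ⊥-elim (ℕₚ.<⇒≱ (subst (sz X <_) (ℕₚ.+-identityʳ (sz D)) lt') (sz-mono {X = D} {X} λ h → B∈ (Alt.DB A h)))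
      grow (suc j) {l = nothing} lt' nq A = grown A nq (λ h → h) (weak λ ())
      grow (suc j) {D} {l = just y} {r} lt' nq A = case same? r of λ where
          (yes e) → grown A nq (λ h → h) (closed refl e)
          (no ne) → case (a ∈?ℕ L y) ,′ (b ∈?ℕ L y) of λ where
            (no na , _) → grown A nq (λ h → h) (weak λ { refl → (λ e → ne (sym e)) , a , inj₁ refl , na })
            (_ , no nb) → grown A nq (λ h → h) (weak λ { refl → (λ e → ne (sym e)) , b , inj₂ refl , nb })
            (yes a∈ , yes b∈) → case Q? y of λ where
              (yes Qy) → grown A nq (λ h → h) (strong refl Qy (λ e → ne (sym e)) a∈ b∈)
              (no nQ) → case step A a∈ b∈ (λ e → ne (sym e)) of λ (l' , A') →
                case grow j {D ⊹ y} (ℕₚ.≤-trans lt' (ℕₚ.≤-trans (ℕₚ.≤-reflexive (ℕₚ.+-suc (sz D) j)) (ℕₚ.+-monoˡ-≤ j (sz-strict {X = D} {D ⊹ y} {y} ⊹in (⊹new {X = D}) (proj₁ (proj₂ (Alt.lB A refl)))))))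
                    (λ {v} h → case v ≟ y of λ { (yes refl) → nQ ; (no vy) → nq (⊹out {X = D} h vy) }) A' of λ where
                  (grown A'' nq' DD st) → grown A'' nq' (λ h → DD (⊹in h)) st
        where
        same? : ∀ r → Dec (r ≡ just y)
        same? nothing = no λ ()
        same? (just z) = map′ (cong just) just-injective (z ≟ y)


      module On {D χ el er l r} (A : Alt D χ el er l r) where
        open Alt A public
        open Paste D DB public

        coloured : ∀ {ψ} s → Col Y (∈L L') ψ → (∀ {y} → l ≡ just y → ψ y ≢ κ χ s el) → (∀ {y} → r ≡ just y → ψ y ≢ κ χ s er) → Col X (∈L L) (glued D ψ (κ χ s))
        coloured s C hl hr = paste C (λ {u} Du → pick-AB {λ o → o ∈ L u} (κ-AB χ s u) (proj₁ (has Du)) (proj₂ (has Du)) , κ-AB χ s u) (λ Du Dv uv → κ-≢ {χ} s (alt Du Dv uv))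
          λ {u} {v} Du Yv Bv uv q → case front Du (∖no Yv) Bv uv of λ where
            (inj₁ (refl , e)) → hl e (sym q)
            (inj₂ (refl , e)) → hr e (sym q)

        value : ∀ {ψ u o} s → ¬ D ∋ u → ψ u ≡ o → glued D ψ (κ χ s) u ≡ o
        value {ψ} s nu e = trans (glued-off {D} {ψ} nu) e

        Y∋ : ∀ {v} → B ∋ v → ¬ D ∋ v → Y ∋ v
        Y∋ Bv nD = ∖in (B∈ Bv) nD

        list-in : ∀ {ψ y} → Col Y (∈L L') ψ → B ∋ y → ¬ D ∋ y → ψ y ∈ L y
        list-in {ψ} {y} C By nD = subst (ψ y ∈_) (on-B By) (C .lst (Y∋ By nD))

        regB : ∀ {y} → B ∋ y → ¬ D ∋ y → y ≢ p₁ → y ≢ p₂ → Unique (L y) × 3 ≤ length (L y)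
        regB By nD a b = let R = regular (B∈ By) a b in proj₁ R , Reg-3≤ {L = L} R

        two : ∀ {y} c → Unique (L y) × 3 ≤ length (L y) → ∃[ s ] ∃[ t ] (s ∈ L y ⊖ c × t ∈ L y ⊖ c × s ≢ t)
        two {y} c (u , le) = pick2 (⊖uniq {L y} {c} u) (⊖len {L y} {c} u le)

      module Inside {D χ el er l r} (A : Alt D χ el er l r) (nq : NoQ D) (D₁ : D ∋ p₁) (D₂ : D ∋ p₂) where
        open On A

        off₁ : ∀ {v} → ¬ D ∋ v → v ≢ p₁
        off₁ nv refl = nv D₁
        off₂ : ∀ {v} → ¬ D ∋ v → v ≢ p₂
        off₂ nv refl = nv D₂
        regY : ∀ {v} → Y ∋ v → Reg Y L' v
        regY Yv = reg' Yv (off₁ (∖no Yv)) (off₂ (∖no Yv))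
        outq : ∀ {v} → Q v → Out Y v
        outq Qv = Out-Y (Y∋ (Q-B Qv) λ d → nq d Qv) (Q-B Qv)
        listq : ∀ {v} → Q v → Unique (L v) × 3 ≤ length (L v)
        listq Qv = let nD = λ d → nq d Qv in regB (Q-B Qv) nD (off₁ nD) (off₂ nD)

        -- Both ends of the path carry colours absent from the lists beyond them, so the path
        -- restricts nothing in `B` and the target keeps its full lists.
        all : ∀ s → (∀ {y} → l ≡ just y → ¬ κ χ s el ∈ L y) → (∀ {y} → r ≡ just y → ¬ κ χ s er ∈ L y) → Conf F
        all s hl hr = prod₃ (proj₁ (listq (inj₁ refl))) (proj₁ (listq (inj₂ refl))) (proj₂ (listq (inj₁ refl))) (ℕₚ.≤-trans (s≤s (s≤s z≤n)) (proj₂ (listq (inj₂ refl)))) λ {x} {y} x∈ y∈ xy →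
          case thomassen {Y} {L'} {q₁} {q₂} {x} {y} (outq (inj₁ refl) , outq (inj₂ refl) , inj₂ (q~ , xy)) (λ Yv _ _ → regY Yv) of λ (ψ , C , e₁ , e₂) →
          let C' = Col-lists {P = Off L' q₁ q₂} {∈L L'} (λ {v} _ h → case (v ≟ q₁) ,′ (v ≟ q₂) of λ where
                (yes refl , _) → subst₂ _∈_ (sym e₁) (sym (on-B Bq₁)) x∈
                (_ , yes refl) → subst₂ _∈_ (sym e₂) (sym (on-B Bq₂)) y∈
                (no p , no q) → h p q) C in
          glued D ψ (κ χ s) , coloured s C' (λ e q → hl e (subst (_∈ _) q (list-in C' (proj₁ (lB e)) (proj₁ (proj₂ (lB e))))))
                                            (λ e q → hr e (subst (_∈ _) q (list-in C' (proj₁ (rB e)) (proj₁ (proj₂ (rB e))))))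
            , value s (λ d → nq d (inj₁ refl)) e₁ , value s (λ d → nq d (inj₂ refl)) e₂

        -- Only the vertex beyond the right end loses a colour; the two it keeps are enough for
        -- `two-colours`.
        one-bad : ∀ s {y} → (∀ {y'} → l ≡ just y' → y' ≢ y × ¬ κ χ s el ∈ L y') → r ≡ just y → Conf F
        one-bad s {y} hl refl = case two (κ χ s er) (regB By nD (off₁ nD) (off₂ nD)) of λ (o , t , o∈ , t∈ , ot) →
            Conf-mono (λ (ψ , C , e , e₁ , e₂) →
                let y∈ = λ {P : ℕ → Set} (p : P o) (q : P t) → case e of λ { (inj₁ r) → subst P (sym r) p ; (inj₂ r) → subst P (sym r) q }
                    C' = Col-lists {P = Off L' y y} {∈L L'} (λ {v} _ h → case v ≟ y of λ where
                      (yes refl) → subst (ψ v ∈_) (sym (on-B By)) (y∈ {_∈ L v} (⊖out o∈) (⊖out t∈))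
                      (no ne) → h ne ne) C in
                glued D ψ (κ χ s) , coloured s C' (λ f q → proj₂ (hl f) (subst (_∈ _) q (list-in C' (proj₁ (lB f)) (proj₁ (proj₂ (lB f))))))
                  (λ { refl → y∈ {_≢ κ χ s er} (⊖ne {L y} o∈) (⊖ne {L y} t∈) }) , value s (λ d → nq d (inj₁ refl)) e₁ , value s (λ d → nq d (inj₂ refl)) e₂)
              (two-colours ih {Y} {L'} {y} (less ∖out (B∈ B₁) (λ h → ∖no h D₁)) (Out-Y (Y∋ By nD) By) (outq (inj₁ refl)) (outq (inj₂ refl)) q~ ot λ Yv _ → regY Yv)
          where
          By = proj₁ (rB refl)
          nD = proj₁ (proj₂ (rB refl))

        -- Of the two alternating colourings, choose the one that gives `el` the colour missing
        -- beyond it.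
        weak-conf : (∀ {y} → l ≡ just y → just y ≢ r × ∃[ o ] (AB o × ¬ o ∈ L y)) → Conf F
        weak-conf h = by l refl r refl
          where
          perfect : ∀ l' → l ≡ l' → ∃[ s ] (∀ {y} → l ≡ just y → ¬ κ χ s el ∈ L y)
          perfect nothing refl = false , λ ()
          perfect (just y) refl = case h refl of λ (_ , o , oAB , no∈) → case κ-pick χ el oAB of λ (s , e) → s , λ { refl q → no∈ (subst (_∈ L y) e q) }
          by : ∀ l' → l ≡ l' → ∀ r' → r ≡ r' → Conf F
          by l' el' nothing er' = case perfect l' el' of λ where
            (s , g) → all s g (λ e → case trans (sym er') e of λ ())
          by l' el' (just y) er' = case perfect l' el' of λ where
            (s , g) → one-bad s (λ e → (λ { refl → proj₁ (h e) (sym er') }) , g e) er'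

        -- A third colour at `y` suits both ends of the closed path, and what remains is a star at
        -- `y`. If this star had moves, they would start at a neighbour of `y` enclosed by `y` and
        -- the path, from where no walk reaches the target.
        closed-conf : ∀ {y} → l ≡ just y → r ≡ just y → Conf F
        closed-conf {y} refl refl = case third-colour (proj₁ Ly) (proj₂ Ly) of λ (e , e∈ , ea , eb) →
            case any? (λ u → (Y ∋? u) ×-dec (y ~? u)) of λ where
              (no none) → isolated e∈ ea eb λ {u} Yu yu → none (u , Yu , yu)
              (yes (u , Yu , yu)) → case next Oy yu Yu of λ (y₀ , yy₀ , o₀) → attached e∈ ea eb yy₀ o₀
          where
          By = proj₁ (lB refl)
          nD = proj₁ (proj₂ (lB refl))
          el-y = proj₂ (proj₂ (lB refl))
          er-y = proj₂ (proj₂ (rB refl))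
          Ly = regB By nD (off₁ nD) (off₂ nD)
          Oy = Out-Y (Y∋ By nD) By
          el≢er : el ≢ er
          el≢er q = ends q refl
          nQ : ¬ Q y
          nQ Qy = case Qy of λ where
              (inj₁ refl) → bad (inj₂ refl) q~
              (inj₂ refl) → bad (inj₁ refl) (~-sym q~)
            where
            bad : ∀ {v} → Q v → y ~ v → ⊥
            bad Qv yv = case third By (DB Del) (DB Der) (Q-B Qv) (~-sym el-y) (~-sym er-y) yv el≢er of λ where
              (inj₁ refl) → nq Del Qv
              (inj₂ refl) → nq Der Qv
          not-AB : ∀ {e o} → e ≢ a → e ≢ b → AB o → e ≢ o
          not-AB ea eb (inj₁ refl) = ea
          not-AB ea eb (inj₂ refl) = eb
          done : ∀ {ψ e x z} → e ≢ a → e ≢ b → Col Y (∈L L') ψ → ψ y ≡ e → ψ q₁ ≡ x → ψ q₂ ≡ z → F x z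
          done {ψ} ea eb C ey e₁ e₂ = glued D ψ (κ χ false) , coloured false C (λ { refl q → not-AB ea eb (κ-AB χ false el) (trans (sym ey) q) })
            (λ { refl q → not-AB ea eb (κ-AB χ false er) (trans (sym ey) q) }) , value false (λ d → nq d (inj₁ refl)) e₁ , value false (λ d → nq d (inj₂ refl)) e₂
          isolated : ∀ {e} → e ∈ L y → e ≢ a → e ≢ b → (∀ {u} → Y ∋ u → ¬ y ~ u) → Conf F
          isolated {e} e∈ ea eb none = prod₃ (proj₁ (listq (inj₁ refl))) (proj₁ (listq (inj₂ refl))) (proj₂ (listq (inj₁ refl))) (ℕₚ.≤-trans (s≤s (s≤s z≤n)) (proj₂ (listq (inj₂ refl)))) λ {x} {z} x∈ z∈ xz →
            case thomassen {Y} {L'} {q₁} {q₂} {x} {z} (outq (inj₁ refl) , outq (inj₂ refl) , inj₂ (q~ , xz)) (λ Yv _ _ → regY Yv) of λ (ψ , C , e₁ , e₂) →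
            done {upd ψ y e} ea eb (extend {P = ∈L L'} {∈L L'} (Col-mono -out (Col-lists {P = Off L' q₁ q₂} {∈L L'} (λ {v} _ h → case (v ≟ q₁) ,′ (v ≟ q₂) of λ where
                (yes refl , _) → subst₂ _∈_ (sym e₁) (sym (on-B Bq₁)) x∈
                (_ , yes refl) → subst₂ _∈_ (sym e₂) (sym (on-B Bq₂)) z∈
                (no p , no q) → h p q) C)) (λ _ h → h) (subst (e ∈_) (sym (on-B By)) e∈) (λ Yu yu → ⊥-elim (none (-out Yu) yu)))
              (upd-eq ψ y e) (trans (upd-ne ψ λ { refl → nQ (inj₁ refl) }) e₁) (trans (upd-ne ψ λ { refl → nQ (inj₂ refl) }) e₂)
          attached : ∀ {e y₀} → e ∈ L y → e ≢ a → e ≢ b → y ~ y₀ → Out Y y₀ → Conf F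
          attached {e} {y₀} e∈ ea eb yy₀ o₀ = case gov ih {Y} {L'} {q₁} {q₂} (star y y₀ e (L' y₀ ⊖ e)) (less ∖out (B∈ B₁) (λ h → ∖no h D₁)) can
                (⊖uniq {L' y₀} {e} (proj₁ R₀) , ⊖len {L' y₀} {e} (proj₁ R₀) (Reg-3≤ {L = L'} R₀) , λ h → ⊖ne {L' y₀} h refl) of λ where
              (inj₁ cf) → Conf-mono (λ (ψ , C , (ey , ey₀) , e₁ , e₂) → done ea eb (Col-lists {P = Off L' y y₀} {∈L L'} (λ {v} _ h → case (v ≟ y) ,′ (v ≟ y₀) of λ where
                  (yes refl , _) → subst₂ _∈_ (sym ey) (sym (on-B By)) e∈
                  (_ , yes refl) → ⊖out {L' v} ey₀
                  (no p , no q) → h p q) C) ey e₁ e₂) cf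
              (inj₂ (s' , en , _ , st)) → case starNorm st (λ Yv vy _ → let R = regY Yv in proj₁ R , Reg-3≤ {L = L'} R) of λ where
                (inj₁ q) → ⊥-elim (nQ (subst Q q (src-Q en)))
                (inj₂ (u₁ , u₂ , _ , _ , yu₁ , yu₂ , u₁₂ , Y₁ , Y₂ , _ , _ , rest)) → ⊥-elim (surround yu₁ yu₂ Y₁ (src-Q en) (steps-walk rest (inn Y₁ (inj₁ refl) , inn Y₂ (inj₂ refl))))
            where
            R₀ = regY (out∈ o₀)
            can : Can Y L' y y₀ q₁ q₂
            can = record { out₁ = Oy ; out₂ = o₀ ; p-adj = yy₀ ; outq₁ = outq (inj₁ refl) ; outq₂ = outq (inj₂ refl) ; q-adj = q~ ; reg = λ Yv _ _ → regY Yv }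
            src-Q : ∀ {s' G} → End s' q₁ q₂ G → Q (src s')
            src-Q (inj₁ (q , _)) = inj₁ q
            src-Q (inj₂ (q , _)) = inj₂ q
            inn : ∀ {u u₁ u₂ R} → Y ∋ u → u ≡ u₁ ⊎ u ≡ u₂ → (Y ∖ (R ∖ (∅ ⊹ u₁ ⊹ u₂))) ∋ u
            inn {u} {u₁} {u₂} Yu h = ∖in Yu λ q → ∖no q (case h of λ { (inj₁ refl) → ⊹in (⊹new {X = ∅}) ; (inj₂ refl) → ⊹new {X = ∅ ⊹ u₁} })
            -- The neighbour u₁ of y lies between el and er, and so does the target edge.
            surround : ∀ {u₁ u₂ v} → y ~ u₁ → y ~ u₂ → Y ∋ u₁ → Q v → Walk (Y ∖ ((∅ ⊹ y ⊹ y₀) ∖ (∅ ⊹ u₁ ⊹ u₂))) u₁ v → ⊥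
            surround {u₁} {u₂} yu₁ yu₂ Y₁ Qv w = crossing ne nu nr bt {D} (λ h → B∈ (DB h)) nD conn (B-out (Q-B Qv))
                (Wmono (λ h → ∖in (-in (∖out (∖out h)) λ { refl → ∖no h (∖in (⊹in (⊹new {X = ∅})) λ g → case pair-out g of λ { (inj₁ q) → ~-irr yu₁ q ; (inj₂ q) → ~-irr yu₂ q }) }) (∖no (∖out h))) w)
              where
              open Around By
              ne : Nb el
              ne = B∈ (DB Del) , ~-sym el-y
              nr : Nb er
              nr = B∈ (DB Der) , ~-sym er-y
              nu : Nb u₁
              nu = ∖out Y₁ , yu₁
              u≢ : ∀ {v} → D ∋ v → u₁ ≢ v
              u≢ Dv refl = ∖no Y₁ Dv
              at : ∀ {u m} → Nb u → u ≢ m → (X - y - m) ∋ u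
              at (Xu , yu) q = -in (-in Xu λ r → ~-irr yu (sym r)) q
              bt : Btw el u₁ er
              bt = btw ne nu nr (λ q → u≢ Del (sym q)) el≢er (u≢ Der)
                (λ bb → cross₁ nu ne nr bb (B-out (DB Del)) (PC By (DB Del) (~-sym el-y) (at nu (u≢ Del)) (at nr λ q → el≢er (sym q))))
                (λ bb → cross₁ ne nr nu bb (B-out (DB Der)) (PC By (DB Der) (~-sym er-y) (at ne el≢er) (at nu (u≢ Der))))

        -- Each alternation leaves a full product of lists at the target. If both products shrink to
        -- democracies, these differ, since the colour that `y` loses in one alternation survives in
        -- the other.
        strong-both : ∀ {y y'} → l ≡ just y → r ≡ just y' → Q y → Q y' → y ≢ y' → a ∈ L y → b ∈ L y → Conf F
        strong-both {y} {y'} refl refl Qy Qy' yy' a∈ b∈ = target Qy Qy' yy' (case products false ,′ products true of λ where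
            (inj₁ cf , _) → cf
            (_ , inj₁ cf) → cf
            (inj₂ (c , d , h , h') , inj₂ (c' , d' , g , g')) → dm c d , dm c' d' , differ h g , dem-in false h h' , dem-in true g g')
          where
          By = Q-B Qy
          By' = Q-B Qy'
          nD = λ d → nq d Qy
          nD' = λ d → nq d Qy'
          Ly = listq Qy
          Ly' = listq Qy'
          one : ∀ s {x z} → x ∈ L y ⊖ κ χ s el → z ∈ L y' ⊖ κ χ s er → x ≢ z → FF y y' x z
          one s {x} {z} x∈ z∈ xz = case thomassen {Y} {L'} {y} {y'} {x} {z} (outq Qy , outq Qy' , inj₂ (Q~ Qy Qy' yy' , xz)) (λ Yv _ _ → regY Yv) of λ (ψ , C , e₁ , e₂) →
            glued D ψ (κ χ s) , coloured s (Col-lists {P = Off L' y y'} {∈L L'} (λ {v} _ h → case (v ≟ y) ,′ (v ≟ y') of λ where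
                (yes refl , _) → subst₂ _∈_ (sym e₁) (sym (on-B By)) (⊖out x∈)
                (_ , yes refl) → subst₂ _∈_ (sym e₂) (sym (on-B By')) (⊖out z∈)
                (no p , no q) → h p q) C) (λ { refl q → ⊖ne {L y} x∈ (trans (sym e₁) q) }) (λ { refl q → ⊖ne {L y'} z∈ (trans (sym e₂) q) })
              , value s nD e₁ , value s nD' e₂
          products : ∀ s → Conf (FF y y') ⊎ ∃[ c ] ∃[ d ] ((L y ⊖ κ χ s el) ≐₂ (c , d) × (L y' ⊖ κ χ s er) ≐₂ (c , d))
          products s = prod (⊖uniq (proj₁ Ly)) (⊖uniq (proj₁ Ly')) (⊖len {L y} (proj₁ Ly) (proj₂ Ly)) (⊖len {L y'} (proj₁ Ly') (proj₂ Ly')) (one s)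
          dem-in : ∀ s {c d} → (L y ⊖ κ χ s el) ≐₂ (c , d) → (L y' ⊖ κ χ s er) ≐₂ (c , d) → Has (FF y y') (dm c d)
          dem-in s (c∈ , d∈ , cd , _) (c∈' , d∈' , _) = cd , one s c∈ d∈' cd , one s d∈ c∈' λ q → cd (sym q)
          differ : ∀ {c d c' d'} → (L y ⊖ κ χ false el) ≐₂ (c , d) → (L y ⊖ κ χ true el) ≐₂ (c' , d') → Differ (dm c d) (dm c' d')
          differ (_ , _ , _ , all) (c'∈ , d'∈ , _) = λ same → case all (κ χ true el) (⊖in (pick-AB {λ o → o ∈ L y} (κ-AB χ true el) a∈ b∈) (κ-not χ false el)) ,′ same of λ where
            (inj₁ q , inj₁ (r , _)) → ⊖ne {L y} c'∈ (sym (trans q r))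
            (inj₂ q , inj₁ (_ , r)) → ⊖ne {L y} d'∈ (sym (trans q r))
            (inj₁ q , inj₂ (r , _)) → ⊖ne {L y} d'∈ (sym (trans q r))
            (inj₂ q , inj₂ (_ , r)) → ⊖ne {L y} c'∈ (sym (trans q r))

      beyond : ∀ {u v} → B ∋ u → B ∋ v → u ~ v → ∃[ l ] ((∀ {y} → l ≡ just y → B ∋ y × y ≢ v × u ~ y) × (∀ {y} → B ∋ y → u ~ y → y ≢ v → l ≡ just y))
      beyond {u} {v} Bu Bv uv = case any? (λ y → (B ∋? y) ×-dec ¬? (y ≟ v) ×-dec (u ~? y)) of λ where
        (yes (y , By , yv , uy)) → just y , (λ { refl → By , yv , uy }) , λ {w} Bw uw wv → case third Bu Bv By Bw uv uy uw (λ q → yv (sym q)) of λ where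
          (inj₁ e) → ⊥-elim (wv e)
          (inj₂ refl) → refl
        (no none) → nothing , (λ ()) , λ {w} Bw uw wv → ⊥-elim (none (w , Bw , wv , uw))

      -- A path that halts at the target on its left is grown on its right as well; then it halts
      -- there too, or an argument for a weak or closed end applies.
      disjoint : ¬ Q p₁ → ¬ Q p₂ → Conf F
      disjoint nQ₁ nQ₂ = case beyond B₁ B₂ p₁₂ ,′ beyond B₂ B₁ (~-sym p₁₂) of λ ((l , lB , lf) , (r , rB , rf)) →
          case grow (suc (sz X)) (ℕₚ.≤-trans ℕₚ.≤-refl (ℕₚ.m≤n+m (suc (sz X)) (sz D₀))) nq₀ (A₀ l r lB lf rB rf) of λ where
            (grown A nq DD st) → first A nq (DD in₁) (DD in₂) st
        where
        D₀ = ∅ ⊹ p₁ ⊹ p₂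
        in₁ : D₀ ∋ p₁
        in₁ = ⊹in (⊹new {X = ∅})
        in₂ : D₀ ∋ p₂
        in₂ = ⊹new {X = ∅ ⊹ p₁}
        nq₀ : NoQ D₀
        nq₀ h = case pair-out h of λ { (inj₁ refl) → nQ₁ ; (inj₂ refl) → nQ₂ }
        χ₀ : Fin n → Bool
        χ₀ v = ⌊ v ≟ p₁ ⌋
        χ₁ : χ₀ p₁ ≡ true
        χ₁ = true-⌊⌋ {d = p₁ ≟ p₁} refl
        χ₂ : χ₀ p₂ ≡ false
        χ₂ = false-⌊⌋ {d = p₂ ≟ p₁} λ q → ~-irr p₁₂ (sym q)
        A₀ : ∀ l r → (∀ {y} → l ≡ just y → B ∋ y × y ≢ p₂ × p₁ ~ y) → (∀ {y} → B ∋ y → p₁ ~ y → y ≢ p₂ → l ≡ just y)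
          → (∀ {y} → r ≡ just y → B ∋ y × y ≢ p₁ × p₂ ~ y) → (∀ {y} → B ∋ y → p₂ ~ y → y ≢ p₁ → r ≡ just y) → Alt D₀ χ₀ p₁ p₂ l r
        A₀ l r lB lf rB rf = record
          { DB = λ h → case pair-out h of λ { (inj₁ refl) → B₁ ; (inj₂ refl) → B₂ }
          ; has = λ h → case pair-out h of λ { (inj₁ refl) → L₁ ; (inj₂ refl) → L₂ }
          ; alt = λ hu hv uv q → case pair-out hu ,′ pair-out hv of λ where
              (inj₁ refl , inj₁ refl) → ~-irr uv refl
              (inj₂ refl , inj₂ refl) → ~-irr uv refl
              (inj₁ refl , inj₂ refl) → true≢false (trans (sym q) χ₁) χ₂
              (inj₂ refl , inj₁ refl) → true≢false (trans q χ₁) χ₂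
          ; Del = in₁ ; Der = in₂ ; conn = [ in₁ ] ▸ (p₁₂ , in₂)
          ; lB = λ e → let (p , q , s) = lB e in p , (λ h → case pair-out h of λ { (inj₁ refl) → ~-irr s refl ; (inj₂ refl) → q refl }) , s
          ; rB = λ e → let (p , q , s) = rB e in p , (λ h → case pair-out h of λ { (inj₁ refl) → q refl ; (inj₂ refl) → ~-irr s refl }) , s
          ; front = λ h nD By uy → case pair-out h of λ where
              (inj₁ refl) → inj₁ (refl , lf By uy λ { refl → nD in₂ })
              (inj₂ refl) → inj₂ (refl , rf By uy λ { refl → nD in₁ })
          ; ends = λ q → ⊥-elim (~-irr p₁₂ q) }
        second : ∀ {D χ el er l y} (A : Alt D χ el er l (just y)) → NoQ D → D ∋ p₁ → D ∋ p₂ → Q y → a ∈ L y → b ∈ L y → Stop l (just y) → Conf F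
        second A nq D₁ D₂ Qy a∈ b∈ (weak h) = Inside.weak-conf A nq D₁ D₂ h
        second A nq D₁ D₂ Qy a∈ b∈ (closed e e') = Inside.closed-conf A nq D₁ D₂ e e'
        second A nq D₁ D₂ Qy a∈ b∈ (strong e Qy' ne a∈' b∈') = Inside.strong-both A nq D₁ D₂ e refl Qy' Qy (λ q → ne (cong just q)) a∈' b∈'
        first : ∀ {D χ el er l r} (A : Alt D χ el er l r) → NoQ D → D ∋ p₁ → D ∋ p₂ → Stop l r → Conf F
        first A nq D₁ D₂ (weak h) = Inside.weak-conf A nq D₁ D₂ h
        first A nq D₁ D₂ (closed e e') = Inside.closed-conf A nq D₁ D₂ e e'
        first {D} A nq D₁ D₂ (strong refl Qy ne a∈ b∈) = case grow (suc (sz X)) (ℕₚ.m≤n+m (suc (sz X)) (sz D)) nq (flip A) of λ where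
          (grown A' nq' DD st) → second A' nq' (DD D₁) (DD D₂) Qy a∈ b∈ st


      -- The target edge is p₂r.
      record Joint : Set where
        constructor joint
        field
          {r} : Fin n
          Q₂ : Q p₂
          Qr : Q r
          p₂r : p₂ ~ r
          r₁ : r ≢ p₁
          nQ₁ : ¬ Q p₁

      -- Democracies that share a vertex with the target

      module Shared (ι : Joint) where
        open Joint ι
        Br : B ∋ r
        Br = Q-B Qr
        r≢p₂ : r ≢ p₂
        r≢p₂ q = ~-irr p₂r (sym q)
        p₂≢r : p₂ ≢ r
        p₂≢r = ~-irr p₂r
        G : Rel
        G = FF p₂ r
        Lr : Unique (L r) × 3 ≤ length (L r)
        Lr = let R = regular (B∈ Br) r₁ r≢p₂ in proj₁ R , Reg-3≤ {L = L} R
        in₂ : ∀ {o} → AB o → o ∈ L p₂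
        in₂ {o} h = pick-AB {λ o → o ∈ L p₂} h (proj₁ L₂) (proj₂ L₂)

        -- The exceptional case, from which the moves `apex₁` and `apex₂` arise.
        Apex : Set
        Apex = r ~ p₁ × ∃[ e ] (L r ≐₃ (a , b , e) × G a e × G b e)

        module Ends {D χ el l} (A : Alt D χ el p₁ l (just p₂)) (nq : NoQ D) (D₁ : D ∋ p₁) where
          open On A
          nr : ¬ D ∋ r
          nr d = nq d Qr
          n₂ : ¬ D ∋ p₂
          n₂ d = nq d Q₂
          off₁ : ∀ {v} → ¬ D ∋ v → v ≢ p₁
          off₁ nv refl = nv D₁

          -- The one of `a`, `b` that the alternation leaves for `p₂`, opposite to the colour of
          -- `p₁`.
          β : Bool → ℕ
          β s = κ χ (not s) p₁

          β-AB : ∀ s → AB (β s)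
          β-AB s = κ-AB χ (not s) p₁

          β-≢ : ∀ s → β s ≢ κ χ s p₁
          β-≢ s = κ-not χ s p₁

          -- The target itself is precoloured in Thomassen's theorem; the last hypothesis says that
          -- nothing clashes beyond the other end of the path.
          use : ∀ s {η} → η ∈ L r → η ≢ β s → (∀ {y} → l ≡ just y → (y ≢ r × ¬ κ χ s el ∈ L y) ⊎ (y ≡ r × η ≢ κ χ s el)) → G (β s) η
          use s {η} η∈ ηβ hl = case thomassen {Y} {L'} {p₂} {r} {β s} {η} (Out-Y (Y∋ B₂ n₂) B₂ , Out-Y (Y∋ Br nr) Br , inj₂ (p₂r , λ q → ηβ (sym q)))
                (λ Yv v₂ _ → reg' Yv (off₁ (∖no Yv)) v₂) of λ (ψ , C , e₁ , e₂) →
              let C' = Col-lists {P = Off L' p₂ r} {∈L L'} (λ {v} _ h → case (v ≟ p₂) ,′ (v ≟ r) of λ where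
                    (yes refl , _) → subst₂ _∈_ (sym e₁) (sym (on-B B₂)) (in₂ (β-AB s))
                    (_ , yes refl) → subst₂ _∈_ (sym e₂) (sym (on-B Br)) η∈
                    (no p , no q) → h p q) C in
              glued D ψ (κ χ s) , coloured s C' (λ e q → case hl e of λ where
                  (inj₁ (_ , no∈)) → no∈ (subst (_∈ _) q (list-in C' (proj₁ (lB e)) (proj₁ (proj₂ (lB e)))))
                  (inj₂ (refl , ne)) → ne (trans (sym e₂) q))
                (λ { refl q → β-≢ s (trans (sym e₁) q) }) , value s n₂ e₁ , value s nr e₂

          star-β : ∀ s → (∀ {η} → η ∈ L r → η ≢ β s → G (β s) η) → Has G (st₁ (β s))
          star-β s h = case two (β s) Lr of λ (o , t , o∈ , t∈ , ot) → o , t , ot , h (⊖out o∈) (⊖ne {L r} o∈) , h (⊖out t∈) (⊖ne {L r} t∈)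

          β-differ : β false ≢ β true
          β-differ = κ-not χ false p₁

          conf-none : l ≡ nothing → Conf G
          conf-none refl = st₁ (β false) , st₁ (β true) , β-differ , star-β false (λ η∈ ne → use false η∈ ne λ ()) , star-β true (λ η∈ ne → use true η∈ ne λ ())

          -- The alternation that puts the missing colour on `el` yields a full star at `p₂`. The
          -- opposite one supplies a single further pair, which `finish` turns into a second
          -- government.
          conf-weak : ∀ {y o} → l ≡ just y → y ≢ p₂ → AB o → ¬ o ∈ L y → Conf G
          conf-weak {y} {o} refl y₂ oAB no∈ = case κ-pick χ el oAB of λ (s , es) → go s es
            where
            By = proj₁ (lB refl)
            nD = proj₁ (proj₂ (lB refl))
            el-y = proj₂ (proj₂ (lB refl))
            Ly = regB By nD (off₁ nD) y₂
            module _ (s : Bool) (es : κ χ s el ≡ o) where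
              full : ∀ {η} → η ∈ L r → η ≢ β s → G (β s) η
              full η∈ ne = use s η∈ ne λ { refl → case y ≟ r of λ where
                (yes refl) → inj₂ (refl , λ q → no∈ (subst (_∈ L r) (trans q es) η∈))
                (no yr) → inj₁ (yr , λ h → no∈ (subst (_∈ L y) es h)) }
              βs = β (not s)
              -- If `η` is not the colour of the centre, the star and the new pair contain a star at
              -- `r`; otherwise they contain a democracy, provided that `o'` is in the list of `r`.
              finish : ∀ {o' η} → o' ≢ β s → AB o' → η ∈ L r → η ≢ o' → (η ≡ β s → o' ∈ L r) → G o' η → Conf G
              finish {o'} {η} o'β o'AB η∈ ηo' h g = case η ℕ.≟ β s of λ where
                (no ne) → st₁ (β s) , st₂ η , tt , star-β s full , o' , β s , o'β , g , full η∈ ne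
                (yes refl) → st₁ η , dm η o' , tt , star-β s full , ηo' , full (h refl) o'β , g
              go : Conf G
              go = case y ≟ r of λ where
                  (yes refl) → case third-colour (proj₁ Lr) (proj₂ Lr) of λ (η , η∈ , ηa , ηb) →
                    finish (λ q → κ-not χ (not s) p₁ q) (β-AB (not s)) η∈ (not-AB ηa ηb (β-AB (not s))) (λ q → ⊥-elim (not-AB ηa ηb (β-AB s) q))
                      (use (not s) η∈ (not-AB ηa ηb (β-AB (not s))) λ { refl → inj₂ (refl , not-AB ηa ηb (κ-AB χ (not s) el)) })
                  -- The path is prolonged over `p₂`, so that its colour belongs to the alternation
                  -- and `r` need only avoid it.
                  (no yr) → case step (flip A) (proj₁ L₂) (proj₂ L₂) (λ q → y₂ (sym (just-injective q))) of λ (l'' , A'') → extended yr A''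
                where
                not-AB : ∀ {e o} → e ≢ a → e ≢ b → AB o → e ≢ o
                not-AB ea eb (inj₁ refl) = ea
                not-AB ea eb (inj₂ refl) = eb
                extended : ∀ {l''} → y ≢ r → Alt (D ⊹ p₂) (upd χ p₂ (not (χ p₁))) p₂ el l'' (just y) → Conf G
                extended {l''} yr A'' = list-choice (β' ∈?ℕ L r)
                  where
                  module A'' = On A''
                  χ'' = upd χ p₂ (not (χ p₁))
                  χ''-on : ∀ {v} → D ∋ v → χ'' v ≡ χ v
                  χ''-on Dv = upd-ne χ λ { refl → n₂ Dv }
                  κ''-on : ∀ {v} → D ∋ v → κ χ'' (not s) v ≡ κ χ (not s) v
                  κ''-on Dv = cong (λ t → if t xor not s then a else b) (χ''-on Dv)
                  β' = κ χ'' (not s) p₂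
                  β'β : β' ≢ β s
                  β'β q = κ-≢ {χ''} (not s) (A''.alt A''.Del (⊹in D₁) (~-sym p₁₂)) (trans q (sym (κ''-on D₁)))
                  nr'' : ¬ (D ⊹ p₂) ∋ r
                  nr'' h = nr (⊹out {X = D} h r≢p₂)
                  ny'' : ¬ (D ⊹ p₂) ∋ y
                  ny'' h = nD (⊹out {X = D} h y₂)
                  off₂ : ∀ {v} → ¬ (D ⊹ p₂) ∋ v → v ≢ p₂
                  off₂ nv refl = nv (⊹new {X = D})
                  off₁'' : ∀ {v} → ¬ (D ⊹ p₂) ∋ v → v ≢ p₁
                  off₁'' nv refl = nv (⊹in D₁)
                  regY : ∀ {v} → A''.Y ∋ v → Reg A''.Y A''.L' v
                  regY Yv = A''.reg' Yv (off₁'' (∖no Yv)) (off₂ (∖no Yv))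
                  Or = A''.Out-Y (A''.Y∋ Br nr'') Br
                  with-list : ∀ {M} → Unique M → 3 ≤ length M → (∀ {x} → x ∈ M → x ≢ β' → x ∈ L r × (x ≡ β s → β' ∈ L r)) → Conf G
                  with-list {M} uM leM sub = case A''.two (κ χ'' (not s) el) Ly of λ (c , d , c∈ , d∈ , cd) →
                    case avoiding ih {A''.Y} {upd A''.L' r M} {y} {r} {c} {d} {β'} (less ∖out (B∈ B₁) (λ h → ∖no h (⊹in D₁))) (A''.Out-Y (A''.Y∋ By ny'') By) Or (λ q → yr (sym q)) cd
                        (λ Yu _ → with-lists uM leM Or λ _ → regY Yu) of λ (ψ , C , ey , er) →
                    let y∈ = λ {P : ℕ → Set} (p : P c) (q : P d) → case ey of λ { (inj₁ e) → subst P (sym e) p ; (inj₂ e) → subst P (sym e) q }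
                        r∈ = sub (subst (ψ r ∈_) (upd-eq A''.L' r M) (C .lst (out∈ Or) (λ q → yr (sym q)) (λ q → yr (sym q)))) er
                        C' = Col-lists {P = Off (upd A''.L' r M) y y} {∈L A''.L'} (λ {v} _ h → case (v ≟ y) ,′ (v ≟ r) of λ where
                          (yes refl , _) → subst (ψ v ∈_) (sym (A''.on-B By)) (y∈ {_∈ L v} (⊖out c∈) (⊖out d∈))
                          (_ , yes refl) → subst (ψ v ∈_) (sym (A''.on-B Br)) (proj₁ r∈)
                          (no p , no q) → subst (ψ v ∈_) (upd-ne A''.L' q) (h p p)) C
                    in finish β'β (κ-AB χ'' (not s) p₂) (proj₁ r∈) er (proj₂ r∈)
                      (glued (D ⊹ p₂) ψ (κ χ'' (not s)) , A''.coloured (not s) C' (λ {w} e q → at-r {w} {ψ} e er q) (λ { refl → y∈ {_≢ κ χ'' (not s) el} (⊖ne {L y} c∈) (⊖ne {L y} d∈) })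
                        , glued-on {D ⊹ p₂} {ψ} {κ χ'' (not s)} (⊹new {X = D}) , A''.value (not s) nr'' refl)
                    where
                    at-r : ∀ {w ψ} → l'' ≡ just w → ψ r ≢ β' → ψ w ≢ β'
                    at-r {w} e er = case A''.lB e of λ (Bw , nw , p₂w) → case third B₂ B₁ Br Bw (~-sym p₁₂) p₂r p₂w (λ q → r₁ (sym q)) of λ where
                      (inj₁ refl) → ⊥-elim (nw (⊹in D₁))
                      (inj₂ refl) → er
                  list-choice : Dec (β' ∈ L r) → Conf G
                  list-choice (yes β'∈) = with-list (proj₁ Lr) (proj₂ Lr) λ x∈ _ → x∈ , λ _ → β'∈
                  -- `avoiding` keeps `r` off `β'`, so this dummy entry merely keeps the list at
                  -- three colours, while `β s`, which would call for a democracy, is excluded.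
                  list-choice (no nβ') = with-list {β' ∷ (L r ⊖ β s)} (All.tabulate (λ x∈ q → nβ' (subst (_∈ L r) (sym q) (⊖out x∈))) ∷ ⊖uniq (proj₁ Lr)) (s≤s (⊖len {L r} (proj₁ Lr) (proj₂ Lr)))
                    λ { (here q) ne → ⊥-elim (ne q) ; (there x∈) _ → ⊖out x∈ , λ q → ⊥-elim (⊖ne {L r} x∈ q) }

          last-step : ∀ {S u w} → Walk S u w → u ≢ w → ∃[ v ] (S ∋ v × v ~ w)
          last-step [ _ ] ne = ⊥-elim (ne refl)
          last-step (w ▸ (e , _)) _ = _ , Wend w , e

          -- The path, `p₂` and `r` close a cycle, and parity decides. If the two ends of the path
          -- differ in colour, `el` asks of `r` the same as `p₂` does, which leaves two full stars.
          -- Otherwise a third colour at `r` gives one star; the second government comes from a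
          -- fourth colour at `r` if the path is `p₁` alone, and from colouring backwards if it is
          -- longer.
          conf-strong : l ≡ just r → a ∈ L r → b ∈ L r → Conf G ⊎ Apex
          conf-strong refl a∈ b∈ = case χ el Bool.≟ χ p₁ of λ where
              (no ne) → inj₁ (st₁ (β false) , st₁ (β true) , β-differ , star-β false (λ η∈ d → use false η∈ d (at ne false d)) , star-β true (λ η∈ d → use true η∈ d (at ne true d)))
              (yes eq) → even eq
            where
            at : χ el ≢ χ p₁ → ∀ s {η} → η ≢ β s → ∀ {y} → just r ≡ just y → (y ≢ r × ¬ κ χ s el ∈ L y) ⊎ (y ≡ r × η ≢ κ χ s el)
            at ne s d refl = inj₂ (refl , λ q → d (trans q (case AB-two (κ-AB χ s p₁) (β-AB s) (λ q → β-≢ s (sym q)) (κ-AB χ s el) of λ where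
              (inj₁ q) → ⊥-elim (κ-≢ {χ} s ne q)
              (inj₂ q) → q)))
            not-AB : ∀ {e o} → e ≢ a → e ≢ b → AB o → e ≢ o
            not-AB ea eb (inj₁ refl) = ea
            not-AB ea eb (inj₂ refl) = eb
            apart : ∀ s {e} → e ∈ L r → e ≢ a → e ≢ b → G (β s) e
            apart s e∈ ea eb = use s e∈ (not-AB ea eb (β-AB s)) λ { refl → inj₂ (refl , not-AB ea eb (κ-AB χ s el)) }
            star-e : ∀ {e} → e ∈ L r → e ≢ a → e ≢ b → Has G (st₂ e)
            star-e e∈ ea eb = β false , β true , β-differ , apart false e∈ ea eb , apart true e∈ ea eb
            at-o : ∀ {e o} → AB o → e ∈ L r → e ≢ a → e ≢ b → G o e
            at-o oAB e∈ ea eb = case AB-two (β-AB false) (β-AB true) β-differ oAB of λ where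
              (inj₁ refl) → apart false e∈ ea eb
              (inj₂ refl) → apart true e∈ ea eb
            even : χ el ≡ χ p₁ → Conf G ⊎ Apex
            even eq = case third-colour (proj₁ Lr) (proj₂ Lr) of λ (e , e∈ , ea , eb) → case el ≟ p₁ of λ where
                (yes q) → case Any.any? (λ x → ¬? (x ℕ.≟ a) ×-dec ¬? (x ℕ.≟ b) ×-dec ¬? (x ℕ.≟ e)) (L r) of λ where
                  (yes h) → let (e' , e'∈ , e'a , e'b , e'e) = find h in inj₁ (st₂ e , st₂ e' , (λ z → e'e (sym z)) , star-e e∈ ea eb , star-e e'∈ e'a e'b)
                  (no h) → inj₂ (subst (r ~_) q (~-sym (proj₂ (proj₂ (lB refl)))) , e , ((a∈ , b∈ , e∈) , (ab , (λ z → ea (sym z)) , (λ z → eb (sym z)))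
                    , λ x x∈ → case (x ℕ.≟ a) ,′ (x ℕ.≟ b) of λ where
                        (yes z , _) → inj₁ z
                        (_ , yes z) → inj₂ (inj₁ z)
                        (no xa , no xb) → inj₂ (inj₂ (decidable-stable (x ℕ.≟ e) λ xe → h (lose x∈ (xa , xb , xe))))) , at-o (inj₁ refl) e∈ ea eb , at-o (inj₂ refl) e∈ ea eb)
                (no ne) → inj₁ (st₂ e , st₁ b , tt , star-e e∈ ea eb , e , a , ea , at-o (inj₂ refl) e∈ ea eb , reverse ne)
              where
              reverse : el ≢ p₁ → G b a
              reverse ne = case last-step conn ne of λ (l₀ , Dl₀ , l₀₁) → case κ-pick χ p₁ (inj₂ refl) of λ (s , es) → turned l₀ Dl₀ l₀₁ s es
                where
                -- p₂ has colour b, r has colour a, the path is coloured backwards from r, p₁ has colour a and l₀ a third colour.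
                module _ (l₀ : Fin n) (Dl₀ : D ∋ l₀) (l₀₁ : l₀ ~ p₁) (s : Bool) (es : κ χ s p₁ ≡ b) where
                  D* = D - p₁ - l₀ ⊹ p₂ ⊹ r
                  l₀≢₂ : l₀ ≢ p₂
                  l₀≢₂ refl = n₂ Dl₀
                  l₀≢r : l₀ ≢ r
                  l₀≢r refl = nr Dl₀
                  p₁≢₂ : p₁ ≢ p₂
                  p₁≢₂ = ~-irr p₁₂
                  data In (v : Fin n) : Set where
                    isr : v ≡ r → In v
                    is₂ : v ≡ p₂ → In v
                    isD : D ∋ v → v ≢ p₁ → v ≢ l₀ → In v
                  split : ∀ {v} → D* ∋ v → In v
                  split {v} h = case (v ≟ r) ,′ (v ≟ p₂) of λ where
                    (yes q , _) → isr q
                    (_ , yes q) → is₂ q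
                    (no vr , no v₂) → let d = ⊹out {X = D - p₁ - l₀} (⊹out {X = D - p₁ - l₀ ⊹ p₂} h vr) v₂ in isD (-out (-out d)) (-ne (-out d)) (-ne d)
                  D*B : D* ⊂ B
                  D*B h = case split h of λ { (isr refl) → Br ; (is₂ refl) → B₂ ; (isD d _ _) → DB d }
                  D*in : ∀ {v} → D ∋ v → v ≢ p₁ → v ≢ l₀ → D* ∋ v
                  D*in d p q = ⊹in (⊹in (-in (-in d p) q))
                  D*₂ : D* ∋ p₂
                  D*₂ = ⊹in (⊹new {X = D - p₁ - l₀})
                  D*r : D* ∋ r
                  D*r = ⊹new {X = D - p₁ - l₀ ⊹ p₂}
                  no₁ : ¬ D* ∋ p₁
                  no₁ h = case split h of λ { (isr q) → r₁ (sym q) ; (is₂ q) → p₁≢₂ q ; (isD _ q _) → q refl }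
                  no₀ : ¬ D* ∋ l₀
                  no₀ h = case split h of λ { (isr q) → l₀≢r q ; (is₂ q) → l₀≢₂ q ; (isD _ _ q) → q refl }
                  κ₁ : Fin n → ℕ
                  κ₁ = upd (κ χ s) p₂ b
                  κ* : Fin n → ℕ
                  κ* = upd κ₁ r a
                  κ*r : κ* r ≡ a
                  κ*r = upd-eq κ₁ r a
                  κ*₂ : κ* p₂ ≡ b
                  κ*₂ = trans (upd-ne κ₁ p₂≢r) (upd-eq (κ χ s) p₂ b)
                  κ*D : ∀ {v} → D ∋ v → κ* v ≡ κ χ s v
                  κ*D Dv = trans (upd-ne κ₁ λ { refl → nr Dv }) (upd-ne (κ χ s) λ { refl → n₂ Dv })
                  κ*el : κ* el ≡ b
                  κ*el = trans (κ*D Del) (trans (κ-≡ {χ} {el} {p₁} s eq) es)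
                  module P* = Paste D* D*B
                  AB* : ∀ {v} → D* ∋ v → AB (κ* v)
                  AB* {v} h = case split h of λ where
                    (isr refl) → inj₁ κ*r
                    (is₂ refl) → inj₂ κ*₂
                    (isD d _ _) → subst AB (sym (κ*D d)) (κ-AB χ s v)
                  list* : ∀ {v} → D* ∋ v → κ* v ∈ L v
                  list* {v} h = case split h of λ where
                    (isr refl) → subst (_∈ L v) (sym κ*r) a∈
                    (is₂ refl) → subst (_∈ L v) (sym κ*₂) (proj₂ L₂)
                    (isD d _ _) → pick-AB {λ o → o ∈ L v} (AB* h) (proj₁ (has d)) (proj₂ (has d))
                  from-D : ∀ {u y} → D ∋ u → u ≢ p₁ → ¬ D ∋ y → B ∋ y → u ~ y → u ≡ el × y ≡ r
                  from-D Du u₁ nDy By uy = case front Du nDy By uy of λ where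
                    (inj₁ (refl , refl)) → refl , refl
                    (inj₂ (q , _)) → ⊥-elim (u₁ q)
                  proper* : ∀ {u v} → D* ∋ u → D* ∋ v → u ~ v → κ* u ≢ κ* v
                  proper* {u} {v} hu hv uv q = case split hu ,′ split hv of λ where
                    (isr refl , isr refl) → ~-irr uv refl
                    (is₂ refl , is₂ refl) → ~-irr uv refl
                    (isr refl , is₂ refl) → ab (trans (sym κ*r) (trans q κ*₂))
                    (is₂ refl , isr refl) → ab (trans (sym κ*r) (trans (sym q) κ*₂))
                    (isD d d₁ _ , isr refl) → case from-D d d₁ nr Br uv of λ { (refl , _) → ab (trans (sym κ*r) (trans (sym q) κ*el)) }
                    (isr refl , isD d d₁ _) → case from-D d d₁ nr Br (~-sym uv) of λ { (refl , _) → ab (trans (sym κ*r) (trans q κ*el)) }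
                    (isD d d₁ _ , is₂ refl) → p₂≢r (proj₂ (from-D d d₁ n₂ B₂ uv))
                    (is₂ refl , isD d d₁ _) → p₂≢r (proj₂ (from-D d d₁ n₂ B₂ (~-sym uv)))
                    (isD d _ _ , isD d' _ _) → κ-≢ {χ} s (alt d d' uv) (trans (sym (κ*D d)) (trans q (κ*D d')))
                  turned : G b a
                  turned = case third-colour (proj₁ Ll₀) (proj₂ Ll₀) of λ (e₀ , e₀∈ , e₀a , e₀b) →
                      case thomassen {P*.Y} {P*.L'} {p₁} {l₀} {a} {e₀} (P*.Out-Y Y₁ B₁ , P*.Out-Y Y₀ (DB Dl₀) , inj₂ (~-sym l₀₁ , λ q → e₀a (sym q)))
                        (λ Yv v₁ _ → P*.reg' Yv v₁ λ { refl → ∖no Yv D*₂ }) of λ (ψ , C , e₁ , e₂) →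
                      let C' = Col-lists {P = Off P*.L' p₁ l₀} {∈L P*.L'} (λ {v} _ h → case (v ≟ p₁) ,′ (v ≟ l₀) of λ where
                            (yes refl , _) → subst₂ _∈_ (sym e₁) (sym (P*.on-B B₁)) (proj₁ L₁)
                            (_ , yes refl) → subst₂ _∈_ (sym e₂) (sym (P*.on-B (DB Dl₀))) e₀∈
                            (no p , no q) → h p q) C in
                      glued D* ψ κ* , P*.paste C' (λ h → list* h , AB* h) proper* (λ {u} {v} hu Yv Bv uv q → border {ψ} hu Yv Bv uv e₁ e₂ e₀a e₀b q)
                        , trans (glued-on {D*} {ψ} {κ*} D*₂) κ*₂ , trans (glued-on {D*} {ψ} {κ*} D*r) κ*r
                    where
                    Y₁ : P*.Y ∋ p₁
                    Y₁ = ∖in (B∈ B₁) no₁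
                    Y₀ : P*.Y ∋ l₀
                    Y₀ = ∖in (B∈ (DB Dl₀)) no₀
                    Ll₀ : Unique (L l₀) × 3 ≤ length (L l₀)
                    Ll₀ = let R = regular (B∈ (DB Dl₀)) (~-irr l₀₁) l₀≢₂ in proj₁ R , Reg-3≤ {L = L} R
                    which : ∀ {u v} → D* ∋ u → P*.Y ∋ v → B ∋ v → u ~ v → v ≡ p₁ ⊎ v ≡ l₀
                    which {u} {v} hu Yv Bv uv = case (v ≟ p₁) ,′ (v ≟ l₀) of λ where
                      (yes q , _) → inj₁ q
                      (_ , yes q) → inj₂ q
                      (no v₁ , no v₀) → ⊥-elim (case split hu of λ where
                        (isr refl) → case third Br B₂ (DB Del) Bv (~-sym p₂r) (~-sym (proj₂ (proj₂ (lB refl)))) uv (λ { refl → n₂ Del }) of λ where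
                          (inj₁ refl) → ∖no Yv D*₂
                          (inj₂ refl) → ∖no Yv (D*in Del v₁ v₀)
                        (is₂ refl) → case third B₂ B₁ Br Bv (~-sym p₁₂) p₂r uv (λ q → r₁ (sym q)) of λ where
                          (inj₁ q) → v₁ q
                          (inj₂ refl) → ∖no Yv D*r
                        (isD d d₁ _) → case D ∋? v of λ where
                          (yes Dv) → ∖no Yv (D*in Dv v₁ v₀)
                          (no nDv) → case from-D d d₁ nDv Bv uv of λ { (_ , refl) → ∖no Yv D*r })
                    border : ∀ {ψ u v e₀} → D* ∋ u → P*.Y ∋ v → B ∋ v → u ~ v → ψ p₁ ≡ a → ψ l₀ ≡ e₀ → e₀ ≢ a → e₀ ≢ b → κ* u ≢ ψ v
                    border {ψ} {u} hu Yv Bv uv e₁ e₂ e₀a e₀b q = case which hu Yv Bv uv of λ where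
                      (inj₂ refl) → not-AB e₀a e₀b (AB* hu) (trans (sym e₂) (sym q))
                      (inj₁ refl) → case split hu of λ where
                        (is₂ refl) → ab (trans (sym e₁) (trans (sym q) κ*₂))
                        (isr refl) → case third B₁ B₂ (DB Dl₀) Br p₁₂ (~-sym l₀₁) (~-sym uv) (λ q → l₀≢₂ (sym q)) of λ where
                          (inj₁ z) → r≢p₂ z
                          (inj₂ z) → l₀≢r (sym z)
                        (isD d d₁ d₀) → case third B₁ B₂ (DB Dl₀) (DB d) p₁₂ (~-sym l₀₁) (~-sym uv) (λ q → l₀≢₂ (sym q)) of λ where
                          (inj₁ refl) → n₂ d
                          (inj₂ z) → d₀ z

        shared : Conf F ⊎ Apex
        shared = case beyond B₁ B₂ p₁₂ of λ (l , lB , lf) → case grow (suc (sz X)) (ℕₚ.m≤n+m (suc (sz X)) (sz D₀)) nq₀ (A₀ l lB lf) of λ where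
            (grown A nq DD st) → finish A nq (DD (⊹new {X = ∅})) st
          where
          D₀ = ∅ ⊹ p₁
          nq₀ : NoQ D₀
          nq₀ h = case sing-out h of λ { refl → nQ₁ }
          A₀ : ∀ l → (∀ {y} → l ≡ just y → B ∋ y × y ≢ p₂ × p₁ ~ y) → (∀ {y} → B ∋ y → p₁ ~ y → y ≢ p₂ → l ≡ just y) → Alt D₀ (λ _ → true) p₁ p₁ l (just p₂)
          A₀ l lB lf = record
            { DB = λ h → case sing-out h of λ { refl → B₁ }
            ; has = λ h → case sing-out h of λ { refl → L₁ }
            ; alt = λ hu hv uv q → ~-irr uv (trans (sing-out hu) (sym (sing-out hv)))
            ; Del = ⊹new {X = ∅} ; Der = ⊹new {X = ∅} ; conn = [ ⊹new {X = ∅} ]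
            ; lB = λ e → let (p , q , s) = lB e in p , (λ h → ~-irr s (sym (sing-out h))) , s
            ; rB = λ { refl → B₂ , (λ h → ~-irr p₁₂ (sym (sing-out h))) , p₁₂ }
            ; front = λ {u} {y} h nD By uy → case sing-out h of λ where
                refl → case y ≟ p₂ of λ where
                  (yes refl) → inj₂ (refl , refl)
                  (no ne) → inj₁ (refl , lf By uy ne)
            ; ends = λ { _ refl → proj₁ (proj₂ (lB refl)) refl } }
          lift : Conf G ⊎ Apex → Conf F ⊎ Apex
          lift (inj₁ cf) = inj₁ (target Q₂ Qr p₂≢r cf)
          lift (inj₂ x) = inj₂ x
          finish : ∀ {D χ el l} (A : Alt D χ el p₁ l (just p₂)) → NoQ D → D ∋ p₁ → Stop l (just p₂) → Conf F ⊎ Apex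
          finish {l = nothing} A nq D₁ st = inj₁ (target Q₂ Qr p₂≢r (Ends.conf-none A nq D₁ refl))
          finish {l = just y} A nq D₁ (weak h) = case h refl of λ (ne , o , oAB , no∈) → inj₁ (target Q₂ Qr p₂≢r (Ends.conf-weak A nq D₁ refl (λ { refl → ne refl }) oAB no∈))
          -- The neighbours of `p₂` in `B` are `p₁` and `r`, so a path closing up at `p₂` would have
          -- both ends equal or run into the target.
          finish {D} {χ} {el} {l = just y} A nq D₁ (closed refl refl) = ⊥-elim (case third B₂ B₁ Br (P.DB P.Del) (~-sym p₁₂) p₂r (~-sym (proj₂ (proj₂ (P.lB refl)))) (λ q → r₁ (sym q)) of λ where
              (inj₁ q) → P.ends q refl
              (inj₂ refl) → nq P.Del Qr)
            where module P = Alt A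
          finish {l = just y} A nq D₁ (strong refl Qy ne a∈ b∈) = lift (Ends.conf-strong A nq D₁ (cong just (y≡r Qy)) (subst (λ t → a ∈ L t) (y≡r Qy) a∈) (subst (λ t → b ∈ L t) (y≡r Qy) b∈))
            where
            y≡r : Q y → y ≡ r
            y≡r (inj₁ refl) = case Q₂ ,′ Qr of λ where
              (inj₁ q , _) → ⊥-elim (ne (cong just (sym q)))
              (inj₂ _ , inj₁ q) → sym q
              (inj₂ q , inj₂ q') → ⊥-elim (p₂≢r (trans q (sym q')))
            y≡r (inj₂ refl) = case Q₂ ,′ Qr of λ where
              (inj₂ q , _) → ⊥-elim (ne (cong just (sym q)))
              (inj₁ _ , inj₂ q) → sym q
              (inj₁ q , inj₁ q') → ⊥-elim (p₂≢r (trans q (sym q')))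

    -- Outcomes for stars and democracies in a reduced canvas

    partner : ∀ {v} → Q v → ∃[ u ] (Q u × v ~ u × (∀ {w} → Q w → w ≡ v ⊎ w ≡ u))
    partner (inj₁ refl) = q₂ , inj₂ refl , q~ , λ h → h
    partner (inj₂ refl) = q₁ , inj₁ refl , ~-sym q~ , λ { (inj₁ e) → inj₂ e ; (inj₂ e) → inj₁ e }

    record Starred : Set where
      constructor starred
      field
        L : Lists
        B-no : ∀ {v} → X ∋ v → ¬ B ∋ v → 5 ≤ length (L v)
        p x : Fin n
        c : ℕ
        W : List ℕ
        Bp : B ∋ p
        Bx : B ∋ x
        px : p ~ x
        val : Valid (star p x c W)
        regular : ∀ {v} → X ∋ v → v ≢ p → v ≢ x → Reg X L v
        other-edge : ¬ (Q p × Q x)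

    module Star (ς : Starred) where
      open Starred ς

      E : Rel
      E = Ext X L p x ⟪ star p x c W ⟫ q₁ q₂

      data StarOut : Set where
        conf : Conf E → StarOut
        turned : ∀ {y} → Q p → Q y → p ~ y → y ≢ x → (∀ {l} → l ∈ L y ⊖ c → Oriented E p y c l) → StarOut
        triangle : ∀ {y a b} → Q x → Q y → p ~ y → x ~ y → y ≢ p → W ≐₂ (a , b) → L y ≐₃ (a , b , c) → Oriented E x y a b → Oriented E x y b a → StarOut

      L₁ : Lists
      L₁ = upd L p (c ∷ [])
      -- With `c` added the list of `x` has three colours and is regular, and no colouring is
      -- gained, since the neighbour `p` has colour `c`. The star becomes a single coloured vertex.
      L̂ : Lists
      L̂ = upd L₁ x (c ∷ W)

      p≢x : p ≢ x
      p≢x = ~-irr px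

      at-x : L̂ x ≡ c ∷ W
      at-x = upd-eq L₁ x (c ∷ W)

      at : ∀ {v} → v ≢ p → v ≢ x → L̂ v ≡ L v
      at vp vx = trans (upd-ne L₁ vx) (upd-ne L vp)

      reĝ : ∀ {v} → X ∋ v → v ≢ p → Reg X L̂ v
      reĝ {v} Xv vp = with-lists {L = L₁} (All.tabulate (λ y∈ q → proj₂ (proj₂ val) (subst (_∈ W) (sym q) y∈)) ∷ proj₁ val) (s≤s (proj₁ (proj₂ val))) (B-out Bx)
        λ vx → subst (λ l → Unique l × (5 ≤ length l ⊎ (3 ≤ length l × Out X v))) (sym (upd-ne L vp)) (regular Xv vp vx)

      B-nô : ∀ {v} → X ∋ v → ¬ B ∋ v → 5 ≤ length (L̂ v)
      B-nô Xv nB = subst (λ l → 5 ≤ length l) (sym (at (λ { refl → nB Bp }) (λ { refl → nB Bx }))) (B-no Xv nB)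

      in-W : ∀ {y} → y ∈ L̂ x → y ≢ c → y ∈ W
      in-W {y} h ne = case subst (y ∈_) at-x h of λ where
        (here e) → ⊥-elim (ne e)
        (there q) → q

      into : ∀ {ψ} → Col X (Off L̂ p p) ψ → ψ p ≡ c → E (ψ q₁) (ψ q₂)
      into {ψ} C e = ψ , Col-lists {P = Off L̂ p p} {Off L p x} (λ {v} _ h vp vx → subst (ψ v ∈_) (at vp vx) (h vp vp)) C
        , (e , in-W (C .lst (B∈ Bx) (λ q → p≢x (sym q)) (λ q → p≢x (sym q))) (λ q → C .prp (B∈ Bp) (B∈ Bx) px (trans e (sym q)))) , refl , refl

      -- A dictator on the target only has to turn. Otherwise its neighbours in `B` decide, and a
      -- triangle can survive only if they are the two ends of the target.
      outcome : StarOut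
      outcome = case Q? p of λ where
          (yes Qp) → case partner Qp of λ (y , Qy , py , _) → turned Qp Qy py (λ { refl → other-edge (Qp , Qy) }) λ l∈ → turn-ext Qp Qy py (λ { refl → other-edge (Qp , Qy) }) l∈
          (no nQp) → case any? (λ v → (B ∋? v) ×-dec (p ~? v) ×-dec ¬? (v ≟ x)) of λ where
            (no none) → conf (V-conf nQp (AtVertex.one-neighbour (V nQp) Bx (λ q → p≢x (sym q)) λ {u} Bu pu → decidable-stable (u ≟ x) λ ux → none (u , Bu , pu , ux)))
            (yes (v , Bv , pv , vx)) → case Q? v ,′ Q? x of λ where
              (no nQv , _) → conf (V-conf nQp (AtVertex.two-neighbours (V nQp) Bx Bv px pv (λ q → vx (sym q)) nQv))
              (_ , no nQx) → conf (V-conf nQp (AtVertex.two-neighbours (V nQp) Bv Bx pv px vx nQx))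
              (yes Qv , yes Qx) → both nQp Bv pv vx Qv Qx
        where
        V : ¬ Q p → Rooted
        V nQp = rooted L̂ p c Bp reĝ B-nô (λ q → nQp (inj₁ q)) (λ q → nQp (inj₂ q))
        V-in : ∀ (nQp : ¬ Q p) {x y} → AtVertex.F (V nQp) x y → E x y
        V-in nQp (ψ , C , e , refl , refl) = into C e
        V-conf : ∀ (nQp : ¬ Q p) → Conf (AtVertex.F (V nQp)) → Conf E
        V-conf nQp = Conf-mono (V-in nQp)
        turn-ext : ∀ {y l} → Q p → Q y → p ~ y → y ≢ x → l ∈ L y ⊖ c → Oriented E p y c l
        turn-ext {y} {l} Qp Qy py yx l∈ = case thomassen {X} {L̂} {p} {y} {c} {l} (B-out Bp , B-out (Q-B Qy) , inj₂ (py , λ q → ⊖ne {L y} l∈ (sym q))) (λ Xv vp _ → reĝ Xv vp) of λ (ψ , C , e₁ , e₂) →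
          subst₂ (Oriented E p y) e₁ e₂ (orient {E} ψ Qp Qy (~-irr py) (into (Col-lists {P = Off L̂ p y} {Off L̂ p p} (λ {v} _ h vp _ → case v ≟ y of λ where
            (yes refl) → subst₂ _∈_ (sym e₂) (sym (at vp yx)) (⊖out l∈)
            (no ne) → h vp ne) C) e₁))
        both : ∀ {v} (nQp : ¬ Q p) → B ∋ v → p ~ v → v ≢ x → Q v → Q x → StarOut
        both {v} nQp Bv pv vx Qv Qx = case prod {AtVertex.FF (V nQp) x v} (⊖uniq {L̂ x} {c} (proj₁ Rx)) (⊖uniq {L̂ v} {c} (proj₁ Rv)) (⊖len {L̂ x} {c} (proj₁ Rx) (Reg-3≤ {L = L̂} Rx)) (⊖len {L̂ v} {c} (proj₁ Rv) (Reg-3≤ {L = L̂} Rv)) ext of λ where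
            (inj₁ cf) → conf (V-conf nQp (AtVertex.target (V nQp) Qx Qv (λ q → vx (sym q)) cf))
            (inj₂ (a , b , (a∈ , b∈ , ab , all) , lv)) → triangle Qx Qv pv xv v≢p
              (in-W (⊖out a∈) (⊖ne {L̂ x} a∈) , in-W (⊖out b∈) (⊖ne {L̂ x} b∈) , ab , λ z z∈ → all z (⊖in (subst (z ∈_) (sym at-x) (there z∈)) λ { refl → proj₂ (proj₂ val) z∈ }))
              (subst (_≐₃ (a , b , c)) (at v≢p vx) (≐₂-≐₃ (proj₁ Rv) (Reg-3≤ {L = L̂} Rv) lv))
              (oriented (ext a∈ (proj₁ (proj₂ lv)) ab)) (oriented (ext b∈ (proj₁ lv) λ q → ab (sym q)))
          where
          v≢p : v ≢ p
          v≢p q = ~-irr pv (sym q)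
          Rx = reĝ (B∈ Bx) λ q → p≢x (sym q)
          Rv = reĝ (B∈ Bv) v≢p
          xv : x ~ v
          xv = case partner Qx of λ (u , _ , xu , h) → case h Qv of λ where
            (inj₁ q) → ⊥-elim (vx q)
            (inj₂ refl) → xu
          ext : ∀ {α β} → α ∈ L̂ x ⊖ c → β ∈ L̂ v ⊖ c → α ≢ β → AtVertex.FF (V nQp) x v α β
          ext = AtVertex.both-neighbours (V nQp) Bx Bv px pv xv
          oriented : ∀ {α β} → AtVertex.FF (V nQp) x v α β → Oriented E x v α β
          oriented (ψ , C , e , e₁ , e₂) = subst₂ (Oriented E x v) e₁ e₂ (orient {E} ψ Qx Qv (λ q → vx (sym q)) (into C e))

    record Dual : Set where
      constructor dual
      field
        L : Lists
        B-no : ∀ {v} → X ∋ v → ¬ B ∋ v → 5 ≤ length (L v)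
        u w : Fin n
        a b : ℕ
        Bu : B ∋ u
        Bw : B ∋ w
        uw : u ~ w
        ab : a ≢ b
        regular : ∀ {v} → X ∋ v → v ≢ u → v ≢ w → Reg X L v
        other-edge : ¬ (Q u × Q w)

    module Dem (ς : Dual) where
      open Dual ς

      E : Rel
      E = Ext X L u w ⟪ dem u w a b ⟫ q₁ q₂

      data DemOut : Set where
        conf : Conf E → DemOut
        apex : ∀ {m z e} → m ≡ u ⊎ m ≡ w → Q m → Q z → z ~ u → z ~ w → L z ≐₃ (a , b , e) → Oriented E m z a e → Oriented E m z b e → DemOut

      ls : List ℕ
      ls = a ∷ b ∷ []
      L₁ : Lists
      L₁ = upd L u ls
      -- The list {a, b} at both ends of an edge admits just the two colourings of the democracy.
      L̄ : Lists
      L̄ = upd L₁ w ls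
      at-w : L̄ w ≡ ls
      at-w = upd-eq L₁ w ls
      at-u : L̄ u ≡ ls
      at-u = trans (upd-ne L₁ (~-irr uw)) (upd-eq L u ls)
      at : ∀ {v} → v ≢ u → v ≢ w → L̄ v ≡ L v
      at vu vw = trans (upd-ne L₁ vw) (upd-ne L vu)
      both : ∀ {v} → L̄ v ≡ ls → a ∈ L̄ v × b ∈ L̄ v
      both e = subst (a ∈_) (sym e) (here refl) , subst (b ∈_) (sym e) (there (here refl))
      reḡ : ∀ {v} → X ∋ v → v ≢ u → v ≢ w → Reg X L̄ v
      reḡ {v} Xv vu vw = subst (λ l → Unique l × (5 ≤ length l ⊎ (3 ≤ length l × Out X v))) (sym (at vu vw)) (regular Xv vu vw)
      B-nō : ∀ {v} → X ∋ v → ¬ B ∋ v → 5 ≤ length (L̄ v)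
      B-nō Xv nB = subst (λ l → 5 ≤ length l) (sym (at (λ { refl → nB Bu }) (λ { refl → nB Bw }))) (B-no Xv nB)

      into : ∀ {ψ} → Col X (∈L L̄) ψ → E (ψ q₁) (ψ q₂)
      into {ψ} C = ψ , Col-lists {P = ∈L L̄} {Off L u w} (λ {v} _ h vu vw → subst (ψ v ∈_) (at vu vw) h) C
          , pairs (list₂ (subst (ψ u ∈_) at-u (C .lst (B∈ Bu)))) (list₂ (subst (ψ w ∈_) at-w (C .lst (B∈ Bw)))) (C .prp (B∈ Bu) (B∈ Bw) uw) , refl , refl
        where
        pairs : ∀ {x y} → x ≡ a ⊎ x ≡ b → y ≡ a ⊎ y ≡ b → x ≢ y → ⟪ dem u w a b ⟫ x y
        pairs (inj₁ refl) (inj₁ refl) ne = ⊥-elim (ne refl)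
        pairs (inj₁ p) (inj₂ q) ne = inj₁ (p , q)
        pairs (inj₂ p) (inj₁ q) ne = inj₂ (p , q)
        pairs (inj₂ refl) (inj₂ refl) ne = ⊥-elim (ne refl)

      into′ : ∀ {r s x y} → Q r → Q s → r ≢ s → ∃[ ψ ] (Col X (∈L L̄) ψ × ψ r ≡ x × ψ s ≡ y) → Oriented E r s x y
      into′ {r} {s} Qr Qs rs (ψ , C , e₁ , e₂) = subst₂ (Oriented E r s) e₁ e₂ (orient {E} ψ Qr Qs rs (into C))

      outcome : DemOut
      outcome = case Q? u ,′ Q? w of λ where
          (yes Qu , yes Qw) → ⊥-elim (other-edge (Qu , Qw))
          (no nu , no nw) → conf (Conf-mono (λ { (ψ , C , refl , refl) → into C }) (Alternation.disjoint D₁ nu nw))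
          (no nu , yes Qw) → case partner Qw of λ (r , Qr , wr , _) →
            case Alternation.Shared.shared D₁ (Alternation.joint {r = r} Qw Qr wr (λ { refl → nu Qr }) nu) of λ where
              (inj₁ cf) → conf (Conf-mono (λ { (ψ , C , refl , refl) → into C }) cf)
              (inj₂ (ru , e , l , g , g')) → apex (inj₂ refl) Qw Qr ru (~-sym wr) (subst (_≐₃ (a , b , e)) (at (λ q → ~-irr ru q) (λ q → ~-irr wr (sym q))) l)
                (into′ Qw Qr (~-irr wr) g) (into′ Qw Qr (~-irr wr) g')
          (yes Qu , no nw) → case partner Qu of λ (r , Qr , ur , _) →
            case Alternation.Shared.shared D₂ (Alternation.joint {r = r} Qu Qr ur (λ { refl → nw Qr }) nw) of λ where
              (inj₁ cf) → conf (Conf-mono (λ { (ψ , C , refl , refl) → into C }) cf)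
              (inj₂ (rw , e , l , g , g')) → apex (inj₁ refl) Qu Qr (~-sym ur) rw (subst (_≐₃ (a , b , e)) (at (λ q → ~-irr ur (sym q)) (λ q → ~-irr rw q)) l)
                (into′ Qu Qr (~-irr ur) g) (into′ Qu Qr (~-irr ur) g')
        where
        D₁ = seeds L̄ u w a b ab Bu Bw uw (both at-u) (both at-w) reḡ B-nō
        D₂ = seeds L̄ w u a b ab Bw Bu (~-sym uw) (both at-w) (both at-u) (λ Xv vw vu → reḡ Xv vu vw) B-nō

  -- Reorientation, and governments located at vertices

  Ext-swap : ∀ {X L p₁ p₂ q₁ q₂} {C : Rel} {x y} → Ext X L p₁ p₂ C q₁ q₂ x y → Ext X L p₂ p₁ (C ᵀ) q₁ q₂ x y
  Ext-swap {L = L} {p₁} {p₂} (ψ , C , c , e) = ψ , Col-lists {P = Off L p₁ p₂} {Off L p₂ p₁} (λ _ h a b → h b a) C , c , e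

  Ext-rel : ∀ {X L p₁ p₂ q₁ q₂} {C C' : Rel} {x y} → (∀ {k l} → C k l → C' k l) → Ext X L p₁ p₂ C q₁ q₂ x y → Ext X L p₁ p₂ C' q₁ q₂ x y
  Ext-rel h (ψ , C , c , e) = ψ , C , h c , e

  End-mono : ∀ {s q₁ q₂} {F F' : Rel} → (∀ {x y} → F x y → F' x y) → End s q₁ q₂ F → End s q₁ q₂ F'
  End-mono h (inj₁ (a , b , f)) = inj₁ (a , b , λ c → h (f c))
  End-mono h (inj₂ (a , b , f)) = inj₂ (a , b , λ c → h (f c))

  Can-swap : ∀ {X L p₁ p₂ q₁ q₂} → Can X L p₁ p₂ q₁ q₂ → Can X L p₂ p₁ q₁ q₂
  Can-swap c = record { out₁ = c .out₂ ; out₂ = c .out₁ ; p-adj = ~-sym (c .p-adj) ; outq₁ = c .outq₁ ; outq₂ = c .outq₂ ; q-adj = c .q-adj ; reg = λ Xv a b → c .reg Xv b a }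

  ⟪⟫-proper : ∀ s → Valid s → ∀ {k l} → ⟪ s ⟫ k l → k ≢ l
  ⟪⟫-proper (star p x c W) (_ , _ , c∉) (refl , l∈) refl = c∉ l∈
  ⟪⟫-proper (dem u w a b) ne (inj₁ (refl , refl)) e = ne e
  ⟪⟫-proper (dem u w a b) ne (inj₂ (refl , refl)) e = ne (sym e)

  -- Types of governments with the dictator given as a vertex.
  data Site : Set where
    at : Fin n → ℕ → Site
    dd : ℕ → ℕ → Site

  DifferS : Site → Site → Set
  DifferS (at v c) (at v' c') = ¬ (v ≡ v' × c ≡ c')
  DifferS (at _ _) (dd _ _) = ⊤
  DifferS (dd _ _) (at _ _) = ⊤
  DifferS (dd a b) (dd a' b') = Differ (dm a b) (dm a' b')

  HasS : Rel → Fin n → Fin n → Site → Set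
  HasS F r s (at v c) = (v ≡ r × Has F (st₁ c)) ⊎ (v ≡ s × Has F (st₂ c))
  HasS F r s (dd a b) = Has F (dm a b)

  HasS-mono : ∀ {F F' : Rel} {r s} → (∀ {x y} → F x y → F' x y) → ∀ σ → HasS F r s σ → HasS F' r s σ
  HasS-mono {F} h (at v c) (inj₁ (e , f)) = inj₁ (e , Has-mono {F} h (st₁ c) f)
  HasS-mono {F} h (at v c) (inj₂ (e , f)) = inj₂ (e , Has-mono {F} h (st₂ c) f)
  HasS-mono h (dd a b) f = Has-mono h (dm a b) f

  Conf-sites : ∀ {F r s} σ σ' → DifferS σ σ' → HasS F r s σ → HasS F r s σ' → Conf F
  Conf-sites (at _ c) (at _ c') d (inj₁ (refl , f)) (inj₁ (refl , g)) = st₁ c , st₁ c' , (λ e → d (refl , e)) , f , g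
  Conf-sites (at _ c) (at _ c') d (inj₁ (refl , f)) (inj₂ (refl , g)) = st₁ c , st₂ c' , tt , f , g
  Conf-sites (at _ c) (at _ c') d (inj₂ (refl , f)) (inj₁ (refl , g)) = st₂ c , st₁ c' , tt , f , g
  Conf-sites (at _ c) (at _ c') d (inj₂ (refl , f)) (inj₂ (refl , g)) = st₂ c , st₂ c' , (λ e → d (refl , e)) , f , g
  Conf-sites (at _ c) (dd a b) d (inj₁ (refl , f)) g = st₁ c , dm a b , tt , f , g
  Conf-sites (at _ c) (dd a b) d (inj₂ (refl , f)) g = st₂ c , dm a b , tt , f , g
  Conf-sites (dd a b) (at _ c) d f (inj₁ (refl , g)) = dm a b , st₁ c , tt , f , g
  Conf-sites (dd a b) (at _ c) d f (inj₂ (refl , g)) = dm a b , st₂ c , tt , f , g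
  Conf-sites (dd a b) (dd a' b') d f g = dm a b , dm a' b' , d , f , g

  site : Fin n → Fin n → Ty → Site
  site r s (st₁ c) = at r c
  site r s (st₂ c) = at s c
  site r s (dm a b) = dd a b

  Differ-site : ∀ {r s} τ τ' → r ≢ s → Differ τ τ' → DifferS (site r s τ) (site r s τ')
  Differ-site (st₁ _) (st₁ _) ne d (_ , e) = d e
  Differ-site (st₁ _) (st₂ _) ne d (e , _) = ne e
  Differ-site (st₂ _) (st₁ _) ne d (e , _) = ne (sym e)
  Differ-site (st₂ _) (st₂ _) ne d (_ , e) = d e
  Differ-site (st₁ _) (dm _ _) ne d = tt
  Differ-site (st₂ _) (dm _ _) ne d = tt
  Differ-site (dm _ _) (st₁ _) ne d = tt
  Differ-site (dm _ _) (st₂ _) ne d = tt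
  Differ-site (dm _ _) (dm _ _) ne d = d

  -- Classification of canvases and the induction step

  record Problem : Set where
    constructor problem
    field
      {X} : VSet n
      {L} : Lists
      {p₁ p₂ q₁ q₂} : Fin n
      can : Can X L p₁ p₂ q₁ q₂

  module Solve (π : Problem) where
    open Problem π

    P Q : Fin n → Set
    P v = v ≡ p₁ ⊎ v ≡ p₂
    Q v = v ≡ q₁ ⊎ v ≡ q₂

    Short : Fin n → Set
    Short v = X ∋ v × (¬ 5 ≤ length (L v) ⊎ P v ⊎ Q v)

    P? : ∀ v → Dec (P v)
    P? v = (v ≟ p₁) ⊎-dec (v ≟ p₂)
    Q? : ∀ v → Dec (Q v)
    Q? v = (v ≟ q₁) ⊎-dec (v ≟ q₂)

    Short? : ∀ v → Dec (Short v)
    Short? v = (X ∋? v) ×-dec (¬? (5 ≤? length (L v)) ⊎-dec (P? v ⊎-dec Q? v))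

    B : VSet n
    B = ⟦ Short? ⟧

    XP : ∀ {v} → P v → X ∋ v
    XP (inj₁ refl) = out∈ (can .out₁)
    XP (inj₂ refl) = out∈ (can .out₂)
    XQ : ∀ {v} → Q v → X ∋ v
    XQ (inj₁ refl) = out∈ (can .outq₁)
    XQ (inj₂ refl) = out∈ (can .outq₂)

    BP : ∀ {v} → P v → B ∋ v
    BP h = ⟦⟧in (XP h , inj₂ (inj₁ h))
    BQ : ∀ {v} → Q v → B ∋ v
    BQ h = ⟦⟧in (XQ h , inj₂ (inj₂ h))

    B-no : ∀ {v} → X ∋ v → ¬ B ∋ v → 5 ≤ length (L v)
    B-no Xv nB = decidable-stable (5 ≤? _) λ h → nB (⟦⟧in (Xv , inj₁ h))

    B-out : ∀ {v} → B ∋ v → Out X v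
    B-out {v} h = case P? v ,′ Q? v of λ where
      (yes (inj₁ refl) , _) → can .out₁
      (yes (inj₂ refl) , _) → can .out₂
      (_ , yes (inj₁ refl)) → can .outq₁
      (_ , yes (inj₂ refl)) → can .outq₂
      (no np , no nq) → case ⟦⟧out {P? = Short?} h of λ where
        (Xv , inj₁ s) → Reg-Out {L = L} (can .reg Xv (λ e → np (inj₁ e)) (λ e → np (inj₂ e))) s
        (_ , inj₂ (inj₁ p)) → ⊥-elim (np p)
        (_ , inj₂ (inj₂ q)) → ⊥-elim (nq q)

    join-P : ∀ {S v v'} → S ∋ v → S ∋ v' → P v → P v' → Walk S v v'
    join-P a b (inj₁ refl) (inj₁ refl) = [ a ]
    join-P a b (inj₁ refl) (inj₂ refl) = [ a ] ▸ (can .p-adj , b)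
    join-P a b (inj₂ refl) (inj₁ refl) = [ a ] ▸ (~-sym (can .p-adj) , b)
    join-P a b (inj₂ refl) (inj₂ refl) = [ a ]

    join-Q : ∀ {S v v'} → S ∋ v → S ∋ v' → Q v → Q v' → Walk S v v'
    join-Q a b (inj₁ refl) (inj₁ refl) = [ a ]
    join-Q a b (inj₁ refl) (inj₂ refl) = [ a ] ▸ (can .q-adj , b)
    join-Q a b (inj₂ refl) (inj₁ refl) = [ a ] ▸ (~-sym (can .q-adj) , b)
    join-Q a b (inj₂ refl) (inj₂ refl) = [ a ]

    Same : Set
    Same = (p₁ ≡ q₁ × p₂ ≡ q₂) ⊎ (p₁ ≡ q₂ × p₂ ≡ q₁)

    same-when : ∀ {p x} → P p → P x → p ≢ x → Q p → Q x → Same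
    same-when {p} {x} Pp Px ne Qp Qx = case Pp ,′ Px of λ where
        (inj₁ refl , inj₁ refl) → ⊥-elim (ne refl)
        (inj₂ refl , inj₂ refl) → ⊥-elim (ne refl)
        (inj₁ refl , inj₂ refl) → go Qp Qx ne
        (inj₂ refl , inj₁ refl) → go Qx Qp λ e → ne (sym e)
      where
      go : Q p₁ → Q p₂ → p₁ ≢ p₂ → Same
      go (inj₁ a) (inj₁ b) ne = ⊥-elim (ne (trans a (sym b)))
      go (inj₁ a) (inj₂ b) _ = inj₁ (a , b)
      go (inj₂ a) (inj₁ b) _ = inj₂ (a , b)
      go (inj₂ a) (inj₂ b) ne = ⊥-elim (ne (trans a (sym b)))

    -- A removable part off both edges: `ext` changes no colour outside `Y`, so the colours on `P`
    -- and `P'` survive.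
    record Shrink : Set where
      field
        Y : VSet n
        y : Fin n
        Y⊂X : Y ⊂ X
        y∈Y : Y ∋ y
        Y-P : ∀ {v} → P v → ¬ Y ∋ v
        Y-Q : ∀ {v} → Q v → ¬ Y ∋ v
        ext : ∀ {ψ₁ : Fin n → ℕ} → Col (X ∖ Y) (Off L p₁ p₂) ψ₁ → Σ (Fin n → ℕ) λ ψ → Col X (Off L p₁ p₂) ψ × (∀ {v} → ¬ Y ∋ v → ψ v ≡ ψ₁ v)

    record Sep : Set where
      field
        u w p q : Fin n
        Bu : B ∋ u
        Bw : B ∋ w
        uw : u ~ w
        Pp : P p
        Qq : Q q
        p∈ : (X - u - w) ∋ p
        q∈ : (X - u - w) ∋ q
        apart : ¬ Walk (X - u - w) p q

    data Class : Set where
      same : Same → Class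
      shrink : Shrink → Class
      sep : Sep → Class
      ctx : ¬ Same → Ctx X B q₁ q₂ → Class

    -- Without such a cut, every component behind an edge of `B` meets `P` or `P'`; if moreover no
    -- such edge separates these two, it separates nothing, which is `PC`.
    Red : Set
    Red = ∃[ u ] ∃[ w ] ∃[ y ] (B ∋ u × B ∋ w × u ~ w × (X - u - w) ∋ y × ¬ (∃[ v ] ((P v ⊎ Q v) × comp (X - u - w) y ∋ v)))

    red? : Dec Red
    red? = any? λ u → any? λ w → any? λ y → (B ∋? u) ×-dec (B ∋? w) ×-dec (u ~? w) ×-dec ((X - u - w) ∋? y)
      ×-dec ¬? (any? λ v → (P? v ⊎-dec Q? v) ×-dec (comp (X - u - w) y ∋? v))

    red-shrink : Red → Shrink
    red-shrink (u , w , y , Bu , Bw , uw , Sy , none) = record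
        { Y = Y ; y = y ; Y⊂X = YX ; y∈Y = comp-in [ Sy ] ; Y-P = λ Pv h → none (_ , inj₁ Pv , h) ; Y-Q = λ Qv h → none (_ , inj₂ Qv , h)
        ; ext = refill {X} {Off L p₁ p₂} {L} {u} {w} {Y} (B-out Bu) (B-out Bw) uw YX (λ h → -ne (-out (Wend (comp-out h))) refl) (λ h → -ne (Wend (comp-out h)) refl)
            bd λ Yv → can .reg (YX Yv) (λ e → none (_ , inj₁ (inj₁ e) , Yv)) (λ e → none (_ , inj₁ (inj₂ e) , Yv)) , λ h _ _ → h }
      where
      Y = comp (X - u - w) y
      YX : Y ⊂ X
      YX h = -out (-out (Wend (comp-out h)))
      bd : ∀ {x z} → Y ∋ x → X ∋ z → ¬ Y ∋ z → x ~ z → z ≡ u ⊎ z ≡ w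
      bd {x} {z} a b c e = case ((z ≟ u) ,′ (z ≟ w)) of λ where
        (yes q , _) → inj₁ q
        (_ , yes q) → inj₂ q
        (no q , no r) → ⊥-elim (c (comp-edge a (-in (-in b q) r) e))

    sep? : Dec Sep
    sep? = map′ (λ { (u , w , p , q , a , b , c , d , e , f , g , h) → record { u = u ; w = w ; p = p ; q = q ; Bu = a ; Bw = b ; uw = c ; Pp = d ; Qq = e ; p∈ = f ; q∈ = g ; apart = h } })
      (λ s → let open Sep s in u , w , p , q , Bu , Bw , uw , Pp , Qq , p∈ , q∈ , apart)
      (any? λ u → any? λ w → any? λ p → any? λ q → (B ∋? u) ×-dec (B ∋? w) ×-dec (u ~? w) ×-dec P? p ×-dec Q? q
        ×-dec ((X - u - w) ∋? p) ×-dec ((X - u - w) ∋? q) ×-dec ¬? (walk? (X - u - w) p q))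

    Cut₂ : Fin n → Fin n → Fin n → Fin n → Fin n → Set
    Cut₂ z₁ z₂ z₃ z₄ y = z₃ ~ z₄ × z₁ ≢ z₃ × z₁ ≢ z₄ × z₂ ≢ z₃ × z₂ ≢ z₄ × (X - z₁ - z₂ - z₃ - z₄) ∋ y
          × ¬ (∃[ b ] (B ∋ b × Walk (X - z₁ - z₂ - z₃ - z₄) y b))

    Cut₁ : Fin n → Fin n → Fin n → Fin n → Set
    Cut₁ z₁ z₂ z₃ z₄ = B ∋ z₁ × B ∋ z₂ × X ∋ z₃ × X ∋ z₄ × (B ∋ z₃ ⊎ z₁ ~ z₃) × (B ∋ z₄ ⊎ z₁ ~ z₄)

    Cut : Set
    Cut = ∃[ z₁ ] ∃[ z₂ ] ∃[ z₃ ] ∃[ z₄ ] (Cut₁ z₁ z₂ z₃ z₄ × ∃[ y ] Cut₂ z₁ z₂ z₃ z₄ y)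

    cut? : Dec Cut
    cut? = any? λ z₁ → any? λ z₂ → any? λ z₃ → any? λ z₄ → ((B ∋? z₁) ×-dec (B ∋? z₂) ×-dec (X ∋? z₃) ×-dec (X ∋? z₄)
        ×-dec ((B ∋? z₃) ⊎-dec (z₁ ~? z₃)) ×-dec ((B ∋? z₄) ⊎-dec (z₁ ~? z₄)))
        ×-dec (any? λ y → (z₃ ~? z₄) ×-dec ¬? (z₁ ≟ z₃) ×-dec ¬? (z₁ ≟ z₄) ×-dec ¬? (z₂ ≟ z₃) ×-dec ¬? (z₂ ≟ z₄)
          ×-dec ((X - z₁ - z₂ - z₃ - z₄) ∋? y) ×-dec ¬? (any? λ b → (B ∋? b) ×-dec walk? (X - z₁ - z₂ - z₃ - z₄) y b))

    -- Once `z₁` is deleted, `z₃` and `z₄` are outer and their edge can be precoloured; behind the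
    -- cut all lists have five colours, of which two may be lost to `z₁` and `z₂`.
    cut-shrink : Cut → Shrink
    cut-shrink (z₁ , z₂ , z₃ , z₄ , (B₁ , B₂ , X₃ , X₄ , c₃ , c₄) , y , e₃₄ , n₁₃ , n₁₄ , n₂₃ , n₂₄ , Sy , none) = record
        { Y = Y ; y = y ; Y⊂X = YX ; y∈Y = comp-in [ Sy ] ; Y-P = λ Pv h → no-B h (BP Pv) ; Y-Q = λ Qv h → no-B h (BQ Qv)
        ; ext = refill₄ {X} {Off L p₁ p₂} {L} {z₁} {z₂} {z₃} {z₄} {Y} (B-out B₁) o₂ (outer X₃ n₁₃ c₃) (outer X₄ n₁₄ c₄) e₃₄ n₂₃ n₂₄ YX
            (λ h → no-B h B₁) (λ h → no-B h B₂) (λ h → -ne (-out (S∋ h)) refl) (λ h → -ne (S∋ h) refl) bd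
            λ Yv → proj₁ (can .reg (YX Yv) (λ e → no-B Yv (BP (inj₁ e))) (λ e → no-B Yv (BP (inj₂ e)))) , B-no (YX Yv) (no-B Yv) , λ h _ _ → h }
      where
      S = X - z₁ - z₂ - z₃ - z₄
      Y = comp S y
      S∋ : ∀ {v} → Y ∋ v → S ∋ v
      S∋ h = Wend (comp-out h)
      YX : Y ⊂ X
      YX h = -out (-out (-out (-out (S∋ h))))
      no-B : ∀ {v} → Y ∋ v → ¬ B ∋ v
      no-B h Bv = none (_ , Bv , comp-out h)
      outer : ∀ {z} → X ∋ z → z₁ ≢ z → B ∋ z ⊎ z₁ ~ z → Out (X - z₁) z
      outer Xz ne (inj₁ Bz) = mono -out (-in Xz λ e → ne (sym e)) (B-out Bz)
      outer Xz ne (inj₂ e) = expose (B-out B₁) e Xz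
      o₂ : z₂ ≡ z₁ ⊎ Out (X - z₁) z₂
      o₂ = case z₂ ≟ z₁ of λ where
        (yes e) → inj₁ e
        (no ne) → inj₂ (mono -out (-in (out∈ (B-out B₂)) ne) (B-out B₂))
      bd : ∀ {x z} → Y ∋ x → X ∋ z → ¬ Y ∋ z → x ~ z → z ≡ z₁ ⊎ z ≡ z₂ ⊎ z ≡ z₃ ⊎ z ≡ z₄
      bd {x} {z} a b c e = case (z ≟ z₁) ,′ (z ≟ z₂) ,′ (z ≟ z₃) ,′ (z ≟ z₄) of λ where
        (yes q , _) → inj₁ q
        (_ , yes q , _) → inj₂ (inj₁ q)
        (_ , _ , yes q , _) → inj₂ (inj₂ (inj₁ q))
        (_ , _ , _ , yes q) → inj₂ (inj₂ (inj₂ q))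
        (no n₁ , no n₂ , no n₃ , no n₄) → ⊥-elim (c (comp-edge a (-in (-in (-in (-in b n₁) n₂) n₃) n₄) e))

    reduced : ¬ Red → ¬ Sep → ¬ Cut → Ctx X B q₁ q₂
    reduced nred nsep ncut = record { B-out = B-out ; PC = pc ; IR = ir ; Bq₁ = BQ (inj₁ refl) ; Bq₂ = BQ (inj₂ refl) ; q~ = can .q-adj }
      where
      hits : ∀ {u w y} → B ∋ u → B ∋ w → u ~ w → (X - u - w) ∋ y → ∃[ v ] ((P v ⊎ Q v) × comp (X - u - w) y ∋ v)
      hits {u} {w} {y} Bu Bw uw Sy = decidable-stable (any? λ v → (P? v ⊎-dec Q? v) ×-dec (comp (X - u - w) y ∋? v)) λ h → nred (u , w , y , Bu , Bw , uw , Sy , h)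
      pc : ∀ {u w y y'} → B ∋ u → B ∋ w → u ~ w → (X - u - w) ∋ y → (X - u - w) ∋ y' → Walk (X - u - w) y y'
      pc {u} {w} {y} {y'} Bu Bw uw Sy Sy' = case hits Bu Bw uw Sy ,′ hits Bu Bw uw Sy' of λ where
          ((v , h , a) , (v' , h' , a')) → (comp-out a ◂◂ link h h' (Wend (comp-out a)) (Wend (comp-out a'))) ◂◂ Wrev (comp-out a')
        where
        cross-walk : ∀ {p q} → P p → Q q → (X - u - w) ∋ p → (X - u - w) ∋ q → Walk (X - u - w) p q
        cross-walk {p} {q} Pp Qq a b = decidable-stable (walk? (X - u - w) p q) λ h → nsep (record
          { u = u ; w = w ; p = p ; q = q ; Bu = Bu ; Bw = Bw ; uw = uw ; Pp = Pp ; Qq = Qq ; p∈ = a ; q∈ = b ; apart = h })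
        link : ∀ {v v'} → P v ⊎ Q v → P v' ⊎ Q v' → (X - u - w) ∋ v → (X - u - w) ∋ v' → Walk (X - u - w) v v'
        link (inj₁ p) (inj₁ p') a b = join-P a b p p'
        link (inj₂ q) (inj₂ q') a b = join-Q a b q q'
        link (inj₁ p) (inj₂ q) a b = cross-walk p q a b
        link (inj₂ q) (inj₁ p) a b = Wrev (cross-walk p q b a)
      ir : ∀ {z₁ z₂ z₃ z₄ y} → B ∋ z₁ → B ∋ z₂ → X ∋ z₃ → X ∋ z₄ → (B ∋ z₃ ⊎ z₁ ~ z₃) → (B ∋ z₄ ⊎ z₁ ~ z₄)
        → z₃ ~ z₄ → z₁ ≢ z₃ → z₁ ≢ z₄ → z₂ ≢ z₃ → z₂ ≢ z₄ → (X - z₁ - z₂ - z₃ - z₄) ∋ y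
        → ∃[ b ] (B ∋ b × Walk (X - z₁ - z₂ - z₃ - z₄) y b)
      ir {z₁} {z₂} {z₃} {z₄} {y} a b c d e f g h i j k l = decidable-stable (any? λ b → (B ∋? b) ×-dec walk? (X - z₁ - z₂ - z₃ - z₄) y b)
        λ none → ncut (z₁ , z₂ , z₃ , z₄ , (a , b , c , d , e , f) , y , g , h , i , j , k , l , none)

    same? : Dec Same
    same? = ((p₁ ≟ q₁) ×-dec (p₂ ≟ q₂)) ⊎-dec ((p₁ ≟ q₂) ×-dec (p₂ ≟ q₁))

    classify : Class
    classify = case same? of λ where
      (yes s) → same s
      (no ns) → case red? of λ where
        (yes r) → shrink (red-shrink r)
        (no nr) → case sep? of λ where
          (yes s) → sep s
          (no nsp) → case cut? of λ where
            (yes c) → shrink (cut-shrink c)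
            (no nc) → ctx ns (reduced nr nsp nc)

    -- How the type of a government at P determines the one it induces at P′ when P and P′ share a vertex.
    data Image : Site → Site → Set where
      keep : ∀ {p c} → P p → Q p → Image (at p c) (at p c)
      merge : ∀ {p x y a b c} → P p → P x → p ≢ x → ¬ Q p → Q x → Q y → ¬ P y → L y ≐₃ (a , b , c) → Image (at p c) (dd a b)
      split : ∀ {m z a b e} → P m → Q m → Q z → ¬ P z → L z ≐₃ (a , b , e) → Image (dd a b) (at z e)

    other-unique : ∀ {m y y'} → P m → Q m → Q y → ¬ P y → Q y' → ¬ P y' → y ≡ y'
    other-unique Pm Qm Qy ny Qy' ny' = case Qm ,′ Qy ,′ Qy' of λ where
      (inj₁ refl , inj₁ refl , _) → ⊥-elim (ny Pm)
      (inj₁ refl , _ , inj₁ refl) → ⊥-elim (ny' Pm)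
      (inj₁ refl , inj₂ a , inj₂ b) → trans a (sym b)
      (inj₂ refl , inj₂ refl , _) → ⊥-elim (ny Pm)
      (inj₂ refl , _ , inj₂ refl) → ⊥-elim (ny' Pm)
      (inj₂ refl , inj₁ a , inj₁ b) → trans a (sym b)

    source-unique : ∀ {p x p'} → P p → P x → p ≢ x → Q x → P p' → ¬ Q p' → p' ≡ p
    source-unique Pp Px ne Qx Pp' nq = case Pp ,′ Px ,′ Pp' of λ where
      (inj₁ refl , inj₁ refl , _) → ⊥-elim (ne refl)
      (inj₂ refl , inj₂ refl , _) → ⊥-elim (ne refl)
      (inj₁ refl , inj₂ refl , inj₁ a) → a
      (inj₁ refl , inj₂ refl , inj₂ refl) → ⊥-elim (nq Qx)
      (inj₂ refl , inj₁ refl , inj₂ a) → a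
      (inj₂ refl , inj₁ refl , inj₁ refl) → ⊥-elim (nq Qx)

    same-third : ∀ {l a b c a' b' c'} → l ≐₃ (a , b , c) → l ≐₃ (a' , b' , c') → (a ≡ a' × b ≡ b') ⊎ (a ≡ b' × b ≡ a') → c ≡ c'
    same-third (c∈ , ne , _) (_ , _ , all) h = case all _ (proj₂ (proj₂ c∈)) ,′ h of λ where
      (inj₁ refl , inj₁ (refl , _)) → ⊥-elim (proj₁ (proj₂ ne) refl)
      (inj₁ refl , inj₂ (_ , refl)) → ⊥-elim (proj₂ (proj₂ ne) refl)
      (inj₂ (inj₁ refl) , inj₁ (_ , refl)) → ⊥-elim (proj₂ (proj₂ ne) refl)
      (inj₂ (inj₁ refl) , inj₂ (refl , _)) → ⊥-elim (proj₁ (proj₂ ne) refl)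
      (inj₂ (inj₂ e) , _) → e

    same-pair : ∀ {l a b c a' b'} → l ≐₃ (a , b , c) → l ≐₃ (a' , b' , c) → (a ≡ a' × b ≡ b') ⊎ (a ≡ b' × b ≡ a')
    same-pair ((a∈ , b∈ , _) , (ab , ac , bc) , _) (_ , _ , all) = case all _ a∈ ,′ all _ b∈ of λ where
      (inj₁ e , inj₂ (inj₁ f)) → inj₁ (e , f)
      (inj₂ (inj₁ e) , inj₁ f) → inj₂ (e , f)
      (inj₁ refl , inj₁ refl) → ⊥-elim (ab refl)
      (inj₂ (inj₁ refl) , inj₂ (inj₁ refl)) → ⊥-elim (ab refl)
      (inj₂ (inj₂ e) , _) → ⊥-elim (ac e)
      (_ , inj₂ (inj₂ e)) → ⊥-elim (bc e)

    -- Nothing is forgotten: a list {a, b, c} recovers `c` from {a, b} and {a, b} from `c`, and the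
    -- positions of `P` and `P'` determine the vertices involved. So the two governments of a
    -- confederacy are never merged.
    image-differ : ∀ {σ σ' τ τ'} → Image σ τ → Image σ' τ' → DifferS σ σ' → DifferS τ τ'
    image-differ (keep _ _) (keep _ _) d = d
    image-differ (keep _ _) (merge _ _ _ _ _ _ _ _) d = tt
    image-differ (keep Pp _) (split _ _ _ nz _) d (refl , _) = nz Pp
    image-differ (merge _ _ _ _ _ _ _ _) (keep _ _) d = tt
    image-differ (merge Pp Px ne nQ Qx Qy ny l) (merge Pp' Px' ne' nQ' Qx' Qy' ny' l') d h =
      case other-unique Px Qx Qy ny Qy' ny' of λ where
        refl → d (sym (source-unique Pp Px ne Qx Pp' nQ') , same-third l l' h)
    image-differ (merge _ _ _ _ _ _ _ _) (split _ _ _ _ _) d = tt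
    image-differ (split _ _ _ nz _) (keep Pp _) d (refl , _) = nz Pp
    image-differ (split _ _ _ _ _) (merge _ _ _ _ _ _ _ _) d = tt
    image-differ (split Pm Qm Qz nz l) (split _ _ Qz' nz' l') d (refl , refl) = d (same-pair l l')

    record Smaller : Set₁ where
      constructor smaller-than
      field
        {k} : ℕ
        ih : IH k
        lt : sz X < suc k

    module Step (κ : Smaller) where
      open Smaller κ

      record Remaining : Set where
        constructor remaining
        field
          ns : ¬ Same
          cx : Ctx X B q₁ q₂

      module Last (ρ : Remaining) where
        open Remaining ρ

        σ : Setup
        σ = setup cx ih lt

        open Geometry σ using (Oriented)

        q≢ : q₁ ≢ q₂
        q≢ = ~-irr (can .q-adj)

        private
          P-or : ∀ {p x} → P p → P x → p ≢ x → ∀ {v} → P v → v ≡ p ⊎ v ≡ x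
          P-or (inj₁ refl) (inj₁ refl) ne h = ⊥-elim (ne refl)
          P-or (inj₁ refl) (inj₂ refl) ne h = h
          P-or (inj₂ refl) (inj₁ refl) ne (inj₁ e) = inj₂ e
          P-or (inj₂ refl) (inj₁ refl) ne (inj₂ e) = inj₁ e
          P-or (inj₂ refl) (inj₂ refl) ne h = ⊥-elim (ne refl)

        oriented-star : ∀ {E : Rel} {r s c l l'} → l ≢ l' → Oriented E r s c l → Oriented E r s c l' → HasS E q₁ q₂ (at r c)
        oriented-star ne (inj₁ (refl , refl , e)) (inj₁ (_ , _ , e')) = inj₁ (refl , _ , _ , ne , e , e')
        oriented-star ne (inj₂ (refl , refl , e)) (inj₂ (_ , _ , e')) = inj₂ (refl , _ , _ , ne , e , e')
        oriented-star ne (inj₁ (refl , _)) (inj₂ (f , _)) = ⊥-elim (q≢ f)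
        oriented-star ne (inj₂ (refl , _)) (inj₁ (f , _)) = ⊥-elim (q≢ (sym f))

        oriented-swap : ∀ {E : Rel} {r s x y} → Oriented E r s x y → Oriented E s r y x
        oriented-swap (inj₁ (a , b , e)) = inj₂ (b , a , e)
        oriented-swap (inj₂ (a , b , e)) = inj₁ (b , a , e)

        oriented-dem : ∀ {E : Rel} {r s a b} → a ≢ b → Oriented E r s a b → Oriented E r s b a → HasS E q₁ q₂ (dd a b)
        oriented-dem ne (inj₁ (refl , refl , e)) (inj₁ (_ , _ , e')) = ne , e , e'
        oriented-dem ne (inj₂ (refl , refl , e)) (inj₂ (_ , _ , e')) = ne , e' , e
        oriented-dem ne (inj₁ (refl , _)) (inj₂ (f , _)) = ⊥-elim (q≢ f)
        oriented-dem ne (inj₂ (refl , _)) (inj₁ (f , _)) = ⊥-elim (q≢ (sym f))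

        oriented-end : ∀ {E : Rel} s' {x y} → Oriented E (src s') (dst s') x y → (∀ {k l} → ⟪ s' ⟫ k l → Oriented E (src s') (dst s') k l) → End s' q₁ q₂ E
        oriented-end {E} s' (inj₁ (a , b , _)) h = inj₁ (a , b , λ c → use (h c))
          where
          use : ∀ {k l} → Oriented E (src s') (dst s') k l → E k l
          use (inj₁ (_ , _ , e)) = e
          use (inj₂ (f , _)) = ⊥-elim (q≢ (trans (sym a) f))
        oriented-end {E} s' (inj₂ (a , b , _)) h = inj₂ (a , b , λ c → use (h c))
          where
          use : ∀ {k l} → Oriented E (src s') (dst s') k l → E l k
          use (inj₂ (_ , _ , e)) = e
          use (inj₁ (f , _)) = ⊥-elim (q≢ (trans (sym f) a))

        module _ {p x : Fin n} (Pp : P p) (Px : P x) (px : p ~ x) where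
          distinct : p ≢ x
          distinct = ~-irr px

          regP : ∀ {v} → X ∋ v → v ≢ p → v ≢ x → Reg X L v
          regP {v} Xv vp vx = can .reg Xv (λ e → off (inj₁ e)) (λ e → off (inj₂ e))
            where
            off : ¬ P v
            off h = case P-or Pp Px distinct h of λ where
              (inj₁ e) → vp e
              (inj₂ e) → vx e

          module S (c : ℕ) (W : List ℕ) (val : Valid (star p x c W)) where
            open Geometry.Star σ (Geometry.starred L B-no p x c W (BP Pp) (BP Px) px val regP (λ (a , b) → ns (same-when Pp Px distinct a b))) using (E; outcome; conf; turned; triangle) public

            off-P : ∀ {y} → p ~ y → y ≢ x → ¬ P y
            off-P py yx h = case P-or Pp Px distinct h of λ where
              (inj₁ e) → ~-irr py (sym e)
              (inj₂ e) → yx e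

            reg-y : ∀ {y} → Q y → p ~ y → y ≢ x → Reg X L y
            reg-y Qy py yx = regP (XQ Qy) (λ e → ~-irr py (sym e)) yx

            -- The form used for confederacies: it keeps the type induced at the target rather than
            -- the moves.
            star-site : Conf E ⊎ ∃[ σ ] (HasS E q₁ q₂ σ × Image (at p c) σ)
            star-site = case outcome of λ where
              (conf cf) → inj₁ cf
              (turned {y} Qp Qy py yx f) → let r = reg-y Qy py yx in case pick2 (⊖uniq {L y} {c} (proj₁ r)) (⊖len {L y} {c} (proj₁ r) (Reg-3≤ {L = L} r)) of λ where
                (l , l' , l∈ , l'∈ , ne) → inj₂ (at p c , oriented-star {E} ne (f l∈) (f l'∈) , keep Pp Qp)
              (triangle {y} {a} {b} Qx Qy py xy yp (_ , _ , ab , _) ly f g) → inj₂ (dd a b , oriented-dem {E} ab f g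
                , merge Pp Px distinct (λ Qp → ns (same-when Pp Px distinct Qp Qx)) Qx Qy (off-P py λ e → ~-irr xy (sym e)) ly)

            star-gov : Res X L (star p x c W) q₁ q₂
            star-gov = case outcome of λ where
              (conf cf) → inj₁ cf
              (turned {y} Qp Qy py yx f) → let r = reg-y Qy py yx in case pick1 (ℕₚ.<⇒≤ (⊖len {L y} {c} (proj₁ r) (Reg-3≤ {L = L} r))) of λ where
                (l , l∈) → inj₂ (star p y c (L y ⊖ c) , oriented-end {E} (star p y c (L y ⊖ c)) (f l∈) (λ { (refl , h) → f h })
                  , (⊖uniq {L y} {c} (proj₁ r) , ⊖len {L y} {c} (proj₁ r) (Reg-3≤ {L = L} r) , (λ h → ⊖ne {L y} h refl))
                  , turn py (XQ Qy) yx distinct ∷ nil)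
              (triangle {y} {a} {b} Qx Qy py xy yp w ly f g) → inj₂ (dem x y a b
                , oriented-end {E} (dem x y a b) f (λ { (inj₁ (refl , refl)) → f ; (inj₂ (refl , refl)) → g })
                , proj₁ (proj₂ (proj₂ w))
                , tri px py xy (XQ Qx) (XQ Qy) (inj₁ (refl , w)) (inj₂ ((λ e → ~-irr xy (sym e)) , ly)) ∷ nil)

          module D (a b : ℕ) (ab : a ≢ b) where
            open Geometry.Dem σ (Geometry.dual L B-no p x a b (BP Pp) (BP Px) px ab regP (λ (a , b) → ns (same-when Pp Px distinct a b))) using (E; outcome; conf; apex) public

            dem-site : Conf E ⊎ ∃[ σ ] (HasS E q₁ q₂ σ × Image (dd a b) σ)
            dem-site = case outcome of λ where
              (conf cf) → inj₁ cf
              (apex {m} {z} {e} mP Qm Qz zp zx lz f g) → inj₂ (at z e , oriented-star {E} ab (oriented-swap {E} f) (oriented-swap {E} g)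
                , split (case mP of λ { (inj₁ refl) → Pp ; (inj₂ refl) → Px }) Qm Qz
                    (λ h → case P-or Pp Px distinct h of λ { (inj₁ e) → ~-irr zp e ; (inj₂ e) → ~-irr zx e }) lz)

            dem-gov : Res X L (dem p x a b) q₁ q₂
            dem-gov = case outcome of λ where
                (conf cf) → inj₁ cf
                (apex (inj₁ refl) Qm Qz zp zx lz f g) → inj₂ (result Qm f g lz (apex₂ zp zx (XQ Qz) distinct lz))
                (apex (inj₂ refl) Qm Qz zp zx lz f g) → inj₂ (result Qm f g lz (apex₁ zp zx (XQ Qz) distinct lz))
              where
              result : ∀ {m z e R} → Q m → Oriented E m z a e → Oriented E m z b e → L z ≐₃ (a , b , e)
                → Move L X (dem p x a b) (star z m e (a ∷ b ∷ [])) R → ∃[ s' ] (End s' q₁ q₂ E × Valid s' × Steps L X (dem p x a b) s')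
              result {m} {z} {e} Qm f g (_ , (_ , ae , be) , _) mv = star z m e (a ∷ b ∷ [])
                , oriented-end {E} (star z m e (a ∷ b ∷ [])) (oriented-swap {E} f) (λ { (refl , here refl) → oriented-swap {E} f ; (refl , there (here refl)) → oriented-swap {E} g })
                , ((ab ∷ []) ∷ [] ∷ [] , s≤s (s≤s z≤n) , (λ { (here q) → ae (sym q) ; (there (here q)) → be (sym q) }))
                , mv ∷ nil

        con-final : ∀ {C : Rel} → (∀ {x y} → C x y → x ≢ y) → Conf C → Conf (Ext X L p₁ p₂ C q₁ q₂)
        con-final {C} proper (τ , τ' , d , h , h') = case image τ h ,′ image τ' h' of λ where
            (inj₁ cf , _) → cf
            (_ , inj₁ cf) → cf
            (inj₂ (σ , f , i) , inj₂ (σ' , f' , i')) → Conf-sites σ σ' (image-differ i i' (Differ-site τ τ' (~-irr (can .p-adj)) d)) f f'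
          where
          F : Rel
          F = Ext X L p₁ p₂ C q₁ q₂
          lift : ∀ {E : Rel} {σ₀} → (∀ {x y} → E x y → F x y) → Conf E ⊎ ∃[ σ ] (HasS E q₁ q₂ σ × Image σ₀ σ) → Conf F ⊎ ∃[ σ ] (HasS F q₁ q₂ σ × Image σ₀ σ)
          lift h (inj₁ cf) = inj₁ (Conf-mono h cf)
          lift h (inj₂ (σ , f , i)) = inj₂ (σ , HasS-mono h σ f , i)
          two : ∀ {c y y'} → y ≢ y' → c ≢ y → c ≢ y' → Unique (y ∷ y' ∷ []) × 2 ≤ 2 × ¬ c ∈ y ∷ y' ∷ []
          two ne a b = ((ne ∷ []) ∷ [] ∷ []) , s≤s (s≤s z≤n) , λ { (here e) → a e ; (there (here e)) → b e }
          image : ∀ τ → Has C τ → Conf F ⊎ ∃[ σ ] (HasS F q₁ q₂ σ × Image (site p₁ p₂ τ) σ)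
          image (st₁ c) (y , y' , ne , f , g) = lift (λ h → Ext-rel {C = ⟪ star p₁ p₂ c (y ∷ y' ∷ []) ⟫} {C} (λ { (refl , here refl) → f ; (refl , there (here refl)) → g }) h)
            (S.star-site (inj₁ refl) (inj₂ refl) (can .p-adj) c (y ∷ y' ∷ []) (two ne (proper f) (proper g)))
          image (st₂ c) (y , y' , ne , f , g) = lift (λ h → Ext-rel {C = ⟪ star p₂ p₁ c (y ∷ y' ∷ []) ⟫ ᵀ} {C} (λ { (refl , here refl) → f ; (refl , there (here refl)) → g }) (Ext-swap {C = ⟪ star p₂ p₁ c (y ∷ y' ∷ []) ⟫} h))
            (S.star-site (inj₂ refl) (inj₁ refl) (~-sym (can .p-adj)) c (y ∷ y' ∷ []) (two ne (λ e → proper f (sym e)) (λ e → proper g (sym e))))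
          image (dm a b) (ne , f , g) = lift (λ h → Ext-rel {C = ⟪ dem p₁ p₂ a b ⟫} {C} (λ { (inj₁ (refl , refl)) → f ; (inj₂ (refl , refl)) → g }) h)
            (D.dem-site (inj₁ refl) (inj₂ refl) (can .p-adj) a b ne)

        gov-final : ∀ s → src s ≡ p₁ → dst s ≡ p₂ → Valid s → Res X L s q₁ q₂
        gov-final (star p x c W) refl refl val = S.star-gov (inj₁ refl) (inj₂ refl) (can .p-adj) c W val
        gov-final (dem u w a b) refl refl ab = D.dem-gov (inj₁ refl) (inj₂ refl) (can .p-adj) a b ab

      smaller : ∀ {Y v} → Y ⊂ X → X ∋ v → ¬ Y ∋ v → sz Y < k
      smaller {Y} {v} h a b = ℕₚ.≤-trans (sz-strict {X = Y} {X} {v} h a b) (ℕₚ.≤-pred lt)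

      module Equal (sm : Same) {C : Rel} (proper : ∀ {x y} → C x y → x ≢ y) where
        F : Rel
        F = Ext X L p₁ p₂ C q₁ q₂

        precoloured : ∀ {x y} → C x y → ∃[ ψ ] (Col X (Off L p₁ p₂) ψ × ψ p₁ ≡ x × ψ p₂ ≡ y)
        precoloured c = thomassen {X} {L} (can .out₁ , can .out₂ , inj₂ (can .p-adj , proper c)) (can .reg)

        along-P : p₁ ≡ q₁ → p₂ ≡ q₂ → ∀ {x y} → C x y → F x y
        along-P refl refl c = case precoloured c of λ (ψ , D , e₁ , e₂) → ψ , D , subst₂ C (sym e₁) (sym e₂) c , e₁ , e₂

        against-P : p₁ ≡ q₂ → p₂ ≡ q₁ → ∀ {x y} → C x y → F y x
        against-P refl refl c = case precoloured c of λ (ψ , D , e₁ , e₂) → ψ , D , subst₂ C (sym e₁) (sym e₂) c , e₂ , e₁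

        conf-equal : Conf C → Conf F
        conf-equal cf = case sm of λ where
          (inj₁ (a , b)) → Conf-mono (along-P a b) cf
          (inj₂ (a , b)) → Confᵀ {F = F ᵀ} (Conf-mono {C} {F ᵀ} (against-P a b) cf)

      gov-equal : Same → ∀ s → src s ≡ p₁ → dst s ≡ p₂ → Valid s → Res X L s q₁ q₂
      gov-equal sm s refl refl val = inj₂ (s , end sm , val , nil)
        where
        module E = Equal sm {⟪ s ⟫} (⟪⟫-proper s val)
        end : Same → End s q₁ q₂ (Ext X L (src s) (dst s) ⟪ s ⟫ q₁ q₂)
        end (inj₁ (a , b)) = inj₁ (a , b , E.along-P a b)
        end (inj₂ (a , b)) = inj₂ (a , b , E.against-P a b)

      module Shrunk (sh : Shrink) where
        open Shrink sh

        small : sz (X ∖ Y) < k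
        small = smaller ∖out (Y⊂X y∈Y) λ h → ∖no h y∈Y

        keepP : ∀ {v} → P v → (X ∖ Y) ∋ v
        keepP h = ∖in (XP h) (Y-P h)
        keepQ : ∀ {v} → Q v → (X ∖ Y) ∋ v
        keepQ h = ∖in (XQ h) (Y-Q h)

        can' : Can (X ∖ Y) L p₁ p₂ q₁ q₂
        can' = record
          { out₁ = mono ∖out (keepP (inj₁ refl)) (can .out₁) ; out₂ = mono ∖out (keepP (inj₂ refl)) (can .out₂) ; p-adj = can .p-adj
          ; outq₁ = mono ∖out (keepQ (inj₁ refl)) (can .outq₁) ; outq₂ = mono ∖out (keepQ (inj₂ refl)) (can .outq₂) ; q-adj = can .q-adj
          ; reg = λ Xv a b → Reg-mono {L = L} ∖out Xv (can .reg (∖out Xv) a b) }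

        refilled : ∀ {C : Rel} {x y} → Ext (X ∖ Y) L p₁ p₂ C q₁ q₂ x y → Ext X L p₁ p₂ C q₁ q₂ x y
        refilled {C} (ψ₁ , D₁ , c , e , e') = case ext D₁ of λ (ψ , D , h) → ψ , D , subst₂ C (sym (h (Y-P (inj₁ refl)))) (sym (h (Y-P (inj₂ refl)))) c
          , trans (h (Y-Q (inj₁ refl))) e , trans (h (Y-Q (inj₂ refl))) e'

        con-shrunk : ∀ {C : Rel} → (∀ {x y} → C x y → x ≢ y) → Conf C → Conf (Ext X L p₁ p₂ C q₁ q₂)
        con-shrunk {C} proper cf = Conf-mono (refilled {C}) (ih .con small can' proper cf)

        gov-shrunk : ∀ s → src s ≡ p₁ → dst s ≡ p₂ → Valid s → Res X L s q₁ q₂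
        gov-shrunk s refl refl val = case ih .gov s small can' val of λ where
          (inj₁ cf) → inj₁ (Conf-mono (refilled {⟪ s ⟫}) cf)
          (inj₂ (s' , e , v , st)) → inj₂ (s' , End-mono {s'} (refilled {⟪ s ⟫}) e , v , steps-mono ∖out st)

      module Separated (sp : Sep) where
        open Sep sp

        S K X₁ X₂ : VSet n
        S = X - u - w
        K = comp S p
        X₁ = K ⊹ u ⊹ w
        X₂ = X ∖ K

        KX : K ⊂ X
        KX h = -out (-out (Wend (comp-out h)))
        u∉K : ¬ K ∋ u
        u∉K h = -ne (-out (Wend (comp-out h))) refl
        w∉K : ¬ K ∋ w
        w∉K h = -ne (Wend (comp-out h)) refl
        Xu = out∈ (B-out Bu)
        Xw = out∈ (B-out Bw)
        u₁ : X₁ ∋ u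
        u₁ = ⊹in (⊹new {X = K})
        w₁ : X₁ ∋ w
        w₁ = ⊹new {X = K ⊹ u}
        u₂ : X₂ ∋ u
        u₂ = ∖in Xu u∉K
        w₂ : X₂ ∋ w
        w₂ = ∖in Xw w∉K

        sides : ∀ {v} → X₁ ∋ v → K ∋ v ⊎ v ≡ u ⊎ v ≡ w
        sides {v} h = case (v ≟ u) ,′ (v ≟ w) of λ where
          (yes e , _) → inj₂ (inj₁ e)
          (_ , yes e) → inj₂ (inj₂ e)
          (no a , no b) → inj₁ (⊹out (⊹out {X = K ⊹ u} h b) a)

        X₁X : X₁ ⊂ X
        X₁X h = case sides h of λ where
          (inj₁ q) → KX q
          (inj₂ (inj₁ refl)) → Xu
          (inj₂ (inj₂ refl)) → Xw

        P-split : ∀ {v} → P v → K ∋ v ⊎ v ≡ u ⊎ v ≡ w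
        P-split {v} Pv = case (v ≟ u) ,′ (v ≟ w) of λ where
          (yes e , _) → inj₂ (inj₁ e)
          (_ , yes e) → inj₂ (inj₂ e)
          (no a , no b) → inj₁ (comp-in (join-P p∈ (-in (-in (XP Pv) a) b) Pp Pv))

        P₁ : ∀ {v} → P v → X₁ ∋ v
        P₁ Pv = case P-split Pv of λ where
          (inj₁ q) → ⊹in (⊹in q)
          (inj₂ (inj₁ refl)) → u₁
          (inj₂ (inj₂ refl)) → w₁

        Q-off : ∀ {v} → Q v → ¬ K ∋ v
        Q-off Qv h = apart (comp-out h ◂◂ join-Q (Wend (comp-out h)) q∈ Qv Qq)

        Q₂ : ∀ {v} → Q v → X₂ ∋ v
        Q₂ Qv = ∖in (XQ Qv) (Q-off Qv)

        small₁ : sz X₁ < k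
        small₁ = smaller X₁X (-out (-out q∈)) λ h → case sides h of λ where
          (inj₁ a) → Q-off Qq a
          (inj₂ (inj₁ e)) → -ne (-out q∈) e
          (inj₂ (inj₂ e)) → -ne q∈ e

        small₂ : sz X₂ < k
        small₂ = smaller ∖out (-out (-out p∈)) λ h → ∖no h (comp-in [ p∈ ])

        can₁ : Can X₁ L p₁ p₂ u w
        can₁ = record
          { out₁ = mono X₁X (P₁ (inj₁ refl)) (can .out₁) ; out₂ = mono X₁X (P₁ (inj₂ refl)) (can .out₂) ; p-adj = can .p-adj
          ; outq₁ = mono X₁X u₁ (B-out Bu) ; outq₂ = mono X₁X w₁ (B-out Bw) ; q-adj = uw
          ; reg = λ Xv a b → Reg-mono {L = L} X₁X Xv (can .reg (X₁X Xv) a b) }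

        can₂ : Can X₂ L u w q₁ q₂
        can₂ = record
          { out₁ = mono ∖out u₂ (B-out Bu) ; out₂ = mono ∖out w₂ (B-out Bw) ; p-adj = uw
          ; outq₁ = mono ∖out (Q₂ (inj₁ refl)) (can .outq₁) ; outq₂ = mono ∖out (Q₂ (inj₂ refl)) (can .outq₂) ; q-adj = can .q-adj
          ; reg = λ Xv a b → Reg-mono {L = L} ∖out Xv (can .reg (∖out Xv) (λ e → P-off Xv a b (inj₁ e)) (λ e → P-off Xv a b (inj₂ e))) }
          where
          P-off : ∀ {v} → X₂ ∋ v → v ≢ u → v ≢ w → ¬ P v
          P-off Xv a b Pv = case P-split Pv of λ where
            (inj₁ h) → ∖no Xv h
            (inj₂ (inj₁ e)) → a e
            (inj₂ (inj₂ e)) → b e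

        -- The first side fixes the colours of `u` and `w`, the second takes them as prescribed, and
        -- so the two colourings agree on the cut.
        composed : ∀ {C : Rel} {x y} → Ext X₂ L u w (Ext X₁ L p₁ p₂ C u w) q₁ q₂ x y → Ext X L p₁ p₂ C q₁ q₂ x y
        composed {C} (ψ₂ , D₂ , (ψ₁ , D₁ , c , eu , ew) , e , e') = glued K ψ₂ ψ₁
            , across {P = Off L p₁ p₂} {Off L p₁ p₂} K KX bd (Col-lists {P = Off L u w} {Off L p₁ p₂} lists D₂) D₁ (λ _ h → h) eu ew
            , subst₂ C (sym (on-X₁ (P₁ (inj₁ refl)))) (sym (on-X₁ (P₁ (inj₂ refl)))) c
            , trans (glued-off {K} {ψ₂} {ψ₁} (Q-off (inj₁ refl))) e , trans (glued-off {K} {ψ₂} {ψ₁} (Q-off (inj₂ refl))) e'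
          where
          bd : ∀ {x z} → K ∋ x → X ∋ z → ¬ K ∋ z → x ~ z → z ≡ u ⊎ z ≡ w
          bd {x} {z} a b c e = case ((z ≟ u) ,′ (z ≟ w)) of λ where
            (yes q , _) → inj₁ q
            (_ , yes q) → inj₂ q
            (no q , no r) → ⊥-elim (c (comp-edge a (-in (-in b q) r) e))
          lists : ∀ {v} → X₂ ∋ v → Off L u w v (ψ₂ v) → Off L p₁ p₂ v (ψ₂ v)
          lists {v} Xv h a b = case (v ≟ u) ,′ (v ≟ w) of λ where
            (yes refl , _) → subst (_∈ L u) eu (D₁ .lst u₁ a b)
            (_ , yes refl) → subst (_∈ L w) ew (D₁ .lst w₁ a b)
            (no f , no g) → h f g
          on-X₁ : ∀ {v} → X₁ ∋ v → glued K ψ₂ ψ₁ v ≡ ψ₁ v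
          on-X₁ {v} h = case sides h of λ where
            (inj₁ q) → glued-on {K} {ψ₂} {ψ₁} q
            (inj₂ (inj₁ refl)) → trans (glued-off {K} {ψ₂} {ψ₁} u∉K) (sym eu)
            (inj₂ (inj₂ refl)) → trans (glued-off {K} {ψ₂} {ψ₁} w∉K) (sym ew)

        proper₁ : ∀ {C : Rel} {x y} → Ext X₁ L p₁ p₂ C u w x y → x ≢ y
        proper₁ (ψ , D , _ , refl , refl) e = D .prp u₁ w₁ uw e

        con-sep : ∀ {C : Rel} → (∀ {x y} → C x y → x ≢ y) → Conf C → Conf (Ext X L p₁ p₂ C q₁ q₂)
        con-sep {C} proper cf = Conf-mono (composed {C}) (ih .con small₂ can₂ (proper₁ {C}) (ih .con small₁ can₁ proper cf))

        -- A confederacy at the cut is carried on by the second claim of the induction; a state at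
        -- the cut starts the second side, and the two sequences of moves are joined.
        gov-sep : ∀ s → src s ≡ p₁ → dst s ≡ p₂ → Valid s → Res X L s q₁ q₂
        gov-sep s refl refl val = case ih .gov s small₁ can₁ val of λ where
            (inj₁ cf) → inj₁ (Conf-mono (composed {⟪ s ⟫}) (ih .con small₂ can₂ (proper₁ {⟪ s ⟫}) cf))
            (inj₂ (s₁ , inj₁ (eu , ew , h) , v₁ , steps₁)) → second s₁ v₁ steps₁ (inj₁ (eu , ew)) (subst₂ (λ a b → Can X₂ L a b q₁ q₂) (sym eu) (sym ew) can₂)
              λ f → composed {⟪ s ⟫} (Ext-rel {C = ⟪ s₁ ⟫} {Ext X₁ L (src s) (dst s) ⟪ s ⟫ u w} h (subst₂ (λ a b → Ext X₂ L a b ⟪ s₁ ⟫ q₁ q₂ _ _) eu ew f))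
            (inj₂ (s₁ , inj₂ (ew , eu , h) , v₁ , steps₁)) → second s₁ v₁ steps₁ (inj₂ (ew , eu)) (subst₂ (λ a b → Can X₂ L a b q₁ q₂) (sym ew) (sym eu) (Can-swap can₂))
              λ f → composed {⟪ s ⟫} (Ext-rel {C = ⟪ s₁ ⟫ ᵀ} {Ext X₁ L (src s) (dst s) ⟪ s ⟫ u w} h (Ext-swap {C = ⟪ s₁ ⟫} (subst₂ (λ a b → Ext X₂ L a b ⟪ s₁ ⟫ q₁ q₂ _ _) ew eu f)))
          where
          second : ∀ s₁ → Valid s₁ → Steps L X₁ s s₁ → (src s₁ ≡ u × dst s₁ ≡ w) ⊎ (src s₁ ≡ w × dst s₁ ≡ u) → Can X₂ L (src s₁) (dst s₁) q₁ q₂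
            → (∀ {x y} → Ext X₂ L (src s₁) (dst s₁) ⟪ s₁ ⟫ q₁ q₂ x y → Ext X L (src s) (dst s) ⟪ s ⟫ q₁ q₂ x y) → Res X L s q₁ q₂
          second s₁ v₁ steps₁ ends c₂ into = case ih .gov s₁ small₂ c₂ v₁ of λ where
              (inj₁ cf) → inj₁ (Conf-mono into cf)
              (inj₂ (s' , e , v , steps₂)) → inj₂ (s' , End-mono {s'} into e , v
                , steps-++ X₁X ∖out meet (P₁ (inj₁ refl) , P₁ (inj₂ refl)) steps₁ steps₂)
            where
            meet : ∀ {v} → X₁ ∋ v → X₂ ∋ v → v ≡ src s₁ ⊎ v ≡ dst s₁
            meet a b = case sides a ,′ ends of λ where
              (inj₁ h , _) → ⊥-elim (∖no b h)
              (inj₂ (inj₁ e) , inj₁ (f , _)) → inj₁ (trans e (sym f))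
              (inj₂ (inj₂ e) , inj₁ (_ , f)) → inj₂ (trans e (sym f))
              (inj₂ (inj₁ e) , inj₂ (_ , f)) → inj₂ (trans e (sym f))
              (inj₂ (inj₂ e) , inj₂ (f , _)) → inj₁ (trans e (sym f))

      con-step : ∀ {C : Rel} → (∀ {x y} → C x y → x ≢ y) → Conf C → Conf (Ext X L p₁ p₂ C q₁ q₂)
      con-step proper cf = case classify of λ where
        (same s) → Equal.conf-equal s proper cf
        (shrink sh) → Shrunk.con-shrunk sh proper cf
        (sep sp) → Separated.con-sep sp proper cf
        (ctx ns cx) → Last.con-final (remaining ns cx) proper cf

      gov-step : ∀ s → src s ≡ p₁ → dst s ≡ p₂ → Valid s → Res X L s q₁ q₂
      gov-step s e e' val = case classify of λ where
        (same sm) → gov-equal sm s e e' val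
        (shrink sh) → Shrunk.gov-shrunk sh s e e' val
        (sep sp) → Separated.gov-sep sp s e e' val
        (ctx ns cx) → Last.gov-final (remaining ns cx) s e e' val

  main : ∀ k → IH k
  main zero = record { gov = λ _ () ; con = λ () }
  main (suc k) = record { gov = λ s lt can val → Solve.Step.gov-step (problem can) (Solve.smaller-than (main k) lt) s refl refl val
                        ; con = λ lt can proper cf → Solve.Step.con-step (problem can) (Solve.smaller-than (main k) lt) proper cf }

-- Outer regions of subgraphs, and collections as relations

OuterR-mono : ∀ {M H K d} → (∀ d → es {M} H d ≡ true → es {M} K d ≡ true) → OuterR M K d → OuterR M H d
OuterR-mono h base = base
OuterR-mono h (along o) = along (OuterR-mono h o)
OuterR-mono {M} {H} h (cross {d} e o) = cross (¬true λ q → true≢false (h d q) e) (OuterR-mono {M} {H} h o)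

⊹split : ∀ {n} {X : VSet n} {u v} → (X ⊹ u) ∋ v → v ≡ u ⊎ X ∋ v
⊹split {X = X} {u} {v} h = case v ≟ u of λ where
  (yes e) → inj₁ e
  (no ne) → inj₂ (⊹out {X = X} h ne)

inP-true : ∀ {n} {p₁ p₂ v : Fin n} → InP p₁ p₂ v → inP? p₁ p₂ v ≡ true
inP-true {p₁ = p₁} {p₂} {v} h with v ≟ p₁ | v ≟ p₂ | h
... | yes _ | _ | _ = refl
... | no _ | yes _ | _ = refl
... | no a | no b | inj₁ e = ⊥-elim (a e)
... | no a | no b | inj₂ e = ⊥-elim (b e)

true-inP : ∀ {n} {p₁ p₂ v : Fin n} → inP? p₁ p₂ v ≡ true → InP p₁ p₂ v
true-inP {p₁ = p₁} {p₂} {v} h with v ≟ p₁ | v ≟ p₂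
... | yes e | _ = inj₁ e
... | no _ | yes e = inj₂ e

InP-swap : ∀ {n} {p₁ p₂ v : Fin n} → InP p₁ p₂ v → InP p₂ p₁ v
InP-swap (inj₁ e) = inj₂ e
InP-swap (inj₂ e) = inj₁ e

π₁ π₂ : ℕ × ℕ → ℕ
π₁ = proj₁
π₂ = proj₂

⟨_⟩ : Coll → Rel
⟨ 𝒞 ⟩ x y = (x , y) ∈ 𝒞

Proper : Rel → Set
Proper F = ∀ {x y} → F x y → x ≢ y

members : ∀ {F} τ → Has F τ → Coll
members (st₁ c) (y , y' , _) = (c , y) ∷ (c , y') ∷ []
members (st₂ c) (x , x' , _) = (x , c) ∷ (x' , c) ∷ []
members (dm a b) _ = (a , b) ∷ (b , a) ∷ []

members-All : ∀ {F : Rel} τ (h : Has F τ) → All (λ (x , y) → F x y) (members τ h)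
members-All (st₁ c) (_ , _ , _ , f , g) = f ∷ g ∷ []
members-All (st₂ c) (_ , _ , _ , f , g) = f ∷ g ∷ []
members-All (dm a b) (_ , f , g) = f ∷ g ∷ []

members-gov : ∀ {F} → Proper F → ∀ τ (h : Has F τ) → Government (members τ h)
members-gov pr (st₁ c) (_ , _ , ne , f , g) = (((λ e → ne (cong proj₂ e)) ∷ []) ∷ [] ∷ [] , pr f ∷ pr g ∷ []) , s≤s (s≤s z≤n) , inj₁ (c , inj₁ (refl ∷ refl ∷ []))
members-gov pr (st₂ c) (_ , _ , ne , f , g) = (((λ e → ne (cong proj₁ e)) ∷ []) ∷ [] ∷ [] , pr f ∷ pr g ∷ []) , s≤s (s≤s z≤n) , inj₁ (c , inj₂ (refl ∷ refl ∷ []))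
members-gov pr (dm a b) (ne , f , g) = (((λ e → ne (cong proj₁ e)) ∷ []) ∷ [] ∷ [] , ne ∷ (λ e → ne (sym e)) ∷ []) , s≤s (s≤s z≤n) , inj₂ (a , b , refl)

members-Has : ∀ {F} τ (h : Has F τ) {𝒟} → (∀ {x} → x ∈ members τ h → x ∈ 𝒟) → Has ⟨ 𝒟 ⟩ τ
members-Has (st₁ c) (y , y' , ne , _) k = y , y' , ne , k (here refl) , k (there (here refl))
members-Has (st₂ c) (y , y' , ne , _) k = y , y' , ne , k (here refl) , k (there (here refl))
members-Has (dm a b) (ne , _) k = ne , k (here refl) , k (there (here refl))

private
  two : ∀ {A : Set} {a b x : A} → x ∈ a ∷ b ∷ [] → x ≡ a ⊎ x ≡ b
  two (here e) = inj₁ e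
  two (there (here e)) = inj₂ e

  fst-type : ∀ {𝒟 c} → All (λ x → proj₁ x ≡ c) 𝒟 → ∀ τ → Has ⟨ 𝒟 ⟩ τ → τ ≡ st₁ c
  fst-type al (st₁ c) (_ , _ , _ , f , _) = cong st₁ (All.lookup al f)
  fst-type al (st₂ c) (_ , _ , ne , f , g) = ⊥-elim (ne (trans (All.lookup al f) (sym (All.lookup al g))))
  fst-type al (dm a b) (ne , f , g) = ⊥-elim (ne (trans (All.lookup al f) (sym (All.lookup al g))))

  snd-type : ∀ {𝒟 c} → All (λ x → proj₂ x ≡ c) 𝒟 → ∀ τ → Has ⟨ 𝒟 ⟩ τ → τ ≡ st₂ c
  snd-type al (st₁ c) (_ , _ , ne , f , g) = ⊥-elim (ne (trans (All.lookup al f) (sym (All.lookup al g))))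
  snd-type al (st₂ c) (_ , _ , _ , f , _) = cong st₂ (All.lookup al f)
  snd-type al (dm a b) (ne , f , g) = ⊥-elim (ne (trans (All.lookup al g) (sym (All.lookup al f))))

  dem-type : ∀ {a b} → a ≢ b → ∀ τ → Has ⟨ (a , b) ∷ (b , a) ∷ [] ⟩ τ → τ ≡ dm a b ⊎ τ ≡ dm b a
  dem-type ne (st₁ c) (_ , _ , d , f , g) = case two f ,′ two g of λ where
    (inj₁ refl , inj₁ refl) → ⊥-elim (d refl)
    (inj₁ refl , inj₂ refl) → ⊥-elim (ne refl)
    (inj₂ refl , inj₁ refl) → ⊥-elim (ne refl)
    (inj₂ refl , inj₂ refl) → ⊥-elim (d refl)
  dem-type ne (st₂ c) (_ , _ , d , f , g) = case two f ,′ two g of λ where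
    (inj₁ refl , inj₁ refl) → ⊥-elim (d refl)
    (inj₁ refl , inj₂ refl) → ⊥-elim (ne refl)
    (inj₂ refl , inj₁ refl) → ⊥-elim (ne refl)
    (inj₂ refl , inj₂ refl) → ⊥-elim (d refl)
  dem-type ne (dm c d) (_ , f , _) = case two f of λ where
    (inj₁ refl) → inj₁ refl
    (inj₂ refl) → inj₂ refl

  differ-irr : ∀ τ → ¬ Differ τ τ
  differ-irr (st₁ c) d = d refl
  differ-irr (st₂ c) d = d refl
  differ-irr (dm a b) d = d (inj₁ (refl , refl))

-- All colourings of a dictatorship agree at one end, and a democracy has only its two colourings,
-- so no second type fits in.
government-one-type : ∀ {𝒟} → Government 𝒟 → ∀ τ τ' → Has ⟨ 𝒟 ⟩ τ → Has ⟨ 𝒟 ⟩ τ' → ¬ Differ τ τ'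
government-one-type (_ , _ , inj₁ (c , inj₁ al)) τ τ' h h' d with fst-type al τ h | fst-type al τ' h'
... | refl | refl = d refl
government-one-type (_ , _ , inj₁ (c , inj₂ al)) τ τ' h h' d with snd-type al τ h | snd-type al τ' h'
... | refl | refl = d refl
government-one-type ((_ , ne ∷ _) , _ , inj₂ (a , b , refl)) τ τ' h h' d with dem-type ne τ h | dem-type ne τ' h'
... | inj₁ refl | inj₁ refl = differ-irr (dm a b) d
... | inj₂ refl | inj₂ refl = differ-irr (dm b a) d
... | inj₁ refl | inj₂ refl = d (inj₂ (refl , refl))
... | inj₂ refl | inj₁ refl = d (inj₂ (refl , refl))

-- The two governments may share a colouring, hence the deduplication; the presence of two types
-- keeps the union from being a government.
Conf-confederacy : ∀ {F} → Proper F → Conf F → ∃[ 𝒟 ] (Confederacy 𝒟 × All (λ (x , y) → F x y) 𝒟)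
Conf-confederacy {F} pr (τ , τ' , d , h , h') = 𝒟 , ((deduplicate-! _≟×_ 𝒟₀ , All.map (λ f → pr f) all) , no-gov , l , l' , members-gov pr τ h , members-gov pr τ' h' , λ x → mk⇔ (to x) (from x)) , all
  where
  _≟×_ = ≡-dec ℕ._≟_ ℕ._≟_
  l l' 𝒟₀ 𝒟 : Coll
  l = members τ h
  l' = members τ' h'
  𝒟₀ = l ++ l'
  𝒟 = deduplicate _≟×_ 𝒟₀
  to : ∀ x → x ∈ 𝒟 → x ∈ l ⊎ x ∈ l'
  to x h = ∈-++⁻ l (∈-deduplicate⁻ _≟×_ 𝒟₀ h)
  from : ∀ x → x ∈ l ⊎ x ∈ l' → x ∈ 𝒟
  from x (inj₁ h) = ∈-deduplicate⁺ _≟×_ (∈-++⁺ˡ h)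
  from x (inj₂ h) = ∈-deduplicate⁺ _≟×_ (∈-++⁺ʳ l h)
  all : All (λ (x , y) → F x y) 𝒟
  all = All.tabulate λ {x} x∈ → case to x x∈ of λ where
    (inj₁ q) → All.lookup (members-All τ h) q
    (inj₂ q) → All.lookup (members-All τ' h') q
  no-gov : ¬ Government 𝒟
  no-gov g = government-one-type g τ τ' (members-Has τ h λ q → from _ (inj₁ q)) (members-Has τ' h' λ q → from _ (inj₂ q)) d

data Kind (𝒞 : Coll) : Ty → Set where
  first : ∀ {c} → All (λ x → proj₁ x ≡ c) 𝒞 → Kind 𝒞 (st₁ c)
  second : ∀ {c} → All (λ x → proj₂ x ≡ c) 𝒞 → Kind 𝒞 (st₂ c)
  swap : ∀ {a b} → 𝒞 ≡ (a , b) ∷ (b , a) ∷ [] → Kind 𝒞 (dm a b)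

government-type : ∀ {𝒞} → Government 𝒞 → ∃[ τ ] (Kind 𝒞 τ × Has ⟨ 𝒞 ⟩ τ)
government-type {(x , y) ∷ []} (_ , s≤s () , _)
government-type {(x , y) ∷ (x' , y') ∷ 𝒞} ((((ne ∷ _) ∷ _) , _) , _ , inj₁ (c , inj₁ al@(refl ∷ refl ∷ _))) =
  st₁ c , first al , y , y' , (λ e → ne (cong (c ,_) e)) , here refl , there (here refl)
government-type {(x , y) ∷ (x' , y') ∷ 𝒞} ((((ne ∷ _) ∷ _) , _) , _ , inj₁ (c , inj₂ al@(refl ∷ refl ∷ _))) =
  st₂ c , second al , x , x' , (λ e → ne (cong (_, c) e)) , here refl , there (here refl)
government-type ((_ , ne ∷ _) , _ , inj₂ (a , b , refl)) = dm a b , swap refl , ne , here refl , there (here refl)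

private
  swapped-pair : ∀ {𝒞 a b} → Unique 𝒞 → 2 ≤ length 𝒞 → (∀ {x} → x ∈ 𝒞 → x ≡ (a , b) ⊎ x ≡ (b , a)) → Democracy 𝒞
  swapped-pair {x ∷ []} _ (s≤s ()) _
  swapped-pair {x ∷ y ∷ z ∷ 𝒞} ((n₁ ∷ n₂ ∷ _) ∷ (n₃ ∷ _) ∷ _) _ h = ⊥-elim (case h (here refl) ,′ h (there (here refl)) ,′ h (there (there (here refl))) of λ where
    (inj₁ a , inj₁ b , _) → n₁ (trans a (sym b))
    (inj₂ a , inj₂ b , _) → n₁ (trans a (sym b))
    (inj₁ a , inj₂ _ , inj₁ c) → n₂ (trans a (sym c))
    (inj₂ a , inj₁ _ , inj₂ c) → n₂ (trans a (sym c))
    (inj₁ _ , inj₂ b , inj₂ c) → n₃ (trans b (sym c))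
    (inj₂ _ , inj₁ b , inj₁ c) → n₃ (trans b (sym c)))
  swapped-pair {x ∷ y ∷ []} {a} {b} ((n₁ ∷ _) ∷ _) _ h with h (here refl) | h (there (here refl))
  ... | inj₁ refl | inj₁ refl = ⊥-elim (n₁ refl)
  ... | inj₂ refl | inj₂ refl = ⊥-elim (n₁ refl)
  ... | inj₁ refl | inj₂ refl = a , b , refl
  ... | inj₂ refl | inj₁ refl = b , a , refl

-- If the types of the two parts agreed, their union would again be a dictatorship or a democracy,
-- which a confederacy excludes.
confederacy-Conf : ∀ {𝒞} → Confederacy 𝒞 → Conf ⟨ 𝒞 ⟩
confederacy-Conf {𝒞} (col@(un , _) , ngov , 𝒞₁ , 𝒞₂ , g₁@(_ , le , _) , g₂ , eqv) = case government-type g₁ ,′ government-type g₂ of λ where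
    ((τ , k , h) , (τ' , k' , h')) → case Same? τ τ' of λ where
      (yes d) → τ , τ' , d , Has-mono (λ q → in₁ q) τ h , Has-mono (λ q → in₂ q) τ' h'
      (no nd) → ⊥-elim (ngov (col , len , merged k k' nd))
  where
  in₁ : ∀ {x} → x ∈ 𝒞₁ → x ∈ 𝒞
  in₁ q = Equivalence.from (eqv _) (inj₁ q)
  in₂ : ∀ {x} → x ∈ 𝒞₂ → x ∈ 𝒞
  in₂ q = Equivalence.from (eqv _) (inj₂ q)
  len : 2 ≤ length 𝒞
  len = ℕₚ.≤-trans le (unique-⊆-length (proj₁ (proj₁ g₁)) in₁)
  both : ∀ {P : ℕ × ℕ → Set} → All P 𝒞₁ → All P 𝒞₂ → All P 𝒞
  both a₁ a₂ = All.tabulate λ {x} q → case Equivalence.to (eqv x) q of λ where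
    (inj₁ r) → All.lookup a₁ r
    (inj₂ r) → All.lookup a₂ r
  merged : ∀ {τ τ'} → Kind 𝒞₁ τ → Kind 𝒞₂ τ' → ¬ Differ τ τ' → Dictatorship 𝒞 ⊎ Democracy 𝒞
  merged (first {c} a) (first {c'} a') nd with decidable-stable (c ℕ.≟ c') nd
  ... | refl = inj₁ (c , inj₁ (both a a'))
  merged (second {c} a) (second {c'} a') nd with decidable-stable (c ℕ.≟ c') nd
  ... | refl = inj₁ (c , inj₂ (both a a'))
  merged (swap {a} {b} refl) (swap {a'} {b'} refl) nd = inj₂ (swapped-pair {a = a} {b} un len λ {x} q → All.lookup {P = λ x → x ≡ (a , b) ⊎ x ≡ (b , a)} (both (inj₁ refl ∷ inj₂ refl ∷ []) (other-pair (decidable-stable (((a ℕ.≟ a') ×-dec (b ℕ.≟ b')) ⊎-dec ((a ℕ.≟ b') ×-dec (b ℕ.≟ a'))) nd))) q)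
    where
    other-pair : (a ≡ a' × b ≡ b') ⊎ (a ≡ b' × b ≡ a') → All (λ x → x ≡ (a , b) ⊎ x ≡ (b , a)) ((a' , b') ∷ (b' , a') ∷ [])
    other-pair (inj₁ (refl , refl)) = inj₁ refl ∷ inj₂ refl ∷ []
    other-pair (inj₂ (refl , refl)) = inj₂ refl ∷ inj₁ refl ∷ []
  merged (first _) (second _) nd = ⊥-elim (nd tt)
  merged (first _) (swap _) nd = ⊥-elim (nd tt)
  merged (second _) (first _) nd = ⊥-elim (nd tt)
  merged (second _) (swap _) nd = ⊥-elim (nd tt)
  merged (swap _) (first _) nd = ⊥-elim (nd tt)
  merged (swap _) (second _) nd = ⊥-elim (nd tt)

-- The given canvas as a problem on vertex sets

module Conclusion (M : PlaneMap) (G : Sub M) (p1 p2 q₁ q₂ : Fin (PlaneMap.n M)) (L : Fin (PlaneMap.n M) → List ℕ) (𝒞 : Coll)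
  (canvas₀ : Canvas M G p1 p2 L) (q-edge : OuterEdge M G q₁ q₂)
  (lists : All (λ x → proj₁ x ∈ L p1 × proj₂ x ∈ L p2 × proj₁ x ≢ proj₂ x) 𝒞) where
  open Canvas canvas₀
  open PlaneMap M using (n; m; vert; α; α-invol; σ-vert; φ)
  open Planar M G simple using (plane; Γ; ind; ei; ei-in; ei-out; flank)
  open ListColouring Γ plane

  X : VSet n
  X = vs G

  to-Out : ∀ {v} → OnOuterV M G v → Out X v
  to-Out (h , d , e , o) = h , d , e , OuterR-mono {M} {ind X} {G} (λ d q → proj₁ (ei-out {X} {d} q)) o

  edge-Out : ∀ {u w} → OuterEdge M G u w → Out X u × Out X w × u ~ w
  edge-Out (d , e , refl , refl , o) = to-Out (es-vs G d e , a o) , to-Out (es-vs G (α d) (trans (es-α G d) e) , b o) , d , e , refl , refl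
    where
    back : vert (φ (α d)) ≡ vert d
    back = trans (σ-vert _) (cong vert (α-invol d))
    a : OuterR M G d ⊎ OuterR M G (α d) → ∃[ d' ] (vert d' ≡ vert d × OuterR M G d')
    a (inj₁ o) = d , refl , o
    a (inj₂ o) = φ (α d) , back , along o
    b : OuterR M G d ⊎ OuterR M G (α d) → ∃[ d' ] (vert d' ≡ vert (α d) × OuterR M G d')
    b (inj₁ o) = φ d , σ-vert _ , along o
    b (inj₂ o) = α d , refl , o

  p-out = edge-Out P-outer
  q-out = edge-Out q-edge

  canvas-regular : ∀ {v} → X ∋ v → v ≢ p1 → v ≢ p2 → Reg X L v
  canvas-regular {v} (mk h) a b = L-set v h , (case Plane.Out? plane X v of λ where
    (yes o) → inj₂ (L-nonS v h a b , o)
    (no no') → inj₁ (L-int v h λ o → no' (to-Out o)))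

  can : Can X L p1 p2 q₁ q₂
  can = record { out₁ = proj₁ p-out ; out₂ = proj₁ (proj₂ p-out) ; p-adj = proj₂ (proj₂ p-out)
               ; outq₁ = proj₁ q-out ; outq₂ = proj₁ (proj₂ q-out) ; q-adj = proj₂ (proj₂ q-out) ; reg = canvas-regular }

  -- Realising moves by a harmonica

  Omit : Fin n → Fin n → Fin n → Fin n → Set
  Omit r t u w = (u ≡ r × w ≡ t) ⊎ (u ≡ t × w ≡ r)

  -- The edge rt is omitted; r = t omits nothing, since there are no loops.
  record Frame (H : Sub M) (V : VSet n) (r t : Fin n) : Set where
    field
      vs-to : ∀ {v} → vs H v ≡ true → V ∋ v
      vs-from : ∀ {v} → V ∋ v → vs H v ≡ true
      es-to : ∀ {d} → es H d ≡ true → es G d ≡ true × V ∋ vert d × V ∋ vert (α d) × ¬ Omit r t (vert d) (vert (α d))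
      es-from : ∀ {d} → es G d ≡ true → V ∋ vert d → V ∋ vert (α d) → ¬ Omit r t (vert d) (vert (α d)) → es H d ≡ true

  Frame-delete : ∀ {H V V' r t} (D : Fin n → Bool) → Frame H V r t → (∀ {v} → V' ∋ v → V ∋ v × D v ≡ false) → (∀ {v} → V ∋ v → D v ≡ false → V' ∋ v)
    → Frame (delete M H D) V' r t
  Frame-delete {H} {V} D f to from = record
      { vs-to = λ h → let (a , b) = ∧-true h in from (f.vs-to a) (not-true b)
      ; vs-from = λ h → let (a , b) = to h in true-∧ (f.vs-from a) (cong not b)
      ; es-to = λ {d} h → let (a , b) = ∧-true {es H d} h ; (b₁ , b₂) = ∧-true {not (D (vert d))} b ; (c , c₁ , c₂ , c₃) = f.es-to a in c , from c₁ (not-true b₁) , from c₂ (not-true b₂) , c₃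
      ; es-from = λ e a b ne → let (a₁ , a₂) = to a ; (b₁ , b₂) = to b in true-∧ (f.es-from e a₁ b₁ ne) (true-∧ (cong not a₂) (cong not b₂)) }
    where module f = Frame f

  -- Off the edge of the state, the harmonica is connected through a neighbour of that edge; this
  -- keeps the edge on the outer face.
  data Hub (S : VSet n) (N : Fin n → Set) : Set where
    none : (∀ {r} → ¬ S ∋ r) → Hub S N
    hub : ∀ h → S ∋ h → N h → (∀ {r} → S ∋ r → Walk S r h) → Hub S N

  Near : State → Fin n → Set
  Near (star p x c W) h = p ~ h
  Near (dem u w a b) h = h ~ u × h ~ w

  -- For a star only the set of colours at the free end is compared with `W`, and the path may be
  -- listed in either order; a democracy is matched literally, as the clauses of a harmonica demand.
  Fits : State → Fin n → Fin n → Coll → Set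
  Fits (star p x c W) p₁ p₂ 𝒞 = ((p₁ ≡ p × p₂ ≡ x) ⊎ (p₁ ≡ x × p₂ ≡ p)) × Government 𝒞 × DictatorAt 𝒞 p₁ p₂ p c
    × (∀ y → (Proj 𝒞 p₁ p₂ x y → y ∈ W) × (y ∈ W → Proj 𝒞 p₁ p₂ x y))
  Fits (dem u w a b) p₁ p₂ 𝒞 = p₁ ≡ u × p₂ ≡ w × 𝒞 ≡ (a , b) ∷ (b , a) ∷ []

  Listed : State → Set
  Listed (star p x c W) = c ∈ L p × (∀ {y} → y ∈ W → y ∈ L x)
  Listed (dem u w a b) = (a ∈ L u × b ∈ L u) × (a ∈ L w × b ∈ L w)

  record Stage (Y : VSet n) (s : State) : Set where
    field
      Y⊂X : Y ⊂ X
      src-in : Y ∋ src s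
      dst-in : Y ∋ dst s
      src-out : Out X (src s)
      dst-out : Out X (dst s)
      adj : src s ~ dst s
      valid : Valid s
      listed : Listed s
      regular : ∀ {v} → Y ∋ v → v ≢ src s → v ≢ dst s → Reg X L v

  record Body (Y : VSet n) (s : State) : Set where
    field
      V : VSet n
      r t : Fin n
      V⊂Y : V ⊂ Y
      V-out : ∀ {v} → V ∋ v → Out X v
      src∈ : V ∋ src s
      dst∈ : V ∋ dst s
      q₁∈ : V ∋ q₁
      q₂∈ : V ∋ q₂
      r∈ : V ∋ r
      t∈ : V ∋ t
      kept : ¬ Omit r t (src s) (dst s)
      q-kept : ¬ Omit r t q₁ q₂
      hubs : Hub (V - src s - dst s) (Near s)

  -- Quantified over all subgraphs with the right vertices and edges, since the deletions inside a
  -- harmonica produce the intended subgraph only extensionally.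
  record Built (Y : VSet n) (s : State) : Set where
    field
      body : Body Y s
      harm : ∀ {H} → Frame H (Body.V body) (Body.r body) (Body.t body) → ∀ {p₁ p₂ 𝒞} → Fits s p₁ p₂ 𝒞 → Harmonica M L q₁ q₂ H p₁ p₂ 𝒞

  OuterEdge-sym : ∀ {H u w} → OuterEdge M H u w → OuterEdge M H w u
  OuterEdge-sym {H} (d , e , a , b , inj₁ o) = α d , trans (es-α H d) e , b , trans (cong vert (α-invol d)) a , inj₂ (subst (OuterR M H) (sym (α-invol d)) o)
  OuterEdge-sym {H} (d , e , a , b , inj₂ o) = α d , trans (es-α H d) e , b , trans (cong vert (α-invol d)) a , inj₁ o

  module Framed {Y s} (stage : Stage Y s) (body : Body Y s) {H} (frame : Frame H (Body.V body) (Body.r body) (Body.t body)) where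
    open Stage stage
    open Body body
    open Frame frame

    V⊂X : V ⊂ X
    V⊂X h = Y⊂X (V⊂Y h)

    outV : ∀ {v} → V ∋ v → Out V v
    outV h = Plane.mono plane V⊂X h (V-out h)

    restrict : ∀ {K u w} → (∀ d → es H d ≡ true → es {M} K d ≡ true) → (∀ d → es K d ≡ true → es G d ≡ true)
      → V ∋ u → V ∋ w → ¬ Omit r t u w → OuterEdge M K u w → OuterEdge M H u w
    restrict {K} h g Vu Vw ok (d , e , refl , refl , o) = d , es-from (g d e) Vu Vw ok , refl , refl , (case o of λ where
      (inj₁ o) → inj₁ (OuterR-mono {M} {H} {K} h o)
      (inj₂ o) → inj₂ (OuterR-mono {M} {H} {K} h o))

    outerQ : OuterEdge M H q₁ q₂
    outerQ = restrict {G} (λ d e → proj₁ (es-to e)) (λ d e → e) q₁∈ q₂∈ q-kept q-edge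

    edge-in : ∀ {u w} → u ~ w → V ∋ u → V ∋ w → ¬ Omit r t u w → Adj M H u w
    edge-in (d , e , refl , refl) Vu Vw ok = d , es-from e Vu Vw ok , refl , refl

    -- If the edge were not outer, `flank` would give neighbours on both of its sides; the hub joins
    -- them off the edge, which the crossing property forbids.
    outerS : OuterEdge M H (src s) (dst s)
    outerS = restrict {ind V} (λ d e → let (a , b , c , _) = es-to e in ei-in {V} a b c) (λ d e → proj₁ (ei-out {V} e)) src∈ dst∈ kept
        (case flank {V} o dst∈ adj of λ where
          (inj₁ e) → e
          (inj₂ (r , t , Vr , Vt , ur , ut , l , l')) → ⊥-elim (between Vr Vt ur ut l l'))
      where
      o = outV src∈
      between : ∀ {r t} → V ∋ r → V ∋ t → src s ~ r → src s ~ t → Plane.pos plane {V} o r < Plane.pos plane {V} o (dst s) → Plane.pos plane {V} o (dst s) < Plane.pos plane {V} o t → ⊥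
      between {r} {t} Vr Vt ur ut l l' = Plane.nocross plane {V} o Vr dst∈ Vt ur adj ut l l' {V - src s - dst s} (λ h → -out (-out h)) (λ h → -ne (-out h) refl)
          (link (-in (-in Vr λ e → ~-irr ur (sym e)) λ { refl → ℕₚ.<-irrefl refl l }) (-in (-in Vt λ e → ~-irr ut (sym e)) λ { refl → ℕₚ.<-irrefl refl l' }))
          (outV dst∈) [ ∖in (-in dst∈ λ e → ~-irr adj (sym e)) (λ h → -ne h refl) ]
        where
        link : ∀ {r t} → (V - src s - dst s) ∋ r → (V - src s - dst s) ∋ t → Walk (V - src s - dst s) r t
        link a b = case hubs of λ where
          (none h) → ⊥-elim (h a)
          (hub h _ _ w) → w a ◂◂ Wrev (w b)

    colours : ∃[ a ] ∃[ b ] (a ∈ L (src s) × b ∈ L (dst s) × a ≢ b)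
    colours = go s valid listed
      where
      go : ∀ s → Valid s → Listed s → ∃[ a ] ∃[ b ] (a ∈ L (src s) × b ∈ L (dst s) × a ≢ b)
      go (star p x c W) (_ , le , c∉) (c∈ , W⊆) = case pick1 (ℕₚ.<⇒≤ le) of λ (y , y∈) → c , y , c∈ , W⊆ y∈ , λ { refl → c∉ y∈ }
      go (dem u w a b) ne ((a∈ , _) , (_ , b∈)) = a , b , a∈ , b∈ , ne

    canvas : ∀ {p₁ p₂} → (p₁ ≡ src s × p₂ ≡ dst s) ⊎ (p₁ ≡ dst s × p₂ ≡ src s) → Canvas M H p₁ p₂ L
    canvas {p₁} {p₂} o = record
        { simple = (λ d e → proj₁ simple d (proj₁ (es-to e))) , (λ d e a b → proj₂ simple d e (proj₁ (es-to a)) (proj₁ (es-to b)))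
        ; P-outer = outer o
        ; L-set = λ v h → Canvas.L-set canvas₀ v (un (V⊂X (vs-to h)))
        -- Every vertex of the harmonica is outer already in the whole canvas, so none is interior.
        ; L-int = λ v h nout → ⊥-elim (nout (onto h (V-out (vs-to h))))
        ; L-nonS = λ v h a b → Reg-3≤ {L = L} (non o h a b)
        ; S-col = cols o }
      where
      onto : ∀ {v} → vs H v ≡ true → Out X v → OnOuterV M H v
      onto h (_ , d , e , om) = h , d , e , OuterR-mono {M} {H} {ind X} (λ d q → let (a , b , c , _) = es-to q in ei-in {X} a (V⊂X b) (V⊂X c)) om
      outer : ∀ {p₁ p₂} → (p₁ ≡ src s × p₂ ≡ dst s) ⊎ (p₁ ≡ dst s × p₂ ≡ src s) → OuterEdge M H p₁ p₂
      outer (inj₁ (refl , refl)) = outerS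
      outer (inj₂ (refl , refl)) = OuterEdge-sym {H} outerS
      non : ∀ {p₁ p₂ v} → (p₁ ≡ src s × p₂ ≡ dst s) ⊎ (p₁ ≡ dst s × p₂ ≡ src s) → vs H v ≡ true → v ≢ p₁ → v ≢ p₂ → Reg X L v
      non (inj₁ (refl , refl)) h a b = regular (V⊂Y (vs-to h)) a b
      non (inj₂ (refl , refl)) h a b = regular (V⊂Y (vs-to h)) b a
      cols : ∀ {p₁ p₂} → (p₁ ≡ src s × p₂ ≡ dst s) ⊎ (p₁ ≡ dst s × p₂ ≡ src s) → ∃[ a ] ∃[ b ] (a ∈ L p₁ × b ∈ L p₂ × a ≢ b)
      cols (inj₁ (refl , refl)) = colours
      cols (inj₂ (refl , refl)) = let (a , b , a∈ , b∈ , ne) = colours in b , a , b∈ , a∈ , λ e → ne (sym e)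

  Ends : State → Set
  Ends s' = (src s' ≡ q₁ × dst s' ≡ q₂) ⊎ (src s' ≡ q₂ × dst s' ≡ q₁)

  q≢ : q₁ ≢ q₂
  q≢ e = case q-edge of λ (d , h , a , b , _) → proj₁ simple d h (trans a (trans e (sym b)))

  q~ : q₁ ~ q₂
  q~ = case q-edge of λ (d , h , a , b , _) → d , h , a , b

  no-edge : ∀ {p u w} → u ≢ w → ¬ Omit p p u w
  no-edge ne (inj₁ (a , b)) = ne (trans a (sym b))
  no-edge ne (inj₂ (a , b)) = ne (trans a (sym b))

  pair : ∀ {a b} → a ≢ b → Government ((a , b) ∷ (b , a) ∷ [])
  pair ne = (((λ e → ne (cong proj₁ e)) ∷ []) ∷ [] ∷ [] , ne ∷ (λ e → ne (sym e)) ∷ []) , s≤s (s≤s z≤n) , inj₂ (_ , _ , refl)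

  fork : ∀ {a b c} → a ≢ b → c ≢ a → c ≢ b → Government ((c , a) ∷ (c , b) ∷ [])
  fork ab ca cb = (((λ e → ab (cong proj₂ e)) ∷ []) ∷ [] ∷ [] , ca ∷ cb ∷ []) , s≤s (s≤s z≤n) , inj₁ (_ , inj₁ (refl ∷ refl ∷ []))

  Q : Fin n → Set
  Q v = v ≡ q₁ ⊎ v ≡ q₂

  Ends-Q : ∀ {s'} → Ends s' → Q (src s') × Q (dst s') × (∀ {v} → Q v → v ≡ src s' ⊎ v ≡ dst s')
  Ends-Q (inj₁ (refl , refl)) = inj₁ refl , inj₂ refl , λ h → h
  Ends-Q (inj₂ (refl , refl)) = inj₂ refl , inj₁ refl , λ { (inj₁ e) → inj₂ e ; (inj₂ e) → inj₁ e }

  Q-out : ∀ {v} → Q v → Out X v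
  Q-out (inj₁ refl) = can .outq₁
  Q-out (inj₂ refl) = can .outq₂

  at-end : ∀ {Y s} → Stage Y s → Ends s → Built Y s
  at-end {Y} {s} stage ends = record { body = body ; harm = harm s refl }
    where
    open Stage stage
    V₀ = ∅ ⊹ src s ⊹ dst s
    sub : V₀ ⊂ Y
    sub h = case pair-out h of λ where
      (inj₁ refl) → src-in
      (inj₂ refl) → dst-in
    src₀ : V₀ ∋ src s
    src₀ = ⊹in (⊹new {X = ∅})
    dst₀ : V₀ ∋ dst s
    dst₀ = ⊹new {X = ∅ ⊹ src s}
    has-q : ∀ {v} → Q v → V₀ ∋ v
    has-q h = case proj₂ (proj₂ (Ends-Q {s} ends)) h of λ where
      (inj₁ refl) → src₀
      (inj₂ refl) → dst₀
    body : Body Y s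
    body = record
      { V = V₀ ; r = src s ; t = src s ; V⊂Y = sub
      ; V-out = λ h → case pair-out h of λ { (inj₁ refl) → src-out ; (inj₂ refl) → dst-out }
      ; src∈ = src₀ ; dst∈ = dst₀ ; q₁∈ = has-q (inj₁ refl) ; q₂∈ = has-q (inj₂ refl) ; r∈ = src₀ ; t∈ = src₀
      ; kept = no-edge (~-irr adj) ; q-kept = no-edge q≢
      ; hubs = none λ h → case pair-out (-out (-out h)) of λ { (inj₁ e) → -ne (-out h) e ; (inj₂ e) → -ne h e } }
    both : ∀ {p₁ p₂} → (p₁ ≡ src s × p₂ ≡ dst s) ⊎ (p₁ ≡ dst s × p₂ ≡ src s) → (q₁ ≡ p₁ × q₂ ≡ p₂) ⊎ (q₁ ≡ p₂ × q₂ ≡ p₁)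
    both o = case o ,′ ends of λ where
      (inj₁ (a , b) , inj₁ (c , d)) → inj₁ (trans (sym c) (sym a) , trans (sym d) (sym b))
      (inj₁ (a , b) , inj₂ (c , d)) → inj₂ (trans (sym d) (sym b) , trans (sym c) (sym a))
      (inj₂ (a , b) , inj₁ (c , d)) → inj₂ (trans (sym c) (sym b) , trans (sym d) (sym a))
      (inj₂ (a , b) , inj₂ (c , d)) → inj₁ (trans (sym d) (sym a) , trans (sym c) (sym b))
    made : ∀ {H} → Frame H V₀ (src s) (src s) → ∀ {p₁ p₂ 𝒞} → (p₁ ≡ src s × p₂ ≡ dst s) ⊎ (p₁ ≡ dst s × p₂ ≡ src s) → Government 𝒞 → Harmonica M L q₁ q₂ H p₁ p₂ 𝒞
    made {H} frame {p₁} {p₂} o gov = harm1 (Fr.canvas o) gov Fr.outerQ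
        (λ v → mk⇔ (λ h → inn o (pair-out (vs-to h))) (λ h → vs-from (out o h)))
        (λ d e → let (_ , a , b , _) = es-to e ; ir = proj₁ simple d (proj₁ (es-to e)) in on o (pair-out a) (pair-out b) ir) (both o)
      where
      module Fr = Framed stage body frame
      open Frame frame
      inn : ∀ {p₁ p₂ v} → (p₁ ≡ src s × p₂ ≡ dst s) ⊎ (p₁ ≡ dst s × p₂ ≡ src s) → v ≡ src s ⊎ v ≡ dst s → InP p₁ p₂ v
      inn (inj₁ (refl , refl)) h = h
      inn (inj₂ (refl , refl)) h = InP-swap h
      out : ∀ {p₁ p₂ v} → (p₁ ≡ src s × p₂ ≡ dst s) ⊎ (p₁ ≡ dst s × p₂ ≡ src s) → InP p₁ p₂ v → V₀ ∋ v
      out (inj₁ (refl , refl)) (inj₁ refl) = src₀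
      out (inj₁ (refl , refl)) (inj₂ refl) = dst₀
      out (inj₂ (refl , refl)) (inj₁ refl) = dst₀
      out (inj₂ (refl , refl)) (inj₂ refl) = src₀
      on : ∀ {p₁ p₂ a b} → (p₁ ≡ src s × p₂ ≡ dst s) ⊎ (p₁ ≡ dst s × p₂ ≡ src s) → a ≡ src s ⊎ a ≡ dst s → b ≡ src s ⊎ b ≡ dst s → a ≢ b → (a ≡ p₁ × b ≡ p₂) ⊎ (a ≡ p₂ × b ≡ p₁)
      on _ (inj₁ refl) (inj₁ refl) ne = ⊥-elim (ne refl)
      on _ (inj₂ refl) (inj₂ refl) ne = ⊥-elim (ne refl)
      on (inj₁ (refl , refl)) (inj₁ a) (inj₂ b) _ = inj₁ (a , b)
      on (inj₁ (refl , refl)) (inj₂ a) (inj₁ b) _ = inj₂ (a , b)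
      on (inj₂ (refl , refl)) (inj₁ a) (inj₂ b) _ = inj₂ (a , b)
      on (inj₂ (refl , refl)) (inj₂ a) (inj₁ b) _ = inj₁ (a , b)
    harm : ∀ s' → s' ≡ s → ∀ {H} → Frame H V₀ (src s) (src s) → ∀ {p₁ p₂ 𝒞} → Fits s' p₁ p₂ 𝒞 → Harmonica M L q₁ q₂ H p₁ p₂ 𝒞
    harm (star p x c W) refl frame (o , gov , _) = made frame o gov
    harm (dem u w a b) refl frame (refl , refl , refl) = made frame (inj₁ (refl , refl)) (pair valid)

  -- A harmonica that ends with a turn from x to y consists of the edges px and py only, even if x and y are adjacent.
  at-turn : ∀ {Y p x c W y} → Stage Y (star p x c W) → Y ∋ y → Q p → Q y → (∀ {v} → Q v → v ≡ p ⊎ v ≡ y) → p ~ y → y ≢ x → Built Y (star p x c W)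
  at-turn {Y} {p} {x} {c} {W} {y} stage Yy Qp Qy only py yx = record { body = body ; harm = harm }
    where
    open Stage stage
    V₀ = ∅ ⊹ p ⊹ x ⊹ y
    three : ∀ {v} → V₀ ∋ v → v ≡ p ⊎ v ≡ x ⊎ v ≡ y
    three h = case ⊹split {X = ∅ ⊹ p ⊹ x} h of λ where
      (inj₁ e) → inj₂ (inj₂ e)
      (inj₂ h) → case pair-out h of λ where
        (inj₁ e) → inj₁ e
        (inj₂ e) → inj₂ (inj₁ e)
    p₀ : V₀ ∋ p
    p₀ = ⊹in (⊹in (⊹new {X = ∅}))
    x₀ : V₀ ∋ x
    x₀ = ⊹in (⊹new {X = ∅ ⊹ p})
    y₀ : V₀ ∋ y
    y₀ = ⊹new {X = ∅ ⊹ p ⊹ x}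
    has-q : ∀ {v} → Q v → V₀ ∋ v
    has-q h = case only h of λ where
      (inj₁ refl) → p₀
      (inj₂ refl) → y₀
    px = ~-irr adj
    x∉Q : ¬ Q x
    x∉Q h = case only h of λ where
      (inj₁ e) → px (sym e)
      (inj₂ e) → yx (sym e)
    body : Body Y (star p x c W)
    body = record
      { V = V₀ ; r = x ; t = y
      ; V⊂Y = λ h → case three h of λ { (inj₁ refl) → src-in ; (inj₂ (inj₁ refl)) → dst-in ; (inj₂ (inj₂ refl)) → Yy }
      ; V-out = λ h → case three h of λ { (inj₁ refl) → src-out ; (inj₂ (inj₁ refl)) → dst-out ; (inj₂ (inj₂ refl)) → Q-out Qy }
      ; src∈ = p₀ ; dst∈ = x₀ ; q₁∈ = has-q (inj₁ refl) ; q₂∈ = has-q (inj₂ refl) ; r∈ = x₀ ; t∈ = y₀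
      ; kept = λ { (inj₁ (e , _)) → px e ; (inj₂ (e , _)) → ~-irr py e }
      ; q-kept = λ { (inj₁ (e , _)) → x∉Q (inj₁ (sym e)) ; (inj₂ (_ , e)) → x∉Q (inj₂ (sym e)) }
      ; hubs = hub y (-in (-in y₀ λ e → ~-irr py (sym e)) yx) py λ h → subst (λ v → Walk _ v y) (sym (last h)) [ -in (-in y₀ λ e → ~-irr py (sym e)) yx ] }
      where
      last : ∀ {v} → (V₀ - p - x) ∋ v → v ≡ y
      last h = case three (-out (-out h)) of λ where
        (inj₁ e) → ⊥-elim (-ne (-out h) e)
        (inj₂ (inj₁ e)) → ⊥-elim (-ne h e)
        (inj₂ (inj₂ e)) → e
    harm : ∀ {H} → Frame H V₀ x y → ∀ {p₁ p₂ 𝒞} → Fits (star p x c W) p₁ p₂ 𝒞 → Harmonica M L q₁ q₂ H p₁ p₂ 𝒞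
    harm {H} frame {p₁} {p₂} (o , gov , dict , _) = harm2 p c (Fr.canvas o) gov Fr.outerQ dict
        (λ v → mk⇔ (λ (a , b) → meet (inP a) b) (λ { refl → P-of (inj₁ refl) , Qp }))
        (λ v → mk⇔ (λ h → vertices (three (vs-to h))) (λ h → vs-from (member h)))
        λ d e → let (g , a , b , ok) = es-to e in edges (three a) (three b) (proj₁ simple d g) ok
      where
      module Fr = Framed stage body frame
      open Frame frame
      inP : ∀ {v} → InP p₁ p₂ v → v ≡ p ⊎ v ≡ x
      inP h = case o ,′ h of λ where
        (inj₁ (a , b) , inj₁ e) → inj₁ (trans e a)
        (inj₁ (a , b) , inj₂ e) → inj₂ (trans e b)
        (inj₂ (a , b) , inj₁ e) → inj₂ (trans e a)
        (inj₂ (a , b) , inj₂ e) → inj₁ (trans e b)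
      P-of : ∀ {v} → v ≡ p ⊎ v ≡ x → InP p₁ p₂ v
      P-of h = case o ,′ h of λ where
        (inj₁ (a , b) , inj₁ e) → inj₁ (trans e (sym a))
        (inj₁ (a , b) , inj₂ e) → inj₂ (trans e (sym b))
        (inj₂ (a , b) , inj₁ e) → inj₂ (trans e (sym b))
        (inj₂ (a , b) , inj₂ e) → inj₁ (trans e (sym a))
      meet : ∀ {v} → v ≡ p ⊎ v ≡ x → Q v → v ≡ p
      meet (inj₁ e) _ = e
      meet (inj₂ refl) h = ⊥-elim (x∉Q h)
      vertices : ∀ {v} → v ≡ p ⊎ v ≡ x ⊎ v ≡ y → InP p₁ p₂ v ⊎ Q v
      vertices (inj₁ e) = inj₁ (P-of (inj₁ e))
      vertices (inj₂ (inj₁ e)) = inj₁ (P-of (inj₂ e))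
      vertices (inj₂ (inj₂ refl)) = inj₂ Qy
      member : ∀ {v} → InP p₁ p₂ v ⊎ Q v → V₀ ∋ v
      member (inj₁ h) = case inP h of λ { (inj₁ refl) → p₀ ; (inj₂ refl) → x₀ }
      member (inj₂ h) = has-q h
      on-P : ∀ {d} → (vert d ≡ p × vert (α d) ≡ x) ⊎ (vert d ≡ x × vert (α d) ≡ p) → EdgeOn M d p₁ p₂
      on-P h = case o ,′ h of λ where
        (inj₁ (refl , refl) , h) → h
        (inj₂ (refl , refl) , inj₁ h) → inj₂ h
        (inj₂ (refl , refl) , inj₂ h) → inj₁ h
      on-Q : ∀ {d} → (vert d ≡ p × vert (α d) ≡ y) ⊎ (vert d ≡ y × vert (α d) ≡ p) → EdgeOn M d q₁ q₂
      on-Q h = case Qp ,′ Qy ,′ h of λ where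
        (inj₁ refl , inj₁ refl , _) → ⊥-elim (~-irr py refl)
        (inj₂ refl , inj₂ refl , _) → ⊥-elim (~-irr py refl)
        (inj₁ refl , inj₂ refl , h) → h
        (inj₂ refl , inj₁ refl , inj₁ h) → inj₂ h
        (inj₂ refl , inj₁ refl , inj₂ h) → inj₁ h
      edges : ∀ {d} → vert d ≡ p ⊎ vert d ≡ x ⊎ vert d ≡ y → vert (α d) ≡ p ⊎ vert (α d) ≡ x ⊎ vert (α d) ≡ y → vert d ≢ vert (α d) → ¬ Omit x y (vert d) (vert (α d))
        → EdgeOn M d p₁ p₂ ⊎ EdgeOn M d q₁ q₂
      edges (inj₁ a) (inj₁ b) ne _ = ⊥-elim (ne (trans a (sym b)))
      edges (inj₁ a) (inj₂ (inj₁ b)) _ _ = inj₁ (on-P (inj₁ (a , b)))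
      edges (inj₁ a) (inj₂ (inj₂ b)) _ _ = inj₂ (on-Q (inj₁ (a , b)))
      edges (inj₂ (inj₁ a)) (inj₁ b) _ _ = inj₁ (on-P (inj₂ (a , b)))
      edges (inj₂ (inj₁ a)) (inj₂ (inj₁ b)) ne _ = ⊥-elim (ne (trans a (sym b)))
      edges (inj₂ (inj₁ a)) (inj₂ (inj₂ b)) _ ok = ⊥-elim (ok (inj₁ (a , b)))
      edges (inj₂ (inj₂ a)) (inj₁ b) _ _ = inj₂ (on-Q (inj₂ (a , b)))
      edges (inj₂ (inj₂ a)) (inj₂ (inj₁ b)) _ ok = ⊥-elim (ok (inj₂ (a , b)))
      edges (inj₂ (inj₂ a)) (inj₂ (inj₂ b)) ne _ = ⊥-elim (ne (trans a (sym b)))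

  short-out : ∀ {Y s} (stage : Stage Y s) → ∀ {v a b c} → Y ∋ v → v ≢ src s → v ≢ dst s → L v ≐₃ (a , b , c) → Out X v
  short-out stage Yv a b l = Reg-Out {L = L} r (λ h → ≐₃-not-5 (proj₁ r) h l)
    where r = Stage.regular stage Yv a b

  module Triangle {Y p x c W u₁ u₂ a b} (stage : Stage Y (star p x c W)) (pu₁ : p ~ u₁) (pu₂ : p ~ u₂) (u₁₂ : u₁ ~ u₂)
    (Yu₁ : Y ∋ u₁) (Yu₂ : Y ∋ u₂) (f₁ : Free L x W u₁ a b c) (f₂ : Free L x W u₂ a b c) where
    open Stage stage

    R Y' : VSet n
    R = (∅ ⊹ p ⊹ x) ∖ (∅ ⊹ u₁ ⊹ u₂)
    Y' = Y ∖ R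

    in-U : ∀ {v} → v ≡ u₁ ⊎ v ≡ u₂ → (∅ ⊹ u₁ ⊹ u₂) ∋ v
    in-U (inj₁ refl) = ⊹in (⊹new {X = ∅})
    in-U (inj₂ refl) = ⊹new {X = ∅ ⊹ u₁}

    in-P : ∀ {v} → v ≡ p ⊎ v ≡ x → (∅ ⊹ p ⊹ x) ∋ v
    in-P (inj₁ refl) = ⊹in (⊹new {X = ∅})
    in-P (inj₂ refl) = ⊹new {X = ∅ ⊹ p}

    off : ∀ {v} → Y' ∋ v → v ≡ p ⊎ v ≡ x → v ≡ u₁ ⊎ v ≡ u₂
    off {v} h q = case (v ≟ u₁) ⊎-dec (v ≟ u₂) of λ where
      (yes e) → e
      (no ne) → ⊥-elim (∖no h (∖in (in-P q) λ i → ne (pair-out i)))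

    U-in : ∀ {u} → Y ∋ u → u ≡ u₁ ⊎ u ≡ u₂ → Y' ∋ u
    U-in Yu h = ∖in Yu λ q → ∖no q (in-U h)

    p∉U : ∀ {u} → u ≡ u₁ ⊎ u ≡ u₂ → u ≢ p
    p∉U (inj₁ refl) e = ~-irr pu₁ (sym e)
    p∉U (inj₂ refl) e = ~-irr pu₂ (sym e)

    U-out : ∀ {u} → Y ∋ u → u ≢ p → Free L x W u a b c → Out X u
    U-out Yu up (inj₁ (refl , _)) = dst-out
    U-out Yu up (inj₂ (ux , l)) = short-out stage Yu up ux l

    in-list : ∀ {u} → Free L x W u a b c → a ∈ L u × b ∈ L u
    in-list (inj₁ (refl , a∈ , b∈ , _)) = proj₂ listed a∈ , proj₂ listed b∈
    in-list (inj₂ (_ , (a∈ , b∈ , _) , _)) = a∈ , b∈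

    a≢b : a ≢ b
    a≢b = case f₁ of λ where
      (inj₁ (_ , _ , _ , ne , _)) → ne
      (inj₂ (_ , _ , (ne , _) , _)) → ne

    stage' : Stage Y' (dem u₁ u₂ a b)
    stage' = record
      { Y⊂X = λ h → Y⊂X (∖out h) ; src-in = U-in Yu₁ (inj₁ refl) ; dst-in = U-in Yu₂ (inj₂ refl)
      ; src-out = U-out Yu₁ (p∉U (inj₁ refl)) f₁ ; dst-out = U-out Yu₂ (p∉U (inj₂ refl)) f₂ ; adj = u₁₂ ; valid = a≢b
      ; listed = in-list f₁ , in-list f₂
      ; regular = λ h n₁ n₂ → regular (∖out h) (λ e → outside n₁ n₂ (off h (inj₁ e))) (λ e → outside n₁ n₂ (off h (inj₂ e))) }
      where
      outside : ∀ {v} → v ≢ u₁ → v ≢ u₂ → v ≡ u₁ ⊎ v ≡ u₂ → ⊥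
      outside a b (inj₁ e) = a e
      outside a b (inj₂ e) = b e

    module _ (built : Built Y' (dem u₁ u₂ a b)) where
      open Built built renaming (body to body'; harm to harm')
      module B' = Body body'

      p∉V' : ¬ B'.V ∋ p
      p∉V' h = p∉U (off (B'.V⊂Y h) (inj₁ refl)) refl

      V₀ : VSet n
      V₀ = B'.V ⊹ p ⊹ x

      split : ∀ {v} → V₀ ∋ v → (v ≡ p ⊎ v ≡ x) ⊎ B'.V ∋ v
      split h = case ⊹split {X = B'.V ⊹ p} h of λ where
        (inj₁ e) → inj₁ (inj₂ e)
        (inj₂ h) → case ⊹split {X = B'.V} h of λ where
          (inj₁ e) → inj₁ (inj₁ e)
          (inj₂ h) → inj₂ h

      p₀ : V₀ ∋ p
      p₀ = ⊹in (⊹new {X = B'.V})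
      x₀ : V₀ ∋ x
      x₀ = ⊹new {X = B'.V ⊹ p}
      up : ∀ {v} → B'.V ∋ v → V₀ ∋ v
      up h = ⊹in (⊹in h)

      S = V₀ - p - x

      -- What lies beyond the democracy hangs on a common neighbour of `u₁` and `u₂`, hence on
      -- either of them.
      near : ∀ {h o} → B'.V ∋ h → h ≢ x → (∀ {v} → v ≡ u₁ ⊎ v ≡ u₂ → v ≡ h ⊎ v ≡ o) → h ~ o → p ~ h
        → (∀ {g} → Near (dem u₁ u₂ a b) g → g ~ h) → Hub S (p ~_)
      near {h} {o} Vh hx U ho ph gh = hub h (inS Vh hx) ph walk
        where
        inS : ∀ {v} → B'.V ∋ v → v ≢ x → S ∋ v
        inS Vv vx = -in (-in (up Vv) λ { refl → p∉V' Vv }) vx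
        inner : (B'.V - u₁ - u₂) ⊂ S
        inner h = inS (-out (-out h)) λ e → case off (B'.V⊂Y (-out (-out h))) (inj₂ e) of λ where
          (inj₁ q) → -ne (-out h) q
          (inj₂ q) → -ne h q
        walk : ∀ {r} → S ∋ r → Walk S r h
        walk {r} Sr = case split (-out (-out Sr)) of λ where
          (inj₁ (inj₁ e)) → ⊥-elim (-ne (-out Sr) e)
          (inj₁ (inj₂ e)) → ⊥-elim (-ne Sr e)
          (inj₂ Vr) → case (r ≟ u₁) ⊎-dec (r ≟ u₂) of λ where
            (yes e) → case U e of λ where
              (inj₁ refl) → [ Sr ]
              (inj₂ refl) → [ Sr ] ▸ (~-sym ho , inS Vh hx)
            (no ne) → case B'.hubs of λ where
              (none e) → ⊥-elim (e (-in (-in Vr λ q → ne (inj₁ q)) λ q → ne (inj₂ q)))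
              (hub g _ ng w) → Wmono inner (w (-in (-in Vr λ q → ne (inj₁ q)) λ q → ne (inj₂ q))) ▸ (gh ng , inS Vh hx)

      body : Body Y (star p x c W)
      body = record
        { V = V₀ ; r = B'.r ; t = B'.t
        ; V⊂Y = λ h → case split h of λ { (inj₁ (inj₁ refl)) → src-in ; (inj₁ (inj₂ refl)) → dst-in ; (inj₂ q) → ∖out (B'.V⊂Y q) }
        ; V-out = λ h → case split h of λ { (inj₁ (inj₁ refl)) → src-out ; (inj₁ (inj₂ refl)) → dst-out ; (inj₂ q) → B'.V-out q }
        ; src∈ = p₀ ; dst∈ = x₀ ; q₁∈ = up B'.q₁∈ ; q₂∈ = up B'.q₂∈ ; r∈ = up B'.r∈ ; t∈ = up B'.t∈
        ; kept = λ { (inj₁ (refl , _)) → p∉V' B'.r∈ ; (inj₂ (refl , _)) → p∉V' B'.t∈ } ; q-kept = B'.q-kept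
        -- The old leaf `x` may be one of `u₁`, `u₂` and belongs to the removed edge; the hub is
        -- then the other one.
        ; hubs = case u₁ ≟ x of λ where
            (no ne) → near B'.src∈ ne (λ h → h) u₁₂ pu₁ proj₁
            (yes e) → near B'.dst∈ (λ q → ~-irr u₁₂ (trans e (sym q))) (λ { (inj₁ e) → inj₂ e ; (inj₂ e) → inj₁ e }) (~-sym u₁₂) pu₂ proj₂ }

      harm : ∀ {H} → Frame H V₀ B'.r B'.t → ∀ {p₁ p₂ 𝒞} → Fits (star p x c W) p₁ p₂ 𝒞 → Harmonica M L q₁ q₂ H p₁ p₂ 𝒞
      harm {H} frame {p₁} {p₂} {𝒞} (o , gov , dict , proj) = harm3 p c u₁ u₂ a b (Fr.canvas o) gov Fr.outerQ dict
          (Fr.edge-in pu₁ p₀ (up B'.src∈) (λ { (inj₁ (refl , _)) → p∉V' B'.r∈ ; (inj₂ (refl , _)) → p∉V' B'.t∈ }))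
          (Fr.edge-in pu₂ p₀ (up B'.dst∈) (λ { (inj₁ (refl , _)) → p∉V' B'.r∈ ; (inj₂ (refl , _)) → p∉V' B'.t∈ }))
          (Fr.edge-in u₁₂ (up B'.src∈) (up B'.dst∈) B'.kept) a≢b
          (λ { u (inj₁ refl) nP → outer f₁ nP ; u (inj₂ refl) nP → outer f₂ nP })
          (λ { u (inj₁ refl) hP → inner (inj₁ refl) f₁ hP ; u (inj₂ refl) hP → inner (inj₂ refl) f₂ hP })
          (harm' (Frame-delete {H} {V₀} {B'.V} (λ v → inP? p₁ p₂ v ∧ not (inP? u₁ u₂ v)) frame (λ h → up h , kept-in h) from) (refl , refl , refl))
        where
        module Fr = Framed stage body frame
        inP : ∀ {v} → InP p₁ p₂ v → v ≡ p ⊎ v ≡ x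
        inP h = case o ,′ h of λ where
          (inj₁ (a , b) , inj₁ e) → inj₁ (trans e a)
          (inj₁ (a , b) , inj₂ e) → inj₂ (trans e b)
          (inj₂ (a , b) , inj₁ e) → inj₂ (trans e a)
          (inj₂ (a , b) , inj₂ e) → inj₁ (trans e b)
        P-of : ∀ {v} → v ≡ p ⊎ v ≡ x → InP p₁ p₂ v
        P-of h = case o ,′ h of λ where
          (inj₁ (a , b) , inj₁ e) → inj₁ (trans e (sym a))
          (inj₁ (a , b) , inj₂ e) → inj₂ (trans e (sym b))
          (inj₂ (a , b) , inj₁ e) → inj₂ (trans e (sym b))
          (inj₂ (a , b) , inj₂ e) → inj₁ (trans e (sym a))
        outer : ∀ {u} → Free L x W u a b c → ¬ InP p₁ p₂ u → ∀ y → (y ∈ L u) ⇔ (y ≡ a ⊎ y ≡ b ⊎ y ≡ c)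
        outer (inj₁ (e , _)) nP = ⊥-elim (nP (P-of (inj₂ e)))
        outer (inj₂ (_ , (a∈ , b∈ , c∈) , _ , all)) nP y = mk⇔ (all y) λ { (inj₁ refl) → a∈ ; (inj₂ (inj₁ refl)) → b∈ ; (inj₂ (inj₂ refl)) → c∈ }
        inner : ∀ {u} → u ≡ u₁ ⊎ u ≡ u₂ → Free L x W u a b c → InP p₁ p₂ u → ∀ y → Proj 𝒞 p₁ p₂ u y ⇔ (y ≡ a ⊎ y ≡ b)
        inner U (inj₁ (refl , a∈ , b∈ , _ , all)) hP y = mk⇔ (λ h → all y (proj₁ (proj y) h)) λ { (inj₁ refl) → proj₂ (proj y) a∈ ; (inj₂ refl) → proj₂ (proj y) b∈ }
        inner U (inj₂ (ux , _)) hP y = ⊥-elim (case inP hP of λ { (inj₁ e) → p∉U U e ; (inj₂ e) → ux e })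
        kept-in : ∀ {v} → B'.V ∋ v → inP? p₁ p₂ v ∧ not (inP? u₁ u₂ v) ≡ false
        kept-in {v} h = ¬true λ q → let (a , b) = ∧-true {inP? p₁ p₂ v} q in true≢false (inP-true (off (B'.V⊂Y h) (inP (true-inP {p₁ = p₁} {p₂} {v} a)))) (not-true b)
        from : ∀ {v} → V₀ ∋ v → inP? p₁ p₂ v ∧ not (inP? u₁ u₂ v) ≡ false → B'.V ∋ v
        from {v} h e = case split h of λ where
          (inj₂ q) → q
          (inj₁ q) → case (v ≟ u₁) ,′ (v ≟ u₂) of λ where
            (yes refl , _) → B'.src∈
            (_ , yes refl) → B'.dst∈
            (no n₁ , no n₂) → ⊥-elim (true≢false (true-∧ (inP-true (P-of q)) (cong not (¬true {inP? u₁ u₂ v} λ i → case true-inP {p₁ = u₁} {u₂} {v} i of λ { (inj₁ a) → n₁ a ; (inj₂ b) → n₂ b }))) e)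

      by-triangle : Built Y (star p x c W)
      by-triangle = record { body = body ; harm = λ {H} → harm {H} }

  -- The vertex o of the democracy at m and o is removed, and the apex z becomes the dictator.
  module Apex {Y u w a b z e m o} (stage : Stage Y (dem u w a b)) (ends : (o ≡ u × m ≡ w) ⊎ (o ≡ w × m ≡ u))
    (zu : z ~ u) (zw : z ~ w) (Yz : Y ∋ z) (lz : L z ≐₃ (a , b , e)) where
    open Stage stage

    Y' : VSet n
    Y' = Y ∖ (∅ ⊹ o)

    s' : State
    s' = star z m e (a ∷ b ∷ [])

    om : ∀ {v} → v ≡ u ⊎ v ≡ w → v ≡ o ⊎ v ≡ m
    om h = case ends ,′ h of λ where
      (inj₁ (a , b) , inj₁ e) → inj₁ (trans e (sym a))
      (inj₁ (a , b) , inj₂ e) → inj₂ (trans e (sym b))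
      (inj₂ (a , b) , inj₁ e) → inj₂ (trans e (sym b))
      (inj₂ (a , b) , inj₂ e) → inj₁ (trans e (sym a))

    zo : z ~ o
    zo = case ends of λ { (inj₁ (refl , _)) → zu ; (inj₂ (refl , _)) → zw }
    zm : z ~ m
    zm = case ends of λ { (inj₁ (_ , refl)) → zw ; (inj₂ (_ , refl)) → zu }
    m≢o : m ≢ o
    m≢o e = case ends of λ { (inj₁ (refl , refl)) → ~-irr adj (sym e) ; (inj₂ (refl , refl)) → ~-irr adj e }
    Ym : Y ∋ m
    Ym = case ends of λ { (inj₁ (_ , refl)) → dst-in ; (inj₂ (_ , refl)) → src-in }
    Yo : Y ∋ o
    Yo = case ends of λ { (inj₁ (refl , _)) → src-in ; (inj₂ (refl , _)) → dst-in }
    out-m : Out X m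
    out-m = case ends of λ { (inj₁ (_ , refl)) → dst-out ; (inj₂ (_ , refl)) → src-out }
    out-o : Out X o
    out-o = case ends of λ { (inj₁ (refl , _)) → src-out ; (inj₂ (refl , _)) → dst-out }
    list-m : a ∈ L m × b ∈ L m
    list-m = case ends of λ { (inj₁ (_ , refl)) → proj₂ listed ; (inj₂ (_ , refl)) → proj₁ listed }

    ea : e ≢ a
    ea q = proj₁ (proj₂ (proj₁ (proj₂ lz))) (sym q)
    eb : e ≢ b
    eb q = proj₂ (proj₂ (proj₁ (proj₂ lz))) (sym q)

    stage' : Stage Y' s'
    stage' = record
      { Y⊂X = λ h → Y⊂X (∖out h) ; src-in = ∖in Yz (λ h → ~-irr zo (sing-out h)) ; dst-in = ∖in Ym (λ h → m≢o (sing-out h))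
      ; src-out = short-out stage Yz (~-irr zu) (~-irr zw) lz ; dst-out = out-m ; adj = zm
      ; valid = ((valid ∷ []) ∷ [] ∷ [] , s≤s (s≤s z≤n) , λ { (here q) → ea q ; (there (here q)) → eb q })
      ; listed = proj₂ (proj₂ (proj₁ lz)) , λ { (here refl) → proj₁ list-m ; (there (here refl)) → proj₂ list-m }
      ; regular = λ h n₁ n₂ → regular (∖out h) (λ q → outside h n₂ (om (inj₁ q))) (λ q → outside h n₂ (om (inj₂ q))) }
      where
      outside : ∀ {v} → Y' ∋ v → v ≢ m → v ≡ o ⊎ v ≡ m → ⊥
      outside h n (inj₁ refl) = ∖no h (⊹new {X = ∅})
      outside h n (inj₂ q) = n q

    module _ (built : Built Y' s') where
      open Built built renaming (body to body'; harm to harm')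
      module B' = Body body'

      o∉V' : ¬ B'.V ∋ o
      o∉V' h = ∖no (B'.V⊂Y h) (⊹new {X = ∅})

      V₀ : VSet n
      V₀ = B'.V ⊹ o

      up : ∀ {v} → B'.V ∋ v → V₀ ∋ v
      up = ⊹in
      o₀ : V₀ ∋ o
      o₀ = ⊹new {X = B'.V}

      member : ∀ {v} → v ≡ u ⊎ v ≡ w → V₀ ∋ v
      member h = case om h of λ where
        (inj₁ refl) → o₀
        (inj₂ refl) → up B'.dst∈

      S = V₀ - u - w

      hubs : Hub S (Near (dem u w a b))
      hubs = hub z Sz (zu , zw) walk
        where
        Sz : S ∋ z
        Sz = -in (-in (up B'.src∈) (~-irr zu)) (~-irr zw)
        mo : ∀ {v} → v ≡ o ⊎ v ≡ m → v ≡ u ⊎ v ≡ w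
        mo h = case ends ,′ h of λ where
          (inj₁ (a , b) , inj₁ e) → inj₁ (trans e a)
          (inj₁ (a , b) , inj₂ e) → inj₂ (trans e b)
          (inj₂ (a , b) , inj₁ e) → inj₂ (trans e a)
          (inj₂ (a , b) , inj₂ e) → inj₁ (trans e b)
        not-mo : ∀ {v} → S ∋ v → ¬ (v ≡ o ⊎ v ≡ m)
        not-mo h q = case mo q of λ { (inj₁ e) → -ne (-out h) e ; (inj₂ e) → -ne h e }
        inner : (B'.V - z - m) ⊂ S
        inner h = -in (-in (up (-out (-out h))) (λ q → bad (om (inj₁ q)))) (λ q → bad (om (inj₂ q)))
          where
          bad : ¬ (_ ≡ o ⊎ _ ≡ m)
          bad (inj₁ refl) = o∉V' (-out (-out h))
          bad (inj₂ q) = -ne h q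
        walk : ∀ {r} → S ∋ r → Walk S r z
        walk {r} Sr = case r ≟ z of λ where
            (yes refl) → [ Sr ]
            (no ne) → case B'.hubs of λ where
              (none h) → ⊥-elim (h (deep ne))
              (hub g _ zg w) → Wmono inner (w (deep ne)) ▸ (~-sym zg , Sz)
          where
          deep : r ≢ z → (B'.V - z - m) ∋ r
          deep ne = -in (-in (⊹out {X = B'.V} (-out (-out Sr)) λ q → not-mo Sr (inj₁ q)) ne) λ q → not-mo Sr (inj₂ q)

      no-omit : ∀ {x y} → x ≡ o ⊎ y ≡ o → ¬ Omit B'.r B'.t x y
      no-omit (inj₁ refl) (inj₁ (refl , _)) = o∉V' B'.r∈
      no-omit (inj₁ refl) (inj₂ (refl , _)) = o∉V' B'.t∈
      no-omit (inj₂ refl) (inj₁ (_ , refl)) = o∉V' B'.t∈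
      no-omit (inj₂ refl) (inj₂ (_ , refl)) = o∉V' B'.r∈

      body : Body Y (dem u w a b)
      body = record
        { V = V₀ ; r = B'.r ; t = B'.t
        ; V⊂Y = λ h → case ⊹split {X = B'.V} h of λ { (inj₁ refl) → Yo ; (inj₂ q) → ∖out (B'.V⊂Y q) }
        ; V-out = λ h → case ⊹split {X = B'.V} h of λ { (inj₁ refl) → out-o ; (inj₂ q) → B'.V-out q }
        ; src∈ = member (inj₁ refl) ; dst∈ = member (inj₂ refl) ; q₁∈ = up B'.q₁∈ ; q₂∈ = up B'.q₂∈ ; r∈ = up B'.r∈ ; t∈ = up B'.t∈
        ; kept = no-omit (case ends of λ { (inj₁ (q , _)) → inj₁ (sym q) ; (inj₂ (q , _)) → inj₂ (sym q) }) ; q-kept = B'.q-kept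
        ; hubs = hubs }

      harm : ∀ {H} → Frame H V₀ B'.r B'.t → ∀ {p₁ p₂ 𝒞} → Fits (dem u w a b) p₁ p₂ 𝒞 → Harmonica M L q₁ q₂ H p₁ p₂ 𝒞
      harm {H} frame {𝒞 = 𝒞} (refl , refl , refl) = case ends of λ where
          (inj₁ (refl , refl)) → harm4₁ z e a b (Fr.canvas (inj₁ (refl , refl))) (pair valid) Fr.outerQ (a , b , refl) at-u at-w zu' zw' three rest
          (inj₂ (refl , refl)) → harm4₂ z e a b (Fr.canvas (inj₁ (refl , refl))) (pair valid) Fr.outerQ (a , b , refl) at-u at-w zu' zw' three rest
        where
        module Fr = Framed stage body frame
        uw : u ≢ w
        uw = ~-irr adj
        at-u : ∀ y → Proj 𝒞 u w u y ⇔ (y ≡ a ⊎ y ≡ b)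
        at-u y = mk⇔ (λ { (_ , here refl , inj₁ (_ , refl)) → inj₁ refl ; (_ , there (here refl) , inj₁ (_ , refl)) → inj₂ refl ; (_ , _ , inj₂ (q , _)) → ⊥-elim (uw q) })
          λ { (inj₁ refl) → _ , here refl , inj₁ (refl , refl) ; (inj₂ refl) → _ , there (here refl) , inj₁ (refl , refl) }
        at-w : ∀ y → Proj 𝒞 u w w y ⇔ (y ≡ a ⊎ y ≡ b)
        at-w y = mk⇔ (λ { (_ , here refl , inj₂ (_ , refl)) → inj₂ refl ; (_ , there (here refl) , inj₂ (_ , refl)) → inj₁ refl ; (_ , _ , inj₁ (q , _)) → ⊥-elim (uw (sym q)) })
          λ { (inj₁ refl) → _ , there (here refl) , inj₂ (refl , refl) ; (inj₂ refl) → _ , here refl , inj₂ (refl , refl) }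
        three : ∀ y → (y ∈ L z) ⇔ (y ≡ a ⊎ y ≡ b ⊎ y ≡ e)
        three y = mk⇔ (proj₂ (proj₂ lz) y) λ { (inj₁ refl) → proj₁ (proj₁ lz) ; (inj₂ (inj₁ refl)) → proj₁ (proj₂ (proj₁ lz)) ; (inj₂ (inj₂ refl)) → proj₂ (proj₂ (proj₁ lz)) }
        to-z : ∀ {v} → v ≡ o ⊎ v ≡ m → Adj M H z v
        to-z (inj₁ refl) = Fr.edge-in zo (up B'.src∈) o₀ (no-omit (inj₂ refl))
        to-z (inj₂ refl) = Fr.edge-in zm (up B'.src∈) (up B'.dst∈) B'.kept
        zu' : Adj M H z u
        zu' = to-z (om (inj₁ refl))
        zw' : Adj M H z w
        zw' = to-z (om (inj₂ refl))
        leaves : ∀ y → (Proj ((e , a) ∷ (e , b) ∷ []) z m m y → y ∈ a ∷ b ∷ []) × (y ∈ a ∷ b ∷ [] → Proj ((e , a) ∷ (e , b) ∷ []) z m m y)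
        leaves y = (λ { (_ , here refl , inj₂ (_ , refl)) → here refl ; (_ , there (here refl) , inj₂ (_ , refl)) → there (here refl) ; (_ , _ , inj₁ (q , _)) → ⊥-elim (~-irr zm (sym q)) })
          , λ { (here refl) → _ , here refl , inj₂ (refl , refl) ; (there (here refl)) → _ , there (here refl) , inj₂ (refl , refl) }
        rest : Harmonica M L q₁ q₂ (delete M H (λ v → ⌊ v ≟ o ⌋)) z m ((e , a) ∷ (e , b) ∷ [])
        rest = harm' (Frame-delete {H} {V₀} {B'.V} (λ v → ⌊ v ≟ o ⌋) frame
            (λ {v} h → up h , false-⌊⌋ {d = v ≟ o} λ { refl → o∉V' h })
            (λ {v} h q → ⊹out {X = B'.V} h λ r → true≢false (true-⌊⌋ {d = v ≟ o} r) q))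
          (inj₁ (refl , refl) , fork valid ea eb , inj₁ (refl , refl ∷ refl ∷ []) , leaves)

      by-apex : Built Y (dem u w a b)
      by-apex = record { body = body ; harm = λ {H} → harm {H} }

  -- `starNorm` absorbs the turns before a triangle. If no triangle follows, the dictator is still
  -- the first vertex of the last state and hence on the target, so at most one final turn is left.
  build : ∀ k {Y s s'} → sz Y < k → Stage Y s → Steps L Y s s' → Ends s' → Built Y s
  build zero ()
  build (suc k) {Y} {dem u w a b} lt stage nil ends = at-end stage ends
  build (suc k) {Y} {dem u w a b} lt stage (apex₁ zu zw Yz uw lz ∷ r) ends =
      Ap.by-apex (build k small Ap.stage' r ends)
    where
    module Ap = Apex stage (inj₁ (refl , refl)) zu zw Yz lz
    small : sz Ap.Y' < k
    small = ℕₚ.<-≤-trans (sz-strict {X = Ap.Y'} {Y} {u} ∖out Ap.Yo λ h → ∖no h (⊹new {X = ∅})) (ℕₚ.≤-pred lt)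
  build (suc k) {Y} {dem u w a b} lt stage (apex₂ zu zw Yz uw lz ∷ r) ends =
      Ap.by-apex (build k small Ap.stage' r ends)
    where
    module Ap = Apex stage (inj₂ (refl , refl)) zu zw Yz lz
    small : sz Ap.Y' < k
    small = ℕₚ.<-≤-trans (sz-strict {X = Ap.Y'} {Y} {w} ∖out Ap.Yo λ h → ∖no h (⊹new {X = ∅})) (ℕₚ.≤-pred lt)
  build (suc k) {Y} {star p x c W} {s'} lt stage r ends = case starNorm r (λ Yy np nx → let q = regular Yy np nx in proj₁ q , Reg-3≤ {L = L} q) of λ where
      (inj₂ (u₁ , u₂ , a , b , e₁ , e₂ , e₁₂ , Y₁ , Y₂ , f₁ , f₂ , r')) → triangle e₁ e₂ e₁₂ Y₁ Y₂ f₁ f₂ r'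
      (inj₁ e) → arrived e
    where
    open Stage stage
    triangle : ∀ {u₁ u₂ a b} → p ~ u₁ → p ~ u₂ → u₁ ~ u₂ → Y ∋ u₁ → Y ∋ u₂ → Free L x W u₁ a b c → Free L x W u₂ a b c
      → Steps L (Y ∖ ((∅ ⊹ p ⊹ x) ∖ (∅ ⊹ u₁ ⊹ u₂))) (dem u₁ u₂ a b) s' → Built Y (star p x c W)
    triangle {u₁} {u₂} e₁ e₂ e₁₂ Y₁ Y₂ f₁ f₂ r' = Tr.by-triangle (build k small Tr.stage' r' ends)
      where
      module Tr = Triangle stage e₁ e₂ e₁₂ Y₁ Y₂ f₁ f₂
      small : sz Tr.Y' < k
      small = ℕₚ.<-≤-trans (sz-strict {X = Tr.Y'} {Y} {p} ∖out src-in λ h → Tr.p∉U (Tr.off h (inj₁ refl)) refl) (ℕₚ.≤-pred lt)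
    arrived : src s' ≡ p → Built Y (star p x c W)
    arrived refl = case dst s' ≟ x of λ where
        (yes refl) → at-end stage (case ends of λ { (inj₁ h) → inj₁ h ; (inj₂ h) → inj₂ h })
        (no ne) → let (Qp , Qy , only) = Ends-Q {s'} ends in
          at-turn stage (proj₂ (steps-on r (src-in , dst-in))) Qp Qy only (link ends) ne
      where
      link : Ends s' → src s' ~ dst s'
      link (inj₁ (a , b)) = subst₂ _~_ (sym a) (sym b) q~
      link (inj₂ (a , b)) = subst₂ _~_ (sym a) (sym b) (~-sym q~)

  -- Transfer of the induction to collections on the target edge

  F : Rel
  F = Ext X L p1 p2 ⟨ 𝒞 ⟩ q₁ q₂

  𝒞-proper : Proper ⟨ 𝒞 ⟩
  𝒞-proper h = proj₂ (proj₂ (All.lookup lists h))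

  F-proper : Proper F
  F-proper (ψ , C , _ , refl , refl) = C .prp (out∈ (can .outq₁)) (out∈ (can .outq₂)) (can .q-adj)

  -- `Ext` respects the lists only off `P`; on `P` they are respected because `𝒞` consists of
  -- colourings from the lists.
  F⇒Φ : ∀ {x} → F (proj₁ x) (proj₂ x) → Φ M L q₁ q₂ G p1 p2 𝒞 x
  F⇒Φ (ψ , C , c∈ , e , e') = ψ , (colour , λ d e → C .prp (mk (es-vs G d e)) (mk (es-vs G (α d) (trans (es-α G d) e))) (d , e , refl , refl)) , c∈ , e , e'
    where
    colour : ∀ v → vs G v ≡ true → ψ v ∈ L v
    colour v h = case (v ≟ p1) ,′ (v ≟ p2) of λ where
      (yes refl , _) → proj₁ (All.lookup lists c∈)
      (_ , yes refl) → proj₁ (proj₂ (All.lookup lists c∈))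
      (no a , no b) → C .lst (mk h) a b

  Result : Set
  Result = (∃[ 𝒟 ] (Government 𝒟 × All (Φ M L q₁ q₂ G p1 p2 𝒞) 𝒟))
      × ((∃[ 𝒟 ] (Confederacy 𝒟 × All (Φ M L q₁ q₂ G p1 p2 𝒞) 𝒟))
         ⊎ (Government 𝒞
            × ∃[ G' ] (_⊆_ M G' G × Harmonica M L q₁ q₂ G' p1 p2 𝒞)))

  found : ∀ τ → Has F τ → ∃[ 𝒟 ] (Government 𝒟 × All (Φ M L q₁ q₂ G p1 p2 𝒞) 𝒟)
  found τ h = members τ h , members-gov F-proper τ h , All.map F⇒Φ (members-All τ h)

  from-Conf : Conf F → Result
  from-Conf cf@(τ , _ , _ , h , _) = found τ h , inj₁ (case Conf-confederacy F-proper cf of λ (𝒟 , c , a) → 𝒟 , c , All.map F⇒Φ a)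

  from-confederacy : Confederacy 𝒞 → Result
  from-confederacy c = from-Conf (main _ .con ℕₚ.≤-refl can 𝒞-proper (confederacy-Conf c))


  End-type : ∀ s' → Valid s' → End s' q₁ q₂ F → ∃[ τ ] Has F τ
  End-type (star p x c W) (u , le , _) e = case pick2 u le ,′ e of λ where
    ((y , y' , y∈ , y'∈ , ne) , inj₁ (_ , _ , h)) → st₁ c , y , y' , ne , h (refl , y∈) , h (refl , y'∈)
    ((y , y' , y∈ , y'∈ , ne) , inj₂ (_ , _ , h)) → st₂ c , y , y' , ne , h (refl , y∈) , h (refl , y'∈)
  End-type (dem u w a b) ne (inj₁ (_ , _ , h)) = dm a b , ne , h (inj₁ (refl , refl)) , h (inj₂ (refl , refl))
  End-type (dem u w a b) ne (inj₂ (_ , _ , h)) = dm a b , ne , h (inj₂ (refl , refl)) , h (inj₁ (refl , refl))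

  omit? : ∀ r t u w → Dec (Omit r t u w)
  omit? r t u w = ((u ≟ r) ×-dec (w ≟ t)) ⊎-dec ((u ≟ t) ×-dec (w ≟ r))

  spanned : VSet n → Fin n → Fin n → Sub M
  spanned V r t = record
      { vs = V
      ; es = λ d → ei V d ∧ not ⌊ omit? r t (vert d) (vert (α d)) ⌋
      ; es-α = λ d → cong₂ _∧_ (es-α (ind V) d) (cong not (same d))
      ; es-vs = λ d h → es-vs (ind V) d (proj₁ (∧-true h)) }
    where
    flip : ∀ {u w} → Omit r t u w → Omit r t w u
    flip (inj₁ (a , b)) = inj₂ (b , a)
    flip (inj₂ (a , b)) = inj₁ (b , a)
    same : ∀ d → ⌊ omit? r t (vert (α d)) (vert (α (α d))) ⌋ ≡ ⌊ omit? r t (vert d) (vert (α d)) ⌋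
    same d rewrite α-invol d with omit? r t (vert d) (vert (α d))
    ... | yes o = true-⌊⌋ {d = omit? r t (vert (α d)) (vert d)} (flip o)
    ... | no o = false-⌊⌋ {d = omit? r t (vert (α d)) (vert d)} λ q → o (flip q)

  spanned-frame : ∀ V r t → Frame (spanned V r t) V r t
  spanned-frame V r t = record
    { vs-to = mk ; vs-from = un
    ; es-to = λ {d} h → let (a , b) = ∧-true h ; (g , c , e) = ei-out {V} {d} a in g , c , e , λ o → true≢false (true-⌊⌋ {d = omit? r t (vert d) (vert (α d))} o) (not-true b)
    ; es-from = λ {d} g a b no' → true-∧ (ei-in {V} g a b) (cong not (false-⌊⌋ {d = omit? r t (vert d) (vert (α d))} no')) }

  from-state : ∀ s → (src s ≡ p1 × dst s ≡ p2) ⊎ (src s ≡ p2 × dst s ≡ p1) → Stage X s → Fits s p1 p2 𝒞 → Government 𝒞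
    → (∀ {x y} → Ext X L (src s) (dst s) ⟪ s ⟫ q₁ q₂ x y → F x y) → Result
  from-state s o stage fits gov into = case main _ .IH.gov s ℕₚ.≤-refl (canS o) (Stage.valid stage) of λ where
      (inj₁ cf) → from-Conf (Conf-mono into cf)
      (inj₂ (s' , e , v , steps)) → (let (τ , h) = End-type s' v (End-mono {s'} into e) in found τ h) , inj₂ (gov , harmonica s' (ends s' e) steps)
    where
    canS : (src s ≡ p1 × dst s ≡ p2) ⊎ (src s ≡ p2 × dst s ≡ p1) → Can X L (src s) (dst s) q₁ q₂
    canS (inj₁ (a , b)) = subst₂ (λ a b → Can X L a b q₁ q₂) (sym a) (sym b) can
    canS (inj₂ (a , b)) = subst₂ (λ a b → Can X L a b q₁ q₂) (sym a) (sym b) (Can-swap can)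
    ends : ∀ s' {E} → End s' q₁ q₂ E → (src s' ≡ q₁ × dst s' ≡ q₂) ⊎ (src s' ≡ q₂ × dst s' ≡ q₁)
    ends s' (inj₁ (a , b , _)) = inj₁ (a , b)
    ends s' (inj₂ (a , b , _)) = inj₂ (a , b)
    harmonica : ∀ s' → (src s' ≡ q₁ × dst s' ≡ q₂) ⊎ (src s' ≡ q₂ × dst s' ≡ q₁) → Steps L X s s' → ∃[ G' ] (_⊆_ M G' G × Harmonica M L q₁ q₂ G' p1 p2 𝒞)
    harmonica s' e steps = spanned B.V B.r B.t , ((λ v h → un (B.V⊂Y (mk h))) , λ d h → proj₁ (ei-out {B.V} {d} (proj₁ (∧-true h))))
        , built .Built.harm (spanned-frame B.V B.r B.t) fits
      where
      built = build _ ℕₚ.≤-refl stage steps e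
      module B = Body (built .Built.body)

  private
    p≢ : p1 ≢ p2
    p≢ = ~-irr (can .p-adj)

    -- Distinct colourings under one dictator differ at the free end, so the colours there form a
    -- valid list of leaves for a star.
    uniq₁ : ∀ {𝒞 c} → Unique 𝒞 → All (λ x → proj₁ x ≡ c) 𝒞 → Unique (map π₂ 𝒞)
    uniq₁ [] [] = []
    uniq₁ {(x , y) ∷ 𝒞} (ne ∷ u) (refl ∷ al) = All.tabulate (λ z∈ e → case ∈-map⁻ π₂ z∈ of λ { (w , w∈ , refl) → All.lookup ne w∈ (cong₂ _,_ (sym (All.lookup al w∈)) e) }) ∷ uniq₁ u al

    uniq₂' : ∀ {𝒞 c} → Unique 𝒞 → All (λ x → proj₂ x ≡ c) 𝒞 → Unique (map π₁ 𝒞)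
    uniq₂' [] [] = []
    uniq₂' {(x , y) ∷ 𝒞} (ne ∷ u) (refl ∷ al) = All.tabulate (λ z∈ e → case ∈-map⁻ π₁ z∈ of λ { (w , w∈ , refl) → All.lookup ne w∈ (cong₂ _,_ e (sym (All.lookup al w∈))) }) ∷ uniq₂' u al

    nonempty : ∀ {𝒞 : Coll} → 2 ≤ length 𝒞 → ∃[ x ] x ∈ 𝒞
    nonempty {x ∷ _} _ = x , here refl

  from-government : Government 𝒞 → Result
  from-government gov@((u , _) , le , inj₁ (c , inj₁ al)) = from-state (star p1 p2 c W) (inj₁ (refl , refl))
      (record { Y⊂X = λ h → h ; src-in = out∈ (can .out₁) ; dst-in = out∈ (can .out₂) ; src-out = can .out₁ ; dst-out = can .out₂ ; adj = can .p-adj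
              ; valid = uniq₁ u al , subst (2 ≤_) (sym (length-map π₂ 𝒞)) le , (λ h → 𝒞-proper (inW h) refl)
              ; listed = (let (x , x∈) = nonempty le in subst (_∈ L p1) (All.lookup al x∈) (proj₁ (All.lookup lists x∈))) , (λ h → proj₁ (proj₂ (All.lookup lists (inW h))))
              ; regular = canvas-regular })
      (inj₁ (refl , refl) , gov , inj₁ (refl , al) , λ y → (λ { (z , z∈ , inj₁ (e , _)) → ⊥-elim (p≢ (sym e)) ; (z , z∈ , inj₂ (_ , refl)) → ∈-map⁺ π₂ z∈ })
        , λ h → _ , inW h , inj₂ (refl , refl))
      gov λ h → Ext-rel {C = ⟪ star p1 p2 c W ⟫} {⟨ 𝒞 ⟩} (λ { (refl , h) → inW h }) h
    where
    W = map π₂ 𝒞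
    inW : ∀ {y} → y ∈ W → (c , y) ∈ 𝒞
    inW h = case ∈-map⁻ π₂ h of λ { ((x , y) , w∈ , refl) → subst (λ t → (t , y) ∈ 𝒞) (All.lookup al w∈) w∈ }
  from-government gov@((u , _) , le , inj₁ (c , inj₂ al)) = from-state (star p2 p1 c W) (inj₂ (refl , refl))
      (record { Y⊂X = λ h → h ; src-in = out∈ (can .out₂) ; dst-in = out∈ (can .out₁) ; src-out = can .out₂ ; dst-out = can .out₁ ; adj = ~-sym (can .p-adj)
              ; valid = uniq₂' u al , subst (2 ≤_) (sym (length-map π₁ 𝒞)) le , (λ h → 𝒞-proper (inW h) refl)
              ; listed = (let (x , x∈) = nonempty le in subst (_∈ L p2) (All.lookup al x∈) (proj₁ (proj₂ (All.lookup lists x∈)))) , (λ h → proj₁ (All.lookup lists (inW h)))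
              ; regular = λ h a b → canvas-regular h b a })
      (inj₂ (refl , refl) , gov , inj₂ (refl , al) , λ y → (λ { (z , z∈ , inj₂ (e , _)) → ⊥-elim (p≢ e) ; (z , z∈ , inj₁ (_ , refl)) → ∈-map⁺ π₁ z∈ })
        , λ h → _ , inW h , inj₁ (refl , refl))
      gov λ h → Ext-rel {C = ⟪ star p2 p1 c W ⟫ ᵀ} {⟨ 𝒞 ⟩} (λ { (refl , h) → inW h }) (Ext-swap {C = ⟪ star p2 p1 c W ⟫} h)
    where
    W = map π₁ 𝒞
    inW : ∀ {y} → y ∈ W → (y , c) ∈ 𝒞
    inW h = case ∈-map⁻ π₁ h of λ { ((x , y) , w∈ , refl) → subst (λ t → (x , t) ∈ 𝒞) (All.lookup al w∈) w∈ }
  from-government gov@((_ , ne ∷ _) , le , inj₂ (a , b , refl)) = from-state (dem p1 p2 a b) (inj₁ (refl , refl))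
      (record { Y⊂X = λ h → h ; src-in = out∈ (can .out₁) ; dst-in = out∈ (can .out₂) ; src-out = can .out₁ ; dst-out = can .out₂ ; adj = can .p-adj
              ; valid = ne ; listed = (proj₁ ab , proj₁ ba) , (proj₁ (proj₂ ba) , proj₁ (proj₂ ab)) ; regular = canvas-regular })
      (refl , refl , refl) gov λ h → Ext-rel {C = ⟪ dem p1 p2 a b ⟫} {⟨ 𝒞 ⟩} (λ { (inj₁ (refl , refl)) → here refl ; (inj₂ (refl , refl)) → there (here refl) }) h
    where
    ab = All.lookup lists (here refl)
    ba = All.lookup lists (there (here refl))

theorem4p3 : (M : PlaneMap) (G : Sub M) (p1 p2 q1 q2 : Fin (PlaneMap.n M))
    (L : Fin (PlaneMap.n M) → List ℕ) (𝒞 : Coll)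
    → Canvas M G p1 p2 L
    → OuterEdge M G q1 q2
    → All (λ x → proj₁ x ∈ L p1 × proj₂ x ∈ L p2 × proj₁ x ≢ proj₂ x) 𝒞
    → Government 𝒞 ⊎ Confederacy 𝒞
    → (∃[ 𝒟 ] (Government 𝒟 × All (Φ M L q1 q2 G p1 p2 𝒞) 𝒟))
      × ((∃[ 𝒟 ] (Confederacy 𝒟 × All (Φ M L q1 q2 G p1 p2 𝒞) 𝒟))
         ⊎ (Government 𝒞
            × ∃[ G' ] (_⊆_ M G' G × Harmonica M L q1 q2 G' p1 p2 𝒞)))
theorem4p3 M G p1 p2 q1 q2 L 𝒞 canvas q-edge lists = λ where
    (inj₁ g) → from-government g
    (inj₂ c) → from-confederacy c
  where open Conclusion M G p1 p2 q1 q2 L 𝒞 canvas q-edge lists
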